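{- Fix $C>0$ and suppose $n$ is sufficiently large. Let $f,g,h\colon S_n\to\{0,1\}$ satisfy $\mathbb{E}[f]\mathbb{E}[g]\mathbb{E}[h]\ge n^{ -C}$, and suppose each of $f,g,h$ is relatively $(i,n^{i/4})$-global for each $1\le i\le 4\lceil C\rceil$. Then \[\Big|\mathbb{E}_{\sigma,\tau\sim S_n}[f(\sigma)g(\tau)h(\sigma\tau)]-\mathbb{E}[\tilde f]\mathbb{E}[\tilde g]\mathbb{E}[\tilde h]-\mathbb{E}[f]\mathbb{E}[g]\mathbb{E}[h]\Big|\le n^{ -0.1}\,\mathbb{E}[f]\mathbb{E}[g]\mathbb{E}[h].\]
   Context: $\sigma,\tau$ are independent uniform elements of $S_n$, $\mathbb{E}[f]=\mathbb{E}_{\sigma\sim S_n}f(\sigma)$, and $(\sigma\tau)(x)=\sigma(\tau(x))$. For $f\colon S_n\to\mathbb{R}$, $\tilde f=f\cdot\mathrm{sign}$. For ordered tuples $I=(i_1,\dots,i_t)$, $J=(j_1,\dots,j_t)$ of distinct elements of $[n]$, let $\mathcal U_{I\to J}=\{\pi\in S_n:\pi(i_l)=j_l\ \forall l\}$ and $\|f_{I\to J}\|_2^2=\mathbb{E}_{\sigma\sim S_n}[f(\sigma)^2\mid \sigma\in\mathcal U_{I\to J}]$. $f$ is relatively $(t,K)$-global if $\|f_{I\to J}\|_2^2\le K\|f\|_2^2$ for all such $I,J$ of size $t$, where $\|f\|_2^2=\mathbb{E}[f^2]$. -}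

module Defs where

open import Data.Bool using (Bool; true; false; if_then_else_)
open import Data.Nat as ℕ using (ℕ; zero; suc)
open import Data.Nat.Properties as ℕP using ()
open import Data.Integer as ℤ using (ℤ)
open import Data.Fin as Fin using (Fin; toℕ)
open import Data.Fin.Properties as FinP using ()
open import Data.Vec as Vec using (Vec; []; _∷_; lookup; tabulate; toList)
open import Data.List as List using (List; []; _∷_; [_]; map; concatMap; filter; length; allFin; cartesianProduct)
open import Data.Product using (_×_; _,_; proj₁; proj₂)
open import Data.Rational as ℚ using (ℚ; 0ℚ; 1ℚ; _+_; _*_; _-_; -_; _≤_)
open import Relation.Nullary.Decidable using (Dec; yes; no; _×-dec_)
open import Relation.Binary.PropositionalEquality using (_≡_; decSetoid)
import Data.List.Relation.Unary.Unique.DecSetoid as UniqueDS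
open import Data.List.Relation.Unary.All using (All)

module UFin {n : ℕ} = UniqueDS (decSetoid (FinP._≟_ {n}))

Distinct : {n t : ℕ} → Vec (Fin n) t → Set
Distinct v = UFin.Unique (toList v)

distinct? : {n t : ℕ} → (v : Vec (Fin n) t) → Dec (Distinct v)
distinct? v = UFin.unique? (toList v)

-- A permutation σ ∈ S_n is represented by the vector (σ(0), …, σ(n-1))
-- of its values; the vectors that represent permutations are exactly the
-- ones with distinct entries.
Perm : ℕ → Set
Perm n = Vec (Fin n) n

allVecs : (n m : ℕ) → List (Vec (Fin n) m)
allVecs n zero = [ [] ]
allVecs n (suc m) = concatMap (λ x → map (x ∷_) (allVecs n m)) (allFin n)

Sn : (n : ℕ) → List (Perm n)
Sn n = filter distinct? (allVecs n n)

_∘ₚ_ : {n : ℕ} → Perm n → Perm n → Perm n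
σ ∘ₚ τ = tabulate (λ x → lookup σ (lookup τ x))

inversions : {n : ℕ} → Perm n → ℕ
inversions {n} σ =
  length (filter (λ p → (toℕ (proj₁ p) ℕP.<? toℕ (proj₂ p))
                        ×-dec (toℕ (lookup σ (proj₂ p)) ℕP.<? toℕ (lookup σ (proj₁ p))))
                 (cartesianProduct (allFin n) (allFin n)))

sign : {n : ℕ} → Perm n → ℚ
sign σ = if (inversions σ ℕ.% 2) ℕ.≡ᵇ 0 then 1ℚ else - 1ℚ

𝟙 : Bool → ℚ
𝟙 true = 1ℚ
𝟙 false = 0ℚ

sumℚ : List ℚ → ℚ
sumℚ = List.foldr _+_ 0ℚ

avg : List ℚ → ℚ
avg [] = 0ℚ
avg (x ∷ xs) = sumℚ (x ∷ xs) * (ℤ.+ 1 ℚ./ suc (length xs))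

𝔼 : {n : ℕ} → (Perm n → ℚ) → ℚ
𝔼 {n} F = avg (map F (Sn n))

𝔼₂ : {n : ℕ} → (Perm n → Perm n → ℚ) → ℚ
𝔼₂ {n} F = avg (map (λ p → F (proj₁ p) (proj₂ p)) (cartesianProduct (Sn n) (Sn n)))

tilde : {n : ℕ} → (Perm n → ℚ) → Perm n → ℚ
tilde f σ = f σ * sign σ

norm2² : {n : ℕ} → (Perm n → ℚ) → ℚ
norm2² f = 𝔼 (λ σ → f σ * f σ)

InU : {n t : ℕ} → Vec (Fin n) t → Vec (Fin n) t → Perm n → Set
InU {t = t} I J σ = (l : Fin t) → lookup σ (lookup I l) ≡ lookup J l

inU? : {n t : ℕ} → (I J : Vec (Fin n) t) → (σ : Perm n) → Dec (InU I J σ)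
inU? {t = t} I J σ = Data.Fin.Properties.all? (λ l → lookup σ (lookup I l) FinP.≟ lookup J l)
  where import Data.Fin.Properties

condNorm2² : {n t : ℕ} → (Perm n → ℚ) → Vec (Fin n) t → Vec (Fin n) t → ℚ
condNorm2² {n} f I J = avg (map (λ σ → f σ * f σ) (filter (inU? I J) (Sn n)))

_^ℚ_ : ℚ → ℕ → ℚ
x ^ℚ zero = 1ℚ
x ^ℚ suc k = x * (x ^ℚ k)

fromℕ : ℕ → ℚ
fromℕ k = ℤ.+ k ℚ./ 1

-- f is relatively (t, K)-global with K = n^{t/4}:
--   ‖f_{I→J}‖₂² ≤ n^{t/4} ‖f‖₂²  for all distinct I, J of size t.
-- Both sides are ≥ 0, so this is equivalent to the 4th-power form
--   (‖f_{I→J}‖₂²)^4 ≤ n^t (‖f‖₂²)^4, which avoids irrational numbers.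
RelGlobalRoot4 : {n : ℕ} → (Perm n → ℚ) → (t : ℕ) → Set
RelGlobalRoot4 {n} f t =
  (I J : Vec (Fin n) t) → Distinct I → Distinct J →
  (condNorm2² f I J) ^ℚ 4 ≤ fromℕ (n ℕ.^ t) * (norm2² f ^ℚ 4)

{-# OPTIONS --safe #-}
-- Split h into its projection onto the span of the indicators of σ I = J with ∣I∣ ≤ D, sign times the corresponding
-- projection of its twist by the sign, and a remainder. In the trilinear form E f(σ) g(τ) h(στ) the first two parts
-- produce the two main terms (level 0) and, for 1 ≤ i ≤ D, a term in which only the exact level-i parts of f, g, h occur.
-- By Cauchy-Schwarz that term is at most nⁱ times the product of the norms of the three coefficient arrays E fᵢ 1[σ I = J].
-- These are small by a level inequality: the coefficients against products of differences [σ x = u] - [σ y = u] over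
-- disjoint pairs (x , y) are bounded using only that f is spread, by Cauchy-Schwarz steps each of which replaces the
-- dependence on the density of f by its square root, and averaging over the pairs gives all coefficients back.
-- The remainder is orthogonal to low levels, so it lies in the span of functions with many translates that some
-- transposition separates by sign; these translates are orthogonal, so by Bessel convolution with such a function gains a
-- large power of n, more than is lost through the densities.
module Submission where

open import Defs
open import Level using (0ℓ)
open import Data.Bool using (Bool; true; false; if_then_else_; _∧_; _∨_)
import Data.Bool.Properties as BoolP
open import Data.Nat as ℕ using (ℕ; zero; suc)
import Data.Nat.Properties as ℕP
import Data.Nat.DivMod as DivMod
open import Data.Integer as ℤ using (ℤ)
import Data.Integer.Properties as ℤP
import Data.Integer.DivMod as ℤDM
open import Data.Rational as ℚ using (ℚ; 0ℚ; 1ℚ; _+_; _*_; _-_; -_; _≤_; _<_; ∣_∣; ↥_; ↧ₙ_; ceiling)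
import Data.Rational.Properties as ℚP
import Data.Rational.Unnormalised as U
import Data.Rational.Unnormalised.Properties as UP
open import Data.Fin as Fin using (Fin; zero; suc; toℕ)
import Data.Fin.Properties as FinP
open import Data.Vec as Vec using (Vec; []; _∷_; lookup; tabulate; toList)
import Data.Vec.Properties as VecP
open import Data.List as List using (List; []; _∷_; _++_; map; concatMap; filter; length; allFin; cartesianProduct)
import Data.List.Properties as ListP
open import Data.List.Membership.Propositional using (_∈_; _∉_)
import Data.List.Membership.Propositional.Properties as MemP
open import Data.List.Relation.Unary.All as All using (All; []; _∷_)
import Data.List.Relation.Unary.All.Properties as AllP
open import Data.List.Relation.Unary.Any as Any using (Any; here; there)
open import Data.List.Relation.Unary.AllPairs as AllPairs using (AllPairs; []; _∷_)
open import Data.List.Relation.Unary.Unique.Propositional using (Unique)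
import Data.List.Relation.Unary.Unique.Propositional.Properties as UniqueP
open import Data.List.Relation.Binary.Permutation.Propositional as Perm′ using (_↭_)
open import Data.Maybe using (Maybe; just; nothing)
open import Data.Product using (Σ; _×_; _,_; proj₁; proj₂; ∃; ∃-syntax)
open import Data.Sum using (_⊎_; inj₁; inj₂; [_,_]′)
open import Data.Empty using (⊥; ⊥-elim)
open import Data.Unit using (⊤; tt)
open import Function using (_∘_; id; case_of_)
open import Relation.Nullary using (¬_; Dec; yes; no; does)
open import Relation.Nullary.Decidable using (recompute; dec-true; dec-false)
open import Relation.Binary.PropositionalEquality using (_≡_; _≢_; refl; sym; trans; cong; cong₂; subst; subst₂; module ≡-Reasoning)
open import Tactic.RingSolver using (solve-∀)
open import Tactic.RingSolver.Core.AlmostCommutativeRing using (AlmostCommutativeRing; fromCommutativeRing)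
import Data.Nat.Tactic.RingSolver as ℕR
open import Data.List.Relation.Binary.BagAndSetEquality using (∼bag⇒↭)
open import Data.List.Membership.Propositional.Properties.WithK using (unique∧set⇒bag)
open import Function.Bundles using (mk⇔)
open import Relation.Binary.Definitions using (tri<; tri≈; tri>)

-- Rational numbers

-- Put `n = ρ^4`. A global `f` of mean `a` has mass at most about `a * (ρ / n)^i` on an event fixing
-- `i` values, that is `a * ζ^(2 i)` with `ζ = ρ^(-3/2)`. The level inequality turns this into a
-- squared array norm of about `a^2 * s * ζ^(2 i)` at level `i`, where `s` is a small power of `n`.
-- Three such norms against `n^(2 i)` leave `s^3 * (ρ^8 * ζ^6)^i = s^3 * ρ^(-i)`, so a level
-- contributes about `n^(-1/8)` times the product of the means, and the gap between 1/8 and 1/10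
-- pays for `s^3` and the constants. The sign twist of `f` is not nonnegative, so it cannot be
-- iterated; it enters the level inequality only at the last Cauchy-Schwarz step, where the weight
-- is still `f`. All numbers are rational. Roots of `n` are powers of an integer `s` with `s^64`
-- within a constant factor of `n`. Eigenvalues are avoided as well: bounds for operators pass from
-- generators to their span by comparing the growth of iterates, and this gives both the gain of
-- convolution and the lower frame bound for the indicators.

private
  isZero : ∀ x → Maybe (0ℚ ≡ x)
  isZero x with 0ℚ ℚP.≟ x
  ... | yes p = just p
  ... | no _ = nothing

ring : AlmostCommutativeRing 0ℓ 0ℓ
ring = fromCommutativeRing ℚP.+-*-commutativeRing isZero

x*yz≡y*xz : ∀ x y z → x * (y * z) ≡ y * (x * z)
x*yz≡y*xz = solve-∀ ring

xy*xy≡xx*yy : ∀ x y → x * y * (x * y) ≡ x * x * (y * y)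
xy*xy≡xx*yy = solve-∀ ring

xy*z≡y*xz : ∀ x y z → x * y * z ≡ y * (x * z)
xy*z≡y*xz = solve-∀ ring

xy*zw≡xz*yw : ∀ x y z w → x * y * (z * w) ≡ x * z * (y * w)
xy*zw≡xz*yw = solve-∀ ring

x≡x-y+y : ∀ x y → x ≡ x - y + y
x≡x-y+y = solve-∀ ring

xy*z≡x*zy : ∀ x y z → x * y * z ≡ x * (z * y)
xy*z≡x*zy = solve-∀ ring

x+yx≡[1+y]x : ∀ x y → x + y * x ≡ (1ℚ + y) * x
x+yx≡[1+y]x = solve-∀ ring

x*yz≡xz*y : ∀ x y z → x * (y * z) ≡ x * z * y
x*yz≡xz*y = solve-∀ ring

module ≤R = ℚP.≤-Reasoning

2ℚ : ℚ
2ℚ = 1ℚ + 1ℚ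

≤⇒0≤- : ∀ {p q} → p ≤ q → 0ℚ ≤ q - p
≤⇒0≤- {p} {q} h = subst (_≤ q - p) (ℚP.+-inverseʳ p) (ℚP.+-monoˡ-≤ (- p) h)

0≤-⇒≤ : ∀ {p q} → 0ℚ ≤ q - p → p ≤ q
0≤-⇒≤ {p} {q} h = subst₂ _≤_ (ℚP.+-identityˡ p) (e q p) (ℚP.+-monoˡ-≤ p h)
  where e : ∀ q p → q - p + p ≡ q
        e = solve-∀ ring

0≤+ : ∀ {p q} → 0ℚ ≤ p → 0ℚ ≤ q → 0ℚ ≤ p + q
0≤+ = ℚP.+-mono-≤

*-monoˡ : ∀ {r p q} → 0ℚ ≤ r → p ≤ q → r * p ≤ r * q
*-monoˡ {r} h = ℚP.*-monoˡ-≤-nonNeg r {{ℚ.nonNegative h}}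

*-monoʳ : ∀ {r p q} → 0ℚ ≤ r → p ≤ q → p * r ≤ q * r
*-monoʳ {r} h = ℚP.*-monoʳ-≤-nonNeg r {{ℚ.nonNegative h}}

0≤* : ∀ {p q} → 0ℚ ≤ p → 0ℚ ≤ q → 0ℚ ≤ p * q
0≤* {p} {q} hp hq = subst (_≤ p * q) (ℚP.*-zeroʳ p) (*-monoˡ hp hq)

*-mono : ∀ {p q r s} → 0ℚ ≤ p → 0ℚ ≤ r → p ≤ q → r ≤ s → p * r ≤ q * s
*-mono hp hr h h′ = ℚP.≤-trans (*-monoˡ hp h′) (*-monoʳ (ℚP.≤-trans hr h′) h)

0≤1 : 0ℚ ≤ 1ℚ
0≤1 = ℚP.nonNegative⁻¹ 1ℚ

0<1 : 0ℚ < 1ℚ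
0<1 = ℚP.positive⁻¹ 1ℚ

0≤2 : 0ℚ ≤ 2ℚ
0≤2 = ℚP.nonNegative⁻¹ 2ℚ

neg-flip : ∀ {p} → p ≤ 0ℚ → 0ℚ ≤ - p
neg-flip {p} h = ℚP.neg-antimono-≤ {p} {0ℚ} h

0≤sq : ∀ p → 0ℚ ≤ p * p
0≤sq p with ℚP.≤-total 0ℚ p
... | inj₁ h = 0≤* h h
... | inj₂ h = subst (0ℚ ≤_) (e p) (0≤* (neg-flip h) (neg-flip h))
  where e : ∀ p → - p * - p ≡ p * p
        e = solve-∀ ring

0<* : ∀ {p q} → 0ℚ < p → 0ℚ < q → 0ℚ < p * q
0<* {p} {q} hp hq = subst (_< p * q) (ℚP.*-zeroʳ p) (ℚP.*-monoʳ-<-pos p {{ℚ.positive hp}} hq)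

cancelˡ : ∀ {r p q} → 0ℚ < r → r * p ≤ r * q → p ≤ q
cancelˡ {r} h = ℚP.*-cancelˡ-≤-pos r {{ℚ.positive h}}

cancelʳ : ∀ {r p q} → 0ℚ < r → p * r ≤ q * r → p ≤ q
cancelʳ {r} h = ℚP.*-cancelʳ-≤-pos r {{ℚ.positive h}}

≤∨> : ∀ p q → p ≤ q ⊎ q < p
≤∨> p q with p ℚP.≤? q
... | yes h = inj₁ h
... | no h = inj₂ (ℚP.≰⇒> h)

≡∨pos : ∀ {p} → 0ℚ ≤ p → p ≡ 0ℚ ⊎ 0ℚ < p
≡∨pos {p} h with ≤∨> p 0ℚ
... | inj₁ h′ = inj₁ (ℚP.≤-antisym h′ h)
... | inj₂ h′ = inj₂ h′

sq-mono : ∀ {x y} → 0ℚ ≤ x → x ≤ y → x * x ≤ y * y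
sq-mono h h′ = *-mono h h h′ h′

sq-cancel : ∀ {x y} → 0ℚ ≤ y → x * x ≤ y * y → x ≤ y
sq-cancel {x} {y} hy h with ≤∨> x y
... | inj₁ g = g
... | inj₂ g = ⊥-elim (ℚP.<-irrefl refl (ℚP.<-≤-trans lt h))
  where
  0<x : 0ℚ < x
  0<x = ℚP.≤-<-trans hy g
  lt : y * y < x * x
  lt = ℚP.≤-<-trans (*-monoˡ hy (ℚP.<⇒≤ g)) (ℚP.*-monoˡ-<-pos x {{ℚ.positive 0<x}} g)

sq≡0 : ∀ {x} → x * x ≤ 0ℚ → x ≡ 0ℚ
sq≡0 {x} h = ℚP.≤-antisym (sq-cancel ℚP.≤-refl h)
  (subst (0ℚ ≤_) (e x) (neg-flip (sq-cancel ℚP.≤-refl (subst (_≤ 0ℚ) (e′ x) h))))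
  where e : ∀ x → - (- x) ≡ x
        e = solve-∀ ring
        e′ : ∀ x → x * x ≡ - x * - x
        e′ = solve-∀ ring

-- The common source of Cauchy-Schwarz for finite sums, for averages and for semidefinite forms. The
-- values of `s` and `t` are polynomials in `A`, `S`, `B`, so nothing is divided by a quantity that
-- may vanish.
discriminant : ∀ {A S B} → (∀ s t → 0ℚ ≤ s * s * A + 2ℚ * (s * t * S) + t * t * B) → S * S ≤ A * B
discriminant {A} {S} {B} h with ≡∨pos 0≤B
  where
  0≤B : 0ℚ ≤ B
  0≤B = subst (0ℚ ≤_) (e A S B) (h 0ℚ 1ℚ)
    where e : ∀ A S B → 0ℚ * 0ℚ * A + 2ℚ * (0ℚ * 1ℚ * S) + 1ℚ * 1ℚ * B ≡ B
          e = solve-∀ ring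
... | inj₂ B>0 = cancelˡ B>0 (0≤-⇒≤ (subst (0ℚ ≤_) (e A S B) (h B (- S))))
  where e : ∀ A S B → B * B * A + 2ℚ * (B * (- S) * S) + (- S) * (- S) * B ≡ B * (A * B) - B * (S * S)
        e = solve-∀ ring
-- For `B = 0` the form at `s = S`, `t = - (A + 1)` is `- (A + 2) * (S * S)`, which forces
-- `S * S ≤ 0`.
... | inj₁ refl = subst (S * S ≤_) (sym (ℚP.*-zeroʳ A)) (cancelˡ A+2>0 (0≤-⇒≤ (subst (0ℚ ≤_) (e A S) (h S (- (A + 1ℚ))))))
  where
  0≤A : 0ℚ ≤ A
  0≤A = subst (0ℚ ≤_) (e A S) (h 1ℚ 0ℚ)
    where e : ∀ A S → 1ℚ * 1ℚ * A + 2ℚ * (1ℚ * 0ℚ * S) + 0ℚ * 0ℚ * 0ℚ ≡ A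
          e = solve-∀ ring
  A+2>0 : 0ℚ < A + 2ℚ
  A+2>0 = ℚP.+-mono-≤-< 0≤A (ℚP.positive⁻¹ 2ℚ)
  e : ∀ A S → S * S * A + 2ℚ * (S * (- (A + 1ℚ)) * S) + (- (A + 1ℚ)) * (- (A + 1ℚ)) * 0ℚ ≡ (A + 2ℚ) * 0ℚ - (A + 2ℚ) * (S * S)
  e = solve-∀ ring

^-+ : ∀ x m k → x ^ℚ (m ℕ.+ k) ≡ x ^ℚ m * x ^ℚ k
^-+ x zero k = sym (ℚP.*-identityˡ _)
^-+ x (suc m) k = trans (cong (x *_) (^-+ x m k)) (sym (ℚP.*-assoc x _ _))

^-* : ∀ x y m → (x * y) ^ℚ m ≡ x ^ℚ m * y ^ℚ m
^-* x y zero = refl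
^-* x y (suc m) = trans (cong (x * y *_) (^-* x y m)) (e x y (x ^ℚ m) (y ^ℚ m))
  where e : ∀ x y a b → x * y * (a * b) ≡ x * a * (y * b)
        e = solve-∀ ring

^-^ : ∀ x m k → (x ^ℚ m) ^ℚ k ≡ x ^ℚ (m ℕ.* k)
^-^ x m zero = cong (x ^ℚ_) (sym (ℕP.*-zeroʳ m))
^-^ x m (suc k) = trans (cong (x ^ℚ m *_) (^-^ x m k)) (trans (sym (^-+ x m (m ℕ.* k))) (cong (x ^ℚ_) (sym (ℕP.*-suc m k))))

1^ : ∀ m → 1ℚ ^ℚ m ≡ 1ℚ
1^ zero = refl
1^ (suc m) = trans (ℚP.*-identityˡ _) (1^ m)

0≤^ : ∀ {x} m → 0ℚ ≤ x → 0ℚ ≤ x ^ℚ m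
0≤^ zero h = 0≤1
0≤^ (suc m) h = 0≤* h (0≤^ m h)

0<^ : ∀ {x} m → 0ℚ < x → 0ℚ < x ^ℚ m
0<^ zero h = 0<1
0<^ (suc m) h = 0<* h (0<^ m h)

^-mono : ∀ {x y} m → 0ℚ ≤ x → x ≤ y → x ^ℚ m ≤ y ^ℚ m
^-mono zero h h′ = ℚP.≤-refl
^-mono (suc m) h h′ = *-mono h (0≤^ m h) h′ (^-mono m h h′)

1≤^ : ∀ {x} m → 1ℚ ≤ x → 1ℚ ≤ x ^ℚ m
1≤^ {x} m h = subst (_≤ x ^ℚ m) (1^ m) (^-mono m 0≤1 h)

^-monoᵉ : ∀ {x} {m k} → 1ℚ ≤ x → m ℕ.≤ k → x ^ℚ m ≤ x ^ℚ k
^-monoᵉ {x} {m} {k} h h′ = subst₂ _≤_ (ℚP.*-identityʳ _)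
  (trans (sym (^-+ x m (k ℕ.∸ m))) (cong (x ^ℚ_) (ℕP.m+[n∸m]≡n h′)))
  (*-monoˡ (0≤^ m (ℚP.≤-trans 0≤1 h)) (1≤^ (k ℕ.∸ m) h))

^-cancel : ∀ {x y} m → 0ℚ ≤ x → 0ℚ ≤ y → x ^ℚ suc m ≤ y ^ℚ suc m → x ≤ y
^-cancel {x} {y} m hx hy h with ≤∨> x y
... | inj₁ g = g
... | inj₂ g = ⊥-elim (ℚP.<-irrefl refl (ℚP.<-≤-trans lt h))
  where
  0<x : 0ℚ < x
  0<x = ℚP.≤-<-trans hy g
  lt : y ^ℚ suc m < x ^ℚ suc m
  lt = ℚP.≤-<-trans (*-monoˡ hy (^-mono m hy (ℚP.<⇒≤ g))) (ℚP.*-monoˡ-<-pos (x ^ℚ m) {{ℚ.positive (0<^ m 0<x)}} g)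

opaque
  -- fromℕ would otherwise be unfolded to a normalised fraction during unification.
  nat : ℕ → ℚ
  nat = fromℕ

  nat≡fromℕ : ∀ k → nat k ≡ fromℕ k
  nat≡fromℕ k = refl

private
  toℚᵘ-nat : ∀ k → ℚ.toℚᵘ (nat k) U.≃ (ℤ.+ k U./ 1)
  toℚᵘ-nat k rewrite nat≡fromℕ k = ℚP.toℚᵘ-fromℚᵘ (ℤ.+ k U./ 1)

nat-0 : nat 0 ≡ 0ℚ
nat-0 = nat≡fromℕ 0

nat-suc : ∀ k → nat (suc k) ≡ 1ℚ + nat k
nat-suc k = ℚP.toℚᵘ-injective (UP.≃-trans h (UP.≃-sym (ℚP.toℚᵘ-homo-+ 1ℚ (nat k))))
  where
  h : ℚ.toℚᵘ (nat (suc k)) U.≃ (ℚ.toℚᵘ 1ℚ U.+ ℚ.toℚᵘ (nat k))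
  h = UP.≃-trans (toℚᵘ-nat (suc k)) (UP.≃-trans g (UP.+-congʳ (ℚ.toℚᵘ 1ℚ) (UP.≃-sym (toℚᵘ-nat k))))
    where
    g : (ℤ.+ suc k U./ 1) U.≃ (ℚ.toℚᵘ 1ℚ U.+ (ℤ.+ k U./ 1))
    g = U.*≡* (cong (ℤ._* ℤ.+ 1) (cong (λ z → (ℤ.+ 1) ℤ.+ z) (sym (ℤP.*-identityʳ (ℤ.+ k)))))

nat-1 : nat 1 ≡ 1ℚ
nat-1 = nat≡fromℕ 1

nat-+ : ∀ m k → nat (m ℕ.+ k) ≡ nat m + nat k
nat-+ zero k = trans (sym (ℚP.+-identityˡ _)) (cong (_+ nat k) (sym nat-0))
nat-+ (suc m) k = trans (nat-suc (m ℕ.+ k)) (trans (cong (1ℚ +_) (nat-+ m k))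
  (trans (sym (ℚP.+-assoc 1ℚ (nat m) (nat k))) (cong (_+ nat k) (sym (nat-suc m)))))

nat-* : ∀ m k → nat (m ℕ.* k) ≡ nat m * nat k
nat-* zero k = trans nat-0 (trans (sym (ℚP.*-zeroˡ (nat k))) (cong (_* nat k) (sym nat-0)))
nat-* (suc m) k = trans (nat-+ k (m ℕ.* k)) (trans (cong (nat k +_) (nat-* m k))
  (trans (e (nat k) (nat m)) (cong (_* nat k) (sym (nat-suc m)))))
  where e : ∀ a b → a + b * a ≡ (1ℚ + b) * a
        e = solve-∀ ring

nat-^ : ∀ m k → nat (m ℕ.^ k) ≡ nat m ^ℚ k
nat-^ m zero = nat-1
nat-^ m (suc k) = trans (nat-* m (m ℕ.^ k)) (cong (nat m *_) (nat-^ m k))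

0≤nat : ∀ k → 0ℚ ≤ nat k
0≤nat zero = ℚP.≤-reflexive (sym nat-0)
0≤nat (suc k) = subst (0ℚ ≤_) (sym (nat-suc k)) (0≤+ 0≤1 (0≤nat k))

nat-mono : ∀ {m k} → m ℕ.≤ k → nat m ≤ nat k
nat-mono {m} {k} h = subst₂ _≤_ (ℚP.+-identityʳ _)
  (trans (sym (nat-+ m (k ℕ.∸ m))) (cong nat (ℕP.m+[n∸m]≡n h))) (ℚP.+-monoʳ-≤ (nat m) (0≤nat (k ℕ.∸ m)))

nat-cancel : ∀ {m k} → nat m ≤ nat k → m ℕ.≤ k
nat-cancel {m} {k} h with m ℕP.≤? k
... | yes p = p
... | no p = ⊥-elim (ℚP.<-irrefl refl (ℚP.<-≤-trans (ℚP.<-≤-trans lt (nat-mono (ℕP.≰⇒> p))) h))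
  where lt : nat k < nat (suc k)
        lt = subst₂ _<_ (ℚP.+-identityˡ _) (sym (nat-suc k)) (ℚP.+-monoˡ-< (nat k) 0<1)

0<nat : ∀ {k} → 1 ℕ.≤ k → 0ℚ < nat k
0<nat {k} h = ℚP.<-≤-trans 0<1 (subst (_≤ nat k) nat-1 (nat-mono h))

archimedean : ∀ p → ∃[ m ] p ≤ nat m
archimedean p@(ℚ.mkℚ _ _ _) = ℤ.∣ ↥ p ∣ , ℚP.toℚᵘ-cancel-≤ (UP.≤-respʳ-≃ (UP.≃-sym (toℚᵘ-nat ℤ.∣ ↥ p ∣)) (le (ℚ.toℚᵘ p)))
  where
  z≤∣z∣ : ∀ z → z ℤ.≤ ℤ.+ ℤ.∣ z ∣
  z≤∣z∣ (ℤ.+ m) = ℤP.≤-refl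
  z≤∣z∣ ℤ.-[1+ m ] = ℤ.-≤+
  le : ∀ u → u U.≤ (ℤ.+ ℤ.∣ U.↥ u ∣ U./ 1)
  le (U.mkℚᵘ z d) = U.*≤* (subst₂ ℤ._≤_ (sym (ℤP.*-identityʳ z)) (ℤP.pos-* ℤ.∣ z ∣ (suc d))
    (ℤP.≤-trans (z≤∣z∣ z) (ℤ.+≤+ (ℕP.m≤m*n ℤ.∣ z ∣ (suc d)))))

-- Finite sums

∑ : {A : Set} → List A → (A → ℚ) → ℚ
∑ [] f = 0ℚ
∑ (x ∷ xs) f = f x + ∑ xs f

module _ {A : Set} where

  ∑-cong : (xs : List A) {f g : A → ℚ} → (∀ x → f x ≡ g x) → ∑ xs f ≡ ∑ xs g
  ∑-cong [] h = refl
  ∑-cong (x ∷ xs) h = cong₂ _+_ (h x) (∑-cong xs h)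

  ∑-cong∈ : (xs : List A) {f g : A → ℚ} → (∀ {x} → x ∈ xs → f x ≡ g x) → ∑ xs f ≡ ∑ xs g
  ∑-cong∈ [] h = refl
  ∑-cong∈ (x ∷ xs) h = cong₂ _+_ (h (here refl)) (∑-cong∈ xs (h ∘ there))

  ∑-0 : (xs : List A) → ∑ xs (λ _ → 0ℚ) ≡ 0ℚ
  ∑-0 [] = refl
  ∑-0 (x ∷ xs) = trans (ℚP.+-identityˡ _) (∑-0 xs)

  ∑-zero : (xs : List A) {f : A → ℚ} → (∀ x → f x ≡ 0ℚ) → ∑ xs f ≡ 0ℚ
  ∑-zero xs h = trans (∑-cong xs h) (∑-0 xs)

  ∑-+ : (xs : List A) (f g : A → ℚ) → ∑ xs (λ x → f x + g x) ≡ ∑ xs f + ∑ xs g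
  ∑-+ [] f g = refl
  ∑-+ (x ∷ xs) f g = trans (cong (f x + g x +_) (∑-+ xs f g)) (e (f x) (g x) _ _)
    where e : ∀ a b c d → a + b + (c + d) ≡ a + c + (b + d)
          e = solve-∀ ring

  ∑-*ˡ : (xs : List A) (c : ℚ) (f : A → ℚ) → ∑ xs (λ x → c * f x) ≡ c * ∑ xs f
  ∑-*ˡ [] c f = sym (ℚP.*-zeroʳ c)
  ∑-*ˡ (x ∷ xs) c f = trans (cong (c * f x +_) (∑-*ˡ xs c f)) (sym (ℚP.*-distribˡ-+ c _ _))

  ∑-*ʳ : (xs : List A) (f : A → ℚ) (c : ℚ) → ∑ xs (λ x → f x * c) ≡ ∑ xs f * c
  ∑-*ʳ xs f c = trans (∑-cong xs (λ x → ℚP.*-comm (f x) c)) (trans (∑-*ˡ xs c f) (ℚP.*-comm c _))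

  ∑-neg : (xs : List A) (f : A → ℚ) → ∑ xs (λ x → - f x) ≡ - ∑ xs f
  ∑-neg [] f = refl
  ∑-neg (x ∷ xs) f = trans (cong (- f x +_) (∑-neg xs f)) (sym (ℚP.neg-distrib-+ (f x) _))

  ∑-- : (xs : List A) (f g : A → ℚ) → ∑ xs (λ x → f x - g x) ≡ ∑ xs f - ∑ xs g
  ∑-- xs f g = trans (∑-+ xs f (λ x → - g x)) (cong (∑ xs f +_) (∑-neg xs g))

  ∑-++ : (xs ys : List A) (f : A → ℚ) → ∑ (xs ++ ys) f ≡ ∑ xs f + ∑ ys f
  ∑-++ [] ys f = sym (ℚP.+-identityˡ _)
  ∑-++ (x ∷ xs) ys f = trans (cong (f x +_) (∑-++ xs ys f)) (sym (ℚP.+-assoc (f x) _ _))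

  ∑-mono : (xs : List A) {f g : A → ℚ} → (∀ x → f x ≤ g x) → ∑ xs f ≤ ∑ xs g
  ∑-mono [] h = ℚP.≤-refl
  ∑-mono (x ∷ xs) h = ℚP.+-mono-≤ (h x) (∑-mono xs h)

  ∑-mono∈ : (xs : List A) {f g : A → ℚ} → (∀ {x} → x ∈ xs → f x ≤ g x) → ∑ xs f ≤ ∑ xs g
  ∑-mono∈ [] h = ℚP.≤-refl
  ∑-mono∈ (x ∷ xs) h = ℚP.+-mono-≤ (h (here refl)) (∑-mono∈ xs (h ∘ there))

  0≤∑ : (xs : List A) {f : A → ℚ} → (∀ x → 0ℚ ≤ f x) → 0ℚ ≤ ∑ xs f
  0≤∑ [] h = ℚP.≤-refl
  0≤∑ (x ∷ xs) h = 0≤+ (h x) (0≤∑ xs h)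

  ∑-∈≤ : {xs : List A} {x : A} {f : A → ℚ} → (∀ x → 0ℚ ≤ f x) → x ∈ xs → f x ≤ ∑ xs f
  ∑-∈≤ {y ∷ xs} {x} {f} h (here refl) = subst (_≤ f x + ∑ xs f) (ℚP.+-identityʳ _) (ℚP.+-monoʳ-≤ (f x) (0≤∑ xs h))
  ∑-∈≤ {y ∷ xs} {x} {f} h (there p) = subst (_≤ f y + ∑ xs f) (ℚP.+-identityˡ _) (ℚP.+-mono-≤ (h y) (∑-∈≤ h p))

  ∑-const : (xs : List A) (c : ℚ) → ∑ xs (λ _ → c) ≡ nat (length xs) * c
  ∑-const [] c = sym (trans (cong (_* c) nat-0) (ℚP.*-zeroˡ c))
  ∑-const (x ∷ xs) c = trans (cong (c +_) (∑-const xs c))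
    (trans (x+yx≡[1+y]x c (nat (length xs))) (cong (_* c) (sym (nat-suc (length xs)))))

  ∑-↭ : {xs ys : List A} (f : A → ℚ) → xs ↭ ys → ∑ xs f ≡ ∑ ys f
  ∑-↭ f Perm′.refl = refl
  ∑-↭ f (Perm′.prep x p) = cong (f x +_) (∑-↭ f p)
  ∑-↭ f (Perm′.swap x y p) = trans (cong (λ z → f x + (f y + z)) (∑-↭ f p)) (e (f x) (f y) _)
    where e : ∀ a b c → a + (b + c) ≡ b + (a + c)
          e = solve-∀ ring
  ∑-↭ f (Perm′.trans p q) = trans (∑-↭ f p) (∑-↭ f q)

  ∑-CS : (xs : List A) (f g : A → ℚ) → ∑ xs (λ x → f x * g x) * ∑ xs (λ x → f x * g x) ≤ ∑ xs (λ x → f x * f x) * ∑ xs (λ x → g x * g x)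
  ∑-CS xs f g = discriminant λ s t → subst (0ℚ ≤_)
    (trans (∑-cong xs (λ x → e s t (f x) (g x)))
      (trans (∑-+ xs _ _) (cong₂ _+_
        (trans (∑-+ xs _ _) (cong₂ _+_ (∑-*ˡ xs (s * s) _) (trans (∑-*ˡ xs 2ℚ _) (cong (2ℚ *_) (∑-*ˡ xs (s * t) _)))))
        (∑-*ˡ xs (t * t) _))))
    (0≤∑ xs (λ x → 0≤sq (s * f x + t * g x)))
    where e : ∀ s t a b → (s * a + t * b) * (s * a + t * b) ≡ s * s * (a * a) + 2ℚ * (s * t * (a * b)) + t * t * (b * b)
          e = solve-∀ ring

module _ {A B : Set} where

  ∑-map : (φ : A → B) (xs : List A) (f : B → ℚ) → ∑ (map φ xs) f ≡ ∑ xs (f ∘ φ)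
  ∑-map φ [] f = refl
  ∑-map φ (x ∷ xs) f = cong (f (φ x) +_) (∑-map φ xs f)

  ∑-concatMap : (φ : A → List B) (xs : List A) (f : B → ℚ) → ∑ (concatMap φ xs) f ≡ ∑ xs (λ x → ∑ (φ x) f)
  ∑-concatMap φ [] f = refl
  ∑-concatMap φ (x ∷ xs) f = trans (∑-++ (φ x) (concatMap φ xs) f) (cong (∑ (φ x) f +_) (∑-concatMap φ xs f))

  ∑-swap : (xs : List A) (ys : List B) (f : A → B → ℚ) → ∑ xs (λ x → ∑ ys (f x)) ≡ ∑ ys (λ y → ∑ xs (λ x → f x y))
  ∑-swap [] ys f = sym (∑-0 ys)
  ∑-swap (x ∷ xs) ys f = trans (cong (∑ ys (f x) +_) (∑-swap xs ys f)) (sym (∑-+ ys (f x) _))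

  ∑-product : (xs : List A) (ys : List B) (f : A → ℚ) (g : B → ℚ) → ∑ xs (λ x → ∑ ys (λ y → f x * g y)) ≡ ∑ xs f * ∑ ys g
  ∑-product xs ys f g = trans (∑-cong xs (λ x → ∑-*ˡ ys (f x) g)) (∑-*ʳ xs f (∑ ys g))

[_≟_] : {n : ℕ} → Fin n → Fin n → ℚ
[ i ≟ j ] = if does (i FinP.≟ j) then 1ℚ else 0ℚ

module _ {n : ℕ} where

  ≟-refl : (i : Fin n) → [ i ≟ i ] ≡ 1ℚ
  ≟-refl i rewrite dec-true (i FinP.≟ i) refl = refl

  ≟-≢ : {i j : Fin n} → i ≢ j → [ i ≟ j ] ≡ 0ℚ
  ≟-≢ {i} {j} h rewrite dec-false (i FinP.≟ j) h = refl

  0∨1 : (i j : Fin n) → (i ≡ j × [ i ≟ j ] ≡ 1ℚ) ⊎ (i ≢ j × [ i ≟ j ] ≡ 0ℚ)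
  0∨1 i j with i FinP.≟ j
  ... | yes p = inj₁ (p , refl)
  ... | no p = inj₂ (p , refl)

  0≤≟ : (i j : Fin n) → 0ℚ ≤ [ i ≟ j ]
  0≤≟ i j with i FinP.≟ j
  ... | yes p = 0≤1
  ... | no p = ℚP.≤-refl

  ≟-idem : (i j : Fin n) → [ i ≟ j ] * [ i ≟ j ] ≡ [ i ≟ j ]
  ≟-idem i j with i FinP.≟ j
  ... | yes p = refl
  ... | no p = refl

  ≟-sym : (i j : Fin n) → [ i ≟ j ] ≡ [ j ≟ i ]
  ≟-sym i j with 0∨1 i j
  ... | inj₁ (refl , e) = refl
  ... | inj₂ (p , e) = trans e (sym (≟-≢ (p ∘ sym)))

  ≟-subst : (i j : Fin n) (f : Fin n → ℚ) → [ i ≟ j ] * f i ≡ [ i ≟ j ] * f j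
  ≟-subst i j f with i FinP.≟ j
  ... | yes refl = refl
  ... | no p = trans (ℚP.*-zeroˡ (f i)) (sym (ℚP.*-zeroˡ (f j)))

suc≟suc : {n : ℕ} (i j : Fin n) → [ suc i ≟ suc j ] ≡ [ i ≟ j ]
suc≟suc i j with 0∨1 i j
... | inj₁ (refl , e) = trans (≟-refl (suc i)) (sym (≟-refl i))
... | inj₂ (p , e) = trans (≟-≢ (p ∘ FinP.suc-injective)) (sym e)

∑ᶠ : (n : ℕ) → (Fin n → ℚ) → ℚ
∑ᶠ n = ∑ (allFin n)

∑ᶠ-suc : (n : ℕ) (f : Fin (suc n) → ℚ) → ∑ᶠ (suc n) f ≡ f zero + ∑ᶠ n (f ∘ suc)
∑ᶠ-suc n f = cong (f zero +_) (trans (cong (λ l → ∑ l f) (sym (ListP.map-tabulate id suc))) (∑-map suc (allFin n) f))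

∑-select : {n : ℕ} (i : Fin n) (f : Fin n → ℚ) → ∑ᶠ n (λ j → [ i ≟ j ] * f j) ≡ f i
∑-select {suc n} zero f = trans (∑ᶠ-suc n (λ j → [ zero ≟ j ] * f j)) (trans (cong₂ _+_ (ℚP.*-identityˡ (f zero))
  (∑-zero (allFin n) (λ j → ℚP.*-zeroˡ (f (suc j))))) (ℚP.+-identityʳ (f zero)))
∑-select {suc n} (suc i) f = trans (∑ᶠ-suc n (λ j → [ suc i ≟ j ] * f j)) (trans (cong₂ _+_ (ℚP.*-zeroˡ (f zero))
  (trans (∑-cong (allFin n) (λ j → cong (_* f (suc j)) (suc≟suc i j))) (∑-select i (f ∘ suc)))) (ℚP.+-identityˡ (f (suc i))))

∑-≟ : {n : ℕ} (i : Fin n) → ∑ᶠ n (λ j → [ i ≟ j ]) ≡ 1ℚ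
∑-≟ {n} i = trans (∑-cong (allFin n) (λ j → sym (ℚP.*-identityʳ [ i ≟ j ]))) (∑-select i (λ _ → 1ℚ))

∑ᶠ-const : (n : ℕ) (c : ℚ) → ∑ᶠ n (λ _ → c) ≡ nat n * c
∑ᶠ-const n c = trans (∑-const (allFin n) c) (cong (λ m → nat m * c) (ListP.length-tabulate id))

∑ᵛ : (n i : ℕ) → (Vec (Fin n) i → ℚ) → ℚ
∑ᵛ n i = ∑ (allVecs n i)

∑ᵛ-zero : (n : ℕ) (f : Vec (Fin n) 0 → ℚ) → ∑ᵛ n 0 f ≡ f []
∑ᵛ-zero n f = ℚP.+-identityʳ (f [])

∑ᵛ-suc : (n i : ℕ) (f : Vec (Fin n) (suc i) → ℚ) → ∑ᵛ n (suc i) f ≡ ∑ᶠ n (λ x → ∑ᵛ n i (λ v → f (x ∷ v)))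
∑ᵛ-suc n i f = trans (∑-concatMap (λ x → map (x ∷_) (allVecs n i)) (allFin n) f)
  (∑-cong (allFin n) (λ x → ∑-map (x ∷_) (allVecs n i) f))

∈-allVecs : {n i : ℕ} (v : Vec (Fin n) i) → v ∈ allVecs n i
∈-allVecs [] = here refl
∈-allVecs {n} {suc i} (x ∷ v) = MemP.∈-concatMap⁺ (λ x → map (x ∷_) (allVecs n i))
  (Any.map (λ { refl → MemP.∈-map⁺ (x ∷_) (∈-allVecs v) }) (MemP.∈-allFin x))

∑ᵛ-const : (n i : ℕ) (c : ℚ) → ∑ᵛ n i (λ _ → c) ≡ nat n ^ℚ i * c
∑ᵛ-const n zero c = trans (∑ᵛ-zero n (λ _ → c)) (sym (ℚP.*-identityˡ c))
∑ᵛ-const n (suc i) c = trans (∑ᵛ-suc n i _) (trans (∑-cong (allFin n) (λ x → ∑ᵛ-const n i c))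
  (trans (∑ᶠ-const n _) (sym (ℚP.*-assoc (nat n) _ c))))

-- Averages over a permutation group

archimedean′ : ∀ B {ε} → 0ℚ < ε → ∃[ m ] B < nat m * ε
archimedean′ B {ε} h = suc m , ℚP.≤-<-trans (subst (_≤ nat m * ε) e (*-monoʳ (ℚP.<⇒≤ h) (proj₂ (archimedean (B * r)))))
    (subst (nat m * ε <_) (sym (cong (_* ε) (nat-suc m))) (subst₂ _<_ (ℚP.+-identityˡ (nat m * ε)) (e″ (nat m) ε) (ℚP.+-monoˡ-< (nat m * ε) h)))
  where
  instance _ = ℚ.positive h
           _ = ℚP.pos⇒nonZero ε
  r = ℚ.1/ ε
  m = proj₁ (archimedean (B * r))
  e : B * r * ε ≡ B
  e = trans (ℚP.*-assoc B r ε) (trans (cong (B *_) (ℚP.*-inverseˡ ε)) (ℚP.*-identityʳ B))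
  e″ : ∀ a b → b + a * b ≡ (1ℚ + a) * b
  e″ = solve-∀ ring

-- Bernoulli's inequality for `1 + d / y`, multiplied by `y^(m + 1)` so that `y = 0` is no
-- exception.
bernoulli : ∀ {y d} m → 0ℚ ≤ y → 0ℚ ≤ d → y ^ℚ m * (y + nat m * d) ≤ (y + d) ^ℚ m * y
bernoulli {y} {d} zero hy hd = ℚP.≤-reflexive (trans (cong (λ z → 1ℚ * (y + z * d)) nat-0) (e y d))
  where e : ∀ y d → 1ℚ * (y + 0ℚ * d) ≡ 1ℚ * y
        e = solve-∀ ring
bernoulli {y} {d} (suc m) hy hd = begin
  y * y ^ℚ m * (y + nat (suc m) * d) ≡⟨ cong (λ z → y * y ^ℚ m * (y + z * d)) (nat-suc m) ⟩
  y * y ^ℚ m * (y + (1ℚ + nat m) * d) ≤⟨ 0≤-⇒≤ (subst (0ℚ ≤_) (e y (y ^ℚ m) (nat m) d) (0≤* (0≤^ m hy) (0≤* (0≤nat m) (0≤* hd hd)))) ⟩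
  (y + d) * (y ^ℚ m * (y + nat m * d)) ≤⟨ *-monoˡ (0≤+ hy hd) (bernoulli m hy hd) ⟩
  (y + d) * ((y + d) ^ℚ m * y) ≡⟨ ℚP.*-assoc (y + d) _ y ⟨
  (y + d) * (y + d) ^ℚ m * y ∎
  where open ≤R
        e : ∀ y a b d → a * (b * (d * d)) ≡ (y + d) * (a * (y + b * d)) - y * a * (y + (1ℚ + b) * d)
        e = solve-∀ ring

-- If `x` exceeded `y > 0`, then `(x / y)^m` would grow at least linearly in `m` and overtake
-- `K / c`. This is how an uncontrolled constant `K` is discarded at the end of the power iteration.
geometric-dominance : ∀ {x y c K} → 0ℚ ≤ x → 0ℚ ≤ y → 0ℚ < c → (∀ m → x ^ℚ m * c ≤ K * y ^ℚ m) → x ≤ y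
geometric-dominance {x} {y} {c} {K} hx hy hc h with ≤∨> x y
... | inj₁ g = g
... | inj₂ g with ≡∨pos hy
...   | inj₁ refl = subst (_≤ 0ℚ) (ℚP.*-identityʳ x) (cancelʳ hc (subst₂ _≤_ refl (e K c) (h 1)))
  where e : ∀ K c → K * (0ℚ * 1ℚ) ≡ 0ℚ * c
        e = solve-∀ ring
...   | inj₂ y>0 = ⊥-elim (ℚP.<-irrefl refl (ℚP.<-≤-trans (proj₂ ar) le))
  where
  d = x - y
  0<d : 0ℚ < d
  0<d = subst (_< x - y) (ℚP.+-inverseʳ y) (ℚP.+-monoˡ-< (- y) g)
  0<dc : 0ℚ < d * c
  0<dc = 0<* 0<d hc
  ar = archimedean′ (K * y) 0<dc
  m = proj₁ ar
  open ≤R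
  x≡ : y + d ≡ x
  x≡ = e y x
    where e : ∀ y x → y + (x - y) ≡ x
          e = solve-∀ ring
  step : y ^ℚ m * ((y + nat m * d) * c) ≤ y ^ℚ m * (K * y)
  step = begin
    y ^ℚ m * ((y + nat m * d) * c) ≡⟨ ℚP.*-assoc (y ^ℚ m) _ c ⟨
    y ^ℚ m * (y + nat m * d) * c ≤⟨ *-monoʳ (ℚP.<⇒≤ hc) (bernoulli m hy (ℚP.<⇒≤ 0<d)) ⟩
    (y + d) ^ℚ m * y * c ≡⟨ cong (λ z → z ^ℚ m * y * c) x≡ ⟩
    x ^ℚ m * y * c ≡⟨ e (x ^ℚ m) y c ⟩
    y * (x ^ℚ m * c) ≤⟨ *-monoˡ hy (h m) ⟩
    y * (K * y ^ℚ m) ≡⟨ e′ y K (y ^ℚ m) ⟩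
    y ^ℚ m * (K * y) ∎
    where e : ∀ a b c → a * b * c ≡ b * (a * c)
          e = solve-∀ ring
          e′ : ∀ a b c → a * (b * c) ≡ c * (b * a)
          e′ = solve-∀ ring
  le : nat m * (d * c) ≤ K * y
  le = ℚP.≤-trans (0≤-⇒≤ (subst (0ℚ ≤_) (e y (nat m) d c) (0≤* hy (ℚP.<⇒≤ hc)))) (cancelˡ (0<^ m y>0) step)
    where e : ∀ y a d c → y * c ≡ (y + a * d) * c - a * (d * c)
          e = solve-∀ ring

-- The axioms of S_n that the argument uses; σ ⟨ x ⟩ is σ(x) and tr x y is the transposition (x y).
record PermGroup (n : ℕ) : Set₁ where
  infixl 7 _·_
  infix 8 _⟨_⟩
  field
    G : Set
    els : List G
    ∈els : ∀ g → g ∈ els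
    _≟G_ : (g h : G) → Dec (g ≡ h)
    _·_ : G → G → G
    e : G
    inv : G → G
    _⟨_⟩ : G → Fin n → Fin n
    ext : ∀ {g h} → (∀ x → g ⟨ x ⟩ ≡ h ⟨ x ⟩) → g ≡ h
    act-· : ∀ g h x → (g · h) ⟨ x ⟩ ≡ g ⟨ h ⟨ x ⟩ ⟩
    act-e : ∀ x → e ⟨ x ⟩ ≡ x
    act-inv : ∀ g x → inv g ⟨ g ⟨ x ⟩ ⟩ ≡ x
    act-inv′ : ∀ g x → g ⟨ inv g ⟨ x ⟩ ⟩ ≡ x
    tr : Fin n → Fin n → G
    tr-l : ∀ x y → tr x y ⟨ x ⟩ ≡ y
    tr-r : ∀ x y → tr x y ⟨ y ⟩ ≡ x
    tr-o : ∀ x y {z} → z ≢ x → z ≢ y → tr x y ⟨ z ⟩ ≡ z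
    reindex : (φ ψ : G → G) → (∀ g → φ (ψ g) ≡ g) → (∀ g → ψ (φ g) ≡ g) → (f : G → ℚ) → ∑ els (f ∘ φ) ≡ ∑ els f
    sgn : G → ℚ
    sgn-· : ∀ g h → sgn (g · h) ≡ sgn g * sgn h
    sgn-sq : ∀ g → sgn g * sgn g ≡ 1ℚ
    sgn-tr : ∀ {x y} → x ≢ y → sgn (tr x y) ≡ - 1ℚ

-- Expectation, inner product and projections.

module Functions {n : ℕ} (𝓖 : PermGroup n) where
  open PermGroup 𝓖

  act-inj : ∀ g {x y} → g ⟨ x ⟩ ≡ g ⟨ y ⟩ → x ≡ y
  act-inj g {x} {y} h = trans (sym (act-inv g x)) (trans (cong (inv g ⟨_⟩) h) (act-inv g y))

  ·-assoc : ∀ g h k → g · h · k ≡ g · (h · k)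
  ·-assoc g h k = ext λ x → trans (act-· (g · h) k x) (trans (act-· g h _) (sym (trans (act-· g _ x) (cong (g ⟨_⟩) (act-· h k x)))))

  ·-idʳ : ∀ g → g · e ≡ g
  ·-idʳ g = ext λ x → trans (act-· g e x) (cong (g ⟨_⟩) (act-e x))

  ·-idˡ : ∀ g → e · g ≡ g
  ·-idˡ g = ext λ x → trans (act-· e g x) (act-e _)

  ·-invʳ : ∀ g → g · inv g ≡ e
  ·-invʳ g = ext λ x → trans (act-· g _ x) (trans (act-inv′ g x) (sym (act-e x)))

  ·-invˡ : ∀ g → inv g · g ≡ e
  ·-invˡ g = ext λ x → trans (act-· _ g x) (trans (act-inv g x) (sym (act-e x)))

  cancel-invˡ : ∀ g h → g · (inv g · h) ≡ h
  cancel-invˡ g h = trans (sym (·-assoc g _ h)) (trans (cong (_· h) (·-invʳ g)) (·-idˡ h))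

  cancel-invˡ′ : ∀ g h → inv g · (g · h) ≡ h
  cancel-invˡ′ g h = trans (sym (·-assoc _ g h)) (trans (cong (_· h) (·-invˡ g)) (·-idˡ h))

  cancel-invʳ : ∀ g h → h · inv g · g ≡ h
  cancel-invʳ g h = trans (·-assoc h _ g) (trans (cong (h ·_) (·-invˡ g)) (·-idʳ h))

  cancel-invʳ′ : ∀ g h → h · g · inv g ≡ h
  cancel-invʳ′ g h = trans (·-assoc h g _) (trans (cong (h ·_) (·-invʳ g)) (·-idʳ h))

  F : Set
  F = G → ℚ

  private
    size : ℚ
    size = nat (length els)

    nonempty : ∀ {xs : List G} → e ∈ xs → 1 ℕ.≤ length xs
    nonempty {_ ∷ _} _ = ℕ.s≤s ℕ.z≤n

    0<size : 0ℚ < size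
    0<size = 0<nat (nonempty (∈els e))

    κ : ℚ
    κ = ℚ.1/_ size {{ℚP.pos⇒nonZero size {{ℚ.positive 0<size}}}}

    κ-size : κ * size ≡ 1ℚ
    κ-size = ℚP.*-inverseˡ size {{ℚP.pos⇒nonZero size {{ℚ.positive 0<size}}}}

    0≤κ : 0ℚ ≤ κ
    0≤κ = ℚP.<⇒≤ (ℚP.positive⁻¹ κ {{ℚP.1/pos⇒pos size {{ℚ.positive 0<size}}}})

  opaque
    -- Opacity keeps the sum over the group from unfolding; the rest of the proof works with the
    -- laws in this block.
    E : F → ℚ
    E f = κ * ∑ els f

    E-∑els : ∀ f → ∑ els f ≡ nat (length els) * E f
    E-∑els f = trans (sym (ℚP.*-identityˡ (∑ els f))) (trans (cong (_* ∑ els f) (sym κ-size)) (xy*z≡y*xz κ size _))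

    E-cong : ∀ {f g} → (∀ σ → f σ ≡ g σ) → E f ≡ E g
    E-cong h = cong (κ *_) (∑-cong els h)

    E-+ : ∀ f g → E (λ σ → f σ + g σ) ≡ E f + E g
    E-+ f g = trans (cong (κ *_) (∑-+ els f g)) (ℚP.*-distribˡ-+ κ _ _)

    E-*ˡ : ∀ c f → E (λ σ → c * f σ) ≡ c * E f
    E-*ˡ c f = trans (cong (κ *_) (∑-*ˡ els c f)) (x*yz≡y*xz κ c _)

    E-mono : ∀ {f g} → (∀ σ → f σ ≤ g σ) → E f ≤ E g
    E-mono h = *-monoˡ 0≤κ (∑-mono els h)

    E-const : ∀ c → E (λ _ → c) ≡ c
    E-const c = trans (cong (κ *_) (∑-const els c)) (trans (sym (ℚP.*-assoc κ size c)) (trans (cong (_* c) κ-size) (ℚP.*-identityˡ c)))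

    E-reindex : (φ ψ : G → G) → (∀ g → φ (ψ g) ≡ g) → (∀ g → ψ (φ g) ≡ g) → ∀ f → E (f ∘ φ) ≡ E f
    E-reindex φ ψ h h′ f = cong (κ *_) (reindex φ ψ h h′ f)

    E-∑ : {A : Set} (xs : List A) (f : A → F) → E (λ σ → ∑ xs (λ x → f x σ)) ≡ ∑ xs (λ x → E (f x))
    E-∑ xs f = trans (cong (κ *_) (∑-swap els xs (λ σ x → f x σ))) (sym (∑-*ˡ xs κ _))

    E-swap : (f : G → G → ℚ) → E (λ σ → E (λ τ → f σ τ)) ≡ E (λ τ → E (λ σ → f σ τ))
    E-swap f = cong (κ *_) (trans (∑-*ˡ els κ _) (trans (cong (κ *_) (∑-swap els els f)) (sym (∑-*ˡ els κ _))))

    E-definite : ∀ f → (∀ σ → 0ℚ ≤ f σ) → E f ≤ 0ℚ → ∀ σ → f σ ≡ 0ℚ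
    E-definite f h h′ σ = ℚP.≤-antisym (ℚP.≤-trans (∑-∈≤ h (∈els σ)) ∑≤0) (h σ)
      where
      ∑≤0 : ∑ els f ≤ 0ℚ
      ∑≤0 = cancelˡ (ℚP.positive⁻¹ κ {{ℚP.1/pos⇒pos size {{ℚ.positive 0<size}}}}) (subst (κ * ∑ els f ≤_) (sym (ℚP.*-zeroʳ κ)) h′)

    E≡∑ : ∃[ c ] (∀ f → E f ≡ ∑ els (λ σ → c * f σ))
    E≡∑ = κ , λ f → sym (∑-*ˡ els κ f)

  E-*ʳ : ∀ f c → E (λ σ → f σ * c) ≡ E f * c
  E-*ʳ f c = trans (E-cong (λ σ → ℚP.*-comm (f σ) c)) (trans (E-*ˡ c f) (ℚP.*-comm c _))

  E-neg : ∀ f → E (λ σ → - f σ) ≡ - E f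
  E-neg f = trans (E-cong (λ σ → eq (f σ))) (trans (E-*ˡ (- 1ℚ) f) (sym (eq (E f))))
    where eq : ∀ a → - a ≡ (- 1ℚ) * a
          eq = solve-∀ ring

  E-- : ∀ f g → E (λ σ → f σ - g σ) ≡ E f - E g
  E-- f g = trans (E-+ f (λ σ → - g σ)) (cong (E f +_) (E-neg g))

  E-zero : ∀ {f} → (∀ σ → f σ ≡ 0ℚ) → E f ≡ 0ℚ
  E-zero h = trans (E-cong h) (E-const 0ℚ)

  0≤E : ∀ {f} → (∀ σ → 0ℚ ≤ f σ) → 0ℚ ≤ E f
  0≤E {f} h = subst (_≤ E f) (E-const 0ℚ) (E-mono h)

  E-R : ∀ π f → E (λ σ → f (σ · π)) ≡ E f
  E-R π = E-reindex (_· π) (_· inv π) (cancel-invʳ π) (cancel-invʳ′ π)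

  E-L : ∀ π f → E (λ σ → f (π · σ)) ≡ E f
  E-L π = E-reindex (π ·_) (inv π ·_) (cancel-invˡ π) (cancel-invˡ′ π)

  inv-inv : ∀ g → inv (inv g) ≡ g
  inv-inv g = trans (sym (cancel-invʳ g (inv (inv g)))) (trans (cong (_· g) (·-invˡ (inv g))) (·-idˡ g))

  E-inv : ∀ f → E (λ σ → f (inv σ)) ≡ E f
  E-inv = E-reindex inv inv inv-inv inv-inv

  E-CS : ∀ (w u v : F) → (∀ σ → 0ℚ ≤ w σ) →
    E (λ σ → w σ * (u σ * v σ)) * E (λ σ → w σ * (u σ * v σ)) ≤ E (λ σ → w σ * (u σ * u σ)) * E (λ σ → w σ * (v σ * v σ))
  E-CS w u v h = discriminant λ s t → subst (0ℚ ≤_)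
    (trans (E-cong (λ σ → eq s t (w σ) (u σ) (v σ)))
      (trans (E-+ _ _) (cong₂ _+_
        (trans (E-+ _ _) (cong₂ _+_ (E-*ˡ (s * s) _) (trans (E-*ˡ 2ℚ _) (cong (2ℚ *_) (E-*ˡ (s * t) _)))))
        (E-*ˡ (t * t) _))))
    (0≤E (λ σ → 0≤* (h σ) (0≤sq (s * u σ + t * v σ))))
    where eq : ∀ s t w a b → w * ((s * a + t * b) * (s * a + t * b)) ≡ s * s * (w * (a * a)) + 2ℚ * (s * t * (w * (a * b))) + t * t * (w * (b * b))
          eq = solve-∀ ring

  ⟪_,_⟫ : F → F → ℚ
  ⟪ f , g ⟫ = E (λ σ → f σ * g σ)

  ⟪⟫-comm : ∀ f g → ⟪ f , g ⟫ ≡ ⟪ g , f ⟫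
  ⟪⟫-comm f g = E-cong (λ σ → ℚP.*-comm (f σ) (g σ))

  ⟪⟫-+ˡ : ∀ f g h → ⟪ (λ σ → f σ + g σ) , h ⟫ ≡ ⟪ f , h ⟫ + ⟪ g , h ⟫
  ⟪⟫-+ˡ f g h = trans (E-cong (λ σ → ℚP.*-distribʳ-+ (h σ) (f σ) (g σ))) (E-+ _ _)

  ⟪⟫-+ʳ : ∀ f g h → ⟪ h , (λ σ → f σ + g σ) ⟫ ≡ ⟪ h , f ⟫ + ⟪ h , g ⟫
  ⟪⟫-+ʳ f g h = trans (E-cong (λ σ → ℚP.*-distribˡ-+ (h σ) (f σ) (g σ))) (E-+ _ _)

  ⟪⟫-*ˡ : ∀ c f h → ⟪ (λ σ → c * f σ) , h ⟫ ≡ c * ⟪ f , h ⟫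
  ⟪⟫-*ˡ c f h = trans (E-cong (λ σ → ℚP.*-assoc c (f σ) (h σ))) (E-*ˡ c _)

  ⟪⟫-*ʳ : ∀ c f h → ⟪ h , (λ σ → c * f σ) ⟫ ≡ c * ⟪ h , f ⟫
  ⟪⟫-*ʳ c f h = trans (⟪⟫-comm h _) (trans (⟪⟫-*ˡ c f h) (cong (c *_) (⟪⟫-comm f h)))

  ⟪⟫--ˡ : ∀ f g h → ⟪ (λ σ → f σ - g σ) , h ⟫ ≡ ⟪ f , h ⟫ - ⟪ g , h ⟫
  ⟪⟫--ˡ f g h = trans (E-cong (λ σ → eq (f σ) (g σ) (h σ))) (E-- _ _)
    where eq : ∀ a b c → (a - b) * c ≡ a * c - b * c
          eq = solve-∀ ring

  ⟪⟫--ʳ : ∀ f g h → ⟪ h , (λ σ → f σ - g σ) ⟫ ≡ ⟪ h , f ⟫ - ⟪ h , g ⟫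
  ⟪⟫--ʳ f g h = trans (⟪⟫-comm h _) (trans (⟪⟫--ˡ f g h) (cong₂ _-_ (⟪⟫-comm f h) (⟪⟫-comm g h)))

  ⟪⟫-cong : ∀ {f f′ g g′ : F} → (∀ σ → f σ ≡ f′ σ) → (∀ σ → g σ ≡ g′ σ) → ⟪ f , g ⟫ ≡ ⟪ f′ , g′ ⟫
  ⟪⟫-cong h h′ = E-cong (λ σ → cong₂ _*_ (h σ) (h′ σ))

  0≤⟪⟫ : ∀ f → 0ℚ ≤ ⟪ f , f ⟫
  0≤⟪⟫ f = 0≤E (λ σ → 0≤sq (f σ))

  ⟪⟫-definite : ∀ f → ⟪ f , f ⟫ ≤ 0ℚ → ∀ σ → f σ ≡ 0ℚ
  ⟪⟫-definite f h σ = sq≡0 (ℚP.≤-reflexive (E-definite (λ σ → f σ * f σ) (λ σ → 0≤sq (f σ)) h σ))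

  ⟪⟫-CS : ∀ f g → ⟪ f , g ⟫ * ⟪ f , g ⟫ ≤ ⟪ f , f ⟫ * ⟪ g , g ⟫
  ⟪⟫-CS f g = subst₂ _≤_ (cong₂ _*_ (eq f g) (eq f g)) (cong₂ _*_ (eq f f) (eq g g)) (E-CS (λ _ → 1ℚ) f g (λ _ → 0≤1))
    where eq : ∀ f g → E (λ σ → 1ℚ * (f σ * g σ)) ≡ ⟪ f , g ⟫
          eq f g = E-cong (λ σ → ℚP.*-identityˡ (f σ * g σ))

  -- Functions on `G` are compared pointwise, so the constructors carry pointwise equations instead
  -- of fixing the function up to propositional equality.
  data Span (P : F → Set) : F → Set where
    gen : ∀ {p} → P p → Span P p
    null : ∀ {p} → (∀ σ → p σ ≡ 0ℚ) → Span P p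
    add : ∀ {p q r} → Span P p → Span P q → (∀ σ → r σ ≡ p σ + q σ) → Span P r
    scale : ∀ {p r} c → Span P p → (∀ σ → r σ ≡ c * p σ) → Span P r

  span-resp : ∀ {P p q} → (∀ σ → q σ ≡ p σ) → Span P p → Span P q
  span-resp {p = p} h s = scale 1ℚ s (λ σ → trans (h σ) (sym (ℚP.*-identityˡ (p σ))))

  span-∑ : ∀ {P} {A : Set} (xs : List A) (f : A → F) → (∀ x → Span P (f x)) → Span P (λ σ → ∑ xs (λ x → f x σ))
  span-∑ [] f h = null (λ _ → refl)
  span-∑ (x ∷ xs) f h = add (h x) (span-∑ xs f h) (λ _ → refl)

  span-⊆ : ∀ {P Q} → (∀ {p} → P p → Span Q p) → ∀ {p} → Span P p → Span Q p
  span-⊆ h (gen x) = h x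
  span-⊆ h (null x) = null x
  span-⊆ h (add s t x) = add (span-⊆ h s) (span-⊆ h t) x
  span-⊆ h (scale c s x) = scale c (span-⊆ h s) x

  span-- : ∀ {P p q} → Span P p → Span P q → Span P (λ σ → p σ - q σ)
  span-- {p = p} {q} s t = add s (scale (- 1ℚ) t (λ _ → refl)) (λ σ → eq (p σ) (q σ))
    where eq : ∀ a b → a - b ≡ a + (- 1ℚ) * b
          eq = solve-∀ ring

  ⊥-span : ∀ {P f} → (∀ {p} → P p → ⟪ f , p ⟫ ≡ 0ℚ) → ∀ {p} → Span P p → ⟪ f , p ⟫ ≡ 0ℚ
  ⊥-span h (gen x) = h x
  ⊥-span {f = f} h (null x) = E-zero (λ σ → trans (cong (f σ *_) (x σ)) (ℚP.*-zeroʳ (f σ)))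
  ⊥-span {f = f} h (add {p} {q} s t x) = trans (⟪⟫-cong {f} (λ _ → refl) x) (trans (⟪⟫-+ʳ p q f)
    (trans (cong₂ _+_ (⊥-span {f = f} h s) (⊥-span {f = f} h t)) refl))
  ⊥-span {f = f} h (scale {p} c s x) = trans (⟪⟫-cong {f} (λ _ → refl) x) (trans (⟪⟫-*ʳ c p f)
    (trans (cong (c *_) (⊥-span {f = f} h s)) (ℚP.*-zeroʳ c)))

  record Projection (P : F → Set) : Set where
    field
      proj : F → F
      proj∈ : ∀ f → Span P (proj f)
      proj⊥ : ∀ f {p} → Span P p → ⟪ (λ σ → f σ - proj f σ) , p ⟫ ≡ 0ℚ

  -- Orthogonal but not normalised: the coefficient along `w` is divided by `⟪ w , w ⟫`, so no
  -- square root is taken. If this norm is zero, `v` agrees with its old projection and the old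
  -- projection serves again.
  gram-schmidt : (vs : List F) → Projection (_∈ vs)
  gram-schmidt [] = record { proj = λ _ _ → 0ℚ ; proj∈ = λ _ → null (λ _ → refl) ; proj⊥ = λ f → ⊥-span {f = λ σ → f σ - 0ℚ} (λ ()) }
  gram-schmidt (v ∷ vs) with gram-schmidt vs
  ... | record { proj = π ; proj∈ = π∈ ; proj⊥ = π⊥ } = step (≡∨pos (0≤⟪⟫ w))
    where
    w : F
    w σ = v σ - π v σ
    w⊥ : ∀ {p} → Span (_∈ vs) p → ⟪ w , p ⟫ ≡ 0ℚ
    w⊥ = π⊥ v
    up : ∀ {p} → Span (_∈ vs) p → Span (_∈ (v ∷ vs)) p
    up = span-⊆ (gen ∘ there)
    split-v : ∀ g → ⟪ g , v ⟫ ≡ ⟪ g , π v ⟫ + ⟪ g , w ⟫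
    split-v g = trans (⟪⟫-cong {g} (λ _ → refl) (λ σ → eq (v σ) (π v σ))) (⟪⟫-+ʳ (π v) w g)
      where eq : ∀ a b → a ≡ b + (a - b)
            eq = solve-∀ ring
    step : ⟪ w , w ⟫ ≡ 0ℚ ⊎ 0ℚ < ⟪ w , w ⟫ → Projection (_∈ (v ∷ vs))
    step (inj₁ w0) = record
      { proj = π
      ; proj∈ = λ f → up (π∈ f)
      ; proj⊥ = λ f → ⊥-span {f = λ σ → f σ - π f σ} λ where
          (here refl) → trans (split-v (λ σ → f σ - π f σ)) (trans (cong₂ _+_ (π⊥ f (π∈ v))
            (E-zero (λ σ → trans (cong ((f σ - π f σ) *_) (⟪⟫-definite w (ℚP.≤-reflexive w0) σ)) (ℚP.*-zeroʳ (f σ - π f σ))))) refl)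
          (there p∈) → π⊥ f (gen p∈) }
    step (inj₂ w>0) = record { proj = π′ ; proj∈ = π′∈ ; proj⊥ = λ f → ⊥-span {f = λ σ → f σ - π′ f σ} (π′⊥ f) }
      where
      instance _ = ℚP.pos⇒nonZero ⟪ w , w ⟫ {{ℚ.positive w>0}}
      c : F → ℚ
      c f = ⟪ f , w ⟫ * ℚ.1/ ⟪ w , w ⟫
      c-w : ∀ f → c f * ⟪ w , w ⟫ ≡ ⟪ f , w ⟫
      c-w f = trans (ℚP.*-assoc ⟪ f , w ⟫ (ℚ.1/ ⟪ w , w ⟫) ⟪ w , w ⟫) (trans (cong (⟪ f , w ⟫ *_) (ℚP.*-inverseˡ ⟪ w , w ⟫)) (ℚP.*-identityʳ ⟪ f , w ⟫))
      π′ : F → F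
      π′ f σ = π f σ + c f * w σ
      w∈ : Span (_∈ (v ∷ vs)) w
      w∈ = span-- (gen (here refl)) (up (π∈ v))
      π′∈ : ∀ f → Span (_∈ (v ∷ vs)) (π′ f)
      π′∈ f = add (up (π∈ f)) (scale (c f) w∈ (λ _ → refl)) (λ _ → refl)
      r : ∀ f q → ⟪ (λ σ → f σ - π′ f σ) , q ⟫ ≡ ⟪ (λ σ → f σ - π f σ) , q ⟫ - c f * ⟪ w , q ⟫
      r f q = trans (⟪⟫-cong {g = q} (λ σ → eq (f σ) (π f σ) (c f * w σ)) (λ _ → refl))
        (trans (⟪⟫--ˡ (λ σ → f σ - π f σ) (λ σ → c f * w σ) q) (cong (λ z → ⟪ (λ σ → f σ - π f σ) , q ⟫ - z) (⟪⟫-*ˡ (c f) w q)))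
        where eq : ∀ a b d → a - (b + d) ≡ a - b - d
              eq = solve-∀ ring
      ⊥vs : ∀ f {p} → Span (_∈ vs) p → ⟪ (λ σ → f σ - π′ f σ) , p ⟫ ≡ 0ℚ
      ⊥vs f {p} s = trans (r f p) (trans (cong₂ (λ a b → a - c f * b) (π⊥ f s) (w⊥ s)) (eq (c f)))
        where eq : ∀ a → 0ℚ - a * 0ℚ ≡ 0ℚ
              eq = solve-∀ ring
      ⊥w : ∀ f → ⟪ (λ σ → f σ - π′ f σ) , w ⟫ ≡ 0ℚ
      ⊥w f = trans (r f w) (trans (cong₂ _-_ (trans (⟪⟫--ˡ f (π f) w) (cong (λ z → ⟪ f , w ⟫ - z) (trans (⟪⟫-comm (π f) w) (w⊥ (π∈ f))))) (c-w f)) (eq ⟪ f , w ⟫))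
        where eq : ∀ a → a - 0ℚ - a ≡ 0ℚ
              eq = solve-∀ ring
      π′⊥ : ∀ f {p} → p ∈ (v ∷ vs) → ⟪ (λ σ → f σ - π′ f σ) , p ⟫ ≡ 0ℚ
      π′⊥ f (here refl) = trans (split-v (λ σ → f σ - π′ f σ)) (trans (cong₂ _+_ (⊥vs f (π∈ v)) (⊥w f)) refl)
      π′⊥ f (there p∈) = ⊥vs f (gen p∈)

-- Operators dominated on a spanning set

module PowerTrick {n : ℕ} (𝓖 : PermGroup n) where
  open PermGroup 𝓖 using (G)
  open Functions 𝓖

  -- A symmetric positive semidefinite operator H, dominated by θ on the H-invariant set P, is dominated
  -- by θ on all of Span P: ⟪ Hᵐ p , p ⟫ ≤ K θᵐ with K depending on p, and ⟪ Hᵐ p , p ⟫ is log-convex in m.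
  module _ (H : F → F)
    (H-cong : ∀ {p q} → (∀ σ → p σ ≡ q σ) → ∀ σ → H p σ ≡ H q σ)
    (H-+ : ∀ p q σ → H (λ σ → p σ + q σ) σ ≡ H p σ + H q σ)
    (H-* : ∀ c p σ → H (λ σ → c * p σ) σ ≡ c * H p σ)
    (H-sym : ∀ p q → ⟪ H p , q ⟫ ≡ ⟪ p , H q ⟫)
    (H-psd : ∀ p → 0ℚ ≤ ⟪ H p , p ⟫)
    where

    iter : ℕ → F → F
    iter zero p = p
    iter (suc m) p = H (iter m p)

    private
      iter-cong : ∀ m {p q} → (∀ σ → p σ ≡ q σ) → ∀ σ → iter m p σ ≡ iter m q σ
      iter-cong zero h = h
      iter-cong (suc m) h = H-cong (iter-cong m h)

      iter-+ : ∀ m p q σ → iter m (λ σ → p σ + q σ) σ ≡ iter m p σ + iter m q σ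
      iter-+ zero p q σ = refl
      iter-+ (suc m) p q σ = trans (H-cong (iter-+ m p q) σ) (H-+ (iter m p) (iter m q) σ)

      iter-* : ∀ m c p σ → iter m (λ σ → c * p σ) σ ≡ c * iter m p σ
      iter-* zero c p σ = refl
      iter-* (suc m) c p σ = trans (H-cong (iter-* m c p) σ) (H-* c (iter m p) σ)

      iter-H : ∀ m p σ → iter m (H p) σ ≡ H (iter m p) σ
      iter-H zero p σ = refl
      iter-H (suc m) p σ = H-cong (iter-H m p) σ

      iter-sym : ∀ m p q → ⟪ iter m p , q ⟫ ≡ ⟪ p , iter m q ⟫
      iter-sym zero p q = refl
      iter-sym (suc m) p q = trans (H-sym (iter m p) q) (trans (iter-sym m p (H q)) (⟪⟫-cong {p} (λ _ → refl) (iter-H m q)))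

      form-step : ∀ m p q → ⟪ iter (suc (suc m)) p , q ⟫ ≡ ⟪ iter m (H p) , H q ⟫
      form-step m p q = trans (H-sym (iter (suc m) p) q) (⟪⟫-cong {g = H q} (λ σ → sym (iter-H m p σ)) (λ _ → refl))

      form-psd : ∀ m p → 0ℚ ≤ ⟪ iter m p , p ⟫
      form-psd zero p = 0≤⟪⟫ p
      form-psd (suc zero) p = H-psd p
      form-psd (suc (suc m)) p = subst (0ℚ ≤_) (sym (form-step m p p)) (form-psd m (H p))

      form-expand : ∀ m s t p q → ⟪ iter m (λ σ → s * p σ + t * q σ) , (λ σ → s * p σ + t * q σ) ⟫
        ≡ s * s * ⟪ iter m p , p ⟫ + 2ℚ * (s * t * ⟪ iter m p , q ⟫) + t * t * ⟪ iter m q , q ⟫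
      form-expand m s t p q = trans (⟪⟫-cong {g = λ σ → s * p σ + t * q σ}
          (λ σ → trans (iter-+ m (λ σ → s * p σ) (λ σ → t * q σ) σ) (cong₂ _+_ (iter-* m s p σ) (iter-* m t q σ))) (λ _ → refl))
        (trans (⟪⟫-+ˡ (λ σ → s * iter m p σ) (λ σ → t * iter m q σ) _)
        (trans (cong₂ _+_
          (trans (⟪⟫-*ˡ s (iter m p) _) (cong (s *_) (trans (⟪⟫-+ʳ (λ σ → s * p σ) (λ σ → t * q σ) (iter m p)) (cong₂ _+_ (⟪⟫-*ʳ s p (iter m p)) (⟪⟫-*ʳ t q (iter m p))))))
          (trans (⟪⟫-*ˡ t (iter m q) _) (cong (t *_) (trans (⟪⟫-+ʳ (λ σ → s * p σ) (λ σ → t * q σ) (iter m q)) (cong₂ _+_ (⟪⟫-*ʳ s p (iter m q)) (⟪⟫-*ʳ t q (iter m q)))))))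
        (trans (cong (λ z → s * (s * ⟪ iter m p , p ⟫ + t * ⟪ iter m p , q ⟫) + t * (s * z + t * ⟪ iter m q , q ⟫))
          (trans (iter-sym m q p) (⟪⟫-comm q (iter m p))))
        (eq s t ⟪ iter m p , p ⟫ ⟪ iter m p , q ⟫ ⟪ iter m q , q ⟫))))
        where eq : ∀ s t a b c → s * (s * a + t * b) + t * (s * b + t * c) ≡ s * s * a + 2ℚ * (s * t * b) + t * t * c
              eq = solve-∀ ring

      form-CS : ∀ m p q → ⟪ iter m p , q ⟫ * ⟪ iter m p , q ⟫ ≤ ⟪ iter m p , p ⟫ * ⟪ iter m q , q ⟫
      form-CS m p q = discriminant λ s t → subst (0ℚ ≤_) (form-expand m s t p q) (form-psd m _)

      a : F → ℕ → ℚ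
      a p m = ⟪ iter m p , p ⟫

      -- Cauchy-Schwarz for the form of the `m`-th power of `H`, applied to `p` and `H p`.
      log-convex : ∀ p m → a p (suc m) * a p (suc m) ≤ a p m * a p (suc (suc m))
      log-convex p m = subst₂ _≤_ (cong₂ _*_ e₁ e₁) (cong (a p m *_) (sym (form-step m p p))) (form-CS m p (H p))
        where e₁ : ⟪ iter m p , H p ⟫ ≡ a p (suc m)
              e₁ = sym (H-sym (iter m p) p)

    module _ (P : F → Set) (P-H : ∀ {p} → P p → P (H p)) (θ : ℚ) (0≤θ : 0ℚ ≤ θ)
      (P-θ : ∀ {p} → P p → ⟪ H p , p ⟫ ≤ θ * ⟪ p , p ⟫) where

      private
        P-step : ∀ m {p} → P p → a p (suc m) ≤ θ * a p m
        P-step zero h = P-θ h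
        -- The other exponents reduce by two on replacing `p` by `H p`. For this one, domination at
        -- `H p` bounds `a p 3` by `θ * a p 2`, and log-convexity trades that for the wanted pair of
        -- indices.
        P-step (suc zero) {p} h with ≡∨pos (form-psd 2 p)
        ... | inj₁ z = subst (_≤ θ * a p 1) (sym z) (0≤* 0≤θ (form-psd 1 p))
        ... | inj₂ pos = cancelˡ pos (begin
            a p 2 * a p 2 ≤⟨ log-convex p 1 ⟩
            a p 1 * a p 3 ≡⟨ cong (a p 1 *_) (form-step 1 p p) ⟩
            a p 1 * ⟪ H (H p) , H p ⟫ ≤⟨ *-monoˡ (form-psd 1 p) (P-θ (P-H h)) ⟩
            a p 1 * (θ * ⟪ H p , H p ⟫) ≡⟨ cong (λ z → a p 1 * (θ * z)) (sym (form-step 0 p p)) ⟩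
            a p 1 * (θ * a p 2) ≡⟨ eq (a p 1) θ (a p 2) ⟩
            a p 2 * (θ * a p 1) ∎)
          where open ≤R
                eq : ∀ a b c → a * (b * c) ≡ c * (b * a)
                eq = solve-∀ ring
        P-step (suc (suc m)) {p} h = subst₂ _≤_ (sym (form-step (suc m) p p)) (cong (θ *_) (sym (form-step m p p))) (P-step m (P-H h))

        P-bound : ∀ m {p} → P p → a p m ≤ ⟪ p , p ⟫ * θ ^ℚ m
        P-bound zero {p} h = ℚP.≤-reflexive (sym (ℚP.*-identityʳ ⟪ p , p ⟫))
        P-bound (suc m) {p} h = ℚP.≤-trans (P-step m h) (ℚP.≤-trans (*-monoˡ 0≤θ (P-bound m h))
          (ℚP.≤-reflexive (x*yz≡y*xz θ ⟪ p , p ⟫ (θ ^ℚ m))))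

        -- Domination by `θ` is not visibly closed under addition, but growth of order `θ^m` with an
        -- arbitrary constant is. The detour through `Bounded` is therefore linear.
        Bounded : F → Set
        Bounded p = ∃[ K ] (∀ m → a p m ≤ K * θ ^ℚ m)

        a-cong : ∀ {p q} m → (∀ σ → p σ ≡ q σ) → a p m ≡ a q m
        a-cong m h = ⟪⟫-cong (iter-cong m h) h

        -- The forms of `p + q` and `p - q` add up to twice those of `p` and `q`, and the form of
        -- the difference is nonnegative.
        parallelogram : ∀ p q m → a (λ σ → p σ + q σ) m ≤ 2ℚ * (a p m + a q m)
        parallelogram p q m = subst (_≤ 2ℚ * (a p m + a q m)) (sym e₁) (0≤-⇒≤ (subst (0ℚ ≤_) (trans (form-expand m 1ℚ (- 1ℚ) p q) (eq (a p m) ⟪ iter m p , q ⟫ (a q m)))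
            (form-psd m (λ σ → 1ℚ * p σ + (- 1ℚ) * q σ))))
          where
          e₁ : a (λ σ → p σ + q σ) m ≡ 1ℚ * 1ℚ * a p m + 2ℚ * (1ℚ * 1ℚ * ⟪ iter m p , q ⟫) + 1ℚ * 1ℚ * a q m
          e₁ = trans (a-cong m (λ σ → sym (cong₂ _+_ (ℚP.*-identityˡ (p σ)) (ℚP.*-identityˡ (q σ))))) (form-expand m 1ℚ 1ℚ p q)
          eq : ∀ x y z → 1ℚ * 1ℚ * x + 2ℚ * (1ℚ * (- 1ℚ) * y) + (- 1ℚ) * (- 1ℚ) * z
            ≡ 2ℚ * (x + z) - (1ℚ * 1ℚ * x + 2ℚ * (1ℚ * 1ℚ * y) + 1ℚ * 1ℚ * z)
          eq = solve-∀ ring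

        span-bounded : ∀ {p} → Span P p → Bounded p
        span-bounded (gen {p} h) = ⟪ p , p ⟫ , λ m → P-bound m h
        span-bounded (null {p} h) = 0ℚ , λ m → ℚP.≤-reflexive (trans (E-zero (λ σ → trans (cong (iter m p σ *_) (h σ)) (ℚP.*-zeroʳ (iter m p σ)))) (sym (ℚP.*-zeroˡ (θ ^ℚ m))))
        span-bounded (add {p} {q} {r} s t h) with span-bounded s | span-bounded t
        ... | K , bK | L , bL = 2ℚ * (K + L) , λ m → begin
            a r m ≡⟨ a-cong m h ⟩
            a (λ σ → p σ + q σ) m ≤⟨ parallelogram p q m ⟩
            2ℚ * (a p m + a q m) ≤⟨ *-monoˡ 0≤2 (ℚP.+-mono-≤ (bK m) (bL m)) ⟩
            2ℚ * (K * θ ^ℚ m + L * θ ^ℚ m) ≡⟨ eq K L (θ ^ℚ m) ⟩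
            2ℚ * (K + L) * θ ^ℚ m ∎
          where open ≤R
                eq : ∀ k l t → 2ℚ * (k * t + l * t) ≡ 2ℚ * (k + l) * t
                eq = solve-∀ ring
        span-bounded (scale {p} {r} c s h) with span-bounded s
        ... | K , bK = c * c * K , λ m → begin
            a r m ≡⟨ a-cong m h ⟩
            a (λ σ → c * p σ) m ≡⟨ ⟪⟫-cong {g = λ σ → c * p σ} (iter-* m c p) (λ _ → refl) ⟩
            ⟪ (λ σ → c * iter m p σ) , (λ σ → c * p σ) ⟫ ≡⟨ trans (⟪⟫-*ˡ c (iter m p) _) (cong (c *_) (⟪⟫-*ʳ c p (iter m p))) ⟩
            c * (c * a p m) ≡⟨ ℚP.*-assoc c c (a p m) ⟨
            c * c * a p m ≤⟨ *-monoˡ (0≤sq c) (bK m) ⟩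
            c * c * (K * θ ^ℚ m) ≡⟨ ℚP.*-assoc (c * c) K (θ ^ℚ m) ⟨
            c * c * K * θ ^ℚ m ∎
          where open ≤R

        ratio : ∀ p → 0ℚ < a p 0 → ∀ m → a p m * a p 1 ≤ a p (suc m) * a p 0
        ratio p pos zero = ℚP.≤-reflexive (ℚP.*-comm (a p 0) (a p 1))
        ratio p pos (suc m) with ≡∨pos (form-psd m p)
        ... | inj₁ z = subst (_≤ a p (2 ℕ.+ m) * a p 0) (sym (trans (cong (_* a p 1) z′) (ℚP.*-zeroˡ (a p 1)))) (0≤* (form-psd (2 ℕ.+ m) p) (form-psd 0 p))
          where z′ : a p (suc m) ≡ 0ℚ
                z′ = sq≡0 (subst (a p (suc m) * a p (suc m) ≤_) (trans (cong (_* a p (2 ℕ.+ m)) z) (ℚP.*-zeroˡ (a p (2 ℕ.+ m)))) (log-convex p m))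
        ... | inj₂ pos′ = cancelˡ pos′ (begin
            a p m * (a p (suc m) * a p 1) ≡⟨ eq (a p m) (a p (suc m)) (a p 1) ⟩
            a p (suc m) * (a p m * a p 1) ≤⟨ *-monoˡ (form-psd (suc m) p) (ratio p pos m) ⟩
            a p (suc m) * (a p (suc m) * a p 0) ≡⟨ ℚP.*-assoc (a p (suc m)) (a p (suc m)) (a p 0) ⟨
            a p (suc m) * a p (suc m) * a p 0 ≤⟨ *-monoʳ (form-psd 0 p) (log-convex p m) ⟩
            a p m * a p (2 ℕ.+ m) * a p 0 ≡⟨ ℚP.*-assoc (a p m) (a p (2 ℕ.+ m)) (a p 0) ⟩
            a p m * (a p (2 ℕ.+ m) * a p 0) ∎)
          where open ≤R
                eq : ∀ a b c → a * (b * c) ≡ b * (a * c)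
                eq = solve-∀ ring

        -- By log-convexity the successive quotients of `a p` do not decrease, so the first quotient
        -- already gives a geometric lower bound; denominators are cleared.
        growth : ∀ p → 0ℚ < a p 0 → ∀ m → a p 1 ^ℚ m * a p 0 ≤ a p m * a p 0 ^ℚ m
        growth p pos zero = ℚP.≤-reflexive (trans (ℚP.*-identityˡ (a p 0)) (sym (ℚP.*-identityʳ (a p 0))))
        growth p pos (suc m) = begin
            a p 1 * a p 1 ^ℚ m * a p 0 ≡⟨ ℚP.*-assoc (a p 1) (a p 1 ^ℚ m) (a p 0) ⟩
            a p 1 * (a p 1 ^ℚ m * a p 0) ≤⟨ *-monoˡ (form-psd 1 p) (growth p pos m) ⟩
            a p 1 * (a p m * a p 0 ^ℚ m) ≡⟨ eq (a p 1) (a p m) (a p 0 ^ℚ m) ⟩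
            a p m * a p 1 * a p 0 ^ℚ m ≤⟨ *-monoʳ (0≤^ m (form-psd 0 p)) (ratio p pos m) ⟩
            a p (suc m) * a p 0 * a p 0 ^ℚ m ≡⟨ ℚP.*-assoc (a p (suc m)) (a p 0) (a p 0 ^ℚ m) ⟩
            a p (suc m) * (a p 0 * a p 0 ^ℚ m) ∎
          where open ≤R
                eq : ∀ a b c → a * (b * c) ≡ b * a * c
                eq = solve-∀ ring

      -- The lower bound `growth` and the upper bound from `Bounded` compare the powers of
      -- `⟪ H p , p ⟫` and `θ * ⟪ p , p ⟫` up to a constant depending on `p`; letting `m` grow
      -- removes the constant. This bounds the largest eigenvalue on the span without producing it.
      span-dominated : ∀ {p} → Span P p → ⟪ H p , p ⟫ ≤ θ * ⟪ p , p ⟫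
      span-dominated {p} s with ≡∨pos (0≤⟪⟫ p) | span-bounded s
      ... | inj₁ z | _ = ℚP.≤-trans (ℚP.≤-reflexive (E-zero (λ σ → trans (cong (H p σ *_) (⟪⟫-definite p (ℚP.≤-reflexive z) σ)) (ℚP.*-zeroʳ (H p σ))))) (0≤* 0≤θ (0≤⟪⟫ p))
      ... | inj₂ pos | K , bK = geometric-dominance {K = K} (form-psd 1 p) (0≤* 0≤θ (0≤⟪⟫ p)) pos λ m → begin
            a p 1 ^ℚ m * a p 0 ≤⟨ growth p pos m ⟩
            a p m * a p 0 ^ℚ m ≤⟨ *-monoʳ (0≤^ m (form-psd 0 p)) (bK m) ⟩
            K * θ ^ℚ m * a p 0 ^ℚ m ≡⟨ ℚP.*-assoc K (θ ^ℚ m) (a p 0 ^ℚ m) ⟩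
            K * (θ ^ℚ m * a p 0 ^ℚ m) ≡⟨ cong (K *_) (^-* θ (a p 0) m) ⟨
            K * (θ * a p 0) ^ℚ m ∎
        where open ≤R

-- Convolution

module Convolution {n : ℕ} (𝓖 : PermGroup n) where
  open PermGroup 𝓖 using (G; _·_; inv)
  open Functions 𝓖

  conv : F → F → F
  conv f g ρ = E (λ τ → f (ρ · inv τ) * g τ)

  tri : F → F → F → ℚ
  tri f g h = E (λ σ → E (λ τ → f σ * g τ * h (σ · τ)))

  tri≡⟪conv⟫ : ∀ f g h → tri f g h ≡ ⟪ conv f g , h ⟫
  tri≡⟪conv⟫ f g h = trans (E-swap (λ σ τ → f σ * g τ * h (σ · τ)))
    (trans (E-cong (λ τ → trans (E-cong (λ σ → cong (λ z → f z * g τ * h (σ · τ)) (sym (cancel-invʳ′ τ σ))))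
                               (E-R τ (λ ρ → f (ρ · inv τ) * g τ * h ρ))))
    (trans (E-swap (λ τ ρ → f (ρ · inv τ) * g τ * h ρ))
           (E-cong (λ ρ → E-*ʳ (λ τ → f (ρ · inv τ) * g τ) (h ρ)))))

  tri-⊥₁ : ∀ f g h → (∀ τ → ⟪ f , (λ σ → h (σ · τ)) ⟫ ≡ 0ℚ) → tri f g h ≡ 0ℚ
  tri-⊥₁ f g h h⊥ = trans (E-swap (λ σ τ → f σ * g τ * h (σ · τ)))
    (E-zero (λ τ → trans (E-cong (λ σ → xy*z≡y*xz (f σ) (g τ) (h (σ · τ)))) (trans (E-*ˡ (g τ) (λ σ → f σ * h (σ · τ))) (trans (cong (g τ *_) (h⊥ τ)) (ℚP.*-zeroʳ (g τ))))))

  tri-⊥₂ : ∀ f g h → (∀ σ → ⟪ g , (λ τ → h (σ · τ)) ⟫ ≡ 0ℚ) → tri f g h ≡ 0ℚ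
  tri-⊥₂ f g h h⊥ = E-zero (λ σ → trans (E-cong (λ τ → ℚP.*-assoc (f σ) (g τ) (h (σ · τ))))
    (trans (E-*ˡ (f σ) (λ τ → g τ * h (σ · τ))) (trans (cong (f σ *_) (h⊥ σ)) (ℚP.*-zeroʳ (f σ)))))

  tri-+₃ : ∀ f g h h′ → tri f g (λ σ → h σ + h′ σ) ≡ tri f g h + tri f g h′
  tri-+₃ f g h h′ = trans (tri≡⟪conv⟫ f g (λ σ → h σ + h′ σ)) (trans (⟪⟫-+ʳ h h′ (conv f g)) (cong₂ _+_ (sym (tri≡⟪conv⟫ f g h)) (sym (tri≡⟪conv⟫ f g h′))))

  tri-cong : ∀ {f f′ g g′ h h′ : F} → (∀ σ → f σ ≡ f′ σ) → (∀ σ → g σ ≡ g′ σ) → (∀ σ → h σ ≡ h′ σ) → tri f g h ≡ tri f′ g′ h′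
  tri-cong a b c = E-cong (λ σ → E-cong (λ τ → cong₂ _*_ (cong₂ _*_ (a σ) (b τ)) (c (σ · τ))))

  tri--₁ : ∀ f f′ g h → tri (λ σ → f σ - f′ σ) g h ≡ tri f g h - tri f′ g h
  tri--₁ f f′ g h = trans (E-cong (λ σ → trans (E-cong (λ τ → eq (f σ) (f′ σ) (g τ) (h (σ · τ)))) (E-- (λ τ → f σ * g τ * h (σ · τ)) (λ τ → f′ σ * g τ * h (σ · τ)))))
      (E-- (λ σ → E (λ τ → f σ * g τ * h (σ · τ))) (λ σ → E (λ τ → f′ σ * g τ * h (σ · τ))))
    where eq : ∀ a a′ b c → (a - a′) * b * c ≡ a * b * c - a′ * b * c
          eq = solve-∀ ring

  tri--₂ : ∀ f g g′ h → tri f (λ σ → g σ - g′ σ) h ≡ tri f g h - tri f g′ h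
  tri--₂ f g g′ h = trans (E-cong (λ σ → trans (E-cong (λ τ → eq (f σ) (g τ) (g′ τ) (h (σ · τ)))) (E-- (λ τ → f σ * g τ * h (σ · τ)) (λ τ → f σ * g′ τ * h (σ · τ)))))
      (E-- (λ σ → E (λ τ → f σ * g τ * h (σ · τ))) (λ σ → E (λ τ → f σ * g′ τ * h (σ · τ))))
    where eq : ∀ a b b′ c → a * (b - b′) * c ≡ a * b * c - a * b′ * c
          eq = solve-∀ ring

  tri-sq : ∀ f g h → tri f g h * tri f g h ≤ ⟪ conv f g , conv f g ⟫ * ⟪ h , h ⟫
  tri-sq f g h = subst (_≤ ⟪ conv f g , conv f g ⟫ * ⟪ h , h ⟫) (cong₂ _*_ (sym (tri≡⟪conv⟫ f g h)) (sym (tri≡⟪conv⟫ f g h))) (⟪⟫-CS (conv f g) h)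

  conv-cong : ∀ f {p q} → (∀ σ → p σ ≡ q σ) → ∀ σ → conv f p σ ≡ conv f q σ
  conv-cong f h ρ = E-cong (λ τ → cong (f (ρ · inv τ) *_) (h τ))

  conv-+ : ∀ f p q σ → conv f (λ σ → p σ + q σ) σ ≡ conv f p σ + conv f q σ
  conv-+ f p q ρ = ⟪⟫-+ʳ p q (λ τ → f (ρ · inv τ))

  conv-* : ∀ f c p σ → conv f (λ σ → c * p σ) σ ≡ c * conv f p σ
  conv-* f c p ρ = ⟪⟫-*ʳ c p (λ τ → f (ρ · inv τ))

  inv-· : ∀ g h → inv (g · h) ≡ inv h · inv g
  inv-· g h = trans (sym (·-idʳ _)) (trans (cong (inv (g · h) ·_) (sym (trans (·-assoc g h _) (trans (cong (g ·_) (cancel-invˡ h (inv g))) (·-invʳ g)))))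
    (cancel-invˡ′ (g · h) (inv h · inv g)))

  conv-R : ∀ f p π ρ → conv f (λ τ → p (τ · π)) ρ ≡ conv f p (ρ · π)
  conv-R f p π ρ = trans (E-cong (λ τ → cong (λ z → f z * p (τ · π)) (eq τ))) (E-R π (λ τ → f (ρ · π · inv τ) * p τ))
    where eq : ∀ τ → ρ · inv τ ≡ ρ · π · inv (τ · π)
          eq τ = sym (trans (·-assoc ρ π _) (cong (ρ ·_) (trans (cong (π ·_) (inv-· τ π)) (cancel-invˡ π (inv τ)))))

  ‖shift‖ : ∀ f ρ → E (λ τ → f (ρ · inv τ) * f (ρ · inv τ)) ≡ ⟪ f , f ⟫
  ‖shift‖ f ρ = trans (E-inv (λ τ → f (ρ · τ) * f (ρ · τ))) (E-L ρ (λ τ → f τ * f τ))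

  private
    norm-of-combination : ∀ {ν} (ws : List F) → AllPairs (λ v w → ⟪ v , w ⟫ ≡ 0ℚ) ws → All (λ w → ⟪ w , w ⟫ ≡ ν) ws → (c : F → ℚ) →
      ⟪ (λ σ → ∑ ws (λ w → c w * w σ)) , (λ σ → ∑ ws (λ w → c w * w σ)) ⟫ ≡ ∑ ws (λ w → c w * c w) * ν
    norm-of-combination {ν} [] _ _ c = trans (E-zero (λ _ → refl)) (sym (ℚP.*-zeroˡ ν))
    norm-of-combination {ν} (v ∷ ws) (o ∷ os) (e ∷ es) c = begin
        ⟪ (λ σ → c v * v σ + S σ) , (λ σ → c v * v σ + S σ) ⟫
          ≡⟨ trans (⟪⟫-+ˡ (λ σ → c v * v σ) S _) (cong₂ _+_ (⟪⟫-+ʳ (λ σ → c v * v σ) S (λ σ → c v * v σ)) (⟪⟫-+ʳ (λ σ → c v * v σ) S S)) ⟩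
        ⟪ (λ σ → c v * v σ) , (λ σ → c v * v σ) ⟫ + ⟪ (λ σ → c v * v σ) , S ⟫ + (⟪ S , (λ σ → c v * v σ) ⟫ + ⟪ S , S ⟫)
          ≡⟨ cong₂ _+_ (cong₂ _+_ (trans (⟪⟫-*ˡ (c v) v _) (cong (c v *_) (trans (⟪⟫-*ʳ (c v) v v) (cong (c v *_) e)))) (⟪⟫-comm (λ σ → c v * v σ) S))
               (cong (⟪ S , (λ σ → c v * v σ) ⟫ +_) (norm-of-combination ws os es c)) ⟩
        c v * (c v * ν) + ⟪ S , (λ σ → c v * v σ) ⟫ + (⟪ S , (λ σ → c v * v σ) ⟫ + ∑ ws (λ w → c w * c w) * ν)
          ≡⟨ cong (λ z → c v * (c v * ν) + z + (z + ∑ ws (λ w → c w * c w) * ν)) (trans (⟪⟫-*ʳ (c v) v S) (trans (cong (c v *_) (trans (⟪⟫-comm S v) v⊥S)) (ℚP.*-zeroʳ (c v)))) ⟩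
        c v * (c v * ν) + 0ℚ + (0ℚ + ∑ ws (λ w → c w * c w) * ν)
          ≡⟨ eq (c v) ν (∑ ws (λ w → c w * c w)) ⟩
        (c v * c v + ∑ ws (λ w → c w * c w)) * ν ∎
      where
      open ≡-Reasoning
      S : F
      S σ = ∑ ws (λ w → c w * w σ)
      v⊥ : ∀ ws → All (λ w → ⟪ v , w ⟫ ≡ 0ℚ) ws → ⟪ v , (λ σ → ∑ ws (λ w → c w * w σ)) ⟫ ≡ 0ℚ
      v⊥ [] [] = E-zero (λ σ → ℚP.*-zeroʳ (v σ))
      v⊥ (w ∷ ws) (p ∷ ps) = trans (⟪⟫-+ʳ (λ σ → c w * w σ) (λ σ → ∑ ws (λ w → c w * w σ)) v) (cong₂ _+_ (trans (⟪⟫-*ʳ (c w) w v) (trans (cong (c w *_) p) (ℚP.*-zeroʳ (c w)))) (v⊥ ws ps))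
      v⊥S : ⟪ v , S ⟫ ≡ 0ℚ
      v⊥S = v⊥ ws o
      eq : ∀ c ν s → c * (c * ν) + 0ℚ + (0ℚ + s * ν) ≡ (c * c + s) * ν
      eq = solve-∀ ring

  -- With `S` for the left side, testing `u` against the combination of the `w` with its own
  -- coefficients gives `S * S ≤ ⟪ u , u ⟫ * (S * ν)`. Cancelling `S` instead of dividing by `ν`
  -- admits `ν = 0`.
  bessel : ∀ {ν} (ws : List F) → AllPairs (λ v w → ⟪ v , w ⟫ ≡ 0ℚ) ws → All (λ w → ⟪ w , w ⟫ ≡ ν) ws → 0ℚ ≤ ν → (u : F) →
    ∑ ws (λ w → ⟪ u , w ⟫ * ⟪ u , w ⟫) ≤ ⟪ u , u ⟫ * ν
  bessel {ν} ws os es 0≤ν u with ≡∨pos (0≤∑ ws (λ w → 0≤sq ⟪ u , w ⟫))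
  ... | inj₁ z = subst (_≤ ⟪ u , u ⟫ * ν) (sym z) (0≤* (0≤⟪⟫ u) 0≤ν)
  ... | inj₂ pos = cancelʳ pos (subst₂ _≤_ (cong₂ _*_ u-w u-w) (trans (cong (⟪ u , u ⟫ *_) (norm-of-combination ws os es (⟪ u ,_⟫))) (eq ⟪ u , u ⟫ _ ν)) (⟪⟫-CS u w))
    where
    w : F
    w σ = ∑ ws (λ w → ⟪ u , w ⟫ * w σ)
    u-w : ⟪ u , w ⟫ ≡ ∑ ws (λ w → ⟪ u , w ⟫ * ⟪ u , w ⟫)
    u-w = trans (E-cong (λ σ → sym (∑-*ˡ ws (u σ) _))) (trans (E-∑ ws (λ w σ → u σ * (⟪ u , w ⟫ * w σ))) (∑-cong ws (λ w → ⟪⟫-*ʳ ⟪ u , w ⟫ w u)))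
    eq : ∀ a b c → a * (b * c) ≡ a * c * b
    eq = solve-∀ ring

  -- The translates v (· a) and v (· b) are eigenvectors of right translation by t for opposite eigenvalues.
  Separated : F → G → G → Set
  Separated v a b = ∃[ t ] ∃[ c ] ∃[ c′ ] (c * c′ ≡ - 1ℚ) × (∀ σ → v (σ · t · a) ≡ c * v (σ · a)) × (∀ σ → v (σ · t · b) ≡ c′ * v (σ · b))

  -- Right translation by `t` preserves the inner product and also multiplies it by `c * c′ = -1`.
  separated-⊥ : ∀ {v a b} → Separated v a b → ⟪ (λ σ → v (σ · a)) , (λ σ → v (σ · b)) ⟫ ≡ 0ℚ
  separated-⊥ {v} {a} {b} (t , c , c′ , cc′ , ha , hb) = solve (trans (sym (E-R t (λ σ → v (σ · a) * v (σ · b))))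
      (trans (E-cong (λ σ → trans (cong₂ _*_ (ha σ) (hb σ)) (eq c c′ (v (σ · a)) (v (σ · b))))) (trans (E-*ˡ (c * c′) _) (cong (_* X) cc′))))
    where
    X = ⟪ (λ σ → v (σ · a)) , (λ σ → v (σ · b)) ⟫
    eq : ∀ c c′ a b → c * a * (c′ * b) ≡ c * c′ * (a * b)
    eq = solve-∀ ring
    eq′ : ∀ x → 2ℚ * x ≡ x - (- 1ℚ) * x
    eq′ = solve-∀ ring
    solve : X ≡ (- 1ℚ) * X → X ≡ 0ℚ
    solve h = ℚP.≤-antisym (cancelˡ {2ℚ} (ℚP.positive⁻¹ 2ℚ) (ℚP.≤-reflexive z)) (cancelˡ {2ℚ} (ℚP.positive⁻¹ 2ℚ) (ℚP.≤-reflexive (sym z)))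
      where z : 2ℚ * X ≡ 2ℚ * 0ℚ
            z = trans (eq′ X) (trans (cong (_- (- 1ℚ) * X) h) (ℚP.+-inverseʳ ((- 1ℚ) * X)))

  Spread-out : ℕ → F → Set
  Spread-out N v = ∃[ ts ] (length ts ≡ N × AllPairs (Separated v) ts)

  module _ (f : F) where
    private
      -- Convolution with `f` followed by its adjoint, so that the form of `H` is the inner product
      -- of two convolutions. It commutes with right translations and hence keeps families
      -- `Separated`.
      H : F → F
      H p τ = E (λ ρ → f (ρ · inv τ) * conv f p ρ)

      H-form : ∀ p q → ⟪ H p , q ⟫ ≡ ⟪ conv f p , conv f q ⟫
      H-form p q = trans (E-cong (λ τ → trans (sym (E-*ʳ _ (q τ))) (E-cong (λ ρ → xy*z≡y*xz (f (ρ · inv τ)) (conv f p ρ) (q τ)))))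
        (trans (E-swap (λ τ ρ → conv f p ρ * (f (ρ · inv τ) * q τ))) (E-cong (λ ρ → E-*ˡ (conv f p ρ) (λ τ → f (ρ · inv τ) * q τ))))

      H-cong : ∀ {p q} → (∀ σ → p σ ≡ q σ) → ∀ σ → H p σ ≡ H q σ
      H-cong h τ = E-cong (λ ρ → cong (f (ρ · inv τ) *_) (conv-cong f h ρ))

      H-+ : ∀ p q σ → H (λ σ → p σ + q σ) σ ≡ H p σ + H q σ
      H-+ p q τ = trans (E-cong (λ ρ → cong (f (ρ · inv τ) *_) (conv-+ f p q ρ))) (⟪⟫-+ʳ (conv f p) (conv f q) (λ ρ → f (ρ · inv τ)))

      H-* : ∀ c p σ → H (λ σ → c * p σ) σ ≡ c * H p σ
      H-* c p τ = trans (E-cong (λ ρ → cong (f (ρ · inv τ) *_) (conv-* f c p ρ))) (⟪⟫-*ʳ c (conv f p) (λ ρ → f (ρ · inv τ)))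

      H-R : ∀ p π τ → H p (τ · π) ≡ H (λ σ → p (σ · π)) τ
      H-R p π τ = trans (sym (E-R π (λ ρ → f (ρ · inv (τ · π)) * conv f p ρ)))
        (E-cong (λ ρ → cong₂ _*_ (cong f (trans (cong (ρ · π ·_) (inv-· τ π)) (trans (·-assoc ρ π _) (cong (ρ ·_) (cancel-invˡ π (inv τ))))))
                                 (sym (conv-R f p π ρ))))

      separated-H : ∀ {v a b} → Separated v a b → Separated (H v) a b
      separated-H {v} {a} {b} (t , c , c′ , cc′ , ha , hb) = t , c , c′ , cc′ , go a c ha , go b c′ hb
        where
        go : ∀ a c → (∀ σ → v (σ · t · a) ≡ c * v (σ · a)) → ∀ σ → H v (σ · t · a) ≡ c * H v (σ · a)
        go a c h σ = trans (cong (H v) (·-assoc σ t a)) (trans (H-R v (t · a) σ) (trans (H-cong (λ τ → trans (cong v (sym (·-assoc τ t a))) (h τ)) σ)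
          (trans (H-* c (λ τ → v (τ · a)) σ) (cong (c *_) (sym (H-R v a σ))))))

      -- The values `conv f v (ρ · t)` are the coefficients of the single function `f (ρ · inv τ)`
      -- of `τ` against the orthogonal translates of `v`, so Bessel bounds the sum of their squares
      -- for each `ρ`. Averaged over `ρ`, all `N` terms become equal.
      gain₀ : ∀ {v N} → Spread-out N v → nat N * ⟪ conv f v , conv f v ⟫ ≤ ⟪ f , f ⟫ * ⟪ v , v ⟫
      gain₀ {v} {N} (ts , refl , sep) = begin
          nat (length ts) * ⟪ conv f v , conv f v ⟫ ≡⟨ ∑-const ts ⟪ conv f v , conv f v ⟫ ⟨
          ∑ ts (λ _ → ⟪ conv f v , conv f v ⟫) ≡⟨ ∑-cong ts (λ t → sym (E-R t (λ ρ → conv f v ρ * conv f v ρ))) ⟩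
          ∑ ts (λ t → E (λ ρ → conv f v (ρ · t) * conv f v (ρ · t))) ≡⟨ E-∑ ts (λ t ρ → conv f v (ρ · t) * conv f v (ρ · t)) ⟨
          E (λ ρ → ∑ ts (λ t → conv f v (ρ · t) * conv f v (ρ · t))) ≤⟨ E-mono pointwise ⟩
          E (λ _ → ⟪ f , f ⟫ * ⟪ v , v ⟫) ≡⟨ E-const _ ⟩
          ⟪ f , f ⟫ * ⟪ v , v ⟫ ∎
        where
        open ≤R
        shift : G → F
        shift t σ = v (σ · t)
        orth : ∀ {ts} → AllPairs (Separated v) ts → AllPairs (λ v w → ⟪ v , w ⟫ ≡ 0ℚ) (map shift ts)
        orth [] = []
        orth (p ∷ ps) = AllP.map⁺ (All.map (separated-⊥ {v}) p) ∷ orth ps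
        pointwise : ∀ ρ → ∑ ts (λ t → conv f v (ρ · t) * conv f v (ρ · t)) ≤ ⟪ f , f ⟫ * ⟪ v , v ⟫
        pointwise ρ = subst₂ _≤_
          (trans (∑-map shift ts _) (∑-cong ts (λ t → cong₂ _*_ (conv-R f v t ρ) (conv-R f v t ρ))))
          (cong (_* ⟪ v , v ⟫) (‖shift‖ f ρ))
          (bessel (map shift ts) (orth sep) (AllP.map⁺ (All.tabulate (λ {t} _ → E-R t (λ σ → v σ * v σ)))) (0≤⟪⟫ v) (λ τ → f (ρ · inv τ)))

    -- A combination of generators can have a much smaller norm than its terms, so `gain₀` cannot
    -- simply be added up; `span-dominated` carries it to the span with the same constant.
    gain : ∀ {N p} → 1 ℕ.≤ N → Span (Spread-out N) p → nat N * ⟪ conv f p , conv f p ⟫ ≤ ⟪ f , f ⟫ * ⟪ p , p ⟫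
    gain {N} {p} 1≤N s = subst (nat N * ⟪ conv f p , conv f p ⟫ ≤_) (trans (sym (ℚP.*-assoc (nat N) θ ⟪ p , p ⟫)) (cong (_* ⟪ p , p ⟫) N*θ))
        (*-monoˡ (0≤nat N) (subst (_≤ θ * ⟪ p , p ⟫) (H-form p p)
          (PowerTrick.span-dominated 𝓖 H H-cong H-+ H-*
            (λ p q → trans (H-form p q) (trans (⟪⟫-comm (conv f p) (conv f q)) (trans (sym (H-form q p)) (⟪⟫-comm (H q) p))))
            (λ p → subst (0ℚ ≤_) (sym (H-form p p)) (0≤⟪⟫ (conv f p)))
            (Spread-out N) (λ { (ts , l , sep) → ts , l , AllPairs.map separated-H sep })
            θ (0≤* (0≤⟪⟫ f) 0≤r)
            (λ {v} h → cancelˡ 0<N (subst₂ _≤_ (cong (nat N *_) (sym (H-form v v))) (trans (cong (_* ⟪ v , v ⟫) (sym N*θ)) (ℚP.*-assoc (nat N) θ ⟪ v , v ⟫)) (gain₀ h)))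
            s)))
      where
      0<N : 0ℚ < nat N
      0<N = 0<nat 1≤N
      instance _ = ℚ.positive 0<N
               _ = ℚP.pos⇒nonZero (nat N)
      r = ℚ.1/ nat N
      0≤r : 0ℚ ≤ r
      0≤r = ℚP.<⇒≤ (ℚP.positive⁻¹ r {{ℚP.1/pos⇒pos (nat N)}})
      θ = ⟪ f , f ⟫ * r
      N*θ : nat N * θ ≡ ⟪ f , f ⟫
      N*θ = trans (x*yz≡y*xz (nat N) ⟪ f , f ⟫ r) (trans (cong (⟪ f , f ⟫ *_) (ℚP.*-inverseʳ (nat N))) (ℚP.*-identityʳ ⟪ f , f ⟫))

-- Products of labels

cart : {A : Set} {k : ℕ} → List A → List (Vec A k) → List (Vec A (suc k))
cart as vs = concatMap (λ a → map (a ∷_) vs) as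

∑-cart : {A : Set} {k : ℕ} (as : List A) (vs : List (Vec A k)) (f : Vec A (suc k) → ℚ) → ∑ (cart as vs) f ≡ ∑ as (λ a → ∑ vs (λ v → f (a ∷ v)))
∑-cart as vs f = trans (∑-concatMap (λ a → map (a ∷_) vs) as f) (∑-cong as (λ a → ∑-map (a ∷_) vs f))

All-cart : {A : Set} {k : ℕ} {P : Vec A (suc k) → Set} (as : List A) (vs : List (Vec A k)) →
  All (λ a → All (λ v → P (a ∷ v)) vs) as → All P (cart as vs)
All-cart [] vs [] = []
All-cart (a ∷ as) vs (p ∷ ps) = AllP.++⁺ (AllP.map⁺ p) (All-cart as vs ps)

5ℚ : ℚ
5ℚ = 1ℚ + 1ℚ + 1ℚ + 1ℚ + 1ℚ

0≤5 : 0ℚ ≤ 5ℚ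
0≤5 = ℚP.nonNegative⁻¹ 5ℚ

-- Fix disjoint pairs (x_q , y_q) of points.  A label says what a product of indicators contains at the
-- q-th pair: an event, or the difference δ u = [σ x_q = u] - [σ y_q = u].
data Event (n : ℕ) : Set where
  none : Event n
  at₁ at₂ : Fin n → Event n
  both : Fin n → Fin n → Event n

data Label (n : ℕ) : Set where
  ev : Event n → Label n
  δ : Fin n → Label n

-- How the labels of two factors combine at one pair; the values belonging to cross₁ and cross₂ are left open.
data Skeleton (n : ℕ) : Set where
  keep : Event n → Skeleton n
  diag₁ diag₂ : Fin n → Skeleton n
  cross₁ cross₂ : Skeleton n

record Merge (n : ℕ) : Set where
  constructor merge
  field
    left right result : Label n
    coeff : ℚ

open Merge

module _ {n : ℕ} where

  deltas : ∀ {k} → Vec (Label n) k → ℕ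
  deltas [] = 0
  deltas (ev _ ∷ θ) = deltas θ
  deltas (δ _ ∷ θ) = suc (deltas θ)

  weight : Event n → ℕ
  weight none = 0
  weight (at₁ _) = 1
  weight (at₂ _) = 1
  weight (both _ _) = 2

  points : ∀ {k} → Vec (Event n) k → ℕ
  points [] = 0
  points (e ∷ κ) = weight e ℕ.+ points κ

  fill₁ : Event n → List (Label n)
  fill₁ none = ev none ∷ map δ (allFin n)
  fill₁ (at₁ u) = ev (at₁ u) ∷ []
  fill₁ (at₂ u) = ev (at₂ u) ∷ []
  fill₁ (both u v) = ev (both u v) ∷ []

  skel₁ : Event n → List (Skeleton n)
  skel₁ none = keep none ∷ cross₁ ∷ cross₂ ∷ map diag₁ (allFin n) ++ map diag₂ (allFin n)
  skel₁ (at₁ u) = keep (at₁ u) ∷ []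
  skel₁ (at₂ u) = keep (at₂ u) ∷ []
  skel₁ (both u v) = keep (both u v) ∷ []

  pairs² : {A : Set} → (Fin n → Fin n → A) → List A
  pairs² f = concatMap (λ u → map (f u) (allFin n)) (allFin n)

  crossing₁ crossing₂ : Fin n → Fin n → Merge n
  crossing₁ u v = merge (δ u) (δ v) (ev (both u v)) (- 1ℚ)
  crossing₂ u v = merge (δ u) (δ v) (ev (both v u)) (- 1ℚ)

  -- Read off from `(a u - b u) * (a v - b v)` with `a u = [σ x = u]` and `b u = [σ y = u]`. The
  -- products of two `a` or of two `b` survive only for `u = v` and give `diag₁`, `diag₂`; the mixed
  -- products give the crossings, with coefficient -1. `keep none` gathers the cases with at most
  -- one δ.
  merge₁ : Skeleton n → List (Merge n)
  merge₁ (keep none) = merge (ev none) (ev none) (ev none) 1ℚ ∷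
    map (λ u → merge (δ u) (ev none) (δ u) 1ℚ) (allFin n) ++ map (λ u → merge (ev none) (δ u) (δ u) 1ℚ) (allFin n)
  merge₁ (keep e) = merge (ev e) (ev e) (ev e) 1ℚ ∷ []
  merge₁ (diag₁ u) = merge (δ u) (δ u) (ev (at₁ u)) 1ℚ ∷ []
  merge₁ (diag₂ u) = merge (δ u) (δ u) (ev (at₂ u)) 1ℚ ∷ []
  merge₁ cross₁ = pairs² crossing₁
  merge₁ cross₂ = pairs² crossing₂

  side₁ : Skeleton n → List (Label n)
  side₁ (keep e) = fill₁ e
  side₁ (diag₁ u) = δ u ∷ []
  side₁ (diag₂ u) = δ u ∷ []
  side₁ cross₁ = map δ (allFin n)
  side₁ cross₂ = map δ (allFin n)

  event₁ : Skeleton n → List (Event n)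
  event₁ (keep e) = e ∷ []
  event₁ (diag₁ u) = at₁ u ∷ []
  event₁ (diag₂ u) = at₂ u ∷ []
  event₁ cross₁ = pairs² both
  event₁ cross₂ = pairs² both

  forget₁ : Skeleton n → Event n
  forget₁ (keep e) = e
  forget₁ (diag₁ u) = at₁ u
  forget₁ (diag₂ u) = at₂ u
  forget₁ cross₁ = none
  forget₁ cross₂ = none

  diags₁ crosses₁ : Skeleton n → ℕ
  diags₁ (diag₁ _) = 1
  diags₁ (diag₂ _) = 1
  diags₁ _ = 0
  crosses₁ cross₁ = 1
  crosses₁ cross₂ = 1
  crosses₁ _ = 0

  fillings : ∀ {k} → Vec (Event n) k → List (Vec (Label n) k)
  fillings [] = [] ∷ []
  fillings (e ∷ κ) = cart (fill₁ e) (fillings κ)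

  skeletons : ∀ {k} → Vec (Event n) k → List (Vec (Skeleton n) k)
  skeletons [] = [] ∷ []
  skeletons (e ∷ κ) = cart (skel₁ e) (skeletons κ)

  merges : ∀ {k} → Vec (Skeleton n) k → List (Vec (Merge n) k)
  merges [] = [] ∷ []
  merges (s ∷ ss) = cart (merge₁ s) (merges ss)

  sides : ∀ {k} → Vec (Skeleton n) k → List (Vec (Label n) k)
  sides [] = [] ∷ []
  sides (s ∷ ss) = cart (side₁ s) (sides ss)

  events : ∀ {k} → Vec (Skeleton n) k → List (Vec (Event n) k)
  events [] = [] ∷ []
  events (s ∷ ss) = cart (event₁ s) (events ss)

  diags crosses : ∀ {k} → Vec (Skeleton n) k → ℕ
  diags [] = 0
  diags (s ∷ ss) = diags₁ s ℕ.+ diags ss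
  crosses [] = 0
  crosses (s ∷ ss) = crosses₁ s ℕ.+ crosses ss

  lefts rights results : ∀ {k} → Vec (Merge n) k → Vec (Label n) k
  lefts = Vec.map left
  rights = Vec.map right
  results = Vec.map result

  coeffs : ∀ {k} → Vec (Merge n) k → ℚ
  coeffs [] = 1ℚ
  coeffs (m ∷ ms) = coeff m * coeffs ms

  ∑-pairs² : {A : Set} (f : Fin n → Fin n → A) (g : A → ℚ) → ∑ (pairs² f) g ≡ ∑ᶠ n (λ u → ∑ᶠ n (λ v → g (f u v)))
  ∑-pairs² f g = trans (∑-concatMap (λ u → map (f u) (allFin n)) (allFin n) g) (∑-cong (allFin n) (λ u → ∑-map (f u) (allFin n) g))

  All-mapᶠ : {A : Set} {P : A → Set} (f : Fin n → A) → (∀ u → P (f u)) → All P (map f (allFin n))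
  All-mapᶠ f h = AllP.map⁺ (All.tabulate (λ {u} _ → h u))

  All-pairs² : {A : Set} {P : A → Set} (f : Fin n → Fin n → A) → (∀ u v → P (f u v)) → All P (pairs² f)
  All-pairs² f h = go (allFin n)
    where
    go : ∀ us → All _ (concatMap (λ u → map (f u) (allFin n)) us)
    go [] = []
    go (u ∷ us) = AllP.++⁺ (All-mapᶠ (f u) (h u)) (go us)

  ∑-fill-none : (g : Label n → ℚ) → ∑ (fill₁ none) g ≡ g (ev none) + ∑ᶠ n (λ u → g (δ u))
  ∑-fill-none g = cong (g (ev none) +_) (∑-map δ (allFin n) g)

  ∑-merge-none : (g : Merge n → ℚ) → ∑ (merge₁ (keep none)) g ≡ g (merge (ev none) (ev none) (ev none) 1ℚ) +
    (∑ᶠ n (λ u → g (merge (δ u) (ev none) (δ u) 1ℚ)) + ∑ᶠ n (λ u → g (merge (ev none) (δ u) (δ u) 1ℚ)))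
  ∑-merge-none g = cong (g _ +_) (trans (∑-++ (map (λ u → merge (δ u) (ev none) (δ u) 1ℚ) (allFin n)) (map (λ u → merge (ev none) (δ u) (δ u) 1ℚ) (allFin n)) g)
    (cong₂ _+_ (∑-map _ (allFin n) g) (∑-map _ (allFin n) g)))

  ∑-skel-none : (g : Skeleton n → ℚ) → ∑ (skel₁ none) g ≡ g (keep none) + (g cross₁ + (g cross₂ + (∑ᶠ n (g ∘ diag₁) + ∑ᶠ n (g ∘ diag₂))))
  ∑-skel-none g = cong (λ z → g (keep none) + (g cross₁ + (g cross₂ + z)))
    (trans (∑-++ (map diag₁ (allFin n)) (map diag₂ (allFin n)) g) (cong₂ _+_ (∑-map diag₁ (allFin n) g) (∑-map diag₂ (allFin n) g)))

  private
    single² : {A : Set} (a : A) (g : A → A → ℚ) → ∑ (a ∷ []) (λ _ → g a a) ≤ ∑ (a ∷ []) (λ b → ∑ (a ∷ []) (g b))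
    single² a g = ℚP.≤-reflexive (cong (_+ 0ℚ) (sym (ℚP.+-identityʳ (g a a))))

    cross-count : (f : Fin n → Fin n → Merge n) (g : Label n → Label n → ℚ) → (∀ u v → g (left (f u v)) (right (f u v)) ≡ g (δ u) (δ v)) →
      ∑ (pairs² f) (λ m → g (left m) (right m)) ≤ ∑ (map δ (allFin n)) (λ a → ∑ (map δ (allFin n)) (g a))
    cross-count f g h = ℚP.≤-reflexive (trans (∑-pairs² f _) (trans (∑-cong (allFin n) (λ u → trans (∑-cong (allFin n) (h u)) (sym (∑-map δ (allFin n) (g (δ u))))))
      (sym (∑-map δ (allFin n) _))))

    one : ∀ x → x + 0ℚ + 0ℚ ≡ 1ℚ * x + 0ℚ
    one = solve-∀ ring

    one″ : ∀ x → x + 0ℚ ≡ 1ℚ * x + 0ℚ + 0ℚ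
    one″ = solve-∀ ring

    one‴ : ∀ x → x ≡ 1ℚ * x + 0ℚ
    one‴ = solve-∀ ring

  -- Different merges of one entry have different pairs of sides, so they inject into pairs of
  -- labels from `side₁ s`; for `keep none` only the pairs of two δs are missed. After
  -- Cauchy-Schwarz this decouples the left from the right coefficients.
  side-count₁ : (s : Skeleton n) (g : Label n → Label n → ℚ) → (∀ a b → 0ℚ ≤ g a b) →
    ∑ (merge₁ s) (λ m → g (left m) (right m)) ≤ ∑ (side₁ s) (λ a → ∑ (side₁ s) (g a))
  side-count₁ (keep none) g 0≤g = subst₂ _≤_ (sym (∑-merge-none (λ m → g (left m) (right m))))
      (sym (trans (∑-fill-none (λ a → ∑ (fill₁ none) (g a))) (cong₂ _+_ (∑-fill-none (g (ev none)))
        (trans (∑-cong (allFin n) (λ u → ∑-fill-none (g (δ u)))) (∑-+ (allFin n) _ _)))))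
      (0≤-⇒≤ (subst (0ℚ ≤_) (eq (g (ev none) (ev none)) (∑ᶠ n (λ u → g (δ u) (ev none))) (∑ᶠ n (λ u → g (ev none) (δ u))) _)
        (0≤∑ (allFin n) (λ u → 0≤∑ (allFin n) (λ v → 0≤g (δ u) (δ v))))))
    where eq : ∀ a b c d → d ≡ a + c + (b + d) - (a + (b + c))
          eq = solve-∀ ring
  side-count₁ (keep (at₁ u)) g 0≤g = single² (ev (at₁ u)) g
  side-count₁ (keep (at₂ u)) g 0≤g = single² (ev (at₂ u)) g
  side-count₁ (keep (both u v)) g 0≤g = single² (ev (both u v)) g
  side-count₁ (diag₁ u) g 0≤g = single² (δ u) g
  side-count₁ (diag₂ u) g 0≤g = single² (δ u) g
  side-count₁ cross₁ g 0≤g = cross-count crossing₁ g (λ _ _ → refl)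
  side-count₁ cross₂ g 0≤g = cross-count crossing₂ g (λ _ _ → refl)

  side-count : ∀ {k} (s : Vec (Skeleton n) k) (g : Vec (Label n) k → Vec (Label n) k → ℚ) → (∀ a b → 0ℚ ≤ g a b) →
    ∑ (merges s) (λ m → g (lefts m) (rights m)) ≤ ∑ (sides s) (λ a → ∑ (sides s) (g a))
  side-count [] g 0≤g = single² [] g
  side-count (s ∷ ss) g 0≤g = begin
      ∑ (cart (merge₁ s) (merges ss)) (λ m → g (lefts m) (rights m))
        ≡⟨ ∑-cart (merge₁ s) (merges ss) (λ m → g (lefts m) (rights m)) ⟩
      ∑ (merge₁ s) (λ m → ∑ (merges ss) (λ ms → g (left m ∷ lefts ms) (right m ∷ rights ms)))
        ≤⟨ ∑-mono (merge₁ s) (λ m → side-count ss (λ a b → g (left m ∷ a) (right m ∷ b)) (λ a b → 0≤g _ _)) ⟩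
      ∑ (merge₁ s) (λ m → ∑ (sides ss) (λ a → ∑ (sides ss) (λ b → g (left m ∷ a) (right m ∷ b))))
        ≤⟨ side-count₁ s (λ l r → ∑ (sides ss) (λ a → ∑ (sides ss) (λ b → g (l ∷ a) (r ∷ b)))) (λ l r → 0≤∑ (sides ss) (λ a → 0≤∑ (sides ss) (λ b → 0≤g _ _))) ⟩
      ∑ (side₁ s) (λ l → ∑ (side₁ s) (λ r → ∑ (sides ss) (λ a → ∑ (sides ss) (λ b → g (l ∷ a) (r ∷ b)))))
        ≡⟨ ∑-cong (side₁ s) (λ l → trans (∑-swap (side₁ s) (sides ss) _) (∑-cong (sides ss) (λ a → sym (∑-cart (side₁ s) (sides ss) (g (l ∷ a)))))) ⟩
      ∑ (side₁ s) (λ l → ∑ (sides ss) (λ a → ∑ (cart (side₁ s) (sides ss)) (g (l ∷ a))))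
        ≡⟨ ∑-cart (side₁ s) (sides ss) (λ v → ∑ (cart (side₁ s) (sides ss)) (g v)) ⟨
      ∑ (cart (side₁ s) (sides ss)) (λ a → ∑ (cart (side₁ s) (sides ss)) (g a)) ∎
    where open ≤R

  private
    const^ : ∀ {k} → ℚ → Vec (Label n) k → ℚ
    const^ w θ = w ^ℚ deltas θ

    factor : ∀ {k} w (a : Label n) (θ : Vec (Label n) k) → const^ w (a ∷ θ) ≡ const^ w (a ∷ []) * const^ w θ
    factor w (ev x) θ = sym (ℚP.*-identityˡ (const^ w θ))
    factor w (δ x) θ = cong (_* const^ w θ) (sym (ℚP.*-identityʳ w))

  -- A δ-label occurs on one side of five skeleton entries.
  five₁ : (e : Event n) (h : Label n → ℚ) → ∑ (skel₁ e) (λ s → ∑ (side₁ s) h) ≡ ∑ (fill₁ e) (λ a → 5ℚ ^ℚ deltas (a ∷ []) * h a)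
  five₁ none h = begin
      ∑ (skel₁ none) (λ s → ∑ (side₁ s) h)
        ≡⟨ ∑-skel-none (λ s → ∑ (side₁ s) h) ⟩
      ∑ (fill₁ none) h + (S′ + (S′ + (∑ᶠ n (λ u → h (δ u) + 0ℚ) + ∑ᶠ n (λ u → h (δ u) + 0ℚ))))
        ≡⟨ cong₂ _+_ (∑-fill-none h) (cong₂ (λ a b → a + (a + (b + b))) (∑-map δ (allFin n) h) (∑-cong (allFin n) (λ u → ℚP.+-identityʳ (h (δ u))))) ⟩
      h (ev none) + S + (S + (S + (S + S)))
        ≡⟨ eq (h (ev none)) S ⟩
      1ℚ * h (ev none) + 5ℚ * 1ℚ * S
        ≡⟨ cong (1ℚ * h (ev none) +_) (∑-*ˡ (allFin n) (5ℚ * 1ℚ) (λ u → h (δ u))) ⟨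
      1ℚ * h (ev none) + ∑ᶠ n (λ u → 5ℚ * 1ℚ * h (δ u))
        ≡⟨ ∑-fill-none (λ a → 5ℚ ^ℚ deltas (a ∷ []) * h a) ⟨
      ∑ (fill₁ none) (λ a → 5ℚ ^ℚ deltas (a ∷ []) * h a) ∎
    where
    open ≡-Reasoning
    S = ∑ᶠ n (λ u → h (δ u))
    S′ = ∑ (map δ (allFin n)) h
    eq : ∀ a s → a + s + (s + (s + (s + s))) ≡ 1ℚ * a + 5ℚ * 1ℚ * s
    eq = solve-∀ ring
  five₁ (at₁ u) h = one (h (ev (at₁ u)))
  five₁ (at₂ u) h = one (h (ev (at₂ u)))
  five₁ (both u v) h = one (h (ev (both u v)))

  five : ∀ {k} (κ : Vec (Event n) k) (h : Vec (Label n) k → ℚ) → ∑ (skeletons κ) (λ s → ∑ (sides s) h) ≡ ∑ (fillings κ) (λ θ → 5ℚ ^ℚ deltas θ * h θ)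
  five [] h = one (h [])
  five (e ∷ κ) h = begin
      ∑ (cart (skel₁ e) (skeletons κ)) (λ s → ∑ (sides s) h)
        ≡⟨ trans (∑-cart (skel₁ e) (skeletons κ) _) (∑-cong (skel₁ e) (λ s → ∑-cong (skeletons κ) (λ ss → ∑-cart (side₁ s) (sides ss) h))) ⟩
      ∑ (skel₁ e) (λ s → ∑ (skeletons κ) (λ ss → ∑ (side₁ s) (λ a → ∑ (sides ss) (λ θ → h (a ∷ θ)))))
        ≡⟨ ∑-cong (skel₁ e) (λ s → trans (∑-swap (skeletons κ) (side₁ s) _) (∑-cong (side₁ s) (λ a → five κ (λ θ → h (a ∷ θ))))) ⟩
      ∑ (skel₁ e) (λ s → ∑ (side₁ s) (λ a → ∑ (fillings κ) (λ θ → 5ℚ ^ℚ deltas θ * h (a ∷ θ))))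
        ≡⟨ five₁ e (λ a → ∑ (fillings κ) (λ θ → 5ℚ ^ℚ deltas θ * h (a ∷ θ))) ⟩
      ∑ (fill₁ e) (λ a → 5ℚ ^ℚ deltas (a ∷ []) * ∑ (fillings κ) (λ θ → 5ℚ ^ℚ deltas θ * h (a ∷ θ)))
        ≡⟨ ∑-cong (fill₁ e) (λ a → trans (sym (∑-*ˡ (fillings κ) (5ℚ ^ℚ deltas (a ∷ [])) _)) (∑-cong (fillings κ) (λ θ →
             trans (sym (ℚP.*-assoc (5ℚ ^ℚ deltas (a ∷ [])) (5ℚ ^ℚ deltas θ) (h (a ∷ θ)))) (cong (_* h (a ∷ θ)) (sym (factor 5ℚ a θ)))))) ⟩
      ∑ (fill₁ e) (λ a → ∑ (fillings κ) (λ θ → 5ℚ ^ℚ deltas (a ∷ θ) * h (a ∷ θ)))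
        ≡⟨ ∑-cart (fill₁ e) (fillings κ) (λ θ → 5ℚ ^ℚ deltas θ * h θ) ⟨
      ∑ (cart (fill₁ e) (fillings κ)) (λ θ → 5ℚ ^ℚ deltas θ * h θ) ∎
    where open ≡-Reasoning

  -- A δ in the result can come from either factor, whence a 2 per δ. For all other entries the
  -- merge is determined by the event that results.
  results-count₁ : (s : Skeleton n) (h : Label n → ℚ) → ∑ (merge₁ s) (h ∘ result) ≡ ∑ (event₁ s) (λ e → ∑ (fill₁ e) (λ a → 2ℚ ^ℚ deltas (a ∷ []) * h a))
  results-count₁ (keep none) h = trans (∑-merge-none (h ∘ result)) (trans (eq (h (ev none)) (∑ᶠ n (h ∘ δ)))
      (cong (_+ 0ℚ) (sym (trans (∑-fill-none (λ a → 2ℚ ^ℚ deltas (a ∷ []) * h a)) (cong (1ℚ * h (ev none) +_) (∑-*ˡ (allFin n) (2ℚ * 1ℚ) (h ∘ δ)))))))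
    where eq : ∀ a s → a + (s + s) ≡ 1ℚ * a + 2ℚ * 1ℚ * s + 0ℚ
          eq = solve-∀ ring
  results-count₁ (keep (at₁ u)) h = one″ (h (ev (at₁ u)))
  results-count₁ (keep (at₂ u)) h = one″ (h (ev (at₂ u)))
  results-count₁ (keep (both u v)) h = one″ (h (ev (both u v)))
  results-count₁ (diag₁ u) h = one″ (h (ev (at₁ u)))
  results-count₁ (diag₂ u) h = one″ (h (ev (at₂ u)))
  results-count₁ cross₁ h = trans (∑-pairs² crossing₁ (h ∘ result)) (trans (∑-cong (allFin n) (λ u → ∑-cong (allFin n) (λ v → one‴ (h (ev (both u v)))))) (sym (∑-pairs² both _)))
  results-count₁ cross₂ h = trans (∑-pairs² crossing₂ (h ∘ result)) (trans (∑-swap (allFin n) (allFin n) (λ u v → h (ev (both v u))))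
    (trans (∑-cong (allFin n) (λ u → ∑-cong (allFin n) (λ v → one‴ (h (ev (both u v)))))) (sym (∑-pairs² both _))))

  results-count : ∀ {k} (s : Vec (Skeleton n) k) (h : Vec (Label n) k → ℚ) →
    ∑ (merges s) (h ∘ results) ≡ ∑ (events s) (λ κ → ∑ (fillings κ) (λ θ → 2ℚ ^ℚ deltas θ * h θ))
  results-count [] h = one″ (h [])
  results-count (s ∷ ss) h = begin
      ∑ (cart (merge₁ s) (merges ss)) (h ∘ results)
        ≡⟨ trans (∑-cart (merge₁ s) (merges ss) _) (∑-cong (merge₁ s) (λ m → results-count ss (λ θ → h (result m ∷ θ)))) ⟩
      ∑ (merge₁ s) (λ m → ∑ (events ss) (λ κ → ∑ (fillings κ) (λ θ → 2ℚ ^ℚ deltas θ * h (result m ∷ θ))))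
        ≡⟨ results-count₁ s (λ a → ∑ (events ss) (λ κ → ∑ (fillings κ) (λ θ → 2ℚ ^ℚ deltas θ * h (a ∷ θ)))) ⟩
      ∑ (event₁ s) (λ e → ∑ (fill₁ e) (λ a → 2ℚ ^ℚ deltas (a ∷ []) * ∑ (events ss) (λ κ → ∑ (fillings κ) (λ θ → 2ℚ ^ℚ deltas θ * h (a ∷ θ)))))
        ≡⟨ ∑-cong (event₁ s) (λ e → trans (∑-cong (fill₁ e) (λ a → trans (sym (∑-*ˡ (events ss) (2ℚ ^ℚ deltas (a ∷ [])) _))
             (∑-cong (events ss) (λ κ → trans (sym (∑-*ˡ (fillings κ) (2ℚ ^ℚ deltas (a ∷ [])) _)) (∑-cong (fillings κ) (λ θ →
               trans (sym (ℚP.*-assoc (2ℚ ^ℚ deltas (a ∷ [])) (2ℚ ^ℚ deltas θ) (h (a ∷ θ)))) (cong (_* h (a ∷ θ)) (sym (factor 2ℚ a θ)))))))))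
             (∑-swap (fill₁ e) (events ss) _)) ⟩
      ∑ (event₁ s) (λ e → ∑ (events ss) (λ κ → ∑ (fill₁ e) (λ a → ∑ (fillings κ) (λ θ → 2ℚ ^ℚ deltas (a ∷ θ) * h (a ∷ θ)))))
        ≡⟨ trans (∑-cart (event₁ s) (events ss) _) (∑-cong (event₁ s) (λ e → ∑-cong (events ss) (λ κ → ∑-cart (fill₁ e) (fillings κ) _))) ⟨
      ∑ (cart (event₁ s) (events ss)) (λ κ → ∑ (fillings κ) (λ θ → 2ℚ ^ℚ deltas θ * h θ)) ∎
    where open ≡-Reasoning

  -- A diagonal or crossing entry consumes one δ of each side and produces none.
  merge-count : ∀ {k} (s : Vec (Skeleton n) k) → All (λ m → deltas (results m) ℕ.+ 2 ℕ.* (diags s ℕ.+ crosses s) ≡ deltas (lefts m) ℕ.+ deltas (rights m)) (merges s)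
  merge-count [] = refl ∷ []
  merge-count (s ∷ ss) = All-cart (merge₁ s) (merges ss) (All.map (λ {m} h → All.map (λ {ms} h′ → combine s ss m ms h h′) (merge-count ss)) (count₁ s))
    where
    Count₁ : Skeleton n → Merge n → Set
    Count₁ s m = deltas (result m ∷ []) ℕ.+ 2 ℕ.* (diags₁ s ℕ.+ crosses₁ s) ≡ deltas (left m ∷ []) ℕ.+ deltas (right m ∷ [])
    count₁ : (s : Skeleton n) → All (Count₁ s) (merge₁ s)
    count₁ (keep none) = refl ∷ AllP.++⁺ (All-mapᶠ (λ u → merge (δ u) (ev none) (δ u) 1ℚ) (λ _ → refl)) (All-mapᶠ (λ u → merge (ev none) (δ u) (δ u) 1ℚ) (λ _ → refl))
    count₁ (keep (at₁ u)) = refl ∷ []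
    count₁ (keep (at₂ u)) = refl ∷ []
    count₁ (keep (both u v)) = refl ∷ []
    count₁ (diag₁ u) = refl ∷ []
    count₁ (diag₂ u) = refl ∷ []
    count₁ cross₁ = All-pairs² crossing₁ (λ _ _ → refl)
    count₁ cross₂ = All-pairs² crossing₂ (λ _ _ → refl)
    deltas-∷ : ∀ {k} (a : Label n) (θ : Vec (Label n) k) → deltas (a ∷ θ) ≡ deltas (a ∷ []) ℕ.+ deltas θ
    deltas-∷ (ev _) θ = refl
    deltas-∷ (δ _) θ = refl
    combine : ∀ {k} s (ss : Vec (Skeleton n) k) m (ms : Vec (Merge n) k) → Count₁ s m →
      deltas (results ms) ℕ.+ 2 ℕ.* (diags ss ℕ.+ crosses ss) ≡ deltas (lefts ms) ℕ.+ deltas (rights ms) →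
      deltas (results (m ∷ ms)) ℕ.+ 2 ℕ.* (diags (s ∷ ss) ℕ.+ crosses (s ∷ ss)) ≡ deltas (lefts (m ∷ ms)) ℕ.+ deltas (rights (m ∷ ms))
    combine s ss m ms h h′ = trans (cong (ℕ._+ 2 ℕ.* (diags (s ∷ ss) ℕ.+ crosses (s ∷ ss))) (deltas-∷ (result m) (results ms)))
      (trans (eq₁ (deltas (result m ∷ [])) (deltas (results ms)) (diags₁ s) (diags ss) (crosses₁ s) (crosses ss))
      (trans (cong₂ ℕ._+_ h h′) (trans (eq₂ (deltas (left m ∷ [])) (deltas (right m ∷ [])) (deltas (lefts ms)) (deltas (rights ms)))
      (sym (cong₂ ℕ._+_ (deltas-∷ (left m) (lefts ms)) (deltas-∷ (right m) (rights ms)))))))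
      where
      eq₁ : ∀ a b c d e f → a ℕ.+ b ℕ.+ 2 ℕ.* (c ℕ.+ d ℕ.+ (e ℕ.+ f)) ≡ a ℕ.+ 2 ℕ.* (c ℕ.+ e) ℕ.+ (b ℕ.+ 2 ℕ.* (d ℕ.+ f))
      eq₁ = ℕR.solve-∀
      eq₂ : ∀ a b c d → a ℕ.+ b ℕ.+ (c ℕ.+ d) ≡ a ℕ.+ c ℕ.+ (b ℕ.+ d)
      eq₂ = ℕR.solve-∀

  event-points : ∀ {k} (s : Vec (Skeleton n) k) → All (λ κ → points κ ≡ points (Vec.map forget₁ s) ℕ.+ 2 ℕ.* crosses s) (events s)
  event-points [] = refl ∷ []
  event-points (s ∷ ss) = All-cart (event₁ s) (events ss) (All.map (λ {e} h → All.map (λ {κ} h′ → trans (cong₂ ℕ._+_ h h′)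
      (eq (weight (forget₁ s)) (crosses₁ s) (points (Vec.map forget₁ ss)) (crosses ss))) (event-points ss)) (points₁ s))
    where
    points₁ : (s : Skeleton n) → All (λ e → weight e ≡ weight (forget₁ s) ℕ.+ 2 ℕ.* crosses₁ s) (event₁ s)
    points₁ (keep e) = sym (ℕP.+-identityʳ _) ∷ []
    points₁ (diag₁ u) = refl ∷ []
    points₁ (diag₂ u) = refl ∷ []
    points₁ cross₁ = All-pairs² both (λ _ _ → refl)
    points₁ cross₂ = All-pairs² both (λ _ _ → refl)
    eq : ∀ a b c d → a ℕ.+ 2 ℕ.* b ℕ.+ (c ℕ.+ 2 ℕ.* d) ≡ a ℕ.+ c ℕ.+ 2 ℕ.* (b ℕ.+ d)
    eq = ℕR.solve-∀

  forget-points : ∀ {k} (κ : Vec (Event n) k) → All (λ s → points (Vec.map forget₁ s) ≡ points κ ℕ.+ diags s) (skeletons κ)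
  forget-points [] = refl ∷ []
  forget-points (e ∷ κ) = All-cart (skel₁ e) (skeletons κ) (All.map (λ {s} h → All.map (λ {ss} h′ → trans (cong₂ ℕ._+_ h h′)
      (eq (weight e) (diags₁ s) (points κ) (diags ss))) (forget-points κ)) (points₁ e))
    where
    points₁ : (e : Event n) → All (λ s → weight (forget₁ s) ≡ weight e ℕ.+ diags₁ s) (skel₁ e)
    points₁ none = refl ∷ refl ∷ refl ∷ AllP.++⁺ (All-mapᶠ diag₁ (λ _ → refl)) (All-mapᶠ diag₂ (λ _ → refl))
    points₁ (at₁ u) = refl ∷ []
    points₁ (at₂ u) = refl ∷ []
    points₁ (both u v) = refl ∷ []
    eq : ∀ a b c d → a ℕ.+ b ℕ.+ (c ℕ.+ d) ≡ a ℕ.+ c ℕ.+ (b ℕ.+ d)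
    eq = ℕR.solve-∀

-- Quadratic forms in label values

⟦_≟_⟧ : ℕ → ℕ → ℚ
⟦ a ≟ b ⟧ = if does (a ℕP.≟ b) then 1ℚ else 0ℚ

⟦⟧-≡ : ∀ {a b} → a ≡ b → ⟦ a ≟ b ⟧ ≡ 1ℚ
⟦⟧-≡ {a} {b} h = cong (λ c → if c then 1ℚ else 0ℚ) (dec-true (a ℕP.≟ b) h)

⟦⟧-≢ : ∀ {a b} → a ≢ b → ⟦ a ≟ b ⟧ ≡ 0ℚ
⟦⟧-≢ {a} {b} h = cong (λ c → if c then 1ℚ else 0ℚ) (dec-false (a ℕP.≟ b) h)

⟦⟧-cases : ∀ a b → (a ≡ b × ⟦ a ≟ b ⟧ ≡ 1ℚ) ⊎ (a ≢ b × ⟦ a ≟ b ⟧ ≡ 0ℚ)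
⟦⟧-cases a b with a ℕP.≟ b
... | yes h = inj₁ (h , ⟦⟧-≡ h)
... | no h = inj₂ (h , ⟦⟧-≢ h)

0≤⟦⟧ : ∀ a b → 0ℚ ≤ ⟦ a ≟ b ⟧
0≤⟦⟧ a b with ⟦⟧-cases a b
... | inj₁ (_ , h) = subst (0ℚ ≤_) (sym h) 0≤1
... | inj₂ (_ , h) = ℚP.≤-reflexive (sym h)

⟦⟧-idem : ∀ a b → ⟦ a ≟ b ⟧ * ⟦ a ≟ b ⟧ ≡ ⟦ a ≟ b ⟧
⟦⟧-idem a b with ⟦⟧-cases a b
... | inj₁ (_ , h) = subst (λ z → z * z ≡ z) (sym h) refl
... | inj₂ (_ , h) = subst (λ z → z * z ≡ z) (sym h) refl

Pair : ℕ → Set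
Pair n = Fin n × Fin n

module Values {n : ℕ} (𝓖 : PermGroup n) where
  open PermGroup 𝓖 using (G; _⟨_⟩)
  open Functions 𝓖

  eventAtom : Pair n → Event n → F
  eventAtom (x , y) none σ = 1ℚ
  eventAtom (x , y) (at₁ u) σ = [ σ ⟨ x ⟩ ≟ u ]
  eventAtom (x , y) (at₂ u) σ = [ σ ⟨ y ⟩ ≟ u ]
  eventAtom (x , y) (both u v) σ = [ σ ⟨ x ⟩ ≟ u ] * [ σ ⟨ y ⟩ ≟ v ]

  atom : Pair n → Label n → F
  atom p (ev e) σ = eventAtom p e σ
  atom (x , y) (δ u) σ = [ σ ⟨ x ⟩ ≟ u ] - [ σ ⟨ y ⟩ ≟ u ]

  eventVal : ∀ {k} → Vec (Pair n) k → Vec (Event n) k → F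
  eventVal [] [] σ = 1ℚ
  eventVal (p ∷ ps) (e ∷ κ) σ = eventAtom p e σ * eventVal ps κ σ

  val : ∀ {k} → Vec (Pair n) k → Vec (Label n) k → F
  val [] [] σ = 1ℚ
  val (p ∷ ps) (l ∷ θ) σ = atom p l σ * val ps θ σ

  eventAtom-idem : ∀ p e σ → eventAtom p e σ * eventAtom p e σ ≡ eventAtom p e σ
  eventAtom-idem p none σ = refl
  eventAtom-idem (x , y) (at₁ u) σ = ≟-idem (σ ⟨ x ⟩) u
  eventAtom-idem (x , y) (at₂ u) σ = ≟-idem (σ ⟨ y ⟩) u
  eventAtom-idem (x , y) (both u v) σ = trans (xy*xy≡xx*yy [ σ ⟨ x ⟩ ≟ u ] [ σ ⟨ y ⟩ ≟ v ]) (cong₂ _*_ (≟-idem (σ ⟨ x ⟩) u) (≟-idem (σ ⟨ y ⟩) v))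

  eventVal-idem : ∀ {k} (ps : Vec (Pair n) k) κ σ → eventVal ps κ σ * eventVal ps κ σ ≡ eventVal ps κ σ
  eventVal-idem [] [] σ = refl
  eventVal-idem (p ∷ ps) (e ∷ κ) σ = trans (xy*xy≡xx*yy (eventAtom p e σ) (eventVal ps κ σ)) (cong₂ _*_ (eventAtom-idem p e σ) (eventVal-idem ps κ σ))

  0≤eventVal : ∀ {k} (ps : Vec (Pair n) k) κ σ → 0ℚ ≤ eventVal ps κ σ
  0≤eventVal ps κ σ = subst (0ℚ ≤_) (eventVal-idem ps κ σ) (0≤sq (eventVal ps κ σ))

  eventVal-absorb : ∀ {k} (ps : Vec (Pair n) k) κ σ → All (λ θ → eventVal ps κ σ * val ps θ σ ≡ val ps θ σ) (fillings κ)
  eventVal-absorb [] [] σ = refl ∷ []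
  eventVal-absorb (p ∷ ps) (e ∷ κ) σ = All-cart (fill₁ e) (fillings κ) (All.map (λ {a} h → All.map (λ {θ} h′ →
      trans (eq (eventAtom p e σ) (eventVal ps κ σ) (atom p a σ) (val ps θ σ)) (cong₂ _*_ h h′)) (eventVal-absorb ps κ σ)) (absorb₁ e))
    where
    eq : ∀ a b c d → a * b * (c * d) ≡ a * c * (b * d)
    eq = solve-∀ ring
    absorb₁ : ∀ e → All (λ a → eventAtom p e σ * atom p a σ ≡ atom p a σ) (fill₁ e)
    absorb₁ none = ℚP.*-identityˡ 1ℚ ∷ All-mapᶠ δ (λ u → ℚP.*-identityˡ (atom p (δ u) σ))
    absorb₁ (at₁ u) = eventAtom-idem p (at₁ u) σ ∷ []
    absorb₁ (at₂ u) = eventAtom-idem p (at₂ u) σ ∷ []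
    absorb₁ (both u v) = eventAtom-idem p (both u v) σ ∷ []

  private
    Expand₁ : Pair n → G → Event n → Set
    Expand₁ p σ e = (A : Label n → Label n → ℚ) →
      ∑ (fill₁ e) (λ a → ∑ (fill₁ e) (λ b → A a b * (atom p a σ * atom p b σ))) ≡
      ∑ (skel₁ e) (λ s → ∑ (merge₁ s) (λ m → A (Merge.left m) (Merge.right m) * (Merge.coeff m * atom p (Merge.result m) σ)))

    expand-event : ∀ p σ e → (A : Label n → Label n → ℚ) →
      A (ev e) (ev e) * (eventAtom p e σ * eventAtom p e σ) + 0ℚ + 0ℚ ≡ A (ev e) (ev e) * (1ℚ * eventAtom p e σ) + 0ℚ + 0ℚ
    expand-event p σ e A = cong (λ z → A (ev e) (ev e) * z + 0ℚ + 0ℚ) (trans (eventAtom-idem p e σ) (sym (ℚP.*-identityˡ (eventAtom p e σ))))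

    diagonal : ∀ (z : Fin n) (A : Fin n → Fin n → ℚ) → ∑ᶠ n (λ u → ∑ᶠ n (λ v → A u v * ([ z ≟ u ] * [ z ≟ v ]))) ≡ ∑ᶠ n (λ u → A u u * (1ℚ * [ z ≟ u ]) + 0ℚ)
    diagonal z A = ∑-cong (allFin n) (λ u → trans (∑-cong (allFin n) (λ v → eq (A u v) [ z ≟ u ] [ z ≟ v ]))
        (trans (∑-select z (λ v → [ z ≟ u ] * A u v)) (trans (≟-subst z u (A u)) (eq′ [ z ≟ u ] (A u u)))))
      where eq : ∀ a b c → a * (b * c) ≡ c * (b * a)
            eq = solve-∀ ring
            eq′ : ∀ a b → a * b ≡ b * (1ℚ * a) + 0ℚ
            eq′ = solve-∀ ring

    expand-δδ : ∀ p σ (A : Fin n → Fin n → ℚ) → ∑ᶠ n (λ u → ∑ᶠ n (λ v → A u v * (atom p (δ u) σ * atom p (δ v) σ))) ≡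
      ∑ᶠ n (λ u → ∑ᶠ n (λ v → A u v * ((- 1ℚ) * eventAtom p (both u v) σ))) + (∑ᶠ n (λ u → ∑ᶠ n (λ v → A u v * ((- 1ℚ) * eventAtom p (both v u) σ))) +
        (∑ᶠ n (λ u → A u u * (1ℚ * eventAtom p (at₁ u) σ) + 0ℚ) + ∑ᶠ n (λ u → A u u * (1ℚ * eventAtom p (at₂ u) σ) + 0ℚ)))
    expand-δδ (x , y) σ A = trans (∑∑-cong (λ u v → eq (A u v) [ σ ⟨ x ⟩ ≟ u ] [ σ ⟨ y ⟩ ≟ u ] [ σ ⟨ x ⟩ ≟ v ] [ σ ⟨ y ⟩ ≟ v ]))
        (trans (∑∑-+ p₁ (λ u v → p₂ u v + (p₃ u v + p₄ u v))) (cong (∑ᶠ n (λ u → ∑ᶠ n (p₁ u)) +_) (trans (∑∑-+ p₂ (λ u v → p₃ u v + p₄ u v))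
          (cong (∑ᶠ n (λ u → ∑ᶠ n (p₂ u)) +_) (trans (∑∑-+ p₃ p₄) (cong₂ _+_ (diagonal (σ ⟨ x ⟩) A) (diagonal (σ ⟨ y ⟩) A)))))))
      where
      p₁ p₂ p₃ p₄ : Fin n → Fin n → ℚ
      p₁ u v = A u v * ((- 1ℚ) * ([ σ ⟨ x ⟩ ≟ u ] * [ σ ⟨ y ⟩ ≟ v ]))
      p₂ u v = A u v * ((- 1ℚ) * ([ σ ⟨ x ⟩ ≟ v ] * [ σ ⟨ y ⟩ ≟ u ]))
      p₃ u v = A u v * ([ σ ⟨ x ⟩ ≟ u ] * [ σ ⟨ x ⟩ ≟ v ])
      p₄ u v = A u v * ([ σ ⟨ y ⟩ ≟ u ] * [ σ ⟨ y ⟩ ≟ v ])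
      ∑∑-cong : {f g : Fin n → Fin n → ℚ} → (∀ u v → f u v ≡ g u v) → ∑ᶠ n (λ u → ∑ᶠ n (f u)) ≡ ∑ᶠ n (λ u → ∑ᶠ n (g u))
      ∑∑-cong h = ∑-cong (allFin n) (λ u → ∑-cong (allFin n) (h u))
      ∑∑-+ : (f g : Fin n → Fin n → ℚ) → ∑ᶠ n (λ u → ∑ᶠ n (λ v → f u v + g u v)) ≡ ∑ᶠ n (λ u → ∑ᶠ n (f u)) + ∑ᶠ n (λ u → ∑ᶠ n (g u))
      ∑∑-+ f g = trans (∑-cong (allFin n) (λ u → ∑-+ (allFin n) (f u) (g u))) (∑-+ (allFin n) (λ u → ∑ᶠ n (f u)) (λ u → ∑ᶠ n (g u)))
      eq : ∀ a xu yu xv yv → a * ((xu - yu) * (xv - yv)) ≡ a * ((- 1ℚ) * (xu * yv)) + (a * ((- 1ℚ) * (xv * yu)) + (a * (xu * xv) + a * (yu * yv)))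
      eq = solve-∀ ring

    expand₁ : ∀ p σ e → Expand₁ p σ e
    expand₁ p σ none A = begin
        ∑ (fill₁ none) (λ a → ∑ (fill₁ none) (λ b → A a b * (atom p a σ * atom p b σ)))
          ≡⟨ trans (∑-fill-none (λ a → ∑ (fill₁ none) (λ b → A a b * (atom p a σ * atom p b σ)))) (cong₂ _+_ (∑-fill-none (λ b → A (ev none) b * (1ℚ * atom p b σ)))
               (trans (∑-cong (allFin n) (λ u → ∑-fill-none (λ b → A (δ u) b * (atom p (δ u) σ * atom p b σ)))) (∑-+ (allFin n) _ _))) ⟩
        A (ev none) (ev none) * (1ℚ * 1ℚ) + ∑ᶠ n (λ u → A (ev none) (δ u) * (1ℚ * atom p (δ u) σ)) +
          (∑ᶠ n (λ u → A (δ u) (ev none) * (atom p (δ u) σ * 1ℚ)) + ∑ᶠ n (λ u → ∑ᶠ n (λ v → A (δ u) (δ v) * (atom p (δ u) σ * atom p (δ v) σ))))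
          ≡⟨ cong₂ (λ y z → A (ev none) (ev none) * (1ℚ * 1ℚ) + ∑ᶠ n (λ u → A (ev none) (δ u) * (1ℚ * atom p (δ u) σ)) + (y + z))
               (∑-cong (allFin n) (λ u → cong (A (δ u) (ev none) *_) (ℚP.*-comm (atom p (δ u) σ) 1ℚ))) (expand-δδ p σ (λ u v → A (δ u) (δ v))) ⟩
        A (ev none) (ev none) * (1ℚ * 1ℚ) + ∑ᶠ n (λ u → A (ev none) (δ u) * (1ℚ * atom p (δ u) σ)) + (∑ᶠ n (λ u → A (δ u) (ev none) * (1ℚ * atom p (δ u) σ)) + (c₁ + (c₂ + (d₁ + d₂))))
          ≡⟨ eq (A (ev none) (ev none) * (1ℚ * 1ℚ)) (∑ᶠ n (λ u → A (ev none) (δ u) * (1ℚ * atom p (δ u) σ))) (∑ᶠ n (λ u → A (δ u) (ev none) * (1ℚ * atom p (δ u) σ))) _ ⟩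
        A (ev none) (ev none) * (1ℚ * 1ℚ) + (∑ᶠ n (λ u → A (δ u) (ev none) * (1ℚ * atom p (δ u) σ)) + ∑ᶠ n (λ u → A (ev none) (δ u) * (1ℚ * atom p (δ u) σ))) + (c₁ + (c₂ + (d₁ + d₂)))
          ≡⟨ cong₂ _+_ (sym (∑-merge-none term)) (cong₂ _+_ (sym (∑-pairs² crossing₁ term)) (cong (_+ (d₁ + d₂)) (sym (∑-pairs² crossing₂ term)))) ⟩
        ∑ (merge₁ (keep none)) term + (∑ (merge₁ cross₁) term + (∑ (merge₁ cross₂) term + (d₁ + d₂)))
          ≡⟨ ∑-skel-none (λ s → ∑ (merge₁ s) term) ⟨
        ∑ (skel₁ none) (λ s → ∑ (merge₁ s) term) ∎
      where
      open ≡-Reasoning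
      term : Merge n → ℚ
      term m = A (Merge.left m) (Merge.right m) * (Merge.coeff m * atom p (Merge.result m) σ)
      c₁ c₂ d₁ d₂ : ℚ
      c₁ = ∑ᶠ n (λ u → ∑ᶠ n (λ v → A (δ u) (δ v) * ((- 1ℚ) * eventAtom p (both u v) σ)))
      c₂ = ∑ᶠ n (λ u → ∑ᶠ n (λ v → A (δ u) (δ v) * ((- 1ℚ) * eventAtom p (both v u) σ)))
      d₁ = ∑ᶠ n (λ u → A (δ u) (δ u) * (1ℚ * eventAtom p (at₁ u) σ) + 0ℚ)
      d₂ = ∑ᶠ n (λ u → A (δ u) (δ u) * (1ℚ * eventAtom p (at₂ u) σ) + 0ℚ)
      eq : ∀ a b c d → a + b + (c + d) ≡ a + (c + b) + d
      eq = solve-∀ ring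
    expand₁ p σ (at₁ u) A = expand-event p σ (at₁ u) A
    expand₁ p σ (at₂ u) A = expand-event p σ (at₂ u) A
    expand₁ p σ (both u v) A = expand-event p σ (both u v) A

  -- The double sum is grouped by skeletons because Cauchy-Schwarz will be applied to each skeleton
  -- separately.
  expand : ∀ {k} (ps : Vec (Pair n) k) σ κ (D : Vec (Label n) k → Vec (Label n) k → ℚ) →
    ∑ (fillings κ) (λ θ → ∑ (fillings κ) (λ θ′ → D θ θ′ * (val ps θ σ * val ps θ′ σ))) ≡
    ∑ (skeletons κ) (λ s → ∑ (merges s) (λ m → D (lefts m) (rights m) * (coeffs m * val ps (results m) σ)))
  expand [] σ [] D = refl
  expand (p ∷ ps) σ (e ∷ κ) D = begin
      ∑ (cart (fill₁ e) (fillings κ)) (λ θ → ∑ (cart (fill₁ e) (fillings κ)) (λ θ′ → D θ θ′ * (val (p ∷ ps) θ σ * val (p ∷ ps) θ′ σ)))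
        ≡⟨ trans (∑-cart (fill₁ e) (fillings κ) _) (∑-cong (fill₁ e) (λ a → trans (∑-cong (fillings κ) (λ θ → ∑-cart (fill₁ e) (fillings κ) _)) (∑-swap (fillings κ) (fill₁ e) _))) ⟩
      ∑ (fill₁ e) (λ a → ∑ (fill₁ e) (λ b → ∑ (fillings κ) (λ θ → ∑ (fillings κ) (λ θ′ → D (a ∷ θ) (b ∷ θ′) * (atom p a σ * val ps θ σ * (atom p b σ * val ps θ′ σ))))))
        ≡⟨ ∑-cong (fill₁ e) (λ a → ∑-cong (fill₁ e) (λ b → trans (∑-cong (fillings κ) (λ θ → trans (∑-cong (fillings κ) (λ θ′ →
             eq (D (a ∷ θ) (b ∷ θ′)) (atom p a σ) (val ps θ σ) (atom p b σ) (val ps θ′ σ))) (∑-*ʳ (fillings κ) _ _))) (∑-*ʳ (fillings κ) _ _))) ⟩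
      ∑ (fill₁ e) (λ a → ∑ (fill₁ e) (λ b → A a b * (atom p a σ * atom p b σ)))
        ≡⟨ expand₁ p σ e A ⟩
      ∑ (skel₁ e) (λ s → ∑ (merge₁ s) (λ m → A (Merge.left m) (Merge.right m) * (Merge.coeff m * atom p (Merge.result m) σ)))
        ≡⟨ ∑-cong (skel₁ e) (λ s → trans (∑-cong (merge₁ s) (λ m → trans (cong (_* (Merge.coeff m * atom p (Merge.result m) σ)) (expand ps σ κ (λ θ θ′ → D (Merge.left m ∷ θ) (Merge.right m ∷ θ′))))
             (trans (sym (∑-*ʳ (skeletons κ) _ _)) (∑-cong (skeletons κ) (λ ss → trans (sym (∑-*ʳ (merges ss) _ _)) (∑-cong (merges ss) (λ ms →
               eq′ (D (Merge.left m ∷ lefts ms) (Merge.right m ∷ rights ms)) (coeffs ms) (val ps (results ms) σ) (Merge.coeff m) (atom p (Merge.result m) σ)))))))) (∑-swap (merge₁ s) (skeletons κ) _)) ⟩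
      ∑ (skel₁ e) (λ s → ∑ (skeletons κ) (λ ss → ∑ (merge₁ s) (λ m → ∑ (merges ss) (λ ms → D (Merge.left m ∷ lefts ms) (Merge.right m ∷ rights ms) *
        (Merge.coeff m * coeffs ms * (atom p (Merge.result m) σ * val ps (results ms) σ))))))
        ≡⟨ trans (∑-cart (skel₁ e) (skeletons κ) _) (∑-cong (skel₁ e) (λ s → ∑-cong (skeletons κ) (λ ss → ∑-cart (merge₁ s) (merges ss) _))) ⟨
      ∑ (cart (skel₁ e) (skeletons κ)) (λ s → ∑ (merges s) (λ m → D (lefts m) (rights m) * (coeffs m * val (p ∷ ps) (results m) σ))) ∎
    where
    open ≡-Reasoning
    A : Label n → Label n → ℚ
    A a b = ∑ (fillings κ) (λ θ → ∑ (fillings κ) (λ θ′ → D (a ∷ θ) (b ∷ θ′) * (val ps θ σ * val ps θ′ σ)))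
    eq : ∀ d a v b w → d * (a * v * (b * w)) ≡ d * (v * w) * (a * b)
    eq = solve-∀ ring
    eq′ : ∀ d c v m a → d * (c * v) * (m * a) ≡ d * (m * c * (a * v))
    eq′ = solve-∀ ring

  -- The events of a crossing entry run through all joint values at its two points; they form a
  -- partition of unity and disappear on summation.
  events-val : ∀ {k} (ps : Vec (Pair n) k) σ (s : Vec (Skeleton n) k) → ∑ (events s) (λ κ → eventVal ps κ σ) ≡ eventVal ps (Vec.map forget₁ s) σ
  events-val [] σ [] = refl
  events-val (p ∷ ps) σ (s ∷ ss) = trans (∑-cart (event₁ s) (events ss) _)
      (trans (∑-product (event₁ s) (events ss) (λ e → eventAtom p e σ) (λ κ → eventVal ps κ σ)) (cong₂ _*_ (go s) (events-val ps σ ss)))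
    where
    cross : ∑ (pairs² both) (λ e → eventAtom p e σ) ≡ 1ℚ
    cross = trans (∑-pairs² both (λ e → eventAtom p e σ)) (trans (∑-product (allFin n) (allFin n) (λ u → [ σ ⟨ proj₁ p ⟩ ≟ u ]) (λ v → [ σ ⟨ proj₂ p ⟩ ≟ v ]))
      (cong₂ _*_ (∑-≟ (σ ⟨ proj₁ p ⟩)) (∑-≟ (σ ⟨ proj₂ p ⟩))))
    go : ∀ s → ∑ (event₁ s) (λ e → eventAtom p e σ) ≡ eventAtom p (forget₁ s) σ
    go (keep e) = ℚP.+-identityʳ _
    go (diag₁ u) = ℚP.+-identityʳ _
    go (diag₂ u) = ℚP.+-identityʳ _
    go cross₁ = cross
    go cross₂ = cross

  coeffs-sq : ∀ {k} (s : Vec (Skeleton n) k) → All (λ m → coeffs m * coeffs m ≡ 1ℚ) (merges s)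
  coeffs-sq [] = refl ∷ []
  coeffs-sq (s ∷ ss) = All-cart (merge₁ s) (merges ss) (All.map (λ {m} h → All.map (λ {ms} h′ → trans (eq (Merge.coeff m) (coeffs ms)) (cong₂ _*_ h h′)) (coeffs-sq ss)) (go s))
    where
    eq : ∀ a b → a * b * (a * b) ≡ a * a * (b * b)
    eq = solve-∀ ring
    go : ∀ s → All (λ m → Merge.coeff m * Merge.coeff m ≡ 1ℚ) (merge₁ s)
    go (keep none) = refl ∷ AllP.++⁺ (All-mapᶠ (λ u → merge (δ u) (ev none) (δ u) 1ℚ) (λ _ → refl)) (All-mapᶠ (λ u → merge (ev none) (δ u) (δ u) 1ℚ) (λ _ → refl))
    go (keep (at₁ u)) = refl ∷ []
    go (keep (at₂ u)) = refl ∷ []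
    go (keep (both u v)) = refl ∷ []
    go (diag₁ u) = refl ∷ []
    go (diag₂ u) = refl ∷ []
    go cross₁ = All-pairs² crossing₁ (λ _ _ → refl)
    go cross₂ = All-pairs² crossing₂ (λ _ _ → refl)

  module Quadratic {k : ℕ} (ps : Vec (Pair n) k) (f : F) where

    coef : Vec (Label n) k → ℚ
    coef ω = E (λ σ → f σ * val ps ω σ)

    mass : Vec (Event n) k → ℚ
    mass κ = E (λ σ → f σ * eventVal ps κ σ)

    energy : ℕ → Vec (Event n) k → ℚ
    energy t κ = ∑ (fillings κ) (λ θ → ⟦ deltas θ ≟ t ⟧ * (coef θ * coef θ))

    module _ (R A B : ℚ) (0≤R : 0ℚ ≤ R) (0≤A : 0ℚ ≤ A) (0≤B : 0ℚ ≤ B) (μ : ℕ → ℚ) (T i : ℕ)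
      (energy≤ : ∀ κ t → points κ ℕ.≤ T → t ℕ.≤ 2 ℕ.* i → energy t κ ≤ μ t * μ t * (mass κ * (R ^ℚ points κ * A)))
      (mass≤ : ∀ κ → points κ ℕ.≤ T → mass κ ≤ R ^ℚ points κ * A)
      (0≤μ : ∀ t → 0ℚ ≤ μ t)
      (κ : Vec (Event n) k) (κ+2i≤T : points κ ℕ.+ 2 ℕ.* i ℕ.≤ T)
      (μR≤B : ∀ t s → t ℕ.+ 2 ℕ.* s ≡ 2 ℕ.* i → μ t * R ^ℚ s ≤ B)
      (d : Vec (Label n) k → ℚ) (d-support : ∀ θ → deltas θ ≢ i → d θ ≡ 0ℚ)
      where

      private
        W = R ^ℚ points κ * A
        0≤W : 0ℚ ≤ W
        0≤W = 0≤* (0≤^ (points κ) 0≤R) 0≤A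
        β = 2ℚ ^ℚ i * W * B
        0≤β : 0ℚ ≤ β
        0≤β = 0≤* (0≤* (0≤^ i 0≤2) 0≤W) 0≤B

        module Skel (s : Vec (Skeleton n) k) (s∈ : s ∈ skeletons κ) where
          S = diags s ℕ.+ crosses s
          sel : ℕ → ℚ
          sel t = ⟦ t ℕ.+ 2 ℕ.* S ≟ 2 ℕ.* i ⟧
          D b : Vec (Merge n) k → ℚ
          D m = d (lefts m) * d (rights m)
          -- Two labels with `i` δs each can only merge to a result with `2 i - 2 S` of them. The
          -- selector records this, so that the energy of a single level occurs below.
          b m = sel (deltas (results m)) * (coeffs m * coef (results m))
          V = ∑ (sides s) (λ θ → d θ * d θ)
          0≤V : 0ℚ ≤ V
          0≤V = 0≤∑ (sides s) (λ θ → 0≤sq (d θ))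

          D-b : ∀ {m} → m ∈ merges s → D m * (coeffs m * coef (results m)) ≡ D m * b m
          D-b {m} m∈ with deltas (lefts m) ℕP.≟ i | deltas (rights m) ℕP.≟ i
          ... | no h | _ = trans (zero₁ (coeffs m * coef (results m))) (sym (zero₁ (b m)))
            where zero₁ : ∀ z → D m * z ≡ 0ℚ
                  zero₁ z = trans (cong (λ y → y * d (rights m) * z) (d-support (lefts m) h)) (eq (d (rights m)) z)
                    where eq : ∀ y z → 0ℚ * y * z ≡ 0ℚ
                          eq = solve-∀ ring
          ... | yes _ | no h = trans (zero₁ (coeffs m * coef (results m))) (sym (zero₁ (b m)))
            where zero₁ : ∀ z → D m * z ≡ 0ℚ
                  zero₁ z = trans (cong (λ y → d (lefts m) * y * z) (d-support (rights m) h)) (eq (d (lefts m)) z)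
                    where eq : ∀ y z → y * 0ℚ * z ≡ 0ℚ
                          eq = solve-∀ ring
          ... | yes h | yes h′ = cong (D m *_) (sym (trans (cong (_* (coeffs m * coef (results m))) (⟦⟧-≡ count)) (ℚP.*-identityˡ (coeffs m * coef (results m)))))
            where count : deltas (results m) ℕ.+ 2 ℕ.* S ≡ 2 ℕ.* i
                  count = trans (All.lookup (merge-count s) m∈) (trans (cong₂ ℕ._+_ h h′) (cong (i ℕ.+_) (sym (ℕP.+-identityʳ i))))

          D² : ∑ (merges s) (λ m → D m * D m) ≤ V * V
          D² = ℚP.≤-trans (ℚP.≤-reflexive (∑-cong (merges s) (λ m → xy*xy≡xx*yy (d (lefts m)) (d (rights m)))))
              (ℚP.≤-trans (side-count s (λ θ θ′ → d θ * d θ * (d θ′ * d θ′)) (λ θ θ′ → 0≤* (0≤sq (d θ)) (0≤sq (d θ′))))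
                (ℚP.≤-reflexive (∑-product (sides s) (sides s) (λ θ → d θ * d θ) (λ θ → d θ * d θ))))

          h : Vec (Label n) k → ℚ
          h θ = sel (deltas θ) * (coef θ * coef θ)

          b²≡ : ∑ (merges s) (λ m → b m * b m) ≡ ∑ (events s) (λ κ′ → ∑ (fillings κ′) (λ θ → 2ℚ ^ℚ deltas θ * h θ))
          b²≡ = trans (∑-cong∈ (merges s) (λ {m} m∈ → trans (eq (sel (deltas (results m))) (coeffs m) (coef (results m)))
              (trans (cong₂ (λ x y → x * (y * (coef (results m) * coef (results m)))) (⟦⟧-idem (deltas (results m) ℕ.+ 2 ℕ.* S) (2 ℕ.* i)) (All.lookup (coeffs-sq s) m∈))
                (cong (sel (deltas (results m)) *_) (ℚP.*-identityˡ (coef (results m) * coef (results m))))))) (results-count s h)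
            where eq : ∀ a b c → a * (b * c) * (a * (b * c)) ≡ a * a * (b * b * (c * c))
                  eq = solve-∀ ring

          b²≤ : ∑ (merges s) (λ m → b m * b m) ≤ β * β
          b²≤ with S ℕP.≤? i
          -- More than `i` contractions are impossible, and then the selector vanishes on every
          -- result.
          ... | no S≰i = subst (_≤ β * β) (sym (trans b²≡ (∑-zero (events s) (λ κ′ → ∑-zero (fillings κ′) (λ θ →
                trans (cong (λ z → 2ℚ ^ℚ deltas θ * (z * (coef θ * coef θ))) (⟦⟧-≢ (λ e → S≰i (ℕP.*-cancelˡ-≤ 2 (ℕP.≤-trans (ℕP.m≤n+m (2 ℕ.* S) (deltas θ)) (ℕP.≤-reflexive e))))))
                  (eq (2ℚ ^ℚ deltas θ) (coef θ * coef θ))))))) (0≤sq β)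
            where eq : ∀ a b → a * (0ℚ * b) ≡ 0ℚ
                  eq = solve-∀ ring
          ... | yes S≤i = begin
              ∑ (merges s) (λ m → b m * b m) ≡⟨ b²≡ ⟩
              ∑ (events s) (λ κ′ → ∑ (fillings κ′) (λ θ → 2ℚ ^ℚ deltas θ * h θ)) ≤⟨ ∑-mono (events s) (λ κ′ → ∑-mono (fillings κ′) (λ θ → pointwise θ)) ⟩
              ∑ (events s) (λ κ′ → ∑ (fillings κ′) (λ θ → c₂ * c₂ * (⟦ deltas θ ≟ t ⟧ * (coef θ * coef θ)))) ≡⟨ ∑-cong (events s) (λ κ′ → ∑-*ˡ (fillings κ′) (c₂ * c₂) _) ⟩
              ∑ (events s) (λ κ′ → c₂ * c₂ * energy t κ′) ≤⟨ ∑-mono∈ (events s) (λ {κ′} κ′∈ → *-monoˡ (0≤sq c₂) (ℚP.≤-trans (energy≤ κ′ t (κ′≤T κ′∈) (ℕP.m∸n≤m (2 ℕ.* i) (2 ℕ.* S)))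
                                                                                                  (ℚP.≤-reflexive (cong (λ p → μ t * μ t * (mass κ′ * (R ^ℚ p * A))) (P≡ κ′∈))))) ⟩
              ∑ (events s) (λ κ′ → c₂ * c₂ * (μ t * μ t * (mass κ′ * (R ^ℚ P * A)))) ≡⟨ ∑-cong (events s) (λ κ′ → eq₁ (c₂ * c₂) (μ t * μ t) (mass κ′) (R ^ℚ P * A)) ⟩
              ∑ (events s) (λ κ′ → c₂ * c₂ * (μ t * μ t) * (R ^ℚ P * A) * mass κ′) ≡⟨ ∑-*ˡ (events s) (c₂ * c₂ * (μ t * μ t) * (R ^ℚ P * A)) mass ⟩
              c₂ * c₂ * (μ t * μ t) * (R ^ℚ P * A) * ∑ (events s) mass ≡⟨ cong (c₂ * c₂ * (μ t * μ t) * (R ^ℚ P * A) *_) ∑mass ⟩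
              c₂ * c₂ * (μ t * μ t) * (R ^ℚ P * A) * mass κ₀ ≤⟨ *-monoˡ (0≤* (0≤* (0≤sq c₂) (0≤sq (μ t))) (0≤* (0≤^ P 0≤R) 0≤A)) (mass≤ κ₀ κ₀≤T) ⟩
              -- A diagonal entry adds a point both to the events of the skeleton and to `κ₀`; a
              -- crossing adds two points to the former and none to the latter. So the exponents of
              -- `R` add up to `2 * points κ + 2 * S`, and the bound is a perfect square.
              c₂ * c₂ * (μ t * μ t) * (R ^ℚ P * A) * (R ^ℚ points κ₀ * A) ≡⟨ cong₂ (λ p q → c₂ * c₂ * (μ t * μ t) * (p * A) * (q * A)) R^P R^κ₀ ⟩
              c₂ * c₂ * (μ t * μ t) * (R ^ℚ points κ * rd * (rc * rc) * A) * (R ^ℚ points κ * rd * A) ≡⟨ eq₂ c₂ (μ t) (R ^ℚ points κ) rd rc A ⟩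
              c₂ * W * (μ t * (rd * rc)) * (c₂ * W * (μ t * (rd * rc))) ≡⟨ cong (λ z → c₂ * W * (μ t * z) * (c₂ * W * (μ t * z))) (sym (^-+ R (diags s) (crosses s))) ⟩
              c₂ * W * (μ t * R ^ℚ S) * (c₂ * W * (μ t * R ^ℚ S)) ≤⟨ sq-mono (0≤* (0≤* (0≤^ i 0≤2) 0≤W) (0≤* (0≤μ t) (0≤^ S 0≤R))) (*-monoˡ (0≤* (0≤^ i 0≤2) 0≤W) (μR≤B t S t+2S)) ⟩
              β * β ∎
            where
            open ≤R
            t = 2 ℕ.* i ℕ.∸ 2 ℕ.* S
            t+2S : t ℕ.+ 2 ℕ.* S ≡ 2 ℕ.* i
            t+2S = ℕP.m∸n+n≡m (ℕP.*-monoʳ-≤ 2 S≤i)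
            c₂ = 2ℚ ^ℚ i
            rd = R ^ℚ diags s
            rc = R ^ℚ crosses s
            κ₀ = Vec.map forget₁ s
            κ₀≡ : points κ₀ ≡ points κ ℕ.+ diags s
            κ₀≡ = All.lookup (forget-points κ) s∈
            P = points κ₀ ℕ.+ 2 ℕ.* crosses s
            P≡ : ∀ {κ′} → κ′ ∈ events s → points κ′ ≡ P
            P≡ κ′∈ = All.lookup (event-points s) κ′∈
            P≤T : P ℕ.≤ T
            P≤T = ℕP.≤-trans (ℕP.≤-reflexive (trans (cong (ℕ._+ 2 ℕ.* crosses s) κ₀≡) (ℕP.+-assoc (points κ) (diags s) (2 ℕ.* crosses s))))
              (ℕP.≤-trans (ℕP.+-monoʳ-≤ (points κ) (ℕP.≤-trans (ℕP.+-monoˡ-≤ (2 ℕ.* crosses s) (ℕP.m≤m+n (diags s) _))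
                (ℕP.≤-trans (ℕP.≤-reflexive (sym (ℕP.*-distribˡ-+ 2 (diags s) (crosses s)))) (ℕP.*-monoʳ-≤ 2 S≤i)))) κ+2i≤T)
            κ′≤T : ∀ {κ′} → κ′ ∈ events s → points κ′ ℕ.≤ T
            κ′≤T κ′∈ = subst (ℕ._≤ T) (sym (P≡ κ′∈)) P≤T
            κ₀≤T : points κ₀ ℕ.≤ T
            κ₀≤T = ℕP.≤-trans (ℕP.m≤m+n (points κ₀) _) P≤T
            R^κ₀ : R ^ℚ points κ₀ ≡ R ^ℚ points κ * rd
            R^κ₀ = trans (cong (R ^ℚ_) κ₀≡) (^-+ R (points κ) (diags s))
            R^P : R ^ℚ P ≡ R ^ℚ points κ * rd * (rc * rc)
            R^P = trans (^-+ R (points κ₀) (2 ℕ.* crosses s)) (cong₂ _*_ R^κ₀ (trans (cong (λ z → R ^ℚ (crosses s ℕ.+ z)) (ℕP.+-identityʳ (crosses s))) (^-+ R (crosses s) (crosses s))))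
            ∑mass : ∑ (events s) mass ≡ mass κ₀
            ∑mass = trans (sym (E-∑ (events s) (λ κ′ σ → f σ * eventVal ps κ′ σ))) (E-cong (λ σ → trans (∑-*ˡ (events s) (f σ) (λ κ′ → eventVal ps κ′ σ)) (cong (f σ *_) (events-val ps σ s))))
            eq₁ : ∀ a b c d → a * (b * (c * d)) ≡ a * b * d * c
            eq₁ = solve-∀ ring
            eq₂ : ∀ c m r d x a → c * c * (m * m) * (r * d * (x * x) * a) * (r * d * a) ≡ c * (r * a) * (m * (d * x)) * (c * (r * a) * (m * (d * x)))
            eq₂ = solve-∀ ring
            t≤2i : t ℕ.≤ i ℕ.+ i
            t≤2i = ℕP.≤-trans (ℕP.m∸n≤m (2 ℕ.* i) (2 ℕ.* S)) (ℕP.≤-reflexive (cong (i ℕ.+_) (ℕP.+-identityʳ i)))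
            pointwise : ∀ θ → 2ℚ ^ℚ deltas θ * h θ ≤ c₂ * c₂ * (⟦ deltas θ ≟ t ⟧ * (coef θ * coef θ))
            pointwise θ with ⟦⟧-cases (deltas θ) t
            ... | inj₁ (e , e₁) = subst₂ _≤_ (cong (2ℚ ^ℚ deltas θ *_) (cong (_* (coef θ * coef θ)) (sym (⟦⟧-≡ {deltas θ ℕ.+ 2 ℕ.* S} (trans (cong (ℕ._+ 2 ℕ.* S) e) t+2S))))) (cong (λ z → c₂ * c₂ * (z * (coef θ * coef θ))) (sym e₁))
                  (*-monoʳ (0≤* 0≤1 (0≤sq (coef θ))) (subst (2ℚ ^ℚ deltas θ ≤_) (^-+ 2ℚ i i) (^-monoᵉ 1≤2 (subst (ℕ._≤ i ℕ.+ i) (sym e) t≤2i))))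
              where 1≤2 : 1ℚ ≤ 2ℚ
                    1≤2 = ℚP.+-monoʳ-≤ 1ℚ {0ℚ} {1ℚ} 0≤1
            ... | inj₂ (e , e₁) = ℚP.≤-reflexive (trans (cong (λ z → 2ℚ ^ℚ deltas θ * (z * (coef θ * coef θ))) (⟦⟧-≢ (λ e′ → e (ℕP.+-cancelʳ-≡ (2 ℕ.* S) (deltas θ) t (trans e′ (sym t+2S))))))
                  (trans (eq (2ℚ ^ℚ deltas θ) (c₂ * c₂) (coef θ * coef θ)) (cong (λ z → c₂ * c₂ * (z * (coef θ * coef θ))) (sym e₁))))
              where eq : ∀ a b c → a * (0ℚ * c) ≡ b * (0ℚ * c)
                    eq = solve-∀ ring

          bound : ∑ (merges s) (λ m → D m * (coeffs m * coef (results m))) ≤ V * β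
          bound = subst (_≤ V * β) (sym (∑-cong∈ (merges s) D-b)) (sq-cancel (0≤* 0≤V 0≤β)
            (ℚP.≤-trans (∑-CS (merges s) D b) (ℚP.≤-trans (*-mono (0≤∑ (merges s) (λ m → 0≤sq (D m))) (0≤∑ (merges s) (λ m → 0≤sq (b m))) D² b²≤)
              (ℚP.≤-reflexive (eq V β)))))
            where eq : ∀ v b → v * v * (b * b) ≡ v * b * (v * b)
                  eq = solve-∀ ring

        p : F
        p σ = ∑ (fillings κ) (λ θ → d θ * val ps θ σ)

      -- For one skeleton, Cauchy-Schwarz separates the coefficients `d` from those of `f`; the
      -- latter all sit at the level `2 i - 2 S`, where the energy bound applies. Summing over the
      -- skeletons costs a 5 per δ by `five`.
      quadratic : E (λ σ → f σ * (p σ * p σ)) ≤ 5ℚ ^ℚ i * ∑ (fillings κ) (λ θ → d θ * d θ) * β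
      quadratic = begin
          E (λ σ → f σ * (p σ * p σ))
            ≡⟨ E-cong (λ σ → cong (f σ *_) (trans (sym (∑-product (fillings κ) (fillings κ) (λ θ → d θ * val ps θ σ) (λ θ → d θ * val ps θ σ)))
                 (trans (∑-cong (fillings κ) (λ θ → ∑-cong (fillings κ) (λ θ′ → eq₁ (d θ) (val ps θ σ) (d θ′) (val ps θ′ σ)))) (expand ps σ κ (λ θ θ′ → d θ * d θ′))))) ⟩
          E (λ σ → f σ * ∑ (skeletons κ) (λ s → ∑ (merges s) (λ m → d (lefts m) * d (rights m) * (coeffs m * val ps (results m) σ))))
            ≡⟨ E-cong (λ σ → trans (sym (∑-*ˡ (skeletons κ) (f σ) _)) (∑-cong (skeletons κ) (λ s → trans (sym (∑-*ˡ (merges s) (f σ) _)) (∑-cong (merges s) (λ m →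
                 eq₂ (f σ) (d (lefts m) * d (rights m)) (coeffs m) (val ps (results m) σ)))))) ⟩
          E (λ σ → ∑ (skeletons κ) (λ s → ∑ (merges s) (λ m → d (lefts m) * d (rights m) * coeffs m * (f σ * val ps (results m) σ))))
            ≡⟨ trans (E-∑ (skeletons κ) _) (∑-cong (skeletons κ) (λ s → trans (E-∑ (merges s) _) (∑-cong (merges s) (λ m →
                 trans (E-*ˡ (d (lefts m) * d (rights m) * coeffs m) _) (ℚP.*-assoc (d (lefts m) * d (rights m)) (coeffs m) _))))) ⟩
          ∑ (skeletons κ) (λ s → ∑ (merges s) (λ m → d (lefts m) * d (rights m) * (coeffs m * coef (results m))))
            ≤⟨ ∑-mono∈ (skeletons κ) (λ {s} s∈ → Skel.bound s s∈) ⟩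
          ∑ (skeletons κ) (λ s → ∑ (sides s) (λ θ → d θ * d θ) * β)
            ≡⟨ trans (∑-*ʳ (skeletons κ) _ β) (cong (_* β) (trans (five κ (λ θ → d θ * d θ)) (trans (∑-cong (fillings κ) five-i) (∑-*ˡ (fillings κ) (5ℚ ^ℚ i) _)))) ⟩
          5ℚ ^ℚ i * ∑ (fillings κ) (λ θ → d θ * d θ) * β ∎
        where
        open ≤R
        eq₁ : ∀ a b c e → a * b * (c * e) ≡ a * c * (b * e)
        eq₁ = solve-∀ ring
        eq₂ : ∀ a b c e → a * (b * (c * e)) ≡ b * c * (a * e)
        eq₂ = solve-∀ ring
        five-i : ∀ θ → 5ℚ ^ℚ deltas θ * (d θ * d θ) ≡ 5ℚ ^ℚ i * (d θ * d θ)
        five-i θ with deltas θ ℕP.≟ i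
        ... | yes e = cong (λ j → 5ℚ ^ℚ j * (d θ * d θ)) e
        ... | no h = trans (cong (λ z → 5ℚ ^ℚ deltas θ * (z * z)) (d-support θ h)) (trans (eq (5ℚ ^ℚ deltas θ) (5ℚ ^ℚ i)) (cong (λ z → 5ℚ ^ℚ i * (z * z)) (sym (d-support θ h))))
          where eq : ∀ a b → a * (0ℚ * 0ℚ) ≡ b * (0ℚ * 0ℚ)
                eq = solve-∀ ring

-- Indicators

module _ {n : ℕ} where

  _∉ᵛ_ : ∀ {i} → Fin n → Vec (Fin n) i → Set
  z ∉ᵛ [] = ⊤
  z ∉ᵛ (x ∷ I) = z ≢ x × z ∉ᵛ I

  AllDistinct : ∀ {i} → Vec (Fin n) i → Set
  AllDistinct [] = ⊤
  AllDistinct (x ∷ I) = x ∉ᵛ I × AllDistinct I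

  Fresh : ∀ {k} → Fin n → Vec (Pair n) k → Set
  Fresh z [] = ⊤
  Fresh z ((x , y) ∷ ps) = z ≢ x × z ≢ y × Fresh z ps

  Disjoint : ∀ {k} → Vec (Pair n) k → Set
  Disjoint [] = ⊤
  Disjoint ((x , y) ∷ ps) = x ≢ y × Fresh x ps × Fresh y ps × Disjoint ps

  positions : ∀ {k} → Vec (Pair n) k → (κ : Vec (Event n) k) → Vec (Fin n) (points κ)
  positions [] [] = []
  positions (p ∷ ps) (none ∷ κ) = positions ps κ
  positions ((x , y) ∷ ps) (at₁ u ∷ κ) = x ∷ positions ps κ
  positions ((x , y) ∷ ps) (at₂ u ∷ κ) = y ∷ positions ps κ
  positions ((x , y) ∷ ps) (both u v ∷ κ) = x ∷ y ∷ positions ps κ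

  targets : ∀ {k} → (κ : Vec (Event n) k) → Vec (Fin n) (points κ)
  targets [] = []
  targets (none ∷ κ) = targets κ
  targets (at₁ u ∷ κ) = u ∷ targets κ
  targets (at₂ u ∷ κ) = u ∷ targets κ
  targets (both u v ∷ κ) = u ∷ v ∷ targets κ

  fresh-positions : ∀ {k z} (ps : Vec (Pair n) k) κ → Fresh z ps → z ∉ᵛ positions ps κ
  fresh-positions [] [] h = tt
  fresh-positions (p ∷ ps) (none ∷ κ) (_ , _ , h) = fresh-positions ps κ h
  fresh-positions (p ∷ ps) (at₁ u ∷ κ) (a , _ , h) = a , fresh-positions ps κ h
  fresh-positions (p ∷ ps) (at₂ u ∷ κ) (_ , b , h) = b , fresh-positions ps κ h
  fresh-positions (p ∷ ps) (both u v ∷ κ) (a , b , h) = a , b , fresh-positions ps κ h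

  distinct-positions : ∀ {k} (ps : Vec (Pair n) k) κ → Disjoint ps → AllDistinct (positions ps κ)
  distinct-positions [] [] h = tt
  distinct-positions (p ∷ ps) (none ∷ κ) (_ , _ , _ , h) = distinct-positions ps κ h
  distinct-positions (p ∷ ps) (at₁ u ∷ κ) (_ , a , _ , h) = fresh-positions ps κ a , distinct-positions ps κ h
  distinct-positions (p ∷ ps) (at₂ u ∷ κ) (_ , _ , b , h) = fresh-positions ps κ b , distinct-positions ps κ h
  distinct-positions (p ∷ ps) (both u v ∷ κ) (x≢y , a , b , h) = (x≢y , fresh-positions ps κ a) , fresh-positions ps κ b , distinct-positions ps κ h

  nones : (k : ℕ) → Vec (Event n) k
  nones zero = []
  nones (suc k) = none ∷ nones k

  points-nones : ∀ k → points (nones k) ≡ 0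
  points-nones zero = refl
  points-nones (suc k) = points-nones k

module Indicators {n : ℕ} (𝓖 : PermGroup n) where
  open PermGroup 𝓖
  open Functions 𝓖
  open Values 𝓖

  ind : ∀ {i} → Vec (Fin n) i → Vec (Fin n) i → F
  ind [] [] σ = 1ℚ
  ind (x ∷ I) (u ∷ J) σ = [ σ ⟨ x ⟩ ≟ u ] * ind I J σ

  0≤ind : ∀ {i} (I J : Vec (Fin n) i) σ → 0ℚ ≤ ind I J σ
  0≤ind [] [] σ = 0≤1
  0≤ind (x ∷ I) (u ∷ J) σ = 0≤* (0≤≟ (σ ⟨ x ⟩) u) (0≤ind I J σ)

  eventVal≡ind : ∀ {k} (ps : Vec (Pair n) k) κ σ → eventVal ps κ σ ≡ ind (positions ps κ) (targets κ) σ
  eventVal≡ind [] [] σ = refl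
  eventVal≡ind (p ∷ ps) (none ∷ κ) σ = trans (ℚP.*-identityˡ (eventVal ps κ σ)) (eventVal≡ind ps κ σ)
  eventVal≡ind (p ∷ ps) (at₁ u ∷ κ) σ = cong (eventAtom p (at₁ u) σ *_) (eventVal≡ind ps κ σ)
  eventVal≡ind (p ∷ ps) (at₂ u ∷ κ) σ = cong (eventAtom p (at₂ u) σ *_) (eventVal≡ind ps κ σ)
  eventVal≡ind (p@(x , y) ∷ ps) (both u v ∷ κ) σ = trans (cong (eventAtom p (both u v) σ *_) (eventVal≡ind ps κ σ)) (ℚP.*-assoc [ σ ⟨ x ⟩ ≟ u ] [ σ ⟨ y ⟩ ≟ v ] _)

  act-tr-inv : ∀ x y z → tr x y ⟨ tr x y ⟨ z ⟩ ⟩ ≡ z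
  act-tr-inv x y z with z FinP.≟ x | z FinP.≟ y
  ... | yes refl | _ = trans (cong (tr x y ⟨_⟩) (tr-l x y)) (tr-r x y)
  ... | no _ | yes refl = trans (cong (tr x y ⟨_⟩) (tr-r x y)) (tr-l x y)
  ... | no a | no b = trans (cong (tr x y ⟨_⟩) (tr-o x y a b)) (tr-o x y a b)

  ≟-tr : ∀ x y a b → [ tr x y ⟨ a ⟩ ≟ tr x y ⟨ b ⟩ ] ≡ [ a ≟ b ]
  ≟-tr x y a b with 0∨1 a b
  ... | inj₁ (refl , h) = trans (≟-refl (tr x y ⟨ a ⟩)) (sym h)
  ... | inj₂ (a≢b , h) = trans (≟-≢ (a≢b ∘ act-inj (tr x y))) (sym h)

  ind-left-tr : ∀ {i} u v (I J : Vec (Fin n) i) σ → u ∉ᵛ J → v ∉ᵛ J → ind I J (tr u v · σ) ≡ ind I J σ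
  ind-left-tr u v [] [] σ _ _ = refl
  ind-left-tr u v (x ∷ I) (w ∷ J) σ (u≢w , hu) (v≢w , hv) = cong₂ _*_
    (trans (cong₂ [_≟_] (act-· (tr u v) σ x) (sym (tr-o u v (u≢w ∘ sym) (v≢w ∘ sym)))) (≟-tr u v (σ ⟨ x ⟩) w)) (ind-left-tr u v I J σ hu hv)

  -- P(σ I = J) decreases by a factor n - t with each new point, because all new values are equally likely.
  ind-peel : ∀ {i} x u (I J : Vec (Fin n) i) → x ∉ᵛ I → (nat n - nat i) * E (ind (x ∷ I) (u ∷ J)) ≤ E (ind I J)
  ind-peel {i} x u I J x∉I with u∈?J J
    where
    u∈?J : ∀ {i} (J : Vec (Fin n) i) → (u ∉ᵛ J) ⊎ (∀ {I : Vec (Fin n) i} → x ∉ᵛ I → ∀ σ → [ σ ⟨ x ⟩ ≟ u ] * ind I J σ ≡ 0ℚ)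
    u∈?J [] = inj₁ tt
    u∈?J (w ∷ J) with u FinP.≟ w
    ... | yes refl = inj₂ λ { {y ∷ I} (x≢y , _) σ → clash y I x≢y σ }
      where
      clash : ∀ y I → x ≢ y → ∀ σ → [ σ ⟨ x ⟩ ≟ u ] * ([ σ ⟨ y ⟩ ≟ u ] * ind I J σ) ≡ 0ℚ
      clash y I x≢y σ with 0∨1 (σ ⟨ x ⟩) u | 0∨1 (σ ⟨ y ⟩) u
      ... | inj₂ (_ , h) | _ = trans (cong (_* ([ σ ⟨ y ⟩ ≟ u ] * ind I J σ)) h) (ℚP.*-zeroˡ ([ σ ⟨ y ⟩ ≟ u ] * ind I J σ))
      ... | inj₁ (a , _) | inj₁ (b , _) = ⊥-elim (x≢y (act-inj σ (trans a (sym b))))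
      ... | inj₁ _ | inj₂ (_ , h) = trans (cong (λ z → [ σ ⟨ x ⟩ ≟ u ] * (z * ind I J σ)) h) (eq [ σ ⟨ x ⟩ ≟ u ] (ind I J σ))
        where eq : ∀ a b → a * (0ℚ * b) ≡ 0ℚ
              eq = solve-∀ ring
    ... | no u≢w with u∈?J J
    ...   | inj₁ h = inj₁ (u≢w , h)
    ...   | inj₂ h = inj₂ λ { {y ∷ I} (_ , x∉I) σ → trans (x*yz≡y*xz [ σ ⟨ x ⟩ ≟ u ] [ σ ⟨ y ⟩ ≟ w ] (ind I J σ)) (trans (cong ([ σ ⟨ y ⟩ ≟ w ] *_) (h x∉I σ)) (ℚP.*-zeroʳ [ σ ⟨ y ⟩ ≟ w ])) }
  ... | inj₂ h = subst (_≤ E (ind I J)) (sym (trans (cong ((nat n - nat i) *_) (E-zero (h x∉I))) (ℚP.*-zeroʳ (nat n - nat i)))) (0≤E (0≤ind I J))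
  ... | inj₁ u∉J = begin
      (nat n - nat i) * P ≡⟨ cong (_* P) (sym (∑-hits J)) ⟩
      ∑ᶠ n (λ v → 1ℚ - hits J v) * P ≡⟨ ∑-*ʳ (allFin n) (λ v → 1ℚ - hits J v) P ⟨
      ∑ᶠ n (λ v → (1ℚ - hits J v) * P) ≤⟨ ∑-mono (allFin n) each ⟩
      ∑ᶠ n (λ v → E (ind (x ∷ I) (v ∷ J))) ≡⟨ E-∑ (allFin n) (λ v → ind (x ∷ I) (v ∷ J)) ⟨
      E (λ σ → ∑ᶠ n (λ v → [ σ ⟨ x ⟩ ≟ v ] * ind I J σ)) ≡⟨ E-cong (λ σ → ∑-select (σ ⟨ x ⟩) (λ _ → ind I J σ)) ⟩
      E (ind I J) ∎
    where
    open ≤R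
    P = E (ind (x ∷ I) (u ∷ J))
    0≤P : 0ℚ ≤ P
    0≤P = 0≤E (0≤ind (x ∷ I) (u ∷ J))
    hits : ∀ {i} → Vec (Fin n) i → Fin n → ℚ
    hits [] v = 0ℚ
    hits (w ∷ J) v = [ w ≟ v ] + hits J v
    0≤hits : ∀ {i} (J : Vec (Fin n) i) v → 0ℚ ≤ hits J v
    0≤hits [] v = ℚP.≤-refl
    0≤hits (w ∷ J) v = 0≤+ (0≤≟ w v) (0≤hits J v)
    ∑-hits′ : ∀ {i} (J : Vec (Fin n) i) → ∑ᶠ n (hits J) ≡ nat i
    ∑-hits′ [] = trans (∑-0 (allFin n)) (sym nat-0)
    ∑-hits′ {suc i} (w ∷ J) = trans (∑-+ (allFin n) (λ v → [ w ≟ v ]) (hits J)) (trans (cong₂ _+_ (∑-≟ w) (∑-hits′ J)) (sym (nat-suc i)))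
    ∑-hits : ∀ {i} (J : Vec (Fin n) i) → ∑ᶠ n (λ v → 1ℚ - hits J v) ≡ nat n - nat i
    ∑-hits J = trans (∑-- (allFin n) (λ _ → 1ℚ) (hits J)) (cong₂ _-_ (trans (∑ᶠ-const n 1ℚ) (ℚP.*-identityʳ (nat n))) (∑-hits′ J))
    v∈?J : ∀ {i} (J : Vec (Fin n) i) v → (v ∉ᵛ J × hits J v ≡ 0ℚ) ⊎ 1ℚ ≤ hits J v
    v∈?J [] v = inj₁ (tt , refl)
    v∈?J (w ∷ J) v with 0∨1 w v | v∈?J J v
    ... | inj₁ (_ , h) | _ = inj₂ (subst (λ z → 1ℚ ≤ z + hits J v) (sym h) (ℚP.+-monoʳ-≤ 1ℚ {0ℚ} {hits J v} (0≤hits J v)))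
    ... | inj₂ (w≢v , h) | inj₁ (v∉ , h′) = inj₁ ((w≢v ∘ sym , v∉) , cong₂ _+_ h h′)
    ... | inj₂ (w≢v , h) | inj₂ h′ = inj₂ (subst (1ℚ ≤_) (sym (trans (cong (_+ hits J v) h) (ℚP.+-identityˡ (hits J v)))) h′)
    each : ∀ v → (1ℚ - hits J v) * P ≤ E (ind (x ∷ I) (v ∷ J))
    each v with v∈?J J v
    ... | inj₂ h = ℚP.≤-trans (subst ((1ℚ - hits J v) * P ≤_) (ℚP.*-zeroˡ P) (*-monoʳ 0≤P (0≤-⇒≤ {1ℚ - hits J v} {0ℚ} (subst (0ℚ ≤_) (eq (hits J v)) (≤⇒0≤- h))))) (0≤E (0≤ind (x ∷ I) (v ∷ J)))
      where eq : ∀ a → a - 1ℚ ≡ 0ℚ - (1ℚ - a)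
            eq = solve-∀ ring
    ... | inj₁ (v∉J , h) = ℚP.≤-reflexive (trans (cong (λ z → (1ℚ - z) * P) h) (trans (ℚP.*-identityˡ P)
          (trans (sym (E-L (tr u v) (ind (x ∷ I) (u ∷ J)))) (E-cong (λ σ → cong₂ _*_
            (trans (cong₂ [_≟_] (act-· (tr u v) σ x) (sym (tr-r u v))) (≟-tr u v (σ ⟨ x ⟩) v)) (ind-left-tr u v I J σ u∉J v∉J))))))

  ind-prob : ∀ {r T} → 0ℚ ≤ r → 1ℚ ≤ r * (nat n - nat T) → ∀ {i} (I J : Vec (Fin n) i) → AllDistinct I → i ℕ.≤ T → E (ind I J) ≤ r ^ℚ i
  ind-prob 0≤r h [] [] _ _ = ℚP.≤-reflexive (E-const 1ℚ)
  ind-prob {r} {T} 0≤r h {suc i} (x ∷ I) (u ∷ J) (x∉I , dI) i<T = begin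
      P ≡⟨ ℚP.*-identityˡ P ⟨
      1ℚ * P ≤⟨ *-monoʳ 0≤P h ⟩
      r * (nat n - nat T) * P ≤⟨ *-monoʳ 0≤P (*-monoˡ 0≤r (ℚP.+-monoʳ-≤ (nat n) (ℚP.neg-antimono-≤ (nat-mono i≤T)))) ⟩
      r * (nat n - nat i) * P ≡⟨ ℚP.*-assoc r (nat n - nat i) P ⟩
      r * ((nat n - nat i) * P) ≤⟨ *-monoˡ 0≤r (ℚP.≤-trans (ind-peel x u I J x∉I) (ind-prob 0≤r h I J dI i≤T)) ⟩
      r * r ^ℚ i ∎
    where open ≤R
          i≤T = ℕP.≤-trans (ℕP.n≤1+n i) i<T
          P = E (ind (x ∷ I) (u ∷ J))
          0≤P : 0ℚ ≤ P
          0≤P = 0≤E (0≤ind (x ∷ I) (u ∷ J))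

  atom-fresh : ∀ {a b} p l σ → a ≢ proj₁ p → a ≢ proj₂ p → b ≢ proj₁ p → b ≢ proj₂ p → atom p l (σ · tr a b) ≡ atom p l σ
  atom-fresh {a} {b} (x , y) l σ ax ay bx by = go l
    where
    ex : (σ · tr a b) ⟨ x ⟩ ≡ σ ⟨ x ⟩
    ex = trans (act-· σ (tr a b) x) (cong (σ ⟨_⟩) (tr-o a b (ax ∘ sym) (bx ∘ sym)))
    ey : (σ · tr a b) ⟨ y ⟩ ≡ σ ⟨ y ⟩
    ey = trans (act-· σ (tr a b) y) (cong (σ ⟨_⟩) (tr-o a b (ay ∘ sym) (by ∘ sym)))
    go : ∀ l → atom (x , y) l (σ · tr a b) ≡ atom (x , y) l σ
    go (ev none) = refl
    go (ev (at₁ u)) = cong [_≟ u ] ex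
    go (ev (at₂ u)) = cong [_≟ u ] ey
    go (ev (both u v)) = cong₂ (λ p q → [ p ≟ u ] * [ q ≟ v ]) ex ey
    go (δ u) = cong₂ (λ p q → [ p ≟ u ] - [ q ≟ u ]) ex ey

  val-fresh : ∀ {k a b} (ps : Vec (Pair n) k) θ σ → Fresh a ps → Fresh b ps → val ps θ (σ · tr a b) ≡ val ps θ σ
  val-fresh [] [] σ _ _ = refl
  val-fresh (p ∷ ps) (l ∷ θ) σ (ax , ay , ha) (bx , by , hb) = cong₂ _*_ (atom-fresh p l σ ax ay bx by) (val-fresh ps θ σ ha hb)

  -- Transposing the first pair that carries a δ negates its difference and moves no other factor.
  -- The clause on fresh points lets the recursion see that the pairs in front of it are not moved
  -- either.
  val-flip : ∀ {k} (ps : Vec (Pair n) k) θ → Disjoint ps → deltas θ ≢ 0 →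
    ∃[ a ] ∃[ b ] (∀ z → Fresh z ps → a ≢ z × b ≢ z) × (∀ σ → val ps θ (σ · tr a b) ≡ - val ps θ σ)
  val-flip [] [] _ h = ⊥-elim (h refl)
  val-flip ((x , y) ∷ ps) (δ u ∷ θ) (_ , fx , fy , _) _ = x , y , (λ z (zx , zy , _) → zx ∘ sym , zy ∘ sym) , λ σ →
      trans (cong₂ _*_ (cong₂ (λ p q → [ p ≟ u ] - [ q ≟ u ]) (trans (act-· σ (tr x y) x) (cong (σ ⟨_⟩) (tr-l x y))) (trans (act-· σ (tr x y) y) (cong (σ ⟨_⟩) (tr-r x y))))
        (val-fresh ps θ σ fx fy)) (eq [ σ ⟨ x ⟩ ≟ u ] [ σ ⟨ y ⟩ ≟ u ] (val ps θ σ))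
    where eq : ∀ a b c → (b - a) * c ≡ - ((a - b) * c)
          eq = solve-∀ ring
  val-flip (p@(x , y) ∷ ps) (ev e ∷ θ) (_ , fx , fy , d) h with val-flip ps θ d h
  ... | a , b , out , flip = a , b , (λ z (_ , _ , fz) → out z fz) , λ σ →
      trans (cong₂ _*_ (atom-fresh p (ev e) σ (proj₁ (out x fx)) (proj₁ (out y fy)) (proj₂ (out x fx)) (proj₂ (out y fy))) (flip σ)) (eq (atom p (ev e) σ) (val ps θ σ))
    where eq : ∀ a b → a * - b ≡ - (a * b)
          eq = solve-∀ ring

  antisymmetric⇒E≡0 : ∀ {f : F} t → (∀ σ → f (σ · t) ≡ - f σ) → E f ≡ 0ℚ
  antisymmetric⇒E≡0 {f} t h = cancel2 (E f) (trans (sym (E-R t f)) (trans (E-cong h) (E-neg f)))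
    where
    cancel2 : ∀ x → x ≡ - x → x ≡ 0ℚ
    cancel2 x e = ℚP.≤-antisym (cancelˡ {2ℚ} (ℚP.positive⁻¹ 2ℚ) (ℚP.≤-reflexive z)) (cancelˡ {2ℚ} (ℚP.positive⁻¹ 2ℚ) (ℚP.≤-reflexive (sym z)))
      where eq : ∀ x → 2ℚ * x ≡ x + x
            eq = solve-∀ ring
            z : 2ℚ * x ≡ 2ℚ * 0ℚ
            z = trans (eq x) (trans (cong (x +_) e) (ℚP.+-inverseʳ x))

-- The level inequality

10ℚ : ℚ
10ℚ = 5ℚ * 2ℚ

-- The sizes of the constants produced by m squaring steps.
scaled : ℕ → ℚ → ℕ → ℚ → ℚ
scaled zero Λ τ K = K
scaled (suc m) Λ τ K = Λ ^ℚ τ * scaled m Λ (2 ℕ.* τ) K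

squared : ℕ → ℚ → ℚ
squared zero S = S
squared (suc m) S = squared m (S * S)

level-range point-range : ℕ → ℕ → ℕ → ℕ
level-range zero τ T = τ
level-range (suc m) τ T = level-range m (2 ℕ.* τ) (T ℕ.+ 2 ℕ.* τ)
point-range zero τ T = T
point-range (suc m) τ T = point-range m (2 ℕ.* τ) (T ℕ.+ 2 ℕ.* τ)

module LevelInequality {n : ℕ} (𝓖 : PermGroup n) where
  open PermGroup 𝓖
  open Functions 𝓖
  open Values 𝓖
  open Indicators 𝓖

  module _ {k : ℕ} (ps : Vec (Pair n) k) (disj : Disjoint ps) where

    select : ℕ → (Vec (Label n) k → ℚ) → Vec (Label n) k → ℚ
    select i c θ = ⟦ deltas θ ≟ i ⟧ * c θ

    -- Duality: the energy is the pairing of `h` with its own level-`i` combination `p`.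
    -- Cauchy-Schwarz with weight `w` leaves a quadratic form in `p` that is again proportional to
    -- the energy, and one factor of the energy cancels.
    energy-from-quadratic : (h w u : F) (κ : Vec (Event n) k) (i : ℕ) (β : ℚ) → (∀ σ → 0ℚ ≤ w σ) → 0ℚ ≤ β →
      (∀ σ → h σ * eventVal ps κ σ ≡ w σ * u σ) →
      (let p = λ σ → ∑ (fillings κ) (λ θ → select i (Quadratic.coef ps h) θ * val ps θ σ) in
        E (λ σ → w σ * (p σ * p σ)) ≤ 5ℚ ^ℚ i * ∑ (fillings κ) (λ θ → select i (Quadratic.coef ps h) θ * select i (Quadratic.coef ps h) θ) * β) →
      Quadratic.energy ps h i κ ≤ E (λ σ → w σ * (u σ * u σ)) * (5ℚ ^ℚ i * β)
    energy-from-quadratic h w u κ i β 0≤w 0≤β hw quad with ≡∨pos (0≤∑ (fillings κ) (λ θ → 0≤* (0≤⟦⟧ (deltas θ) i) (0≤sq (Quadratic.coef ps h θ))))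
    ... | inj₁ z = subst (_≤ E (λ σ → w σ * (u σ * u σ)) * (5ℚ ^ℚ i * β)) (sym z) (0≤* (0≤E (λ σ → 0≤* (0≤w σ) (0≤sq (u σ)))) (0≤* (0≤^ i 0≤5) 0≤β))
    ... | inj₂ pos = cancelˡ pos (begin
        S * S ≡⟨ cong₂ _*_ S≡ S≡ ⟩
        E (λ σ → w σ * (u σ * p σ)) * E (λ σ → w σ * (u σ * p σ)) ≤⟨ E-CS w u p 0≤w ⟩
        M * E (λ σ → w σ * (p σ * p σ)) ≤⟨ *-monoˡ (0≤E (λ σ → 0≤* (0≤w σ) (0≤sq (u σ)))) quad ⟩
        M * (5ℚ ^ℚ i * ∑ (fillings κ) (λ θ → d θ * d θ) * β) ≡⟨ cong (λ z → M * (5ℚ ^ℚ i * z * β)) (∑-cong (fillings κ) d²) ⟩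
        M * (5ℚ ^ℚ i * S * β) ≡⟨ eq M (5ℚ ^ℚ i) S β ⟩
        S * (M * (5ℚ ^ℚ i * β)) ∎)
      where
      open ≤R
      c = Quadratic.coef ps h
      d : Vec (Label n) k → ℚ
      d = select i c
      p : F
      p σ = ∑ (fillings κ) (λ θ → d θ * val ps θ σ)
      S = Quadratic.energy ps h i κ
      M = E (λ σ → w σ * (u σ * u σ))
      d² : ∀ θ → d θ * d θ ≡ ⟦ deltas θ ≟ i ⟧ * (c θ * c θ)
      d² θ = trans (xy*xy≡xx*yy ⟦ deltas θ ≟ i ⟧ (c θ)) (cong (_* (c θ * c θ)) (⟦⟧-idem (deltas θ) i))
      absorbed : ∀ σ → w σ * (u σ * p σ) ≡ ∑ (fillings κ) (λ θ → d θ * (h σ * val ps θ σ))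
      absorbed σ = trans (trans (sym (ℚP.*-assoc (w σ) (u σ) (p σ))) (cong (_* p σ) (sym (hw σ)))) (trans (sym (∑-*ˡ (fillings κ) (h σ * eventVal ps κ σ) _))
          (∑-cong∈ (fillings κ) (λ {θ} θ∈ → trans (eq′ (h σ) (eventVal ps κ σ) (d θ) (val ps θ σ)) (cong (λ z → d θ * (h σ * z)) (All.lookup (eventVal-absorb ps κ σ) θ∈)))))
        where eq′ : ∀ a b c e → a * b * (c * e) ≡ c * (a * (b * e))
              eq′ = solve-∀ ring
      S≡ : S ≡ E (λ σ → w σ * (u σ * p σ))
      S≡ = sym (trans (E-cong absorbed) (trans (E-∑ (fillings κ) (λ θ σ → d θ * (h σ * val ps θ σ)))
        (∑-cong (fillings κ) (λ θ → trans (E-*ˡ (d θ) _) (ℚP.*-assoc ⟦ deltas θ ≟ i ⟧ (c θ) (c θ))))))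
      eq : ∀ m f s b → m * (f * s * b) ≡ s * (m * (f * b))
      eq = solve-∀ ring

    select-support : ∀ i c θ → deltas θ ≢ i → select i c θ ≡ 0ℚ
    select-support i c θ h = trans (cong (_* c θ) (⟦⟧-≢ h)) (ℚP.*-zeroˡ (c θ))

    module _ {r : ℚ} {T : ℕ} (0≤r : 0ℚ ≤ r) (1≤r* : 1ℚ ≤ r * (nat n - nat T)) where

      private
        1F : F
        1F _ = 1ℚ
        module Q₁ = Quadratic ps 1F

        mass₁ : ∀ κ → points κ ℕ.≤ T → Q₁.mass κ ≤ r ^ℚ points κ
        mass₁ κ h = subst (_≤ r ^ℚ points κ) (E-cong (λ σ → trans (sym (eventVal≡ind ps κ σ)) (sym (ℚP.*-identityˡ (eventVal ps κ σ)))))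
          (ind-prob {T = T} 0≤r 1≤r* (positions ps κ) (targets κ) (distinct-positions ps κ disj) h)

        -- For the constant function every coefficient with a δ vanishes by antisymmetry, so only
        -- level 0 has energy.
        μ₁ : ℕ → ℚ
        μ₁ zero = 1ℚ
        μ₁ (suc _) = 0ℚ

        plain : ∀ {k} (κ : Vec (Event n) k) (φ : Vec (Label n) k → ℚ) → ∑ (fillings κ) (λ θ → ⟦ deltas θ ≟ 0 ⟧ * φ θ) ≡ φ (Vec.map ev κ)
        plain [] φ = trans (ℚP.+-identityʳ (⟦ 0 ≟ 0 ⟧ * φ [])) (trans (cong (_* φ []) (⟦⟧-≡ {0} refl)) (ℚP.*-identityˡ (φ [])))
        plain (none ∷ κ) φ = trans (∑-cart (fill₁ none) (fillings κ) _) (trans (∑-fill-none (λ a → ∑ (fillings κ) (λ θ → ⟦ deltas (a ∷ θ) ≟ 0 ⟧ * φ (a ∷ θ))))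
          (trans (cong₂ _+_ (plain κ (λ θ → φ (ev none ∷ θ))) (∑-zero (allFin n) (λ u → ∑-zero (fillings κ) (λ θ →
             trans (cong (_* φ (δ u ∷ θ)) (⟦⟧-≢ {suc (deltas θ)} {0} (λ ()))) (ℚP.*-zeroˡ (φ (δ u ∷ θ))))))) (ℚP.+-identityʳ _)))
        plain (at₁ u ∷ κ) φ = trans (∑-cart (fill₁ (at₁ u)) (fillings κ) _) (trans (ℚP.+-identityʳ _) (plain κ (λ θ → φ (ev (at₁ u) ∷ θ))))
        plain (at₂ u ∷ κ) φ = trans (∑-cart (fill₁ (at₂ u)) (fillings κ) _) (trans (ℚP.+-identityʳ _) (plain κ (λ θ → φ (ev (at₂ u) ∷ θ))))
        plain (both u v ∷ κ) φ = trans (∑-cart (fill₁ (both u v)) (fillings κ) _) (trans (ℚP.+-identityʳ _) (plain κ (λ θ → φ (ev (both u v) ∷ θ))))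

        val-events : ∀ {k} (ps : Vec (Pair n) k) κ σ → val ps (Vec.map ev κ) σ ≡ eventVal ps κ σ
        val-events [] [] σ = refl
        val-events (p ∷ ps) (e ∷ κ) σ = cong (eventAtom p e σ *_) (val-events ps κ σ)

        coef₁-zero : ∀ θ → deltas θ ≢ 0 → Q₁.coef θ ≡ 0ℚ
        coef₁-zero θ h with val-flip ps θ disj h
        ... | a , b , _ , flip = antisymmetric⇒E≡0 (tr a b) (λ σ → trans (cong (1ℚ *_) (flip σ)) (eq (val ps θ σ)))
          where eq : ∀ x → 1ℚ * - x ≡ - (1ℚ * x)
                eq = solve-∀ ring

        0≤mass₁ : ∀ κ → 0ℚ ≤ Q₁.mass κ
        0≤mass₁ κ = 0≤E (λ σ → 0≤* 0≤1 (0≤eventVal ps κ σ))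

        energy₁ : ∀ κ t → points κ ℕ.≤ T → Q₁.energy t κ ≤ μ₁ t * μ₁ t * (Q₁.mass κ * (r ^ℚ points κ * 1ℚ))
        energy₁ κ zero h = begin
            Q₁.energy 0 κ ≡⟨ plain κ (λ θ → Q₁.coef θ * Q₁.coef θ) ⟩
            Q₁.coef (Vec.map ev κ) * Q₁.coef (Vec.map ev κ) ≡⟨ cong₂ _*_ c≡ c≡ ⟩
            Q₁.mass κ * Q₁.mass κ ≤⟨ *-monoˡ (0≤mass₁ κ) (mass₁ κ h) ⟩
            Q₁.mass κ * r ^ℚ points κ ≡⟨ eq (Q₁.mass κ) (r ^ℚ points κ) ⟩
            1ℚ * 1ℚ * (Q₁.mass κ * (r ^ℚ points κ * 1ℚ)) ∎
          where open ≤R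
                c≡ : Q₁.coef (Vec.map ev κ) ≡ Q₁.mass κ
                c≡ = E-cong (λ σ → cong (1ℚ *_) (val-events ps κ σ))
                eq : ∀ a b → a * b ≡ 1ℚ * 1ℚ * (a * (b * 1ℚ))
                eq = solve-∀ ring
        energy₁ κ (suc t) h = ℚP.≤-reflexive (trans (∑-zero (fillings κ) vanish) (sym (eq (Q₁.mass κ * (r ^ℚ points κ * 1ℚ)))))
          where
          eq : ∀ a → 0ℚ * 0ℚ * a ≡ 0ℚ
          eq = solve-∀ ring
          vanish : ∀ θ → ⟦ deltas θ ≟ suc t ⟧ * (Q₁.coef θ * Q₁.coef θ) ≡ 0ℚ
          vanish θ with ⟦⟧-cases (deltas θ) (suc t)
          ... | inj₂ (_ , z) = trans (cong (_* (Q₁.coef θ * Q₁.coef θ)) z) (ℚP.*-zeroˡ (Q₁.coef θ * Q₁.coef θ))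
          ... | inj₁ (e , _) = trans (cong (λ z → ⟦ deltas θ ≟ suc t ⟧ * (z * z)) (coef₁-zero θ (λ e′ → ℕP.1+n≢0 (trans (sym e) e′)))) (eq′ ⟦ deltas θ ≟ suc t ⟧)
            where eq′ : ∀ a → a * (0ℚ * 0ℚ) ≡ 0ℚ
                  eq′ = solve-∀ ring

        0≤μ₁ : ∀ t → 0ℚ ≤ μ₁ t
        0≤μ₁ zero = 0≤1
        0≤μ₁ (suc t) = ℚP.≤-refl

      -- The trivial bound: Bessel's inequality for the nearly orthogonal functions val ps θ.
      energy-trivial : (f : F) → (∀ σ → f σ * f σ ≡ f σ) → ∀ κ t → points κ ℕ.+ 2 ℕ.* t ℕ.≤ T →
        Quadratic.energy ps f t κ ≤ Quadratic.mass ps f κ * (5ℚ ^ℚ t * (2ℚ ^ℚ t * (r ^ℚ points κ * 1ℚ) * r ^ℚ t))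
      energy-trivial f f² κ t h = subst (λ z → Quadratic.energy ps f t κ ≤ z * (5ℚ ^ℚ t * (2ℚ ^ℚ t * (r ^ℚ points κ * 1ℚ) * r ^ℚ t)))
          (E-cong (λ σ → trans (eq (f σ) (eventVal ps κ σ)) (cong₂ _*_ (f² σ) (eventVal-idem ps κ σ))))
          (energy-from-quadratic f 1F (λ σ → f σ * eventVal ps κ σ) κ t (2ℚ ^ℚ t * (r ^ℚ points κ * 1ℚ) * r ^ℚ t) (λ _ → 0≤1)
            (0≤* (0≤* (0≤^ t 0≤2) (0≤* (0≤^ (points κ) 0≤r) 0≤1)) (0≤^ t 0≤r)) (λ σ → sym (ℚP.*-identityˡ (f σ * eventVal ps κ σ)))
            (Q₁.quadratic r 1ℚ (r ^ℚ t) 0≤r 0≤1 (0≤^ t 0≤r) μ₁ T t (λ κ s hκ _ → energy₁ κ s hκ)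
              (λ κ hκ → subst (Q₁.mass κ ≤_) (sym (ℚP.*-identityʳ (r ^ℚ points κ))) (mass₁ κ hκ)) 0≤μ₁ κ h μR
              (select t (Quadratic.coef ps f)) (select-support t (Quadratic.coef ps f))))
        where
        eq : ∀ a b → 1ℚ * (a * b * (a * b)) ≡ a * a * (b * b)
        eq = solve-∀ ring
        μR : ∀ s s′ → s ℕ.+ 2 ℕ.* s′ ≡ 2 ℕ.* t → μ₁ s * r ^ℚ s′ ≤ r ^ℚ t
        μR zero s′ e = ℚP.≤-reflexive (trans (ℚP.*-identityˡ (r ^ℚ s′)) (cong (r ^ℚ_) (ℕP.*-cancelˡ-≡ s′ t 2 e)))
        μR (suc s) s′ e = subst (_≤ r ^ℚ t) (sym (ℚP.*-zeroˡ (r ^ℚ s′))) (0≤^ t 0≤r)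

      module _ (f : F) (f² : ∀ σ → f σ * f σ ≡ f σ) (K₁ ζ A : ℚ) (1≤K₁ : 1ℚ ≤ K₁) (0≤ζ : 0ℚ ≤ ζ) (0≤A : 0ℚ ≤ A)
        (spread : ∀ {i} (I J : Vec (Fin n) i) → AllDistinct I → i ℕ.≤ T → E (λ σ → f σ * ind I J σ) ≤ (K₁ * (ζ * ζ)) ^ℚ i * A)
        where

        private
          module Q = Quadratic ps f
          R = K₁ * (ζ * ζ)
          0≤K₁ = ℚP.≤-trans 0≤1 1≤K₁
          0≤R : 0ℚ ≤ R
          0≤R = 0≤* 0≤K₁ (0≤* 0≤ζ 0≤ζ)
          Λ = 10ℚ * K₁
          1≤10 : 1ℚ ≤ 10ℚ
          1≤10 = ℚP.+-monoʳ-≤ 1ℚ {0ℚ} {10ℚ - 1ℚ} (ℚP.nonNegative⁻¹ (10ℚ - 1ℚ))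
          1≤Λ : 1ℚ ≤ Λ
          1≤Λ = *-mono 0≤1 0≤1 1≤10 1≤K₁
          0≤f : ∀ σ → 0ℚ ≤ f σ
          0≤f σ = subst (0ℚ ≤_) (f² σ) (0≤sq (f σ))

          mass≤ : ∀ κ → points κ ℕ.≤ T → Q.mass κ ≤ R ^ℚ points κ * A
          mass≤ κ h = subst (_≤ R ^ℚ points κ * A) (E-cong (λ σ → cong (f σ *_) (sym (eventVal≡ind ps κ σ))))
            (spread (positions ps κ) (targets κ) (distinct-positions ps κ disj) h)

        -- `K` collects constants and `S` the dependence on the density. They are kept apart because
        -- a Cauchy-Schwarz step replaces `S * S` by `S` but multiplies `K` by a constant.
        Level-bound : ℕ → ℕ → ℚ → ℚ → Set
        Level-bound τ T′ K S = ∀ κ t → points κ ℕ.≤ T′ → t ℕ.≤ τ →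
          Q.energy t κ ≤ K * S * ζ ^ℚ t * (K * S * ζ ^ℚ t) * (Q.mass κ * (R ^ℚ points κ * A))

        -- One Cauchy-Schwarz step; ε is 1 or the sign character.
        energy-step : (ε : F) → (∀ σ → ε σ * ε σ ≡ 1ℚ) → ∀ {τ T′ K S} → T′ ℕ.+ 2 ℕ.* τ ℕ.≤ T → 0ℚ ≤ K → 0ℚ ≤ S →
          Level-bound (2 ℕ.* τ) (T′ ℕ.+ 2 ℕ.* τ) K S → ∀ κ i → points κ ℕ.≤ T′ → i ℕ.≤ τ →
          Quadratic.energy ps (λ σ → f σ * ε σ) i κ ≤ Q.mass κ * (5ℚ ^ℚ i * (2ℚ ^ℚ i * (R ^ℚ points κ * A) * (K₁ ^ℚ i * (K * S) * ζ ^ℚ (2 ℕ.* i))))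
        energy-step ε ε² {τ} {T′} {K} {S} T′≤T 0≤K 0≤S hyp κ i hκ hi = subst (λ z → Quadratic.energy ps (λ σ → f σ * ε σ) i κ ≤ z * (5ℚ ^ℚ i * (2ℚ ^ℚ i * (R ^ℚ points κ * A) * B)))
            (E-cong (λ σ → cong (f σ *_) (trans (eq (eventVal ps κ σ) (ε σ)) (trans (cong₂ _*_ (eventVal-idem ps κ σ) (ε² σ)) (ℚP.*-identityʳ (eventVal ps κ σ))))))
            (energy-from-quadratic (λ σ → f σ * ε σ) f (λ σ → eventVal ps κ σ * ε σ) κ i _ 0≤f (0≤* (0≤* (0≤^ i 0≤2) (0≤* (0≤^ (points κ) 0≤R) 0≤A)) 0≤B)
              (λ σ → eq′ (f σ) (ε σ) (eventVal ps κ σ))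
              (Q.quadratic R A B 0≤R 0≤A 0≤B μ (T′ ℕ.+ 2 ℕ.* τ) i
                (λ κ′ t hκ′ ht → hyp κ′ t hκ′ (ℕP.≤-trans ht (ℕP.*-monoʳ-≤ 2 hi)))
                (λ κ′ hκ′ → mass≤ κ′ (ℕP.≤-trans hκ′ T′≤T)) 0≤μ κ (ℕP.+-mono-≤ hκ (ℕP.*-monoʳ-≤ 2 hi)) μR
                (select i (Quadratic.coef ps (λ σ → f σ * ε σ))) (select-support i (Quadratic.coef ps (λ σ → f σ * ε σ)))))
          where
          B = K₁ ^ℚ i * (K * S) * ζ ^ℚ (2 ℕ.* i)
          0≤B : 0ℚ ≤ B
          0≤B = 0≤* (0≤* (0≤^ i 0≤K₁) (0≤* 0≤K 0≤S)) (0≤^ (2 ℕ.* i) 0≤ζ)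
          μ : ℕ → ℚ
          μ t = K * S * ζ ^ℚ t
          0≤μ : ∀ t → 0ℚ ≤ μ t
          0≤μ t = 0≤* (0≤* 0≤K 0≤S) (0≤^ t 0≤ζ)
          eq : ∀ a b → a * b * (a * b) ≡ a * a * (b * b)
          eq = solve-∀ ring
          eq′ : ∀ a b c → a * b * c ≡ a * (c * b)
          eq′ = solve-∀ ring
          μR : ∀ t s → t ℕ.+ 2 ℕ.* s ≡ 2 ℕ.* i → μ t * R ^ℚ s ≤ B
          μR t s e = begin
              K * S * ζ ^ℚ t * R ^ℚ s ≡⟨ cong (K * S * ζ ^ℚ t *_) (trans (^-* K₁ (ζ * ζ) s) (cong (K₁ ^ℚ s *_) (trans (^-* ζ ζ s) (trans (sym (^-+ ζ s s)) (cong (λ z → ζ ^ℚ (s ℕ.+ z)) (sym (ℕP.+-identityʳ s))))))) ⟩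
              K * S * ζ ^ℚ t * (K₁ ^ℚ s * ζ ^ℚ (2 ℕ.* s)) ≡⟨ eq″ (K * S) (ζ ^ℚ t) (K₁ ^ℚ s) (ζ ^ℚ (2 ℕ.* s)) ⟩
              K₁ ^ℚ s * (K * S) * (ζ ^ℚ t * ζ ^ℚ (2 ℕ.* s)) ≡⟨ cong (K₁ ^ℚ s * (K * S) *_) (trans (sym (^-+ ζ t (2 ℕ.* s))) (cong (ζ ^ℚ_) e)) ⟩
              K₁ ^ℚ s * (K * S) * ζ ^ℚ (2 ℕ.* i) ≤⟨ *-monoʳ (0≤^ (2 ℕ.* i) 0≤ζ) (*-monoʳ (0≤* 0≤K 0≤S) (^-monoᵉ {m = s} {k = i} 1≤K₁ (ℕP.*-cancelˡ-≤ {s} {i} 2 (ℕP.≤-trans (ℕP.m≤n+m (2 ℕ.* s) t) (ℕP.≤-reflexive e))))) ⟩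
              B ∎
            where open ≤R
                  eq″ : ∀ a b c e → a * b * (c * e) ≡ c * a * (b * e)
                  eq″ = solve-∀ ring

        0≤mass : ∀ κ → 0ℚ ≤ Q.mass κ
        0≤mass κ = 0≤E (λ σ → 0≤* (0≤f σ) (0≤eventVal ps κ σ))

        -- The quadratic form at level `i` involves levels up to `2 * i` and up to `2 * i` further
        -- points, hence the doubled ranges. Its bound is linear in the old factor `S * S`, while
        -- the new bound is quadratic in its own factor, which can therefore be `S`.
        halving : ∀ {τ T′ K S} → T′ ℕ.+ 2 ℕ.* τ ℕ.≤ T → 1ℚ ≤ K → 0ℚ ≤ S →
          Level-bound (2 ℕ.* τ) (T′ ℕ.+ 2 ℕ.* τ) K (S * S) → Level-bound τ T′ (Λ ^ℚ τ * K) S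
        halving {τ} {T′} {K} {S} hT 1≤K 0≤S hyp κ i hκ hi = begin
            Q.energy i κ ≡⟨ ∑-cong (fillings κ) (λ θ → cong (λ z → ⟦ deltas θ ≟ i ⟧ * (z * z)) (E-cong (λ σ → cong (_* val ps θ σ) (sym (ℚP.*-identityʳ (f σ)))))) ⟩
            Quadratic.energy ps (λ σ → f σ * 1ℚ) i κ ≤⟨ energy-step (λ _ → 1ℚ) (λ _ → refl) hT 0≤K (0≤sq S) hyp κ i hκ hi ⟩
            Q.mass κ * (5ℚ ^ℚ i * (2ℚ ^ℚ i * W * (K₁ ^ℚ i * (K * (S * S)) * ζ ^ℚ (2 ℕ.* i)))) ≡⟨ cong (λ z → Q.mass κ * (5ℚ ^ℚ i * (2ℚ ^ℚ i * W * (K₁ ^ℚ i * (K * (S * S)) * z)))) ζ² ⟩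
            Q.mass κ * (5ℚ ^ℚ i * (2ℚ ^ℚ i * W * (K₁ ^ℚ i * (K * (S * S)) * (ζ ^ℚ i * ζ ^ℚ i)))) ≡⟨ eq (Q.mass κ) (5ℚ ^ℚ i) (2ℚ ^ℚ i) W (K₁ ^ℚ i) K S (ζ ^ℚ i) ⟩
            5ℚ ^ℚ i * 2ℚ ^ℚ i * K₁ ^ℚ i * K * (S * ζ ^ℚ i * (S * ζ ^ℚ i) * (Q.mass κ * W)) ≤⟨ *-monoʳ (0≤* (0≤sq (S * ζ ^ℚ i)) (0≤* (0≤mass κ) 0≤W)) consts ⟩
            Λ ^ℚ τ * K * (Λ ^ℚ τ * K) * (S * ζ ^ℚ i * (S * ζ ^ℚ i) * (Q.mass κ * W)) ≡⟨ eq′ (Λ ^ℚ τ * K) S (ζ ^ℚ i) (Q.mass κ * W) ⟩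
            Λ ^ℚ τ * K * S * ζ ^ℚ i * (Λ ^ℚ τ * K * S * ζ ^ℚ i) * (Q.mass κ * W) ∎
          where
          open ≤R
          W = R ^ℚ points κ * A
          0≤W : 0ℚ ≤ W
          0≤W = 0≤* (0≤^ (points κ) 0≤R) 0≤A
          0≤K = ℚP.≤-trans 0≤1 1≤K
          0≤Λ = ℚP.≤-trans 0≤1 1≤Λ
          ζ² : ζ ^ℚ (2 ℕ.* i) ≡ ζ ^ℚ i * ζ ^ℚ i
          ζ² = trans (cong (λ z → ζ ^ℚ (i ℕ.+ z)) (ℕP.+-identityʳ i)) (^-+ ζ i i)
          eq : ∀ m f t w k l s z → m * (f * (t * w * (k * (l * (s * s)) * (z * z)))) ≡ f * t * k * l * (s * z * (s * z) * (m * w))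
          eq = solve-∀ ring
          eq′ : ∀ x s z m → x * x * (s * z * (s * z) * m) ≡ x * s * z * (x * s * z) * m
          eq′ = solve-∀ ring
          consts : 5ℚ ^ℚ i * 2ℚ ^ℚ i * K₁ ^ℚ i * K ≤ Λ ^ℚ τ * K * (Λ ^ℚ τ * K)
          consts = begin
              5ℚ ^ℚ i * 2ℚ ^ℚ i * K₁ ^ℚ i * K ≡⟨ cong (_* K) (sym (trans (^-* 10ℚ K₁ i) (cong (_* K₁ ^ℚ i) (^-* 5ℚ 2ℚ i)))) ⟩
              Λ ^ℚ i * K ≤⟨ *-monoʳ 0≤K (^-monoᵉ 1≤Λ hi) ⟩
              Λ ^ℚ τ * K ≡⟨ ℚP.*-identityʳ (Λ ^ℚ τ * K) ⟨
              Λ ^ℚ τ * K * 1ℚ ≤⟨ *-monoˡ (0≤* (0≤^ τ 0≤Λ) 0≤K) (*-mono 0≤1 0≤1 (1≤^ τ 1≤Λ) 1≤K) ⟩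
              Λ ^ℚ τ * K * (Λ ^ℚ τ * K) ∎

        1≤scaled : ∀ m τ {K} → 1ℚ ≤ K → 1ℚ ≤ scaled m Λ τ K
        1≤scaled zero τ h = h
        1≤scaled (suc m) τ h = *-mono 0≤1 0≤1 (1≤^ τ 1≤Λ) (1≤scaled m (2 ℕ.* τ) h)

        T≤point-range : ∀ m τ T′ → T′ ℕ.≤ point-range m τ T′
        T≤point-range zero τ T′ = ℕP.≤-refl
        T≤point-range (suc m) τ T′ = ℕP.≤-trans (ℕP.m≤m+n T′ (2 ℕ.* τ)) (T≤point-range m (2 ℕ.* τ) (T′ ℕ.+ 2 ℕ.* τ))

        repeated-halving : ∀ m {τ T′ K S} → point-range m τ T′ ℕ.≤ T → 1ℚ ≤ K → 0ℚ ≤ S →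
          Level-bound (level-range m τ T′) (point-range m τ T′) K (squared m S) → Level-bound τ T′ (scaled m Λ τ K) S
        repeated-halving zero hT 1≤K 0≤S hyp = hyp
        repeated-halving (suc m) {τ} {T′} {K} {S} hT 1≤K 0≤S hyp =
          halving (ℕP.≤-trans (T≤point-range m (2 ℕ.* τ) (T′ ℕ.+ 2 ℕ.* τ)) hT) (1≤scaled m (2 ℕ.* τ) 1≤K) 0≤S (repeated-halving m {2 ℕ.* τ} hT 1≤K (0≤sq S) hyp)

        -- ζ⁻¹ is a positive power of n, so K S need only exceed a constant times A^(-1/2).
        base : ∀ {τ T′ K S} → T′ ℕ.+ 2 ℕ.* τ ℕ.≤ T → r ≤ R → Λ ^ℚ τ ≤ K → 1ℚ ≤ S * S * A → Level-bound τ T′ K S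
        base {τ} {T′} {K} {S} hT r≤R Λ≤K 1≤SSA κ t hκ ht = begin
            Q.energy t κ ≤⟨ energy-trivial f f² κ t (ℕP.≤-trans (ℕP.+-mono-≤ hκ (ℕP.*-monoʳ-≤ 2 ht)) hT) ⟩
            Q.mass κ * (5ℚ ^ℚ t * (2ℚ ^ℚ t * (r ^ℚ points κ * 1ℚ) * r ^ℚ t)) ≤⟨ *-monoˡ (0≤mass κ) (*-monoˡ (0≤^ t 0≤5) (*-mono (0≤* (0≤^ t 0≤2) (0≤* 0≤rκ 0≤1)) (0≤^ t 0≤r)
                                                                                            (*-monoˡ (0≤^ t 0≤2) (*-monoʳ 0≤1 (^-mono (points κ) 0≤r r≤R))) (^-mono t 0≤r r≤R))) ⟩
            Q.mass κ * (5ℚ ^ℚ t * (2ℚ ^ℚ t * (R ^ℚ points κ * 1ℚ) * R ^ℚ t)) ≡⟨ cong (λ z → Q.mass κ * (5ℚ ^ℚ t * (2ℚ ^ℚ t * (R ^ℚ points κ * 1ℚ) * z))) (trans (^-* K₁ (ζ * ζ) t) (cong (K₁ ^ℚ t *_) (^-* ζ ζ t))) ⟩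
            Q.mass κ * (5ℚ ^ℚ t * (2ℚ ^ℚ t * (R ^ℚ points κ * 1ℚ) * (K₁ ^ℚ t * (ζ ^ℚ t * ζ ^ℚ t)))) ≡⟨ eq (Q.mass κ) (5ℚ ^ℚ t) (2ℚ ^ℚ t) (R ^ℚ points κ) (K₁ ^ℚ t) (ζ ^ℚ t) ⟩
            5ℚ ^ℚ t * 2ℚ ^ℚ t * K₁ ^ℚ t * 1ℚ * X ≤⟨ *-monoʳ 0≤X (*-mono 0≤Λt 0≤1 consts 1≤SSA) ⟩
            K * K * (S * S * A) * X ≡⟨ eq′ K S A (Q.mass κ) (R ^ℚ points κ) (ζ ^ℚ t) ⟩
            K * S * ζ ^ℚ t * (K * S * ζ ^ℚ t) * (Q.mass κ * (R ^ℚ points κ * A)) ∎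
          where
          open ≤R
          0≤rκ = 0≤^ (points κ) 0≤r
          0≤Λ = ℚP.≤-trans 0≤1 1≤Λ
          X = ζ ^ℚ t * ζ ^ℚ t * (Q.mass κ * R ^ℚ points κ)
          0≤X : 0ℚ ≤ X
          0≤X = 0≤* (0≤sq (ζ ^ℚ t)) (0≤* (0≤mass κ) (0≤^ (points κ) 0≤R))
          0≤Λt : 0ℚ ≤ 5ℚ ^ℚ t * 2ℚ ^ℚ t * K₁ ^ℚ t
          0≤Λt = 0≤* (0≤* (0≤^ t 0≤5) (0≤^ t 0≤2)) (0≤^ t 0≤K₁)
          consts : 5ℚ ^ℚ t * 2ℚ ^ℚ t * K₁ ^ℚ t ≤ K * K
          consts = begin
              5ℚ ^ℚ t * 2ℚ ^ℚ t * K₁ ^ℚ t ≡⟨ trans (^-* 10ℚ K₁ t) (cong (_* K₁ ^ℚ t) (^-* 5ℚ 2ℚ t)) ⟨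
              Λ ^ℚ t ≤⟨ ^-monoᵉ 1≤Λ ht ⟩
              Λ ^ℚ τ ≤⟨ Λ≤K ⟩
              K ≡⟨ ℚP.*-identityʳ K ⟨
              K * 1ℚ ≤⟨ *-monoˡ (ℚP.≤-trans (0≤^ τ 0≤Λ) Λ≤K) (ℚP.≤-trans (1≤^ τ 1≤Λ) Λ≤K) ⟩
              K * K ∎
          eq : ∀ m f t p k z → m * (f * (t * (p * 1ℚ) * (k * (z * z)))) ≡ f * t * k * 1ℚ * (z * z * (m * p))
          eq = solve-∀ ring
          eq′ : ∀ k s a m p z → k * k * (s * s * a) * (z * z * (m * p)) ≡ k * s * z * (k * s * z) * (m * (p * a))
          eq′ = solve-∀ ring

        -- The iteration starts from `squared m S`, which has to reach only `A^(-1/2)`, and `m`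
        -- halvings bring it down to `S`. The character `ε` is attached in one final step; there
        -- Cauchy-Schwarz is weighted by the nonnegative spread `f`, and `ε` disappears as its
        -- square is 1.
        level-inequality : (ε : F) → (∀ σ → ε σ * ε σ ≡ 1ℚ) → ∀ m {D K S} → point-range m (2 ℕ.* D) (2 ℕ.* D) ℕ.+ 2 ℕ.* level-range m (2 ℕ.* D) (2 ℕ.* D) ℕ.≤ T →
          r ≤ R → Λ ^ℚ level-range m (2 ℕ.* D) (2 ℕ.* D) ≤ K → 0ℚ ≤ S → 1ℚ ≤ squared m S * squared m S * A → E f ≤ A →
          ∀ i → i ℕ.≤ D → Quadratic.energy ps (λ σ → f σ * ε σ) i (nones k) ≤ A * A * (Λ ^ℚ D * scaled m Λ (2 ℕ.* D) K * S * ζ ^ℚ (2 ℕ.* i))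
        level-inequality ε ε² m {D} {K} {S} hT r≤R Λ≤K 0≤S 1≤SSA Ef≤A i hi = begin
            Quadratic.energy ps (λ σ → f σ * ε σ) i (nones k) ≤⟨ energy-step ε ε² {D} {0} 2D≤T (ℚP.≤-trans 0≤1 (1≤scaled m (2 ℕ.* D) 1≤K)) 0≤S
                                                                        (repeated-halving m pr≤T 1≤K 0≤S (base hT r≤R Λ≤K 1≤SSA)) (nones k) i (ℕP.≤-reflexive (points-nones k)) hi ⟩
            Q.mass (nones k) * (5ℚ ^ℚ i * (2ℚ ^ℚ i * (R ^ℚ points (nones k) * A) * (K₁ ^ℚ i * (K′ * S) * ζ ^ℚ (2 ℕ.* i))))
              ≡⟨ cong (λ z → Q.mass (nones k) * (5ℚ ^ℚ i * (2ℚ ^ℚ i * (R ^ℚ z * A) * (K₁ ^ℚ i * (K′ * S) * ζ ^ℚ (2 ℕ.* i))))) (points-nones k) ⟩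
            Q.mass (nones k) * (5ℚ ^ℚ i * (2ℚ ^ℚ i * (1ℚ * A) * (K₁ ^ℚ i * (K′ * S) * ζ ^ℚ (2 ℕ.* i))))
              ≡⟨ eq (Q.mass (nones k)) (5ℚ ^ℚ i) (2ℚ ^ℚ i) A (K₁ ^ℚ i) K′ S (ζ ^ℚ (2 ℕ.* i)) ⟩
            Q.mass (nones k) * A * (5ℚ ^ℚ i * 2ℚ ^ℚ i * K₁ ^ℚ i * (K′ * S * ζ ^ℚ (2 ℕ.* i)))
              ≤⟨ *-mono (0≤* (0≤mass (nones k)) 0≤A) (0≤* (0≤* (0≤* (0≤^ i 0≤5) (0≤^ i 0≤2)) (0≤^ i 0≤K₁)) 0≤Y) (*-monoʳ 0≤A mass≤A) (*-monoʳ 0≤Y consts) ⟩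
            A * A * (Λ ^ℚ D * (K′ * S * ζ ^ℚ (2 ℕ.* i))) ≡⟨ cong (A * A *_) (eq′ (Λ ^ℚ D) K′ S (ζ ^ℚ (2 ℕ.* i))) ⟩
            A * A * (Λ ^ℚ D * K′ * S * ζ ^ℚ (2 ℕ.* i)) ∎
          where
          open ≤R
          K′ = scaled m Λ (2 ℕ.* D) K
          1≤K = ℚP.≤-trans (1≤^ (level-range m (2 ℕ.* D) (2 ℕ.* D)) 1≤Λ) Λ≤K
          0≤Y : 0ℚ ≤ K′ * S * ζ ^ℚ (2 ℕ.* i)
          0≤Y = 0≤* (0≤* (ℚP.≤-trans 0≤1 (1≤scaled m (2 ℕ.* D) 1≤K)) 0≤S) (0≤^ (2 ℕ.* i) 0≤ζ)
          pr≤T : point-range m (2 ℕ.* D) (2 ℕ.* D) ℕ.≤ T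
          pr≤T = ℕP.≤-trans (ℕP.m≤m+n _ _) hT
          2D≤T : 2 ℕ.* D ℕ.≤ T
          2D≤T = ℕP.≤-trans (T≤point-range m (2 ℕ.* D) (2 ℕ.* D)) pr≤T
          eventVal-nones : ∀ {k} (ps : Vec (Pair n) k) σ → eventVal ps (nones k) σ ≡ 1ℚ
          eventVal-nones [] σ = refl
          eventVal-nones (p ∷ ps) σ = trans (ℚP.*-identityˡ (eventVal ps (nones _) σ)) (eventVal-nones ps σ)
          mass≤A : Q.mass (nones k) ≤ A
          mass≤A = subst (_≤ A) (E-cong (λ σ → trans (sym (ℚP.*-identityʳ (f σ))) (cong (f σ *_) (sym (eventVal-nones ps σ))))) Ef≤A
          consts : 5ℚ ^ℚ i * 2ℚ ^ℚ i * K₁ ^ℚ i ≤ Λ ^ℚ D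
          consts = ℚP.≤-trans (ℚP.≤-reflexive (sym (trans (^-* 10ℚ K₁ i) (cong (_* K₁ ^ℚ i) (^-* 5ℚ 2ℚ i))))) (^-monoᵉ 1≤Λ hi)
          eq : ∀ m f t a k l s z → m * (f * (t * (1ℚ * a) * (k * (l * s) * z))) ≡ m * a * (f * t * k * (l * s * z))
          eq = solve-∀ ring
          eq′ : ∀ a b c e → a * (b * c * e) ≡ a * b * c * e
          eq′ = solve-∀ ring

-- Juntas

module Juntas {n : ℕ} (𝓖 : PermGroup n) where
  open PermGroup 𝓖
  open Functions 𝓖
  open Indicators 𝓖
  open Convolution 𝓖

  private
    V : ℕ → Set
    V = Vec (Fin n)

  image : ∀ {i} → G → V i → V i
  image π = Vec.map (π ⟨_⟩)

  ≟-act : ∀ π x u → [ π ⟨ x ⟩ ≟ u ] ≡ [ x ≟ inv π ⟨ u ⟩ ]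
  ≟-act π x u with 0∨1 (π ⟨ x ⟩) u
  ... | inj₁ (refl , h) = trans h (sym (trans (cong [ x ≟_] (act-inv π x)) (≟-refl x)))
  ... | inj₂ (ne , h) = trans h (sym (≟-≢ (λ e′ → ne (trans (cong (π ⟨_⟩) e′) (act-inv′ π u)))))

  ind-R : ∀ {i} (I J : V i) π σ → ind I J (σ · π) ≡ ind (image π I) J σ
  ind-R [] [] π σ = refl
  ind-R (x ∷ I) (u ∷ J) π σ = cong₂ _*_ (cong [_≟ u ] (act-· σ π x)) (ind-R I J π σ)

  ind-L : ∀ {i} (I J : V i) π σ → ind I J (π · σ) ≡ ind I (image (inv π) J) σ
  ind-L [] [] π σ = refl
  ind-L (x ∷ I) (u ∷ J) π σ = cong₂ _*_ (trans (cong [_≟ u ] (act-· π σ x)) (≟-act π (σ ⟨ x ⟩) u)) (ind-L I J π σ)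

  ind-self : ∀ {i} (I : V i) σ → ind I (image σ I) σ ≡ 1ℚ
  ind-self [] σ = refl
  ind-self (x ∷ I) σ = cong₂ _*_ (≟-refl (σ ⟨ x ⟩)) (ind-self I σ)

  ind-cases : ∀ {i} (I J : V i) σ → (image σ I ≡ J) ⊎ (ind I J σ ≡ 0ℚ)
  ind-cases [] [] σ = inj₁ refl
  ind-cases (x ∷ I) (u ∷ J) σ with 0∨1 (σ ⟨ x ⟩) u | ind-cases I J σ
  ... | inj₂ (_ , h) | _ = inj₂ (trans (cong (_* ind I J σ) h) (ℚP.*-zeroˡ (ind I J σ)))
  ... | inj₁ _ | inj₂ h = inj₂ (trans (cong ([ σ ⟨ x ⟩ ≟ u ] *_) h) (ℚP.*-zeroʳ [ σ ⟨ x ⟩ ≟ u ]))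
  ... | inj₁ (refl , _) | inj₁ h = inj₁ (cong (_ ∷_) h)

  ind-select : ∀ {i} (I : V i) σ (φ : V i → ℚ) → ∑ᵛ n i (λ J → ind I J σ * φ J) ≡ φ (image σ I)
  ind-select [] σ φ = trans (∑ᵛ-zero n (λ J → ind [] J σ * φ J)) (ℚP.*-identityˡ (φ []))
  ind-select {suc i} (x ∷ I) σ φ = trans (∑ᵛ-suc n i (λ J → ind (x ∷ I) J σ * φ J)) (trans (∑-cong (allFin n) (λ u →
      trans (∑-cong (allVecs n i) (λ J → ℚP.*-assoc [ σ ⟨ x ⟩ ≟ u ] (ind I J σ) (φ (u ∷ J)))) (trans (∑-*ˡ (allVecs n i) [ σ ⟨ x ⟩ ≟ u ] _)
        (cong ([ σ ⟨ x ⟩ ≟ u ] *_) (ind-select I σ (λ J → φ (u ∷ J)))))))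
    (∑-select (σ ⟨ x ⟩) (λ u → φ (u ∷ image σ I))))

  ∑-ind : ∀ {i} (I : V i) σ → ∑ᵛ n i (λ J → ind I J σ) ≡ 1ℚ
  ∑-ind {i} I σ = trans (∑-cong (allVecs n i) (λ J → sym (ℚP.*-identityʳ (ind I J σ)))) (ind-select I σ (λ _ → 1ℚ))

  ind≤1 : ∀ {i} (I J : V i) σ → ind I J σ ≤ 1ℚ
  ind≤1 {i} I J σ = subst (ind I J σ ≤_) (∑-ind I σ) (∑-∈≤ (λ J → 0≤ind I J σ) (∈-allVecs J))

  ∑-act : ∀ π (f : Fin n → ℚ) → ∑ᶠ n (λ x → f (π ⟨ x ⟩)) ≡ ∑ᶠ n f
  ∑-act π f = trans (∑-cong (allFin n) (λ x → sym (∑-select (π ⟨ x ⟩) f))) (trans (∑-swap (allFin n) (allFin n) (λ x y → [ π ⟨ x ⟩ ≟ y ] * f y))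
    (∑-cong (allFin n) (λ y → trans (∑-*ʳ (allFin n) (λ x → [ π ⟨ x ⟩ ≟ y ]) (f y)) (trans (cong (_* f y)
      (trans (∑-cong (allFin n) (λ x → trans (≟-act π x y) (≟-sym x _))) (∑-≟ (inv π ⟨ y ⟩)))) (ℚP.*-identityˡ (f y))))))

  ∑ᵛ-act : ∀ i π (f : V i → ℚ) → ∑ᵛ n i (λ I → f (image π I)) ≡ ∑ᵛ n i f
  ∑ᵛ-act zero π f = refl
  ∑ᵛ-act (suc i) π f = trans (∑ᵛ-suc n i (λ I → f (image π I))) (trans (∑-cong (allFin n) (λ x → ∑ᵛ-act i π (λ I → f (π ⟨ x ⟩ ∷ I))))
    (trans (∑-act π (λ x → ∑ᵛ n i (λ I → f (x ∷ I)))) (sym (∑ᵛ-suc n i f))))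

  image-inv : ∀ {i} π (I : V i) → image (inv π) (image π I) ≡ I
  image-inv π [] = refl
  image-inv π (x ∷ I) = cong₂ _∷_ (act-inv π x) (image-inv π I)

  image-· : ∀ {i} π ρ (I : V i) → image (π · ρ) I ≡ image π (image ρ I)
  image-· π ρ [] = refl
  image-· π ρ (x ∷ I) = cong₂ _∷_ (act-· π ρ x) (image-· π ρ I)

  opaque
    juntas : ℕ → List F
    juntas i = concatMap (λ I → map (ind I) (allVecs n i)) (allVecs n i)

    ind∈juntas : ∀ {i} (I K : V i) → ind I K ∈ juntas i
    ind∈juntas {i} I K = MemP.∈-concatMap⁺ (λ I → map (ind I) (allVecs n i)) (Any.map (λ { refl → MemP.∈-map⁺ (ind I) (∈-allVecs K) }) (∈-allVecs I))

    juntas-elim : ∀ {i} {Q : F → Set} → (∀ I K → Q (ind {i} I K)) → ∀ {p} → p ∈ juntas i → Q p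
    juntas-elim {i} {Q} h {p} p∈ = go (allVecs n i) (MemP.∈-concatMap⁻ (λ I → map (ind I) (allVecs n i)) {xs = allVecs n i} p∈)
      where
      go : ∀ Is → Any (λ I → p ∈ map (ind I) (allVecs n i)) Is → Q p
      go (I ∷ Is) (here q) with MemP.∈-map⁻ (ind I) q
      ... | K , _ , refl = h I K
      go (I ∷ Is) (there q) = go Is q

  J : ℕ → F → Set
  J i = Span (_∈ juntas i)

  ind∈J : ∀ {i} (I K : V i) → J i (ind I K)
  ind∈J I K = gen (ind∈juntas I K)

  J-R : ∀ {i p} π → J i p → J i (λ σ → p (σ · π))
  J-R {i} π (gen p∈) = juntas-elim {Q = λ p → J i (λ σ → p (σ · π))} (λ I K → span-resp (ind-R I K π) (ind∈J (image π I) K)) p∈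
  J-R π (null h) = null (λ σ → h (σ · π))
  J-R π (add s t h) = add (J-R π s) (J-R π t) (λ σ → h (σ · π))
  J-R π (scale c s h) = scale c (J-R π s) (λ σ → h (σ · π))

  J-L : ∀ {i p} π → J i p → J i (λ σ → p (π · σ))
  J-L {i} π (gen p∈) = juntas-elim {Q = λ p → J i (λ σ → p (π · σ))} (λ I K → span-resp (ind-L I K π) (ind∈J I (image (inv π) K))) p∈
  J-L π (null h) = null (λ σ → h (π · σ))
  J-L π (add s t h) = add (J-L π s) (J-L π t) (λ σ → h (π · σ))
  J-L π (scale c s h) = scale c (J-L π s) (λ σ → h (π · σ))

  J-suc : Fin n → ∀ {i p} → J i p → J (suc i) p
  J-suc x {i} = span-⊆ (juntas-elim {Q = J (suc i)} (λ I K → span-resp (eq I K) (span-∑ (allFin n) (λ u → ind (x ∷ I) (u ∷ K)) (λ u → ind∈J (x ∷ I) (u ∷ K)))))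
    where eq : ∀ (I K : V i) σ → ind I K σ ≡ ∑ᶠ n (λ u → ind (x ∷ I) (u ∷ K) σ)
          eq I K σ = sym (∑-select (σ ⟨ x ⟩) (λ _ → ind I K σ))

  proj : ℕ → F → F
  proj i = Projection.proj (gram-schmidt (juntas i))

  proj∈ : ∀ i f → J i (proj i f)
  proj∈ i = Projection.proj∈ (gram-schmidt (juntas i))

  proj⊥ : ∀ i f {p} → J i p → ⟪ (λ σ → f σ - proj i f σ) , p ⟫ ≡ 0ℚ
  proj⊥ i = Projection.proj⊥ (gram-schmidt (juntas i))

  ⟪proj⟫ : ∀ i f {p} → J i p → ⟪ proj i f , p ⟫ ≡ ⟪ f , p ⟫
  ⟪proj⟫ i f {p} h = sym (trans (x≡x-y+y ⟪ f , p ⟫ ⟪ proj i f , p ⟫) (trans (cong (_+ ⟪ proj i f , p ⟫) (trans (sym (⟪⟫--ˡ f (proj i f) p)) (proj⊥ i f h))) (ℚP.+-identityˡ _)))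

  -- The component of exact level i + 1.
  level : ℕ → F → F
  level i f σ = proj (suc i) f σ - proj i f σ

  moment : F → ∀ {i} → V i → V i → ℚ
  moment f I K = E (λ σ → f σ * ind I K σ)

  -- Squared Hilbert-Schmidt norm of the matrix by which `f` acts in the permutation representation
  -- on `i`-tuples.
  norm² : ℕ → F → ℚ
  norm² i f = ∑ᵛ n i (λ I → ∑ᵛ n i (λ K → moment f I K * moment f I K))

  0≤norm² : ∀ i f → 0ℚ ≤ norm² i f
  0≤norm² i f = 0≤∑ (allVecs n i) (λ I → 0≤∑ (allVecs n i) (λ K → 0≤sq (moment f I K)))

  level∈ : Fin n → ∀ i f → J (suc i) (level i f)
  level∈ x i f = span-- (proj∈ (suc i) f) (J-suc x (proj∈ i f))

  level⊥ : Fin n → ∀ i f {p} → J i p → ⟪ level i f , p ⟫ ≡ 0ℚ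
  level⊥ x i f {p} h = trans (⟪⟫--ˡ (proj (suc i) f) (proj i f) p) (trans (cong₂ _-_ (⟪proj⟫ (suc i) f (J-suc x h)) (⟪proj⟫ i f h)) (ℚP.+-inverseʳ ⟪ f , p ⟫))

  level-moment : ∀ i f {p} → J (suc i) p → (∀ {q} → J i q → ⟪ q , p ⟫ ≡ 0ℚ) → ⟪ level i f , p ⟫ ≡ ⟪ f , p ⟫
  level-moment i f {p} h p⊥ = trans (⟪⟫--ˡ (proj (suc i) f) (proj i f) p) (trans (cong₂ _-_ (⟪proj⟫ (suc i) f h) (p⊥ (proj∈ i f))) (eq ⟪ f , p ⟫))
    where eq : ∀ a → a - 0ℚ ≡ a
          eq = solve-∀ ring

  M : ℕ → ℚ
  M i = nat n ^ℚ i

  0≤M : ∀ i → 0ℚ ≤ M i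
  0≤M i = 0≤^ i (0≤nat n)

  -- All attained images of `I` are equally likely by left translation, so the collision probability
  -- of the image, at least `n^(-i)` by Cauchy-Schwarz, is the probability of any one of them.
  -- Tuples with repetitions are included.
  ind-lower : ∀ {i} (I : V i) σ → 1ℚ ≤ M i * E (ind I (image σ I))
  ind-lower {i} I σ = begin
      1ℚ ≡⟨ cong₂ _*_ total total ⟨
      ∑ᵛ n i (λ K → 1ℚ * E (ind I K)) * ∑ᵛ n i (λ K → 1ℚ * E (ind I K)) ≤⟨ ∑-CS (allVecs n i) (λ _ → 1ℚ) (λ K → E (ind I K)) ⟩
      ∑ᵛ n i (λ _ → 1ℚ * 1ℚ) * ∑ᵛ n i (λ K → E (ind I K) * E (ind I K)) ≡⟨ cong₂ _*_ (trans (∑ᵛ-const n i (1ℚ * 1ℚ)) (ℚP.*-identityʳ (M i))) collision ⟩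
      M i * E (ind I (image σ I)) ∎
    where
    open ≤R
    total : ∑ᵛ n i (λ K → 1ℚ * E (ind I K)) ≡ 1ℚ
    total = trans (∑-cong (allVecs n i) (λ K → ℚP.*-identityˡ (E (ind I K)))) (trans (sym (E-∑ (allVecs n i) (ind I))) (trans (E-cong (∑-ind I)) (E-const 1ℚ)))
    uniform : ∀ ρ → E (ind I (image ρ I)) ≡ E (ind I (image σ I))
    uniform ρ = trans (sym (E-L α (ind I (image ρ I)))) (E-cong (λ τ → trans (ind-L I (image ρ I) α τ) (cong (λ K → ind I K τ) moved)))
      where α = ρ · inv σ
            moved : image (inv α) (image ρ I) ≡ image σ I
            moved = trans (cong (λ g → image (inv α) (image g I)) (sym (cancel-invʳ σ ρ))) (trans (cong (image (inv α)) (image-· α σ I)) (image-inv α (image σ I)))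
    collision : ∑ᵛ n i (λ K → E (ind I K) * E (ind I K)) ≡ E (ind I (image σ I))
    collision = trans (∑-cong (allVecs n i) (λ K → sym (E-*ʳ (ind I K) (E (ind I K))))) (trans (sym (E-∑ (allVecs n i) (λ K ρ → ind I K ρ * E (ind I K))))
      (trans (E-cong (λ ρ → trans (ind-select I ρ (λ K → E (ind I K))) (uniform ρ))) (E-const _)))

  -- The operator `H` below does not preserve the set of indicators. It commutes with right
  -- translations, however, and so preserves invariance under the stabiliser of `I`, which is what
  -- this condition amounts to.
  Determined : ℕ → F → Set
  Determined i p = ∃[ I ] (∀ σ τ → image {i} σ I ≡ image τ I → p σ ≡ p τ)

  private
    module Frame (i : ℕ) (x₀ : Fin n) where
      -- `𝒯` is the frame operator of the indicators. As `span-dominated` yields only upper bounds,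
      -- the lower bound for `𝒯` is obtained as an upper bound for `M (M - 𝒯)`, which is
      -- semidefinite by `norm≤`.
      𝒯 H : F → F
      𝒯 p σ = ∑ᵛ n i (λ I → ∑ᵛ n i (λ K → moment p I K * ind I K σ))
      H p σ = M i * (M i * p σ - 𝒯 p σ)

      ⟪𝒯⟫ : ∀ p q → ⟪ 𝒯 p , q ⟫ ≡ ∑ᵛ n i (λ I → ∑ᵛ n i (λ K → moment p I K * moment q I K))
      ⟪𝒯⟫ p q = trans (E-cong (λ σ → trans (sym (∑-*ʳ (allVecs n i) _ (q σ))) (∑-cong (allVecs n i) (λ I → trans (sym (∑-*ʳ (allVecs n i) _ (q σ)))
          (∑-cong (allVecs n i) (λ K → xy*z≡x*zy (moment p I K) (ind I K σ) (q σ)))))))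
        (trans (E-∑ (allVecs n i) _) (∑-cong (allVecs n i) (λ I → trans (E-∑ (allVecs n i) _) (∑-cong (allVecs n i) (λ K → E-*ˡ (moment p I K) _)))))

      ⟪H⟫ : ∀ p q → ⟪ H p , q ⟫ ≡ M i * (M i * ⟪ p , q ⟫ - ∑ᵛ n i (λ I → ∑ᵛ n i (λ K → moment p I K * moment q I K)))
      ⟪H⟫ p q = trans (⟪⟫-*ˡ (M i) (λ σ → M i * p σ - 𝒯 p σ) q) (cong (M i *_) (trans (⟪⟫--ˡ (λ σ → M i * p σ) (𝒯 p) q) (cong₂ _-_ (⟪⟫-*ˡ (M i) p q) (⟪𝒯⟫ p q))))

      moment-cong : ∀ {p q} → (∀ σ → p σ ≡ q σ) → ∀ (I K : V i) → moment p I K ≡ moment q I K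
      moment-cong h I K = E-cong (λ σ → cong (_* ind I K σ) (h σ))

      H-cong : ∀ {p q} → (∀ σ → p σ ≡ q σ) → ∀ σ → H p σ ≡ H q σ
      H-cong h σ = cong (M i *_) (cong₂ _-_ (cong (M i *_) (h σ)) (∑-cong (allVecs n i) (λ I → ∑-cong (allVecs n i) (λ K → cong (_* ind I K σ) (moment-cong h I K)))))

      𝒯-+ : ∀ p q σ → 𝒯 (λ σ → p σ + q σ) σ ≡ 𝒯 p σ + 𝒯 q σ
      𝒯-+ p q σ = trans (∑-cong (allVecs n i) (λ I → trans (∑-cong (allVecs n i) (λ K → trans (cong (_* ind I K σ) (⟪⟫-+ˡ p q (ind I K))) (ℚP.*-distribʳ-+ (ind I K σ) (moment p I K) (moment q I K))))
        (∑-+ (allVecs n i) _ _))) (∑-+ (allVecs n i) _ _)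

      𝒯-* : ∀ c p σ → 𝒯 (λ σ → c * p σ) σ ≡ c * 𝒯 p σ
      𝒯-* c p σ = trans (∑-cong (allVecs n i) (λ I → trans (∑-cong (allVecs n i) (λ K → trans (cong (_* ind I K σ) (⟪⟫-*ˡ c p (ind I K))) (ℚP.*-assoc c (moment p I K) (ind I K σ))))
        (∑-*ˡ (allVecs n i) c _))) (∑-*ˡ (allVecs n i) c _)

      H-+ : ∀ p q σ → H (λ σ → p σ + q σ) σ ≡ H p σ + H q σ
      H-+ p q σ = trans (cong (λ z → M i * (M i * (p σ + q σ) - z)) (𝒯-+ p q σ)) (eq (M i) (p σ) (q σ) (𝒯 p σ) (𝒯 q σ))
        where eq : ∀ m a b c d → m * (m * (a + b) - (c + d)) ≡ m * (m * a - c) + m * (m * b - d)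
              eq = solve-∀ ring

      H-* : ∀ c p σ → H (λ σ → c * p σ) σ ≡ c * H p σ
      H-* c p σ = trans (cong (λ z → M i * (M i * (c * p σ) - z)) (𝒯-* c p σ)) (eq (M i) c (p σ) (𝒯 p σ))
        where eq : ∀ m c a b → m * (m * (c * a) - c * b) ≡ c * (m * (m * a - b))
              eq = solve-∀ ring

      norm≤ : ∀ p → norm² i p ≤ M i * ⟪ p , p ⟫
      norm≤ p = ℚP.≤-trans (∑-mono (allVecs n i) (λ I → ℚP.≤-trans (∑-mono (allVecs n i) (λ K → each I K)) (ℚP.≤-reflexive (cell I)))) (ℚP.≤-reflexive (∑ᵛ-const n i ⟪ p , p ⟫))
        where
        each : ∀ I K → moment p I K * moment p I K ≤ E (λ σ → ind I K σ * (p σ * p σ))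
        each I K = begin
            moment p I K * moment p I K ≡⟨ cong₂ _*_ e₁ e₁ ⟩
            E (λ σ → ind I K σ * (p σ * 1ℚ)) * E (λ σ → ind I K σ * (p σ * 1ℚ)) ≤⟨ E-CS (ind I K) p (λ _ → 1ℚ) (0≤ind I K) ⟩
            E (λ σ → ind I K σ * (p σ * p σ)) * E (λ σ → ind I K σ * (1ℚ * 1ℚ)) ≤⟨ *-monoˡ (0≤E (λ σ → 0≤* (0≤ind I K σ) (0≤sq (p σ)))) (ℚP.≤-trans (E-mono (λ σ → subst (_≤ 1ℚ) (sym (ℚP.*-identityʳ (ind I K σ))) (ind≤1 I K σ))) (ℚP.≤-reflexive (E-const 1ℚ))) ⟩
            E (λ σ → ind I K σ * (p σ * p σ)) * 1ℚ ≡⟨ ℚP.*-identityʳ _ ⟩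
            E (λ σ → ind I K σ * (p σ * p σ)) ∎
          where open ≤R
                e₁ : moment p I K ≡ E (λ σ → ind I K σ * (p σ * 1ℚ))
                e₁ = E-cong (λ σ → eq (p σ) (ind I K σ))
                  where eq : ∀ a b → a * b ≡ b * (a * 1ℚ)
                        eq = solve-∀ ring
        cell : ∀ I → ∑ᵛ n i (λ K → E (λ σ → ind I K σ * (p σ * p σ))) ≡ ⟪ p , p ⟫
        cell I = trans (sym (E-∑ (allVecs n i) _)) (E-cong (λ σ → ind-select I σ (λ _ → p σ * p σ)))

      H-psd : ∀ p → 0ℚ ≤ ⟪ H p , p ⟫
      H-psd p = subst (0ℚ ≤_) (sym (⟪H⟫ p p)) (0≤* (0≤M i) (≤⇒0≤- (norm≤ p)))

      moment-R : ∀ p π (I K : V i) → (∀ σ → p (σ · π) ≡ p σ) → moment p I K ≡ moment p (image π I) K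
      moment-R p π I K h = sym (trans (E-cong (λ σ → cong₂ _*_ (sym (h σ)) (sym (ind-R I K π σ)))) (E-R π (λ σ → p σ * ind I K σ)))

      𝒯-R : ∀ p π σ → (∀ σ → p (σ · π) ≡ p σ) → 𝒯 p (σ · π) ≡ 𝒯 p σ
      𝒯-R p π σ h = trans (∑-cong (allVecs n i) (λ I → ∑-cong (allVecs n i) (λ K → cong₂ _*_ (moment-R p π I K h) (ind-R I K π σ))))
        (∑ᵛ-act i π (λ I → ∑ᵛ n i (λ K → moment p I K * ind I K σ)))

      determined-R : ∀ {p : F} (I : V i) π → image π I ≡ I → (∀ σ τ → image σ I ≡ image τ I → p σ ≡ p τ) → ∀ σ → p (σ · π) ≡ p σ
      determined-R I π fix h σ = h (σ · π) σ (trans (image-· σ π I) (cong (image σ) fix))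

      determined-H : ∀ {p} → Determined i p → Determined i (H p)
      determined-H {p} (I , h) = I , λ σ τ eq → trans (sym (invariant σ (inv σ · τ) (fix σ τ eq))) (cong (H p) (cancel-invˡ σ τ))
        where
        fix : ∀ σ τ → image σ I ≡ image τ I → image (inv σ · τ) I ≡ I
        fix σ τ eq = trans (image-· (inv σ) τ I) (trans (cong (image (inv σ)) (sym eq)) (image-inv σ I))
        invariant : ∀ σ π → image π I ≡ I → H p (σ · π) ≡ H p σ
        invariant σ π f = cong (M i *_) (cong₂ _-_ (cong (M i *_) (p-R σ)) (𝒯-R p π σ p-R))
          where p-R = determined-R I π f h

      -- The moment of `p` at `I` and `image σ I` is `p σ` times the probability of that image,
      -- which `ind-lower` bounds from below. The tuple `I` alone thus contributes enough to
      -- `norm²`.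
      determined-norm : ∀ {p} → Determined i p → ⟪ p , p ⟫ ≤ M i * norm² i p
      determined-norm {p} (I , h) = begin
          ⟪ p , p ⟫ ≤⟨ E-mono pointwise ⟩
          E (λ σ → M i * (p σ * (p σ * E (ind I (image σ I))))) ≡⟨ E-*ˡ (M i) _ ⟩
          M i * E (λ σ → p σ * (p σ * E (ind I (image σ I)))) ≡⟨ cong (M i *_) (E-cong (λ σ → cong (p σ *_) (moment-at σ))) ⟩
          M i * E (λ σ → p σ * moment p I (image σ I)) ≡⟨ cong (M i *_) (E-cong (λ σ → trans (cong (p σ *_) (sym (ind-select I σ (moment p I)))) (sym (∑-*ˡ (allVecs n i) (p σ) _)))) ⟩
          M i * E (λ σ → ∑ᵛ n i (λ K → p σ * (ind I K σ * moment p I K))) ≡⟨ cong (M i *_) (trans (E-∑ (allVecs n i) _) (∑-cong (allVecs n i) (λ K → trans (E-cong (λ σ → sym (ℚP.*-assoc (p σ) (ind I K σ) (moment p I K)))) (E-*ʳ _ (moment p I K))))) ⟩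
          M i * ∑ᵛ n i (λ K → moment p I K * moment p I K) ≤⟨ *-monoˡ (0≤M i) (∑-∈≤ (λ I → 0≤∑ (allVecs n i) (λ K → 0≤sq (moment p I K))) (∈-allVecs I)) ⟩
          M i * norm² i p ∎
        where
        open ≤R
        pointwise : ∀ σ → p σ * p σ ≤ M i * (p σ * (p σ * E (ind I (image σ I))))
        pointwise σ = subst₂ _≤_ (ℚP.*-identityʳ (p σ * p σ)) (eq (p σ) (M i) (E (ind I (image σ I)))) (*-monoˡ (0≤sq (p σ)) (ind-lower I σ))
          where eq : ∀ a b c → a * a * (b * c) ≡ b * (a * (a * c))
                eq = solve-∀ ring
        moment-at : ∀ σ → p σ * E (ind I (image σ I)) ≡ moment p I (image σ I)
        moment-at σ = trans (sym (E-*ˡ (p σ) (ind I (image σ I)))) (E-cong const)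
          where const : ∀ τ → p σ * ind I (image σ I) τ ≡ p τ * ind I (image σ I) τ
                const τ with ind-cases I (image σ I) τ
                ... | inj₁ e′ = cong (_* ind I (image σ I) τ) (h σ τ (sym e′))
                ... | inj₂ z = trans (cong (p σ *_) z) (trans (ℚP.*-zeroʳ (p σ)) (sym (trans (cong (p τ *_) z) (ℚP.*-zeroʳ (p τ)))))

      1≤M : 1ℚ ≤ M i
      1≤M = 1≤^ i (subst (_≤ nat n) nat-1 (nat-mono (ℕP.≤-trans (ℕ.s≤s ℕ.z≤n) (FinP.toℕ<n x₀))))

      θ : ℚ
      θ = M i * M i - 1ℚ

      dominated : ∀ {p} → Span (Determined i) p → ⟪ H p , p ⟫ ≤ θ * ⟪ p , p ⟫
      dominated = PowerTrick.span-dominated 𝓖 H H-cong H-+ H-*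
        (λ p q → trans (⟪H⟫ p q) (trans (cong₂ (λ a b → M i * (M i * a - b)) (⟪⟫-comm p q) (∑-cong (allVecs n i) (λ I → ∑-cong (allVecs n i) (λ K → ℚP.*-comm (moment p I K) (moment q I K)))))
          (trans (sym (⟪H⟫ q p)) (⟪⟫-comm (H q) p))))
        H-psd (Determined i) determined-H θ (≤⇒0≤- (*-mono 0≤1 0≤1 1≤M 1≤M))
        (λ {p} d → subst (_≤ θ * ⟪ p , p ⟫) (sym (⟪H⟫ p p)) (0≤-⇒≤ (subst (0ℚ ≤_) (eq (M i) ⟪ p , p ⟫ (norm² i p)) (≤⇒0≤- (determined-norm d)))))
        where eq : ∀ m a b → m * b - a ≡ (m * m - 1ℚ) * a - m * (m * a - b)
              eq = solve-∀ ring

  -- The lower frame bound for the functions ind I K on their span (the dimension bound d ≤ nⁱ in disguise).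
  frame-bound : ∀ {i p} → Fin n → J i p → ⟪ p , p ⟫ ≤ M i * norm² i p
  frame-bound {i} {p} x₀ h = 0≤-⇒≤ (subst (0ℚ ≤_) (eq (M i) ⟪ p , p ⟫ (norm² i p)) (≤⇒0≤- (subst (_≤ Frame.θ i x₀ * ⟪ p , p ⟫) (Frame.⟪H⟫ i x₀ p p)
      (Frame.dominated i x₀ (span-⊆ (juntas-elim {Q = Span (Determined i)} (λ I K → gen (I , det I K))) h)))))
    where
    eq : ∀ m a b → (m * m - 1ℚ) * a - m * (m * a - b) ≡ m * b - a
    eq = solve-∀ ring
    det : ∀ (I K : V i) σ τ → image σ I ≡ image τ I → ind I K σ ≡ ind I K τ
    det I K σ τ e′ with ind-cases I K σ | ind-cases I K τ
    ... | inj₁ refl | _ = trans (ind-self I σ) (sym (trans (cong (λ K → ind I K τ) e′) (ind-self I τ)))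
    ... | inj₂ a | inj₂ b = trans a (sym b)
    ... | inj₂ a | inj₁ refl = trans (cong (λ K → ind I K σ) (sym e′)) (trans (ind-self I σ) (sym (ind-self I τ)))

  -- The intermediate tuple `L` is the image of `I` under the argument of `g`; the sum over it is
  -- the matrix product in the representation on tuples.
  moment-conv : ∀ f g {i} (I K : V i) → moment (conv f g) I K ≡ ∑ᵛ n i (λ L → moment g I L * moment f L K)
  moment-conv f g {i} I K = trans (sym (tri≡⟪conv⟫ f g (ind I K))) (trans (E-cong inner) (trans (E-∑ (allVecs n i) (λ L σ → moment g I L * (f σ * ind L K σ)))
      (∑-cong (allVecs n i) (λ L → E-*ˡ (moment g I L) (λ σ → f σ * ind L K σ)))))
    where
    inner : ∀ σ → E (λ τ → f σ * g τ * ind I K (σ · τ)) ≡ ∑ᵛ n i (λ L → moment g I L * (f σ * ind L K σ))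
    inner σ = trans (E-cong (λ τ → trans (cong (f σ * g τ *_) (trans (ind-R I K τ σ) (sym (ind-select I τ (λ L → ind L K σ))))) (trans (sym (∑-*ˡ (allVecs n i) (f σ * g τ) _))
        (∑-cong (allVecs n i) (λ L → eq (f σ) (g τ) (ind I L τ) (ind L K σ))))))
      (trans (E-∑ (allVecs n i) (λ L τ → g τ * ind I L τ * (f σ * ind L K σ))) (∑-cong (allVecs n i) (λ L → E-*ʳ (λ τ → g τ * ind I L τ) (f σ * ind L K σ))))
      where eq : ∀ a b c d → a * b * (c * d) ≡ b * c * (a * d)
            eq = solve-∀ ring

  -- Submultiplicativity of the Hilbert-Schmidt norm.
  norm²-conv : ∀ i f g → norm² i (conv f g) ≤ norm² i f * norm² i g
  norm²-conv i f g = begin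
      ∑ᵛ n i (λ I → ∑ᵛ n i (λ K → moment (conv f g) I K * moment (conv f g) I K))
        ≡⟨ ∑-cong (allVecs n i) (λ I → ∑-cong (allVecs n i) (λ K → cong₂ _*_ (moment-conv f g I K) (moment-conv f g I K))) ⟩
      ∑ᵛ n i (λ I → ∑ᵛ n i (λ K → ∑ᵛ n i (λ L → moment g I L * moment f L K) * ∑ᵛ n i (λ L → moment g I L * moment f L K)))
        ≤⟨ ∑-mono (allVecs n i) (λ I → ∑-mono (allVecs n i) (λ K → ∑-CS (allVecs n i) (moment g I) (λ L → moment f L K))) ⟩
      ∑ᵛ n i (λ I → ∑ᵛ n i (λ K → ∑ᵛ n i (λ L → moment g I L * moment g I L) * ∑ᵛ n i (λ L → moment f L K * moment f L K)))
        ≡⟨ ∑-product (allVecs n i) (allVecs n i) (λ I → ∑ᵛ n i (λ L → moment g I L * moment g I L)) (λ K → ∑ᵛ n i (λ L → moment f L K * moment f L K)) ⟩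
      norm² i g * ∑ᵛ n i (λ K → ∑ᵛ n i (λ L → moment f L K * moment f L K))
        ≡⟨ trans (cong (norm² i g *_) (∑-swap (allVecs n i) (allVecs n i) (λ K L → moment f L K * moment f L K))) (ℚP.*-comm (norm² i g) (norm² i f)) ⟩
      norm² i f * norm² i g ∎
    where open ≤R

  -- A convolution is a combination of left translates of its second factor.
  J-conv : ∀ {i} f {g} → J i g → J i (conv f g)
  J-conv {i} f {g} h = span-resp eq (span-∑ els (λ τ σ → c * (f τ * g (inv τ · σ))) (λ τ → scale (c * f τ) (J-L (inv τ) h) (λ σ → sym (ℚP.*-assoc c (f τ) (g (inv τ · σ))))))
    where
    c = proj₁ E≡∑
    eq : ∀ ρ → conv f g ρ ≡ ∑ els (λ τ → c * (f τ * g (inv τ · ρ)))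
    eq ρ = trans (sym (E-reindex (λ τ → inv τ · ρ) (λ τ → ρ · inv τ)
        (λ τ → trans (cong (_· ρ) (trans (inv-· ρ (inv τ)) (cong (_· inv ρ) (inv-inv τ)))) (cancel-invʳ ρ τ))
        (λ τ → trans (cong (ρ ·_) (trans (inv-· (inv τ) ρ) (cong (inv ρ ·_) (inv-inv τ)))) (cancel-invˡ ρ τ))
        (λ τ → f (ρ · inv τ) * g τ)))
      (trans (E-cong (λ τ → cong (λ π → f π * g (inv τ · ρ)) (trans (cong (ρ ·_) (trans (inv-· (inv τ) ρ) (cong (inv ρ ·_) (inv-inv τ)))) (cancel-invˡ ρ τ))))
        (proj₂ E≡∑ (λ τ → f τ * g (inv τ · ρ))))

  -- The two factors `M i` come from two uses of `frame-bound`, one for the convolution and one for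
  -- `h`.
  tri-level : ∀ {i} → Fin n → ∀ f {g h} → J i g → J i h → tri f g h * tri f g h ≤ M i * M i * (norm² i f * norm² i g * norm² i h)
  tri-level {i} x₀ f {g} {h} hg hh = begin
      tri f g h * tri f g h ≤⟨ tri-sq f g h ⟩
      ⟪ conv f g , conv f g ⟫ * ⟪ h , h ⟫ ≤⟨ *-mono (0≤⟪⟫ (conv f g)) (0≤⟪⟫ h) (frame-bound x₀ (J-conv f hg)) (frame-bound x₀ hh) ⟩
      M i * norm² i (conv f g) * (M i * norm² i h) ≤⟨ *-monoʳ (0≤* (0≤M i) (0≤norm² i h)) (*-monoˡ (0≤M i) (norm²-conv i f g)) ⟩
      M i * (norm² i f * norm² i g) * (M i * norm² i h) ≡⟨ eq (M i) (norm² i f) (norm² i g) (norm² i h) ⟩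
      M i * M i * (norm² i f * norm² i g * norm² i h) ∎
    where open ≤R
          eq : ∀ m a b c → m * (a * b) * (m * c) ≡ m * m * (a * b * c)
          eq = solve-∀ ring

-- Harmonic arrays

module Harmonic {n : ℕ} where
  private
    V : ℕ → Set
    V = Vec (Fin n)

  Har : ∀ m → (V m → ℚ) → Set
  Har zero Q = ⊤
  Har (suc m) Q = (∀ v → ∑ᶠ n (λ x → Q (x ∷ v)) ≡ 0ℚ) × (∀ x → Har m (λ v → Q (x ∷ v)))

  diff : ∀ {m} → (V m → ℚ) → V m → V m → ℚ
  diff Q [] [] = Q []
  diff Q (x ∷ xs) (y ∷ ys) = diff (λ v → Q (x ∷ v) - Q (y ∷ v)) xs ys

  diff-cong : ∀ {m} {Q Q′ : V m → ℚ} → (∀ v → Q v ≡ Q′ v) → ∀ xs ys → diff Q xs ys ≡ diff Q′ xs ys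
  diff-cong h [] [] = h []
  diff-cong h (x ∷ xs) (y ∷ ys) = diff-cong (λ v → cong₂ _-_ (h (x ∷ v)) (h (y ∷ v))) xs ys

  har-- : ∀ {m} {Q Q′ : V m → ℚ} → Har m Q → Har m Q′ → Har m (λ v → Q v - Q′ v)
  har-- {zero} _ _ = tt
  har-- {suc m} (a , b) (c , d) = (λ v → trans (∑-- (allFin n) _ _) (cong₂ _-_ (a v) (c v))) , λ x → har-- (b x) (d x)

  ∑-differences : (a : Fin n → ℚ) → ∑ᶠ n a ≡ 0ℚ → ∑ᶠ n (λ x → ∑ᶠ n (λ y → (a x - a y) * (a x - a y))) ≡ 2ℚ * nat n * ∑ᶠ n (λ x → a x * a x)
  ∑-differences a h = begin
      ∑ᶠ n (λ x → ∑ᶠ n (λ y → (a x - a y) * (a x - a y)))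
        ≡⟨ ∑-cong (allFin n) (λ x → trans (∑-cong (allFin n) (λ y → eq (a x) (a y))) (trans (∑-+ (allFin n) (λ y → a x * a x + a y * a y) (λ y → (- 2ℚ * a x) * a y))
             (cong₂ _+_ (trans (∑-+ (allFin n) (λ _ → a x * a x) (λ y → a y * a y)) (cong (_+ S) (∑ᶠ-const n (a x * a x)))) (trans (∑-*ˡ (allFin n) (- 2ℚ * a x) a) (trans (cong (- 2ℚ * a x *_) h) (ℚP.*-zeroʳ (- 2ℚ * a x))))))) ⟩
      ∑ᶠ n (λ x → nat n * (a x * a x) + S + 0ℚ)
        ≡⟨ trans (∑-cong (allFin n) (λ x → ℚP.+-identityʳ (nat n * (a x * a x) + S))) (trans (∑-+ (allFin n) (λ x → nat n * (a x * a x)) (λ _ → S)) (cong₂ _+_ (∑-*ˡ (allFin n) (nat n) _) (∑ᶠ-const n S))) ⟩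
      nat n * S + nat n * S ≡⟨ eq′ (nat n) S ⟩
      2ℚ * nat n * S ∎
    where
    open ≡-Reasoning
    S = ∑ᶠ n (λ x → a x * a x)
    eq : ∀ x y → (x - y) * (x - y) ≡ x * x + y * y + (- 2ℚ * x) * y
    eq = solve-∀ ring
    eq′ : ∀ a b → a * b + a * b ≡ 2ℚ * a * b
    eq′ = solve-∀ ring

  -- One coordinate at a time: a difference in a coordinate with vanishing sums multiplies the sum
  -- of squares by `2 n`, and differences of harmonic slices stay harmonic.
  ∑-diff : ∀ m (Q : V m → ℚ) → Har m Q → ∑ᵛ n m (λ xs → ∑ᵛ n m (λ ys → diff Q xs ys * diff Q xs ys)) ≡ (2ℚ * nat n) ^ℚ m * ∑ᵛ n m (λ v → Q v * Q v)
  ∑-diff zero Q h = trans (∑ᵛ-zero n (λ xs → ∑ᵛ n 0 (λ ys → diff Q xs ys * diff Q xs ys))) (trans (∑ᵛ-zero n (λ ys → diff Q [] ys * diff Q [] ys))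
    (trans (sym (ℚP.*-identityˡ (Q [] * Q []))) (cong (1ℚ *_) (sym (∑ᵛ-zero n (λ v → Q v * Q v))))))
  ∑-diff (suc m) Q (h , hs) = begin
      ∑ᵛ n (suc m) (λ xs → ∑ᵛ n (suc m) (λ ys → diff Q xs ys * diff Q xs ys))
        ≡⟨ trans (∑ᵛ-suc n m _) (∑-cong (allFin n) (λ x → trans (∑-cong (allVecs n m) (λ xs → ∑ᵛ-suc n m _)) (∑-swap (allVecs n m) (allFin n) _))) ⟩
      ∑ᶠ n (λ x → ∑ᶠ n (λ y → ∑ᵛ n m (λ xs → ∑ᵛ n m (λ ys → diff (D x y) xs ys * diff (D x y) xs ys))))
        ≡⟨ ∑-cong (allFin n) (λ x → ∑-cong (allFin n) (λ y → ∑-diff m (D x y) (har-- (hs x) (hs y)))) ⟩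
      ∑ᶠ n (λ x → ∑ᶠ n (λ y → c * ∑ᵛ n m (λ v → D x y v * D x y v)))
        ≡⟨ trans (∑-cong (allFin n) (λ x → ∑-*ˡ (allFin n) c _)) (∑-*ˡ (allFin n) c _) ⟩
      c * ∑ᶠ n (λ x → ∑ᶠ n (λ y → ∑ᵛ n m (λ v → D x y v * D x y v)))
        ≡⟨ cong (c *_) (trans (∑-cong (allFin n) (λ x → ∑-swap (allFin n) (allVecs n m) _)) (trans (∑-swap (allFin n) (allVecs n m) _) (∑-cong (allVecs n m) (λ v → ∑-differences (λ x → Q (x ∷ v)) (h v))))) ⟩
      c * ∑ᵛ n m (λ v → 2ℚ * nat n * ∑ᶠ n (λ x → Q (x ∷ v) * Q (x ∷ v)))
        ≡⟨ cong (c *_) (trans (∑-*ˡ (allVecs n m) (2ℚ * nat n) _) (cong (2ℚ * nat n *_) (trans (∑-swap (allVecs n m) (allFin n) _) (sym (∑ᵛ-suc n m _))))) ⟩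
      c * (2ℚ * nat n * ∑ᵛ n (suc m) (λ v → Q v * Q v))
        ≡⟨ eq c (2ℚ * nat n) _ ⟩
      2ℚ * nat n * c * ∑ᵛ n (suc m) (λ v → Q v * Q v) ∎
    where
    open ≡-Reasoning
    c = (2ℚ * nat n) ^ℚ m
    D : Fin n → Fin n → V m → ℚ
    D x y v = Q (x ∷ v) - Q (y ∷ v)
    eq : ∀ a b d → a * (b * d) ≡ b * a * d
    eq = solve-∀ ring

  -- The number of coincidences among the points x_l , y_l and the points counted by h.
  bad : ∀ {m} → (Fin n → ℚ) → V m → V m → ℚ
  bad h [] [] = 0ℚ
  bad h (x ∷ xs) (y ∷ ys) = [ x ≟ y ] + h x + h y + bad (λ z → [ z ≟ x ] + [ z ≟ y ] + h z) xs ys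

  bad-cong : ∀ {m} {h h′ : Fin n → ℚ} → (∀ z → h z ≡ h′ z) → ∀ (xs ys : V m) → bad h xs ys ≡ bad h′ xs ys
  bad-cong e [] [] = refl
  bad-cong e (x ∷ xs) (y ∷ ys) = cong₂ _+_ (cong₂ _+_ (cong ([ x ≟ y ] +_) (e x)) (e y)) (bad-cong (λ z → cong ([ z ≟ x ] + [ z ≟ y ] +_) (e z)) xs ys)

  0≤bad : ∀ {m} {h : Fin n → ℚ} → (∀ z → 0ℚ ≤ h z) → ∀ (xs ys : V m) → 0ℚ ≤ bad h xs ys
  0≤bad e [] [] = ℚP.≤-refl
  0≤bad e (x ∷ xs) (y ∷ ys) = 0≤+ (0≤+ (0≤+ (0≤≟ x y) (e x)) (e y)) (0≤bad (λ z → 0≤+ (0≤+ (0≤≟ z x) (0≤≟ z y)) (e z)) xs ys)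

  squares : ∀ {m} → (V m → ℚ) → V m → V m → ℚ
  squares Q [] [] = Q [] * Q []
  squares Q (x ∷ xs) (y ∷ ys) = squares (λ v → Q (x ∷ v)) xs ys + squares (λ v → Q (y ∷ v)) xs ys

  squares-- : ∀ {m} (Q Q′ : V m → ℚ) xs ys → squares (λ v → Q v - Q′ v) xs ys ≤ 2ℚ * (squares Q xs ys + squares Q′ xs ys)
  squares-- Q Q′ [] [] = 0≤-⇒≤ (subst (0ℚ ≤_) (eq (Q []) (Q′ [])) (0≤sq (Q [] + Q′ [])))
    where eq : ∀ a b → (a + b) * (a + b) ≡ 2ℚ * (a * a + b * b) - (a - b) * (a - b)
          eq = solve-∀ ring
  squares-- Q Q′ (x ∷ xs) (y ∷ ys) = ℚP.≤-trans (ℚP.+-mono-≤ (squares-- (λ v → Q (x ∷ v)) (λ v → Q′ (x ∷ v)) xs ys) (squares-- (λ v → Q (y ∷ v)) (λ v → Q′ (y ∷ v)) xs ys))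
      (ℚP.≤-reflexive (eq (squares (λ v → Q (x ∷ v)) xs ys) (squares (λ v → Q′ (x ∷ v)) xs ys) (squares (λ v → Q (y ∷ v)) xs ys) (squares (λ v → Q′ (y ∷ v)) xs ys)))
    where eq : ∀ a b c d → 2ℚ * (a + b) + 2ℚ * (c + d) ≡ 2ℚ * (a + c + (b + d))
          eq = solve-∀ ring

  diff²≤squares : ∀ {m} (Q : V m → ℚ) xs ys → diff Q xs ys * diff Q xs ys ≤ 2ℚ ^ℚ m * squares Q xs ys
  diff²≤squares Q [] [] = ℚP.≤-reflexive (sym (ℚP.*-identityˡ (Q [] * Q [])))
  diff²≤squares {suc m} Q (x ∷ xs) (y ∷ ys) = ℚP.≤-trans (diff²≤squares (λ v → Q (x ∷ v) - Q (y ∷ v)) xs ys)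
      (ℚP.≤-trans (*-monoˡ (0≤^ m 0≤2) (squares-- (λ v → Q (x ∷ v)) (λ v → Q (y ∷ v)) xs ys)) (ℚP.≤-reflexive (eq (2ℚ ^ℚ m) _)))
    where eq : ∀ a b → a * (2ℚ * b) ≡ 2ℚ * a * b
          eq = solve-∀ ring

  Sym : ∀ m → (V m → V m → ℚ) → Set
  Sym zero w = ⊤
  Sym (suc m) w = (∀ x y xs ys → w (x ∷ xs) (y ∷ ys) ≡ w (y ∷ xs) (x ∷ ys)) × (∀ x y → Sym m (λ xs ys → w (x ∷ xs) (y ∷ ys)))

  sym-bad : ∀ m c h → Sym m (λ xs ys → c + bad h xs ys)
  sym-bad zero c h = tt
  sym-bad (suc m) c h = (λ x y xs ys → cong (c +_) (cong₂ _+_ (trans (cong (λ z → z + h x + h y) (≟-sym x y)) (eq [ y ≟ x ] (h x) (h y)))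
      (bad-cong (λ z → cong (_+ h z) (ℚP.+-comm [ z ≟ x ] [ z ≟ y ])) xs ys))) ,
    λ x y → sym-resp m (λ xs ys → ℚP.+-assoc c ([ x ≟ y ] + h x + h y) (bad (h′ x y) xs ys)) (sym-bad m (c + ([ x ≟ y ] + h x + h y)) (h′ x y))
    where
    h′ : Fin n → Fin n → Fin n → ℚ
    h′ x y z = [ z ≟ x ] + [ z ≟ y ] + h z
    eq : ∀ a b c → a + b + c ≡ a + c + b
    eq = solve-∀ ring
    sym-resp : ∀ m {w w′ : V m → V m → ℚ} → (∀ xs ys → w xs ys ≡ w′ xs ys) → Sym m w → Sym m w′
    sym-resp zero e s = tt
    sym-resp (suc m) e (a , b) = (λ x y xs ys → trans (sym (e _ _)) (trans (a x y xs ys) (e _ _))) , λ x y → sym-resp m (λ xs ys → e (x ∷ xs) (y ∷ ys)) (b x y)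

  -- Exchanging the `l`-th entries of `xs` and `ys` permutes the `2^m` terms of `squares` and
  -- preserves the weight, so all terms have the same total.
  ∑-squares : ∀ m (w : V m → V m → ℚ) (Q : V m → ℚ) → Sym m w →
    ∑ᵛ n m (λ xs → ∑ᵛ n m (λ ys → w xs ys * squares Q xs ys)) ≡ 2ℚ ^ℚ m * ∑ᵛ n m (λ xs → ∑ᵛ n m (λ ys → w xs ys * (Q xs * Q xs)))
  ∑-squares zero w Q _ = sym (ℚP.*-identityˡ (w [] [] * (Q [] * Q []) + 0ℚ + 0ℚ))
  ∑-squares (suc m) w Q (s , ss) = begin
      ∑ᵛ n (suc m) (λ xs → ∑ᵛ n (suc m) (λ ys → w xs ys * squares Q xs ys))
        ≡⟨ unfold (λ xs ys → w xs ys * squares Q xs ys) ⟩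
      ∑ᶠ n (λ x → ∑ᶠ n (λ y → ∑ᵛ n m (λ xs → ∑ᵛ n m (λ ys → w (x ∷ xs) (y ∷ ys) * (squares (λ v → Q (x ∷ v)) xs ys + squares (λ v → Q (y ∷ v)) xs ys)))))
        ≡⟨ ∑∑-cong (λ x y → trans (∑-cong (allVecs n m) (λ xs → trans (∑-cong (allVecs n m) (λ ys → trans (ℚP.*-distribˡ-+ (w (x ∷ xs) (y ∷ ys)) (squares (λ v → Q (x ∷ v)) xs ys) (squares (λ v → Q (y ∷ v)) xs ys))
             (cong (w (x ∷ xs) (y ∷ ys) * squares (λ v → Q (x ∷ v)) xs ys +_) (cong (_* squares (λ v → Q (y ∷ v)) xs ys) (s x y xs ys))))) (∑-+ (allVecs n m) _ _))) (∑-+ (allVecs n m) _ _)) ⟩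
      ∑ᶠ n (λ x → ∑ᶠ n (λ y → X x y + X y x))
        ≡⟨ trans (∑-cong (allFin n) (λ x → ∑-+ (allFin n) (X x) (λ y → X y x))) (∑-+ (allFin n) _ _) ⟩
      ∑ᶠ n (λ x → ∑ᶠ n (X x)) + ∑ᶠ n (λ x → ∑ᶠ n (λ y → X y x))
        ≡⟨ cong (∑ᶠ n (λ x → ∑ᶠ n (X x)) +_) (∑-swap (allFin n) (allFin n) (λ x y → X y x)) ⟩
      ∑ᶠ n (λ x → ∑ᶠ n (X x)) + ∑ᶠ n (λ x → ∑ᶠ n (X x))
        ≡⟨ cong (λ z → z + z) (trans (∑∑-cong (λ x y → ∑-squares m (λ xs ys → w (x ∷ xs) (y ∷ ys)) (λ v → Q (x ∷ v)) (ss x y))) (trans (∑-cong (allFin n) (λ x → ∑-*ˡ (allFin n) (2ℚ ^ℚ m) _)) (∑-*ˡ (allFin n) (2ℚ ^ℚ m) _))) ⟩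
      2ℚ ^ℚ m * Y + 2ℚ ^ℚ m * Y ≡⟨ eq (2ℚ ^ℚ m) Y ⟩
      2ℚ * 2ℚ ^ℚ m * Y ≡⟨ cong (2ℚ * 2ℚ ^ℚ m *_) (sym (unfold (λ xs ys → w xs ys * (Q xs * Q xs)))) ⟩
      2ℚ * 2ℚ ^ℚ m * ∑ᵛ n (suc m) (λ xs → ∑ᵛ n (suc m) (λ ys → w xs ys * (Q xs * Q xs))) ∎
    where
    open ≡-Reasoning
    ∑∑-cong : {f g : Fin n → Fin n → ℚ} → (∀ u v → f u v ≡ g u v) → ∑ᶠ n (λ u → ∑ᶠ n (f u)) ≡ ∑ᶠ n (λ u → ∑ᶠ n (g u))
    ∑∑-cong h = ∑-cong (allFin n) (λ u → ∑-cong (allFin n) (h u))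
    unfold : (f : V (suc m) → V (suc m) → ℚ) → ∑ᵛ n (suc m) (λ xs → ∑ᵛ n (suc m) (f xs)) ≡ ∑ᶠ n (λ x → ∑ᶠ n (λ y → ∑ᵛ n m (λ xs → ∑ᵛ n m (λ ys → f (x ∷ xs) (y ∷ ys)))))
    unfold f = trans (∑ᵛ-suc n m _) (∑-cong (allFin n) (λ x → trans (∑-cong (allVecs n m) (λ xs → ∑ᵛ-suc n m (f (x ∷ xs)))) (∑-swap (allVecs n m) (allFin n) _)))
    X : Fin n → Fin n → ℚ
    X x y = ∑ᵛ n m (λ xs → ∑ᵛ n m (λ ys → w (x ∷ xs) (y ∷ ys) * squares (λ v → Q (x ∷ v)) xs ys))
    Y = ∑ᶠ n (λ x → ∑ᶠ n (λ y → ∑ᵛ n m (λ xs → ∑ᵛ n m (λ ys → w (x ∷ xs) (y ∷ ys) * (Q (x ∷ xs) * Q (x ∷ xs))))))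
    eq : ∀ a b → a * b + a * b ≡ 2ℚ * a * b
    eq = solve-∀ ring

  -- For distinct `xs` the mean of `bad` over uniform `ys`, starting with no points, is this number
  -- divided by `n`. A new pair can coincide within itself in one way and with each other pair in
  -- three, because two entries of `xs` never coincide.
  coincidences : ℕ → ℕ
  coincidences zero = 0
  coincidences (suc m) = suc (3 ℕ.* m) ℕ.+ coincidences m

  hits : ∀ {m} → (Fin n → ℚ) → V m → ℚ
  hits h [] = 0ℚ
  hits h (x ∷ xs) = h x + hits h xs

  hits-+ : ∀ {m} (g h : Fin n → ℚ) (xs : V m) → hits (λ z → g z + h z) xs ≡ hits g xs + hits h xs
  hits-+ g h [] = refl
  hits-+ g h (x ∷ xs) = trans (cong (g x + h x +_) (hits-+ g h xs)) (eq (g x) (h x) (hits g xs) (hits h xs))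
    where eq : ∀ a b c d → a + b + (c + d) ≡ a + c + (b + d)
          eq = solve-∀ ring

  hits-∉ : ∀ {m} x (xs : V m) → x ∉ᵛ xs → hits [_≟ x ] xs ≡ 0ℚ
  hits-∉ x [] _ = refl
  hits-∉ x (y ∷ xs) (x≢y , h) = cong₂ _+_ (≟-≢ (x≢y ∘ sym)) (hits-∉ x xs h)

  ∑-hits : ∀ {m} (xs : V m) → ∑ᶠ n (λ y → hits [_≟ y ] xs) ≡ nat m
  ∑-hits [] = trans (∑-0 (allFin n)) (sym nat-0)
  ∑-hits {suc m} (x ∷ xs) = trans (∑-+ (allFin n) (λ y → [ x ≟ y ]) (λ y → hits [_≟ y ] xs)) (trans (cong₂ _+_ (∑-≟ x) (∑-hits xs)) (sym (nat-suc m)))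

  ∑-bad : ∀ m (h : Fin n → ℚ) (xs : V m) → AllDistinct xs →
    nat n * ∑ᵛ n m (bad h xs) ≡ nat n ^ℚ m * (nat n * hits h xs + nat m * ∑ᶠ n h + nat (coincidences m))
  ∑-bad zero h [] _ = trans (cong (nat n *_) (∑ᵛ-zero n (bad h []))) (sym (trans (cong (λ z → 1ℚ * (nat n * 0ℚ + z * ∑ᶠ n h + z)) nat-0) (eq (nat n) (∑ᶠ n h))))
    where eq : ∀ a b → 1ℚ * (a * 0ℚ + 0ℚ * b + 0ℚ) ≡ a * 0ℚ
          eq = solve-∀ ring
  ∑-bad (suc m) h (x ∷ xs) (x∉xs , dist) = begin
      N * ∑ᵛ n (suc m) (bad h (x ∷ xs))
        ≡⟨ cong (N *_) (trans (∑ᵛ-suc n m (bad h (x ∷ xs))) (∑-cong (allFin n) (λ y → trans (∑-+ (allVecs n m) (λ _ → [ x ≟ y ] + h x + h y) (bad (h′ y) xs)) (cong (_+ ∑ᵛ n m (bad (h′ y) xs)) (∑ᵛ-const n m ([ x ≟ y ] + h x + h y)))))) ⟩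
      N * ∑ᶠ n (λ y → P * ([ x ≟ y ] + h x + h y) + ∑ᵛ n m (bad (h′ y) xs))
        ≡⟨ trans (sym (∑-*ˡ (allFin n) N _)) (∑-cong (allFin n) (λ y → trans (ℚP.*-distribˡ-+ N (P * ([ x ≟ y ] + h x + h y)) (∑ᵛ n m (bad (h′ y) xs)))
             (trans (cong (N * (P * ([ x ≟ y ] + h x + h y)) +_) (trans (∑-bad m (h′ y) xs dist) (cong₂ (λ a b → P * (N * a + nat m * b + C)) (hits′ y) (∑h′ y))))
               (eq₁ N P [ x ≟ y ] (h x) (h y) (hits [_≟ y ] xs) (hits h xs) (nat m) H C)))) ⟩
      ∑ᶠ n (λ y → P * (N * [ x ≟ y ] + N * h y + N * hits [_≟ y ] xs) + P * (N * h x + N * hits h xs + nat m * (2ℚ + H) + C))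
        ≡⟨ trans (∑-+ (allFin n) _ _) (cong₂ _+_ (trans (∑-*ˡ (allFin n) P _) (cong (P *_) (trans (∑-+ (allFin n) _ _) (cong₂ _+_ (trans (∑-+ (allFin n) _ _) (cong₂ _+_ (trans (∑-*ˡ (allFin n) N _) (cong (N *_) (∑-≟ x))) (∑-*ˡ (allFin n) N h)))
             (trans (∑-*ˡ (allFin n) N _) (cong (N *_) (∑-hits xs)))))))
             (∑ᶠ-const n _)) ⟩
      P * (N * 1ℚ + N * H + N * nat m) + N * (P * (N * h x + N * hits h xs + nat m * (2ℚ + H) + C))
        ≡⟨ eq₂ N P H (nat m) (h x) (hits h xs) C ⟩
      N * P * (N * (h x + hits h xs) + (1ℚ + nat m) * H + (1ℚ + (1ℚ + 1ℚ + 1ℚ) * nat m + C))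
        ≡⟨ cong₂ (λ a b → N * P * (N * (h x + hits h xs) + a * H + b)) (sym (nat-suc m)) (sym const) ⟩
      N * P * (N * (h x + hits h xs) + nat (suc m) * H + nat (coincidences (suc m))) ∎
    where
    open ≡-Reasoning
    N = nat n
    P = nat n ^ℚ m
    C = nat (coincidences m)
    H = ∑ᶠ n h
    h′ : Fin n → Fin n → ℚ
    h′ y z = [ z ≟ x ] + [ z ≟ y ] + h z
    hits′ : ∀ y → hits (h′ y) xs ≡ hits [_≟ y ] xs + hits h xs
    hits′ y = trans (hits-+ (λ z → [ z ≟ x ] + [ z ≟ y ]) h xs) (cong (_+ hits h xs) (trans (hits-+ [_≟ x ] [_≟ y ] xs) (trans (cong (_+ hits [_≟ y ] xs) (hits-∉ x xs x∉xs)) (ℚP.+-identityˡ (hits [_≟ y ] xs)))))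
    one : ∀ z → ∑ᶠ n [_≟ z ] ≡ 1ℚ
    one z = trans (∑-cong (allFin n) (λ y → ≟-sym y z)) (∑-≟ z)
    ∑h′ : ∀ y → ∑ᶠ n (h′ y) ≡ 2ℚ + H
    ∑h′ y = trans (∑-+ (allFin n) (λ z → [ z ≟ x ] + [ z ≟ y ]) h) (cong (_+ H) (trans (∑-+ (allFin n) [_≟ x ] [_≟ y ]) (cong₂ _+_ (one x) (one y))))
    const : nat (coincidences (suc m)) ≡ 1ℚ + (1ℚ + 1ℚ + 1ℚ) * nat m + C
    const = trans (nat-+ (suc (3 ℕ.* m)) (coincidences m)) (cong (_+ C) (trans (nat-suc (3 ℕ.* m)) (cong (1ℚ +_) (trans (nat-* 3 m) (cong (_* nat m)
      (trans (nat-suc 2) (trans (cong (1ℚ +_) (trans (nat-suc 1) (cong (1ℚ +_) nat-1))) refl)))))))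
    eq₁ : ∀ N P e a b g k m H C → N * (P * (e + a + b)) + P * (N * (g + k) + m * (2ℚ + H) + C) ≡ P * (N * e + N * b + N * g) + P * (N * a + N * k + m * (2ℚ + H) + C)
    eq₁ = solve-∀ ring
    eq₂ : ∀ N P H m a k C → P * (N * 1ℚ + N * H + N * m) + N * (P * (N * a + N * k + m * (2ℚ + H) + C)) ≡ N * P * (N * (a + k) + (1ℚ + m) * H + (1ℚ + (1ℚ + 1ℚ + 1ℚ) * m + C))
    eq₂ = solve-∀ ring

  no-coincidence : ∀ {m} (h : Fin n → ℚ) → (∀ z → 0ℚ ≤ h z) → (xs ys : V m) → (Disjoint (Vec.zip xs ys)) ⊎ 1ℚ ≤ bad h xs ys
  no-coincidence h 0≤h [] [] = inj₁ tt
  no-coincidence {suc m} h 0≤h (x ∷ xs) (y ∷ ys) with 0∨1 x y | no-coincidence h′ 0≤h′ xs ys | outside x xs ys | outside y xs ys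
    where
    h′ : Fin n → ℚ
    h′ z = [ z ≟ x ] + [ z ≟ y ] + h z
    0≤h′ : ∀ z → 0ℚ ≤ h′ z
    0≤h′ z = 0≤+ (0≤+ (0≤≟ z x) (0≤≟ z y)) (0≤h z)
    outside : ∀ {m} z (xs ys : V m) → Fresh z (Vec.zip xs ys) ⊎ (∀ h → (∀ w → 0ℚ ≤ h w) → 1ℚ ≤ h z → 1ℚ ≤ bad h xs ys)
    outside z [] [] = inj₁ tt
    outside z (a ∷ as) (b ∷ bs) with z FinP.≟ a | z FinP.≟ b | outside z as bs
    ... | yes refl | _ | _ = inj₂ λ h 0≤h 1≤h → le [ z ≟ b ] (h z) (h b) _ (0≤≟ z b) 1≤h (0≤h b) (0≤bad (λ w → 0≤+ (0≤+ (0≤≟ w z) (0≤≟ w b)) (0≤h w)) as bs)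
      where le : ∀ p q r s → 0ℚ ≤ p → 1ℚ ≤ q → 0ℚ ≤ r → 0ℚ ≤ s → 1ℚ ≤ p + q + r + s
            le p q r s hp hq hr hs = ℚP.+-mono-≤ {1ℚ} {p + q + r} {0ℚ} {s} (ℚP.+-mono-≤ {1ℚ} {p + q} {0ℚ} {r} (ℚP.+-mono-≤ {0ℚ} {p} {1ℚ} {q} hp hq) hr) hs
    ... | no _ | yes refl | _ = inj₂ λ h 0≤h 1≤h → le [ a ≟ z ] (h a) (h z) _ (0≤≟ a z) (0≤h a) 1≤h (0≤bad (λ w → 0≤+ (0≤+ (0≤≟ w a) (0≤≟ w z)) (0≤h w)) as bs)
      where le : ∀ p q r s → 0ℚ ≤ p → 0ℚ ≤ q → 1ℚ ≤ r → 0ℚ ≤ s → 1ℚ ≤ p + q + r + s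
            le p q r s hp hq hr hs = ℚP.+-mono-≤ {1ℚ} {p + q + r} {0ℚ} {s} (ℚP.+-mono-≤ {0ℚ} {p + q} {1ℚ} {r} (ℚP.+-mono-≤ {0ℚ} {p} {0ℚ} {q} hp hq) hr) hs
    ... | no z≢a | no z≢b | inj₁ f = inj₁ (z≢a , z≢b , f)
    ... | no z≢a | no z≢b | inj₂ f = inj₂ λ h 0≤h 1≤h → ℚP.+-mono-≤ {0ℚ} {[ a ≟ b ] + h a + h b} {1ℚ} (0≤+ (0≤+ (0≤≟ a b) (0≤h a)) (0≤h b))
        (f (λ w → [ w ≟ a ] + [ w ≟ b ] + h w) (λ w → 0≤+ (0≤+ (0≤≟ w a) (0≤≟ w b)) (0≤h w)) (ℚP.+-mono-≤ {0ℚ} {[ z ≟ a ] + [ z ≟ b ]} {1ℚ} (0≤+ (0≤≟ z a) (0≤≟ z b)) 1≤h))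
  ... | inj₁ (_ , e) | _ | _ | _ = inj₂ (ℚP.+-mono-≤ {1ℚ} {[ x ≟ y ] + h x + h y} {0ℚ} (ℚP.+-mono-≤ {1ℚ} {[ x ≟ y ] + h x} {0ℚ} (ℚP.+-mono-≤ {1ℚ} {[ x ≟ y ]} {0ℚ} (ℚP.≤-reflexive (sym e)) (0≤h x)) (0≤h y))
      (0≤bad (λ z → 0≤+ (0≤+ (0≤≟ z x) (0≤≟ z y)) (0≤h z)) xs ys))
  ... | inj₂ _ | inj₂ b | _ | _ = inj₂ (ℚP.+-mono-≤ {0ℚ} {[ x ≟ y ] + h x + h y} {1ℚ} (0≤+ (0≤+ (0≤≟ x y) (0≤h x)) (0≤h y)) b)
  ... | inj₂ (x≢y , _) | inj₁ d | inj₁ fx | inj₁ fy = inj₁ (x≢y , fx , fy , d)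
  ... | inj₂ _ | inj₁ _ | inj₂ b | _ = inj₂ (ℚP.+-mono-≤ {0ℚ} {[ x ≟ y ] + h x + h y} {1ℚ} (0≤+ (0≤+ (0≤≟ x y) (0≤h x)) (0≤h y))
      (b (λ z → [ z ≟ x ] + [ z ≟ y ] + h z) (λ z → 0≤+ (0≤+ (0≤≟ z x) (0≤≟ z y)) (0≤h z))
        (ℚP.+-mono-≤ {1ℚ} {[ x ≟ x ] + [ x ≟ y ]} {0ℚ} (ℚP.+-mono-≤ {1ℚ} {[ x ≟ x ]} {0ℚ} (ℚP.≤-reflexive (sym (≟-refl x))) (0≤≟ x y)) (0≤h x))))
  ... | inj₂ _ | inj₁ _ | inj₁ _ | inj₂ b = inj₂ (ℚP.+-mono-≤ {0ℚ} {[ x ≟ y ] + h x + h y} {1ℚ} (0≤+ (0≤+ (0≤≟ x y) (0≤h x)) (0≤h y))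
      (b (λ z → [ z ≟ x ] + [ z ≟ y ] + h z) (λ z → 0≤+ (0≤+ (0≤≟ z x) (0≤≟ z y)) (0≤h z))
        (ℚP.+-mono-≤ {1ℚ} {[ y ≟ x ] + [ y ≟ y ]} {0ℚ} (ℚP.+-mono-≤ {0ℚ} {[ y ≟ x ]} {1ℚ} (0≤≟ y x) (ℚP.≤-reflexive (sym (≟-refl y)))) (0≤h y))))

  -- For a harmonic Q the pairs of tuples with a coincidence carry a negligible part of ∑ (diff Q)².
  disjoint-part : ∀ m (Q : V (suc m) → ℚ) → Har (suc m) Q → (∀ xs → AllDistinct xs ⊎ Q xs ≡ 0ℚ) →
    2ℚ ^ℚ suc m * 2ℚ ^ℚ suc m * nat (coincidences (suc m)) ≤ nat n → 0ℚ < nat n →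
    (Φ : V (suc m) → V (suc m) → ℚ) → (∀ xs ys → 0ℚ ≤ Φ xs ys) → (∀ xs ys → Disjoint (Vec.zip xs ys) → diff Q xs ys * diff Q xs ys ≤ Φ xs ys) →
    nat n ^ℚ suc m * ∑ᵛ n (suc m) (λ v → Q v * Q v) ≤ ∑ᵛ n (suc m) (λ xs → ∑ᵛ n (suc m) (Φ xs))
  disjoint-part m Q har supp big 0<n Φ 0≤Φ hΦ = 0≤-⇒≤ (ℚP.≤-trans (≤⇒0≤- total) (0≤-⇒≤ (subst (0ℚ ≤_) (eq P S (2ℚ ^ℚ m) W) (0≤* (0≤* 0≤2 (≤⇒0≤- (1≤^ m 1≤2))) (0≤* 0≤P 0≤S)))))
    where
    open ≤R
    N = nat n
    P = N ^ℚ suc m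
    S = ∑ᵛ n (suc m) (λ v → Q v * Q v)
    W = ∑ᵛ n (suc m) (λ xs → ∑ᵛ n (suc m) (Φ xs))
    1≤2 : 1ℚ ≤ 2ℚ
    1≤2 = ℚP.+-monoʳ-≤ 1ℚ {0ℚ} {1ℚ} 0≤1
    0≤P = 0≤^ (suc m) (0≤nat n)
    0≤S : 0ℚ ≤ S
    0≤S = 0≤∑ (allVecs n (suc m)) (λ v → 0≤sq (Q v))
    z : Fin n → ℚ
    z _ = 0ℚ
    c = 2ℚ ^ℚ suc m
    0≤c = 0≤^ (suc m) 0≤2
    C = nat (coincidences (suc m))
    pointwise : ∀ xs ys → diff Q xs ys * diff Q xs ys ≤ Φ xs ys + c * (bad z xs ys * squares Q xs ys)
    pointwise xs ys with no-coincidence z (λ _ → ℚP.≤-refl) xs ys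
    ... | inj₁ d = subst (_≤ Φ xs ys + c * (bad z xs ys * squares Q xs ys)) (ℚP.+-identityʳ _) (ℚP.+-mono-≤ (hΦ xs ys d) (0≤* 0≤c (0≤* (0≤bad (λ _ → ℚP.≤-refl) xs ys) 0≤squares)))
      where 0≤squares : 0ℚ ≤ squares Q xs ys
            0≤squares = cancelˡ (0<^ (suc m) (ℚP.positive⁻¹ 2ℚ)) (ℚP.≤-trans (ℚP.≤-reflexive (ℚP.*-zeroʳ c)) (ℚP.≤-trans (0≤sq (diff Q xs ys)) (diff²≤squares Q xs ys)))
    ... | inj₂ b = subst (_≤ Φ xs ys + c * (bad z xs ys * squares Q xs ys)) (ℚP.+-identityˡ _) (ℚP.+-mono-≤ (0≤Φ xs ys) (ℚP.≤-trans (diff²≤squares Q xs ys) (*-monoˡ 0≤c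
        (subst (_≤ bad z xs ys * squares Q xs ys) (ℚP.*-identityˡ (squares Q xs ys)) (*-monoʳ 0≤squares b)))))
      where 0≤squares : 0ℚ ≤ squares Q xs ys
            0≤squares = cancelˡ (0<^ (suc m) (ℚP.positive⁻¹ 2ℚ)) (ℚP.≤-trans (ℚP.≤-reflexive (ℚP.*-zeroʳ c)) (ℚP.≤-trans (0≤sq (diff Q xs ys)) (diff²≤squares Q xs ys)))
    -- One factor `c` is lost in `diff²≤squares` and the other counts the terms of `squares`;
    -- hypothesis `big` pays for both and for the mean number of coincidences.
    bad-sum : ∑ᵛ n (suc m) (λ xs → ∑ᵛ n (suc m) (λ ys → c * (bad z xs ys * squares Q xs ys))) ≤ P * S
    bad-sum = cancelˡ 0<n (begin
        N * ∑ᵛ n (suc m) (λ xs → ∑ᵛ n (suc m) (λ ys → c * (bad z xs ys * squares Q xs ys)))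
          ≡⟨ cong (N *_) (trans (∑-cong (allVecs n (suc m)) (λ xs → ∑-*ˡ (allVecs n (suc m)) c _)) (trans (∑-*ˡ (allVecs n (suc m)) c _) (cong (c *_)
               (trans (∑-cong (allVecs n (suc m)) (λ xs → ∑-cong (allVecs n (suc m)) (λ ys → cong (_* squares Q xs ys) (sym (ℚP.+-identityˡ (bad z xs ys))))))
               (trans (∑-squares (suc m) (λ xs ys → 0ℚ + bad z xs ys) Q (sym-bad (suc m) 0ℚ z))
               (cong (c *_) (∑-cong (allVecs n (suc m)) (λ xs → trans (∑-cong (allVecs n (suc m)) (λ ys → cong (_* (Q xs * Q xs)) (ℚP.+-identityˡ (bad z xs ys)))) (∑-*ʳ (allVecs n (suc m)) (bad z xs) (Q xs * Q xs)))))))))) ⟩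
        N * (c * (c * ∑ᵛ n (suc m) (λ xs → ∑ᵛ n (suc m) (bad z xs) * (Q xs * Q xs))))
          ≡⟨ eq₁ N c _ ⟩
        c * c * (N * ∑ᵛ n (suc m) (λ xs → ∑ᵛ n (suc m) (bad z xs) * (Q xs * Q xs)))
          ≡⟨ cong (c * c *_) (trans (sym (∑-*ˡ (allVecs n (suc m)) N _)) (trans (∑-cong (allVecs n (suc m)) each) (∑-*ˡ (allVecs n (suc m)) (P * C) _))) ⟩
        c * c * (P * C * S) ≡⟨ eq₂ (c * c) P C S ⟩
        c * c * C * (P * S) ≤⟨ *-monoʳ (0≤* 0≤P 0≤S) big ⟩
        N * (P * S) ∎)
      where
      eq₁ : ∀ a b d → a * (b * (b * d)) ≡ b * b * (a * d)
      eq₁ = solve-∀ ring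
      eq₂ : ∀ a b d e → a * (b * d * e) ≡ a * d * (b * e)
      eq₂ = solve-∀ ring
      hits-0 : ∀ {k} (xs : V k) → hits z xs ≡ 0ℚ
      hits-0 [] = refl
      hits-0 (x ∷ xs) = trans (ℚP.+-identityˡ (hits z xs)) (hits-0 xs)
      each : ∀ xs → N * (∑ᵛ n (suc m) (bad z xs) * (Q xs * Q xs)) ≡ P * C * (Q xs * Q xs)
      each xs with supp xs
      ... | inj₂ e = trans (cong (λ q → N * (∑ᵛ n (suc m) (bad z xs) * (q * q))) e) (trans (eq₃ N (∑ᵛ n (suc m) (bad z xs)) (P * C)) (cong (λ q → P * C * (q * q)) (sym e)))
        where eq₃ : ∀ a b d → a * (b * (0ℚ * 0ℚ)) ≡ d * (0ℚ * 0ℚ)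
              eq₃ = solve-∀ ring
      ... | inj₁ d = trans (sym (ℚP.*-assoc N _ (Q xs * Q xs))) (cong (_* (Q xs * Q xs)) (trans (∑-bad (suc m) z xs d) (cong (P *_)
          (trans (cong₂ (λ a b → N * a + nat (suc m) * b + C) (hits-0 xs) (∑-0 (allFin n))) (eq₃ N (nat (suc m)) C)))))
        where eq₃ : ∀ a b d → a * 0ℚ + b * 0ℚ + d ≡ d
              eq₃ = solve-∀ ring
    -- The full sum is `2^(m + 1) * (P * S)` and coincidences account for at most `P * S`, so at
    -- least `P * S` remains for the disjoint tuples.
    total : 2ℚ * 2ℚ ^ℚ m * (P * S) ≤ W + P * S
    total = begin
        2ℚ * 2ℚ ^ℚ m * (P * S) ≡⟨ trans (cong (_* S) (^-* 2ℚ N (suc m))) (ℚP.*-assoc c P S) ⟨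
        (2ℚ * N) ^ℚ suc m * S ≡⟨ ∑-diff (suc m) Q har ⟨
        ∑ᵛ n (suc m) (λ xs → ∑ᵛ n (suc m) (λ ys → diff Q xs ys * diff Q xs ys)) ≤⟨ ∑-mono (allVecs n (suc m)) (λ xs → ∑-mono (allVecs n (suc m)) (pointwise xs)) ⟩
        ∑ᵛ n (suc m) (λ xs → ∑ᵛ n (suc m) (λ ys → Φ xs ys + c * (bad z xs ys * squares Q xs ys))) ≡⟨ trans (∑-cong (allVecs n (suc m)) (λ xs → ∑-+ (allVecs n (suc m)) (Φ xs) _)) (∑-+ (allVecs n (suc m)) _ _) ⟩
        W + ∑ᵛ n (suc m) (λ xs → ∑ᵛ n (suc m) (λ ys → c * (bad z xs ys * squares Q xs ys))) ≤⟨ ℚP.+-monoʳ-≤ W bad-sum ⟩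
        W + P * S ∎
    eq : ∀ p s k w → 2ℚ * (k - 1ℚ) * (p * s) ≡ w - p * s - (w + p * s - 2ℚ * k * (p * s))
    eq = solve-∀ ring

-- From differences to coefficients

sub-tuples : {A : Set} (m : ℕ) {k : ℕ} → Vec A k → List (Vec A m)
sub-tuples zero v = [] ∷ []
sub-tuples (suc m) [] = []
sub-tuples (suc m) (p ∷ ps) = map (p ∷_) (sub-tuples m ps) ++ sub-tuples (suc m) ps

choose : ℕ → ℕ → ℕ
choose zero k = 1
choose (suc m) zero = 0
choose (suc m) (suc k) = choose m k ℕ.+ choose (suc m) k

length-sub-tuples : {A : Set} (m : ℕ) {k : ℕ} (v : Vec A k) → length (sub-tuples m v) ≡ choose m k
length-sub-tuples zero v = refl
length-sub-tuples (suc m) [] = refl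
length-sub-tuples (suc m) (p ∷ ps) = trans (ListP.length-++ (map (p ∷_) (sub-tuples m ps)))
  (cong₂ ℕ._+_ (trans (ListP.length-map (p ∷_) (sub-tuples m ps)) (length-sub-tuples m ps)) (length-sub-tuples (suc m) ps))

choose-mono : ∀ m {k l} → k ℕ.≤ l → choose m k ℕ.≤ choose m l
choose-mono zero h = ℕP.≤-refl
choose-mono (suc m) ℕ.z≤n = ℕ.z≤n
choose-mono (suc m) (ℕ.s≤s h) = ℕP.+-mono-≤ (choose-mono m h) (choose-mono (suc m) h)

choose-+ : ∀ m h j → j ℕ.* choose m h ℕ.≤ choose (suc m) (j ℕ.+ h)
choose-+ m h zero = ℕ.z≤n
choose-+ m h (suc j) = ℕP.+-mono-≤ (choose-mono m (ℕP.m≤n+m h j)) (choose-+ m h j)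

-- Take the first element from the first half and the others from the second half; each choice thus
-- halves the supply.
q^m≤choose : ∀ m q → q ℕ.^ m ℕ.≤ choose m (2 ℕ.^ m ℕ.* q)
q^m≤choose zero q = ℕP.≤-refl
q^m≤choose (suc m) q = ℕP.≤-trans (ℕP.*-mono-≤ (ℕP.m≤n*m q (2 ℕ.^ m) {{ℕP.m^n≢0 2 m}}) (q^m≤choose m q))
  (ℕP.≤-trans (choose-+ m (2 ℕ.^ m ℕ.* q) (2 ℕ.^ m ℕ.* q)) (ℕP.≤-reflexive (cong (choose (suc m)) (eq (2 ℕ.^ m) q))))
  where eq : ∀ a b → a ℕ.* b ℕ.+ a ℕ.* b ≡ 2 ℕ.* a ℕ.* b
        eq = ℕR.solve-∀

module _ {n : ℕ} where

  fresh-sub : ∀ m {k z} (ps : Vec (Pair n) k) → Fresh z ps → All (Fresh z) (sub-tuples m ps)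
  fresh-sub zero ps f = tt ∷ []
  fresh-sub (suc m) [] f = []
  fresh-sub (suc m) (p ∷ ps) (a , b , f) = AllP.++⁺ (AllP.map⁺ (All.map (λ g → a , b , g) (fresh-sub m ps f))) (fresh-sub (suc m) ps f)

  disjoint-sub : ∀ m {k} (ps : Vec (Pair n) k) → Disjoint ps → All Disjoint (sub-tuples m ps)
  disjoint-sub zero ps d = tt ∷ []
  disjoint-sub (suc m) [] d = []
  disjoint-sub (suc m) ((x , y) ∷ ps) (x≢y , fx , fy , d) = AllP.++⁺
    (AllP.map⁺ (All.zipWith (λ { (a , b , c) → x≢y , a , b , c }) (fresh-sub m ps fx , All.zipWith id (fresh-sub m ps fy , disjoint-sub m ps d))))
    (disjoint-sub (suc m) ps d)

module LevelMoments {n : ℕ} (𝓖 : PermGroup n) where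
  open PermGroup 𝓖
  open Functions 𝓖
  open Values 𝓖
  open Indicators 𝓖
  open Juntas 𝓖
  open Harmonic {n}

  private
    V : ℕ → Set
    V = Vec (Fin n)

  ind-++ : ∀ {a b} (I : V a) (I′ : V b) K K′ σ → ind (I Vec.++ I′) (K Vec.++ K′) σ ≡ ind I K σ * ind I′ K′ σ
  ind-++ [] I′ [] K′ σ = sym (ℚP.*-identityˡ (ind I′ K′ σ))
  ind-++ (x ∷ I) I′ (u ∷ K) K′ σ = trans (cong ([ σ ⟨ x ⟩ ≟ u ] *_) (ind-++ I I′ K K′ σ)) (sym (ℚP.*-assoc [ σ ⟨ x ⟩ ≟ u ] (ind I K σ) (ind I′ K′ σ)))

  J-ind* : ∀ {i p} x u → J i p → J (suc i) (λ σ → [ σ ⟨ x ⟩ ≟ u ] * p σ)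
  J-ind* {i} x u (gen p∈) = juntas-elim {Q = λ p → J (suc i) (λ σ → [ σ ⟨ x ⟩ ≟ u ] * p σ)} (λ I K → ind∈J (x ∷ I) (u ∷ K)) p∈
  J-ind* x u (null h) = null (λ σ → trans (cong ([ σ ⟨ x ⟩ ≟ u ] *_) (h σ)) (ℚP.*-zeroʳ [ σ ⟨ x ⟩ ≟ u ]))
  J-ind* x u (add {p} {q} s t h) = add (J-ind* x u s) (J-ind* x u t) (λ σ → trans (cong ([ σ ⟨ x ⟩ ≟ u ] *_) (h σ)) (ℚP.*-distribˡ-+ [ σ ⟨ x ⟩ ≟ u ] (p σ) (q σ)))
  J-ind* x u (scale {p} c s h) = scale c (J-ind* x u s) (λ σ → trans (cong ([ σ ⟨ x ⟩ ≟ u ] *_) (h σ)) (x*yz≡y*xz [ σ ⟨ x ⟩ ≟ u ] c (p σ)))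

  -- A repeated point makes one factor of the indicator redundant or contradictory, so the indicator
  -- belongs to the level below.
  repetition : ∀ {i} (I : V (suc i)) → AllDistinct I ⊎ (∀ K → J i (ind I K))
  repetition {zero} (x ∷ []) = inj₁ (tt , tt)
  repetition {suc i} (x ∷ I) with repetition I | x∈?I I
    where
    x∈?I : ∀ {i} (I : V i) → x ∉ᵛ I ⊎ (∀ u K → (∀ σ → [ σ ⟨ x ⟩ ≟ u ] * ind I K σ ≡ ind I K σ) ⊎ (∀ σ → [ σ ⟨ x ⟩ ≟ u ] * ind I K σ ≡ 0ℚ))
    x∈?I [] = inj₁ tt
    x∈?I (y ∷ I) with x FinP.≟ y | x∈?I I
    ... | no x≢y | inj₁ h = inj₁ (x≢y , h)
    ... | no x≢y | inj₂ h = inj₂ λ { u (w ∷ K) → case h u K of λ where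
            (inj₁ a) → inj₁ λ σ → trans (x*yz≡y*xz [ σ ⟨ x ⟩ ≟ u ] [ σ ⟨ y ⟩ ≟ w ] (ind I K σ)) (cong ([ σ ⟨ y ⟩ ≟ w ] *_) (a σ))
            (inj₂ a) → inj₂ λ σ → trans (x*yz≡y*xz [ σ ⟨ x ⟩ ≟ u ] [ σ ⟨ y ⟩ ≟ w ] (ind I K σ)) (trans (cong ([ σ ⟨ y ⟩ ≟ w ] *_) (a σ)) (ℚP.*-zeroʳ [ σ ⟨ y ⟩ ≟ w ])) }
    ... | yes refl | _ = inj₂ λ { u (w ∷ K) → same u w K (u FinP.≟ w) }
      where
      same : ∀ u w K → Dec (u ≡ w) → (∀ σ → [ σ ⟨ x ⟩ ≟ u ] * ([ σ ⟨ x ⟩ ≟ w ] * ind I K σ) ≡ [ σ ⟨ x ⟩ ≟ w ] * ind I K σ) ⊎ (∀ σ → [ σ ⟨ x ⟩ ≟ u ] * ([ σ ⟨ x ⟩ ≟ w ] * ind I K σ) ≡ 0ℚ)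
      same u .u K (yes refl) = inj₁ λ σ → trans (sym (ℚP.*-assoc [ σ ⟨ x ⟩ ≟ u ] [ σ ⟨ x ⟩ ≟ u ] (ind I K σ))) (cong (_* ind I K σ) (≟-idem (σ ⟨ x ⟩) u))
      same u w K (no u≢w) = inj₂ zero-product
        where
        zero-product : ∀ σ → [ σ ⟨ x ⟩ ≟ u ] * ([ σ ⟨ x ⟩ ≟ w ] * ind I K σ) ≡ 0ℚ
        zero-product σ with 0∨1 (σ ⟨ x ⟩) u | 0∨1 (σ ⟨ x ⟩) w
        ... | inj₂ (_ , h) | _ = trans (cong (_* ([ σ ⟨ x ⟩ ≟ w ] * ind I K σ)) h) (ℚP.*-zeroˡ ([ σ ⟨ x ⟩ ≟ w ] * ind I K σ))
        ... | inj₁ (a , _) | inj₁ (b , _) = ⊥-elim (u≢w (trans (sym a) b))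
        ... | inj₁ _ | inj₂ (_ , h) = trans (cong (λ z → [ σ ⟨ x ⟩ ≟ u ] * (z * ind I K σ)) h) (eq [ σ ⟨ x ⟩ ≟ u ] (ind I K σ))
          where eq : ∀ a b → a * (0ℚ * b) ≡ 0ℚ
                eq = solve-∀ ring
  ... | inj₂ h | _ = inj₂ λ { (u ∷ K) → J-ind* x u (h K) }
  ... | inj₁ d | inj₁ x∉I = inj₁ (x∉I , d)
  ... | inj₁ d | inj₂ h = inj₂ λ { (u ∷ K) → case h u K of λ where
        (inj₁ a) → span-resp a (ind∈J I K)
        (inj₂ a) → null a }

  transitive : ∀ {i} (I K : V i) → AllDistinct I → AllDistinct K → ∃[ α ] image α I ≡ K
  transitive [] [] _ _ = e , refl
  transitive (x ∷ I) (u ∷ K) (x∉I , dI) (u∉K , dK) with transitive I K dI dK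
  ... | α , refl = tr (α ⟨ x ⟩) u · α , cong₂ _∷_ (trans (act-· (tr (α ⟨ x ⟩) u) α x) (tr-l (α ⟨ x ⟩) u)) (go I x∉I u∉K)
    where
    go : ∀ {i} (I : V i) → x ∉ᵛ I → u ∉ᵛ image α I → image (tr (α ⟨ x ⟩) u · α) I ≡ image α I
    go [] _ _ = refl
    go (y ∷ I) (x≢y , h) (u≢ , h′) = cong₂ _∷_ (trans (act-· (tr (α ⟨ x ⟩) u) α y) (tr-o (α ⟨ x ⟩) u (λ e′ → x≢y (sym (act-inj α e′))) (u≢ ∘ sym))) (go I h h′)

  firsts seconds : ∀ {m} → Vec (Pair n) m → V m
  firsts = Vec.map proj₁
  seconds = Vec.map proj₂

  distinct-++ : ∀ {m} (ps : Vec (Pair n) m) → Disjoint ps → AllDistinct (firsts ps Vec.++ seconds ps)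
  distinct-++ [] d = tt
  distinct-++ ((x , y) ∷ ps) (x≢y , fx , fy , d) = ∉-insert (firsts ps) (seconds ps) x≢y (∉-++ ps fx) , insert (firsts ps) (seconds ps) (∉-++ ps fy) (distinct-++ ps d)
    where
    ∉-++ : ∀ {m z} (ps : Vec (Pair n) m) → Fresh z ps → z ∉ᵛ (firsts ps Vec.++ seconds ps)
    ∉-insert : ∀ {a b z y} (I : V a) (I′ : V b) → z ≢ y → z ∉ᵛ (I Vec.++ I′) → z ∉ᵛ (I Vec.++ y ∷ I′)
    ∉-insert [] I′ z≢y h = z≢y , h
    ∉-insert (w ∷ I) I′ z≢y (a , h) = a , ∉-insert I I′ z≢y h
    ∉-++ [] f = tt
    ∉-++ ((x , y) ∷ ps) (a , b , f) = a , ∉-insert (firsts ps) (seconds ps) b (∉-++ ps f)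
    insert : ∀ {a b y} (I : V a) (I′ : V b) → y ∉ᵛ (I Vec.++ I′) → AllDistinct (I Vec.++ I′) → AllDistinct (I Vec.++ y ∷ I′)
    insert [] I′ h d = h , d
    insert (w ∷ I) I′ (y≢w , h) (w∉ , d) = ∉-insert I I′ (y≢w ∘ sym) w∉ , insert I I′ h d

  pair-image : ∀ {m} → G → Vec (Pair n) m → Vec (Pair n) m
  pair-image π = Vec.map (λ (x , y) → π ⟨ x ⟩ , π ⟨ y ⟩)

  disjoint-image : ∀ {m} π (ps : Vec (Pair n) m) → Disjoint ps → Disjoint (pair-image π ps)
  disjoint-image π [] d = tt
  disjoint-image π ((x , y) ∷ ps) (x≢y , fx , fy , d) = x≢y ∘ act-inj π , fresh ps fx , fresh ps fy , disjoint-image π ps d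
    where fresh : ∀ {m z} (ps : Vec (Pair n) m) → Fresh z ps → Fresh (π ⟨ z ⟩) (pair-image π ps)
          fresh [] f = tt
          fresh (p ∷ ps) (a , b , f) = a ∘ act-inj π , b ∘ act-inj π , fresh ps f

  δs : ∀ {m} → V m → Vec (Label n) m
  δs = Vec.map δ

  -- Links the two pictures: iterated differences of the array of moments are the coefficients that
  -- the level inequality bounds.
  diff-moment : ∀ {m} (w : F) (xs ys K : V m) → diff (λ v → E (λ σ → w σ * ind v K σ)) xs ys ≡ E (λ σ → w σ * val (Vec.zip xs ys) (δs K) σ)
  diff-moment w [] [] [] = refl
  diff-moment w (x ∷ xs) (y ∷ ys) (u ∷ K) = trans (diff-cong (λ v → trans (sym (E-- (λ σ → w σ * ind (x ∷ v) (u ∷ K) σ) (λ σ → w σ * ind (y ∷ v) (u ∷ K) σ)))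
        (E-cong (λ σ → eq (w σ) [ σ ⟨ x ⟩ ≟ u ] [ σ ⟨ y ⟩ ≟ u ] (ind v K σ)))) xs ys)
      (trans (diff-moment (λ σ → w σ * ([ σ ⟨ x ⟩ ≟ u ] - [ σ ⟨ y ⟩ ≟ u ])) xs ys K) (E-cong (λ σ → ℚP.*-assoc (w σ) ([ σ ⟨ x ⟩ ≟ u ] - [ σ ⟨ y ⟩ ≟ u ]) _)))
    where eq : ∀ a b c d → a * (b * d) - a * (c * d) ≡ a * (b - c) * d
          eq = solve-∀ ring

  val∈J : ∀ {m} (ps : Vec (Pair n) m) (K : V m) → J m (val ps (δs K))
  val∈J [] [] = span-resp (λ _ → refl) (ind∈J [] [])
  val∈J ((x , y) ∷ ps) (u ∷ K) = span-resp (λ σ → eq [ σ ⟨ x ⟩ ≟ u ] [ σ ⟨ y ⟩ ≟ u ] (val ps (δs K) σ)) (span-- (J-ind* x u (val∈J ps K)) (J-ind* y u (val∈J ps K)))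
    where eq : ∀ a b c → (a - b) * c ≡ a * c - b * c
          eq = solve-∀ ring

  -- i points cannot meet i + 1 disjoint pairs, and the transposition of an unmet pair flips the sign.
  unmet-pair : ∀ {m i} (ps : Vec (Pair n) m) (K : V m) (I : V i) → Disjoint ps → i ℕ.< m →
    ∃[ a ] ∃[ b ] (a ∉ᵛ I × b ∉ᵛ I × (∀ z → Fresh z ps → a ≢ z × b ≢ z) × (∀ σ → val ps (δs K) (σ · tr a b) ≡ - val ps (δs K) σ))
  unmet-pair {suc m} {i} ((x , y) ∷ ps) (u ∷ K) I (x≢y , fx , fy , d) (ℕ.s≤s i≤m) with meets I
    where
    Removal : ∀ {i} → V i → Set
    Removal {i} I = ∃[ j ] Σ (V j) (λ I′ → suc j ≡ i × (∀ z → z ≢ x → z ≢ y → z ∉ᵛ I′ → z ∉ᵛ I))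
    meets : ∀ {i} (I : V i) → (x ∉ᵛ I × y ∉ᵛ I) ⊎ Removal I
    meets [] = inj₁ (tt , tt)
    meets (w ∷ I) with x FinP.≟ w | y FinP.≟ w | meets I
    ... | yes refl | _ | _ = inj₂ (_ , I , refl , λ z zx zy h → zx , h)
    ... | no _ | yes refl | _ = inj₂ (_ , I , refl , λ z zx zy h → zy , h)
    ... | no a | no b | inj₁ (hx , hy) = inj₁ ((a , hx) , (b , hy))
    ... | no a | no b | inj₂ (j , I′ , refl , h) = inj₂ (suc j , w ∷ I′ , refl , λ z zx zy (zw , h′) → zw , h z zx zy h′)
  ... | inj₁ (hx , hy) = x , y , hx , hy , (λ z (zx , zy , _) → zx ∘ sym , zy ∘ sym) , λ σ →
      trans (cong₂ _*_ (cong₂ (λ p q → [ p ≟ u ] - [ q ≟ u ]) (trans (act-· σ (tr x y) x) (cong (σ ⟨_⟩) (tr-l x y))) (trans (act-· σ (tr x y) y) (cong (σ ⟨_⟩) (tr-r x y))))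
        (val-fresh ps (δs K) σ fx fy)) (eq [ σ ⟨ x ⟩ ≟ u ] [ σ ⟨ y ⟩ ≟ u ] (val ps (δs K) σ))
    where eq : ∀ a b c → (b - a) * c ≡ - ((a - b) * c)
          eq = solve-∀ ring
  ... | inj₂ (j , I′ , refl , h) with unmet-pair ps K I′ d i≤m
  ...   | a , b , ha , hb , out , flip = a , b , h a (proj₁ (out x fx)) (proj₁ (out y fy)) ha , h b (proj₂ (out x fx)) (proj₂ (out y fy)) hb , (λ z (_ , _ , fz) → out z fz) , λ σ →
      trans (cong₂ _*_ (atom-fresh (x , y) (δ u) σ (proj₁ (out x fx)) (proj₁ (out y fy)) (proj₂ (out x fx)) (proj₂ (out y fy))) (flip σ)) (eq (atom (x , y) (δ u) σ) (val ps (δs K) σ))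
    where eq : ∀ a b → a * - b ≡ - (a * b)
          eq = solve-∀ ring

  ind-fresh : ∀ {i a b} (I K : V i) σ → a ∉ᵛ I → b ∉ᵛ I → ind I K (σ · tr a b) ≡ ind I K σ
  ind-fresh [] [] σ _ _ = refl
  ind-fresh {a = a} {b} (x ∷ I) (u ∷ K) σ (ax , ha) (bx , hb) = cong₂ _*_ (cong [_≟ u ] (trans (act-· σ (tr a b) x) (cong (σ ⟨_⟩) (tr-o a b (ax ∘ sym) (bx ∘ sym))))) (ind-fresh I K σ ha hb)

  -- Because of this, products of `i + 1` differences see only the exact level `i + 1`: against them
  -- `level i f` has the same coefficients as `f`, for which spreadness is available.
  val⊥J : ∀ {i} (ps : Vec (Pair n) (suc i)) (K : V (suc i)) → Disjoint ps → ∀ {q} → J i q → ⟪ q , val ps (δs K) ⟫ ≡ 0ℚ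
  val⊥J {i} ps K d {q} h = trans (⟪⟫-comm q (val ps (δs K))) (⊥-span {f = val ps (δs K)} (juntas-elim {Q = λ p → ⟪ val ps (δs K) , p ⟫ ≡ 0ℚ} each) h)
    where
    each : ∀ I L → ⟪ val ps (δs K) , ind {i} I L ⟫ ≡ 0ℚ
    each I L with unmet-pair ps K I d (ℕP.n<1+n i)
    ... | a , b , a∉ , b∉ , _ , flip = antisymmetric⇒E≡0 (tr a b) (λ σ → trans (cong₂ _*_ (flip σ) (ind-fresh I L σ a∉ b∉)) (eq (val ps (δs K) σ) (ind I L σ)))
      where eq : ∀ a b → - a * b ≡ - (a * b)
            eq = solve-∀ ring

  module _ (x₀ : Fin n) (i : ℕ) (f : F) where
    private
      fᵢ : F
      fᵢ = level i f
      Q : V (suc i) → V (suc i) → ℚ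
      Q K v = moment fᵢ v K

      J-∑ind : ∀ {a m j} (I K : V a) u (v L : V m) → a ℕ.+ m ≡ j → J j (λ σ → ∑ᶠ n (λ x → ind I K σ * ind (x ∷ v) (u ∷ L) σ))
      J-∑ind I K u v L refl = span-resp (λ σ → trans (∑-cong (allFin n) (λ x → eq (ind I K σ) [ σ ⟨ x ⟩ ≟ u ] (ind v L σ)))
          (trans (∑-*ʳ (allFin n) (λ x → [ σ ⟨ x ⟩ ≟ u ]) (ind I K σ * ind v L σ)) (trans (cong (_* (ind I K σ * ind v L σ)) (one σ)) (trans (ℚP.*-identityˡ (ind I K σ * ind v L σ)) (sym (ind-++ I v K L σ))))))
          (ind∈J (I Vec.++ v) (K Vec.++ L))
        where
        eq : ∀ a b c → a * (b * c) ≡ b * (a * c)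
        eq = solve-∀ ring
        one : ∀ σ → ∑ᶠ n (λ x → [ σ ⟨ x ⟩ ≟ u ]) ≡ 1ℚ
        one σ = trans (∑-cong (allFin n) (λ x → trans (≟-act σ x u) (≟-sym x (inv σ ⟨ u ⟩)))) (∑-≟ (inv σ ⟨ u ⟩))

      -- Summing over the position that is sent to `u` removes one factor and leaves an indicator on
      -- `i` points, to which `level i f` is orthogonal. `I` and `K` hold the coordinates fixed so
      -- far.
      harmonic : ∀ {a m} (I K : V a) (L : V m) → a ℕ.+ m ≡ suc i → Har m (λ v → E (λ σ → fᵢ σ * (ind I K σ * ind v L σ)))
      harmonic I K [] _ = tt
      harmonic {a} {suc m} I K (u ∷ L) a+m = (λ v → trans (sym (E-∑ (allFin n) (λ x σ → fᵢ σ * (ind I K σ * ind (x ∷ v) (u ∷ L) σ))))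
          (trans (E-cong (λ σ → ∑-*ˡ (allFin n) (fᵢ σ) (λ x → ind I K σ * ind (x ∷ v) (u ∷ L) σ))) (level⊥ x₀ i f (J-∑ind I K u v L (ℕP.suc-injective (trans (sym (ℕP.+-suc a m)) a+m)))))) ,
        λ x → har-resp (λ v → E-cong (λ σ → cong (fᵢ σ *_) (trans (cong (_* ind v L σ) (ind-++ I (x ∷ []) K (u ∷ []) σ)) (eq (ind I K σ) [ σ ⟨ x ⟩ ≟ u ] (ind v L σ)))))
          (harmonic (I Vec.++ x ∷ []) (K Vec.++ u ∷ []) L (trans (cong (ℕ._+ m) (ℕP.+-comm a 1)) (trans (sym (ℕP.+-suc a m)) a+m)))
        where
        eq : ∀ a b c → a * (b * 1ℚ) * c ≡ a * (b * c)
        eq = solve-∀ ring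
        har-resp : ∀ {m} {Q Q′ : V m → ℚ} → (∀ v → Q v ≡ Q′ v) → Har m Q → Har m Q′
        har-resp {zero} h _ = tt
        har-resp {suc m} h (a , b) = (λ v → trans (∑-cong (allFin n) (λ x → sym (h (x ∷ v)))) (a v)) , λ x → har-resp (λ v → h (x ∷ v)) (b x)

      harQ : ∀ K → Har (suc i) (Q K)
      harQ K = go (suc i) (λ v → E-cong (λ σ → cong (fᵢ σ *_) (ℚP.*-identityˡ (ind v K σ)))) (harmonic [] [] K refl)
        where
        go : ∀ m {Q Q′ : V m → ℚ} → (∀ v → Q v ≡ Q′ v) → Har m Q → Har m Q′
        go zero h _ = tt
        go (suc m) h (a , b) = (λ v → trans (∑-cong (allFin n) (λ x → sym (h (x ∷ v)))) (a v)) , λ x → go m (λ v → h (x ∷ v)) (b x)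

      support : ∀ K v → AllDistinct v ⊎ Q K v ≡ 0ℚ
      support K v with repetition v
      ... | inj₁ d = inj₁ d
      ... | inj₂ h = inj₂ (level⊥ x₀ i f (h K))

    energyᵥ : Vec (Pair n) (suc i) → ℚ
    energyᵥ S = ∑ᵛ n (suc i) (λ K → E (λ σ → f σ * val S (δs K) σ) * E (λ σ → f σ * val S (δs K) σ))

    module _ (big : 2ℚ ^ℚ suc i * 2ℚ ^ℚ suc i * nat (coincidences (suc i)) ≤ nat n) where

      0<n : 0ℚ < nat n
      0<n = 0<nat (ℕP.≤-trans (ℕ.s≤s ℕ.z≤n) (FinP.toℕ<n x₀))

      -- Every tuple of disjoint pairs is the image of `S` under some permutation, and by
      -- `ind-lower` it is hit with probability at least `n^(-2 (i + 1))`. The sum over disjoint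
      -- tuples is therefore at most `n^(2 (i + 1))` times an average, and `disjoint-part` gives
      -- half of that exponent back.
      average-energy : (S : Vec (Pair n) (suc i)) → Disjoint S → norm² (suc i) fᵢ ≤ M (suc i) * E (λ π → energyᵥ (pair-image π S))
      average-energy S dS = begin
          norm² (suc i) fᵢ
            ≡⟨ ∑-swap (allVecs n (suc i)) (allVecs n (suc i)) (λ v K → Q K v * Q K v) ⟩
          ∑ᵛ n (suc i) (λ K → ∑ᵛ n (suc i) (λ v → Q K v * Q K v))
            ≤⟨ ∑-mono (allVecs n (suc i)) each ⟩
          ∑ᵛ n (suc i) (λ K → M (suc i) * E (λ π → D K π * D K π))
            ≡⟨ trans (∑-*ˡ (allVecs n (suc i)) (M (suc i)) _) (cong (M (suc i) *_) (sym (E-∑ (allVecs n (suc i)) (λ K π → D K π * D K π)))) ⟩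
          M (suc i) * E (λ π → ∑ᵛ n (suc i) (λ K → D K π * D K π))
            ≡⟨ cong (M (suc i) *_) (E-cong (λ π → ∑-cong (allVecs n (suc i)) (λ K → cong (λ z → z * z) (D≡ K π)))) ⟩
          M (suc i) * E (λ π → energyᵥ (pair-image π S)) ∎
        where
        open ≤R
        X = firsts S
        Y = seconds S
        D : V (suc i) → G → ℚ
        D K π = diff (Q K) (image π X) (image π Y)
        D≡ : ∀ K π → D K π ≡ E (λ σ → f σ * val (pair-image π S) (δs K) σ)
        D≡ K π = trans (diff-moment fᵢ (image π X) (image π Y) K) (trans (E-cong (λ σ → cong (λ S → fᵢ σ * val S (δs K) σ) (zip-image S)))
            (level-moment i f (val∈J (pair-image π S) K) (val⊥J (pair-image π S) K (disjoint-image π S dS))))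
          where zip-image : ∀ {m} (S : Vec (Pair n) m) → Vec.zip (image π (firsts S)) (image π (seconds S)) ≡ pair-image π S
                zip-image [] = refl
                zip-image (p ∷ S) = cong (_ ∷_) (zip-image S)
        Φ : V (suc i) → V (suc i) → V (suc i) → ℚ
        Φ K xs ys = M (suc i) * M (suc i) * E (λ π → ind X xs π * ind Y ys π) * (diff (Q K) xs ys * diff (Q K) xs ys)
        0≤Φ : ∀ K xs ys → 0ℚ ≤ Φ K xs ys
        0≤Φ K xs ys = 0≤* (0≤* (0≤sq (M (suc i))) (0≤E (λ π → 0≤* (0≤ind X xs π) (0≤ind Y ys π)))) (0≤sq (diff (Q K) xs ys))
        diff≤Φ : ∀ K xs ys → Disjoint (Vec.zip xs ys) → diff (Q K) xs ys * diff (Q K) xs ys ≤ Φ K xs ys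
        diff≤Φ K xs ys d with transitive (X Vec.++ Y) (xs Vec.++ ys) (distinct-++ S dS) (subst₂ (λ a b → AllDistinct (a Vec.++ b)) (firsts-zip xs ys) (seconds-zip xs ys) (distinct-++ (Vec.zip xs ys) d))
          where firsts-zip : ∀ {m} (xs ys : V m) → firsts (Vec.zip xs ys) ≡ xs
                firsts-zip [] [] = refl
                firsts-zip (x ∷ xs) (y ∷ ys) = cong (x ∷_) (firsts-zip xs ys)
                seconds-zip : ∀ {m} (xs ys : V m) → seconds (Vec.zip xs ys) ≡ ys
                seconds-zip [] [] = refl
                seconds-zip (x ∷ xs) (y ∷ ys) = cong (y ∷_) (seconds-zip xs ys)
        ... | α , hα = subst (_≤ Φ K xs ys) (ℚP.*-identityˡ (diff (Q K) xs ys * diff (Q K) xs ys)) (*-monoʳ (0≤sq (diff (Q K) xs ys))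
            (subst (1ℚ ≤_) (cong₂ _*_ (^-+ (nat n) (suc i) (suc i)) (E-cong (λ π → trans (cong (λ K → ind (X Vec.++ Y) K π) hα) (ind-++ X Y xs ys π)))) (ind-lower (X Vec.++ Y) α)))
        each : ∀ K → ∑ᵛ n (suc i) (λ v → Q K v * Q K v) ≤ M (suc i) * E (λ π → D K π * D K π)
        each K = cancelˡ (0<^ (suc i) 0<n) (begin
            M (suc i) * ∑ᵛ n (suc i) (λ v → Q K v * Q K v)
              ≤⟨ disjoint-part i (Q K) (harQ K) (support K) big 0<n (Φ K) (0≤Φ K) (diff≤Φ K) ⟩
            ∑ᵛ n (suc i) (λ xs → ∑ᵛ n (suc i) (Φ K xs))
              ≡⟨ ∑-cong (allVecs n (suc i)) (λ xs → trans (∑-cong (allVecs n (suc i)) (λ ys → trans (ℚP.*-assoc MM (E (λ π → ind X xs π * ind Y ys π)) (d² xs ys)) (cong (MM *_) (sym (E-*ʳ (λ π → ind X xs π * ind Y ys π) (d² xs ys))))))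
                   (trans (∑-*ˡ (allVecs n (suc i)) MM _) (cong (MM *_) (sym (E-∑ (allVecs n (suc i)) (λ ys π → ind X xs π * ind Y ys π * d² xs ys)))))) ⟩
            ∑ᵛ n (suc i) (λ xs → MM * E (λ π → ∑ᵛ n (suc i) (λ ys → ind X xs π * ind Y ys π * d² xs ys)))
              ≡⟨ trans (∑-*ˡ (allVecs n (suc i)) MM _) (cong (MM *_) (sym (E-∑ (allVecs n (suc i)) (λ xs π → ∑ᵛ n (suc i) (λ ys → ind X xs π * ind Y ys π * d² xs ys))))) ⟩
            MM * E (λ π → ∑ᵛ n (suc i) (λ xs → ∑ᵛ n (suc i) (λ ys → ind X xs π * ind Y ys π * d² xs ys)))
              ≡⟨ cong (MM *_) (E-cong pick) ⟩
            MM * E (λ π → D K π * D K π)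
              ≡⟨ ℚP.*-assoc (M (suc i)) (M (suc i)) _ ⟩
            M (suc i) * (M (suc i) * E (λ π → D K π * D K π)) ∎)
          where
          MM = M (suc i) * M (suc i)
          d² : V (suc i) → V (suc i) → ℚ
          d² xs ys = diff (Q K) xs ys * diff (Q K) xs ys
          pick : ∀ π → ∑ᵛ n (suc i) (λ xs → ∑ᵛ n (suc i) (λ ys → ind X xs π * ind Y ys π * d² xs ys)) ≡ d² (image π X) (image π Y)
          pick π = trans (∑-cong (allVecs n (suc i)) (λ xs → trans (∑-cong (allVecs n (suc i)) (λ ys → ℚP.*-assoc (ind X xs π) (ind Y ys π) (d² xs ys)))
              (trans (∑-*ˡ (allVecs n (suc i)) (ind X xs π) _) (cong (ind X xs π *_) (ind-select Y π (d² xs))))))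
            (ind-select X π (λ xs → d² xs (image π Y)))

      -- Every sub-tuple of ps contributes on average as much as S above.
      norm²-energy : ∀ {k} (ps : Vec (Pair n) k) → Disjoint ps → (b : ℚ) → (∀ π → Quadratic.energy (pair-image π ps) f (suc i) (nones k) ≤ b) →
        nat (choose (suc i) k) * norm² (suc i) fᵢ ≤ M (suc i) * b
      norm²-energy {k} ps dps b h = begin
          nat (choose (suc i) k) * norm² (suc i) fᵢ
            ≡⟨ trans (∑-const (sub-tuples (suc i) ps) (norm² (suc i) fᵢ)) (cong (λ m → nat m * norm² (suc i) fᵢ) (length-sub-tuples (suc i) ps)) ⟨
          ∑ (sub-tuples (suc i) ps) (λ _ → norm² (suc i) fᵢ)
            ≤⟨ ∑-mono∈ (sub-tuples (suc i) ps) (λ {S} S∈ → average-energy S (All.lookup (disjoint-sub (suc i) ps dps) S∈)) ⟩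
          ∑ (sub-tuples (suc i) ps) (λ S → M (suc i) * E (λ π → energyᵥ (pair-image π S)))
            ≡⟨ trans (∑-*ˡ (sub-tuples (suc i) ps) (M (suc i)) _) (cong (M (suc i) *_) (sym (E-∑ (sub-tuples (suc i) ps) (λ S π → energyᵥ (pair-image π S))))) ⟩
          M (suc i) * E (λ π → ∑ (sub-tuples (suc i) ps) (λ S → energyᵥ (pair-image π S)))
            ≡⟨ cong (M (suc i) *_) (E-cong (λ π → sym (energy-sub π (suc i) ps f))) ⟩
          M (suc i) * E (λ π → Quadratic.energy (pair-image π ps) f (suc i) (nones k))
            ≤⟨ *-monoˡ (0≤M (suc i)) (ℚP.≤-trans (E-mono h) (ℚP.≤-reflexive (E-const b))) ⟩
          M (suc i) * b ∎
        where
        open ≤R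
        sq : ∀ {k} → (w : F) → Vec (Pair n) k → Vec (Label n) k → ℚ
        sq w ps θ = E (λ σ → w σ * val ps θ σ) * E (λ σ → w σ * val ps θ σ)
        sq-∷ : ∀ {k} (w : F) p l (ps : Vec (Pair n) k) θ → sq w (p ∷ ps) (l ∷ θ) ≡ sq (λ σ → w σ * atom p l σ) ps θ
        sq-∷ w p l ps θ = cong (λ z → z * z) (E-cong (λ σ → sym (ℚP.*-assoc (w σ) (atom p l σ) (val ps θ σ))))
        -- A filling with `m` δs amounts to the choice of the `m` pairs that carry them together
        -- with the `m` targets.
        energy-sub : ∀ π m {k} (ps : Vec (Pair n) k) (w : F) → ∑ (fillings (nones k)) (λ θ → ⟦ deltas θ ≟ m ⟧ * sq w (pair-image π ps) θ) ≡
          ∑ (sub-tuples m ps) (λ S → ∑ᵛ n m (λ K → sq w (pair-image π S) (δs K)))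
        energy-sub π zero [] w = cong (_+ 0ℚ) (trans (trans (cong (_* sq w [] []) (⟦⟧-≡ {0} refl)) (ℚP.*-identityˡ (sq w [] []))) (sym (∑ᵛ-zero n (λ K → sq w [] (δs K)))))
        energy-sub π (suc m) [] w = trans (ℚP.+-identityʳ (⟦ 0 ≟ suc m ⟧ * sq w [] [])) (trans (cong (_* sq w [] []) (⟦⟧-≢ {0} {suc m} (λ ()))) (ℚP.*-zeroˡ (sq w [] [])))
        energy-sub π m {suc k} (p ∷ ps) w = trans (∑-cart (fill₁ none) (fillings (nones k)) _) (trans (∑-fill-none (λ a → ∑ (fillings (nones k)) (λ θ → ⟦ deltas (a ∷ θ) ≟ m ⟧ * sq w (πp ∷ πps) (a ∷ θ)))) (go m))
          where
          πp = proj₁ p′ , proj₂ p′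
            where p′ : Pair n
                  p′ = π ⟨ proj₁ p ⟩ , π ⟨ proj₂ p ⟩
          πps = pair-image π ps
          keep-none : ∀ m → ∑ (fillings (nones k)) (λ θ → ⟦ deltas θ ≟ m ⟧ * sq w (πp ∷ πps) (ev none ∷ θ)) ≡ ∑ (sub-tuples m ps) (λ S → ∑ᵛ n m (λ K → sq w (pair-image π S) (δs K)))
          keep-none m = trans (∑-cong (fillings (nones k)) (λ θ → cong (⟦ deltas θ ≟ m ⟧ *_) (cong (λ z → z * z) (E-cong (λ σ → cong (w σ *_) (ℚP.*-identityˡ (val πps θ σ))))))) (energy-sub π m ps w)
          go : ∀ m → ∑ (fillings (nones k)) (λ θ → ⟦ deltas θ ≟ m ⟧ * sq w (πp ∷ πps) (ev none ∷ θ)) + ∑ᶠ n (λ u → ∑ (fillings (nones k)) (λ θ → ⟦ suc (deltas θ) ≟ m ⟧ * sq w (πp ∷ πps) (δ u ∷ θ))) ≡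
            ∑ (sub-tuples m (p ∷ ps)) (λ S → ∑ᵛ n m (λ K → sq w (pair-image π S) (δs K)))
          go zero = trans (cong₂ _+_ (keep-none 0) (∑-zero (allFin n) (λ u → ∑-zero (fillings (nones k)) (λ θ → trans (cong (_* sq w (πp ∷ πps) (δ u ∷ θ)) (⟦⟧-≢ {suc (deltas θ)} {0} (λ ()))) (ℚP.*-zeroˡ (sq w (πp ∷ πps) (δ u ∷ θ)))))))
            (ℚP.+-identityʳ (∑ (sub-tuples 0 ps) (λ S → ∑ᵛ n 0 (λ K → sq w (pair-image π S) (δs K)))))
          go (suc m) = trans (cong₂ _+_ (keep-none (suc m)) (trans (∑-cong (allFin n) (λ u → trans (∑-cong (fillings (nones k)) (λ θ → cong₂ _*_ (shift (deltas θ)) (sq-∷ w πp (δ u) πps θ))) (energy-sub π m ps (λ σ → w σ * atom πp (δ u) σ))))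
                (trans (∑-swap (allFin n) (sub-tuples m ps) _) (∑-cong (sub-tuples m ps) (λ S → sym (trans (∑ᵛ-suc n m _) (∑-cong (allFin n) (λ u → ∑-cong (allVecs n m) (λ K → sq-∷ w πp (δ u) (pair-image π S) (δs K))))))))))
              (trans (ℚP.+-comm (∑ (sub-tuples (suc m) ps) H) _) (sym (trans (∑-++ (map (p ∷_) (sub-tuples m ps)) (sub-tuples (suc m) ps) H) (cong (_+ ∑ (sub-tuples (suc m) ps) H) (∑-map (p ∷_) (sub-tuples m ps) H)))))
            where
            H : Vec (Pair n) (suc m) → ℚ
            H S = ∑ᵛ n (suc m) (λ K → sq w (pair-image π S) (δs K))
            shift : ∀ a → ⟦ suc a ≟ suc m ⟧ ≡ ⟦ a ≟ m ⟧
            shift a with ⟦⟧-cases a m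
            ... | inj₁ (refl , h) = trans (⟦⟧-≡ {suc a} refl) (sym h)
            ... | inj₂ (ne , h) = trans (⟦⟧-≢ {suc a} {suc m} (ne ∘ ℕP.suc-injective)) (sym h)

-- Functions orthogonal to the low levels

module _ {n : ℕ} where

  ∉ᵛ-lookup : ∀ {i z} (xs : Vec (Fin n) i) → z ∉ᵛ xs → ∀ l → z ≢ lookup xs l
  ∉ᵛ-lookup (x ∷ xs) (a , h) zero = a
  ∉ᵛ-lookup (x ∷ xs) (a , h) (suc l) = ∉ᵛ-lookup xs h l

  distinct-lookup : ∀ {i} (xs : Vec (Fin n) i) → AllDistinct xs → ∀ {l l′} → lookup xs l ≡ lookup xs l′ → l ≡ l′
  distinct-lookup (x ∷ xs) (x∉ , d) {zero} {zero} e = refl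
  distinct-lookup (x ∷ xs) (x∉ , d) {zero} {suc l′} e = ⊥-elim (∉ᵛ-lookup xs x∉ l′ e)
  distinct-lookup (x ∷ xs) (x∉ , d) {suc l} {zero} e = ⊥-elim (∉ᵛ-lookup xs x∉ l (sym e))
  distinct-lookup (x ∷ xs) (x∉ , d) {suc l} {suc l′} e = cong suc (distinct-lookup xs d e)

  ∉ᵛ? : ∀ {i} z (xs : Vec (Fin n) i) → z ∉ᵛ xs ⊎ ∃[ l ] lookup xs l ≡ z
  ∉ᵛ? z [] = inj₁ tt
  ∉ᵛ? z (x ∷ xs) with z FinP.≟ x | ∉ᵛ? z xs
  ... | yes refl | _ = inj₂ (zero , refl)
  ... | no _ | inj₂ (l , h) = inj₂ (suc l , h)
  ... | no a | inj₁ h = inj₁ (a , h)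

  allDistinct? : ∀ {i} (xs : Vec (Fin n) i) → Dec (AllDistinct xs)
  allDistinct? [] = yes tt
  allDistinct? (x ∷ xs) with ∉ᵛ? x xs | allDistinct? xs
  ... | inj₁ a | yes d = yes (a , d)
  ... | inj₁ _ | no d = no (d ∘ proj₂)
  ... | inj₂ (l , h) | _ = no λ (a , _) → ∉ᵛ-lookup xs a l (sym h)

  fresh-point : ∀ {i} (xs : Vec (Fin n) i) → i ℕ.< n → ∃[ z ] z ∉ᵛ xs
  fresh-point {i} xs i<n = search (FinP.any? (λ z → out? z))
    where
    out? : ∀ z → Dec (z ∉ᵛ xs)
    out? z with ∉ᵛ? z xs
    ... | inj₁ h = yes h
    ... | inj₂ (l , h) = no λ a → ∉ᵛ-lookup xs a l (sym h)
    search : Dec (∃[ z ] z ∉ᵛ xs) → ∃[ z ] z ∉ᵛ xs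
    search (yes h) = h
    search (no h) = ⊥-elim (ℕP.<⇒≱ i<n (FinP.injective⇒≤ {f = pos} pos-injective))
      where
      find : ∀ z → ∃[ l ] lookup xs l ≡ z
      find z with ∉ᵛ? z xs
      ... | inj₁ a = ⊥-elim (h (z , a))
      ... | inj₂ l = l
      pos : Fin n → Fin i
      pos z = proj₁ (find z)
      pos-injective : ∀ {a b} → pos a ≡ pos b → a ≡ b
      pos-injective {a} {b} e = trans (sym (proj₂ (find a))) (trans (cong (lookup xs) e) (proj₂ (find b)))

  fresh-points : ∀ {i} (xs : Vec (Fin n) i) → AllDistinct xs → ∀ k → k ℕ.+ i ℕ.≤ n → ∃[ ws ] AllDistinct (ws Vec.++ xs) × (∀ (l : Fin k) → lookup ws l ∉ᵛ xs)
  fresh-points xs d zero h = [] , d , λ ()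
  fresh-points {i} xs d (suc k) h with fresh-points xs d k (ℕP.≤-trans (ℕP.n≤1+n _) h)
  ... | ws , dws , out with fresh-point (ws Vec.++ xs) h
  ...   | w , w∉ = (w ∷ ws) , (w∉ , dws) , λ { zero → drop ws w∉ ; (suc l) → out l }
    where drop : ∀ {a b z} (ws : Vec (Fin n) a) {xs : Vec (Fin n) b} → z ∉ᵛ (ws Vec.++ xs) → z ∉ᵛ xs
          drop [] h = h
          drop (w ∷ ws) (_ , h) = drop ws h

  distinct-++ˡ : ∀ {a b} (ws : Vec (Fin n) a) {xs : Vec (Fin n) b} → AllDistinct (ws Vec.++ xs) → AllDistinct ws
  distinct-++ˡ [] d = tt
  distinct-++ˡ (w ∷ ws) (h , d) = take∉ ws h , distinct-++ˡ ws d
    where take∉ : ∀ {a b z} (ws : Vec (Fin n) a) {xs : Vec (Fin n) b} → z ∉ᵛ (ws Vec.++ xs) → z ∉ᵛ ws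
          take∉ [] h = tt
          take∉ (w ∷ ws) (x , h) = x , take∉ ws h

  Apart : Pair n → Pair n → Set
  Apart (x , y) (x′ , y′) = x ≢ x′ × x ≢ y′ × y ≢ x′ × y ≢ y′

module HighLevels {n : ℕ} (𝓖 : PermGroup n) where
  open PermGroup 𝓖
  open Functions 𝓖
  open Indicators 𝓖
  open Juntas 𝓖
  open Convolution 𝓖
  open LevelMoments 𝓖 using (ind-fresh)

  private
    V : ℕ → Set
    V = Vec (Fin n)

  swap : Pair n → G
  swap (x , y) = tr x y

  conj-tr : ∀ π x y → π · tr x y ≡ tr (π ⟨ x ⟩) (π ⟨ y ⟩) · π
  conj-tr π x y = ext λ z → trans (act-· π (tr x y) z) (trans (go z (z FinP.≟ x) (z FinP.≟ y)) (sym (act-· (tr (π ⟨ x ⟩) (π ⟨ y ⟩)) π z)))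
    where
    go : ∀ z → Dec (z ≡ x) → Dec (z ≡ y) → π ⟨ tr x y ⟨ z ⟩ ⟩ ≡ tr (π ⟨ x ⟩) (π ⟨ y ⟩) ⟨ π ⟨ z ⟩ ⟩
    go z (yes refl) _ = trans (cong (π ⟨_⟩) (tr-l z y)) (sym (tr-l (π ⟨ z ⟩) (π ⟨ y ⟩)))
    go z (no _) (yes refl) = trans (cong (π ⟨_⟩) (tr-r x z)) (sym (tr-r (π ⟨ x ⟩) (π ⟨ z ⟩)))
    go z (no a) (no b) = trans (cong (π ⟨_⟩) (tr-o x y a b)) (sym (tr-o (π ⟨ x ⟩) (π ⟨ y ⟩) (a ∘ act-inj π) (b ∘ act-inj π)))

  tr² : ∀ σ x y → σ · tr x y · tr x y ≡ σ
  tr² σ x y = trans (·-assoc σ (tr x y) (tr x y)) (trans (cong (σ ·_) (ext λ z → trans (act-· (tr x y) (tr x y) z) (trans (act-tr-inv x y z) (sym (act-e z))))) (·-idʳ σ))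

  commute-fixed : ∀ π x y → π ⟨ x ⟩ ≡ x → π ⟨ y ⟩ ≡ y → π · tr x y ≡ tr x y · π
  commute-fixed π x y hx hy = trans (conj-tr π x y) (cong₂ (λ a b → tr a b · π) hx hy)

  commute-apart : ∀ {p q} → Apart p q → swap p · swap q ≡ swap q · swap p
  commute-apart {x , y} {x′ , y′} (a , b , c , d) = commute-fixed (tr x y) x′ y′ (tr-o x y (a ∘ sym) (c ∘ sym)) (tr-o x y (b ∘ sym) (d ∘ sym))

  -- Multiplication by 1 + c (x y) in the group algebra.
  op : ℚ → Pair n → F → F
  op c p v σ = v σ + c * v (σ · swap p)

  op-cong : ∀ c p {v w} → (∀ σ → v σ ≡ w σ) → ∀ σ → op c p v σ ≡ op c p w σ
  op-cong c p h σ = cong₂ (λ a b → a + c * b) (h σ) (h (σ · swap p))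

  op-- : ∀ c p v w σ → op c p (λ σ → v σ - w σ) σ ≡ op c p v σ - op c p w σ
  op-- c p v w σ = eq (v σ) (w σ) c (v (σ · swap p)) (w (σ · swap p))
    where eq : ∀ a b c d e → a - b + c * (d - e) ≡ a + c * d - (b + c * e)
          eq = solve-∀ ring

  op-adjoint : ∀ c p v w → ⟪ op c p v , w ⟫ ≡ ⟪ v , op c p w ⟫
  op-adjoint c p@(x , y) v w = trans (⟪⟫-+ˡ v (λ σ → c * v (σ · swap p)) w) (trans (cong (⟪ v , w ⟫ +_) (trans (⟪⟫-*ˡ c (λ σ → v (σ · swap p)) w) (trans (cong (c *_) shift) (sym (⟪⟫-*ʳ c (λ σ → w (σ · swap p)) v)))))
      (sym (⟪⟫-+ʳ w (λ σ → c * w (σ · swap p)) v)))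
    where shift : ⟪ (λ σ → v (σ · swap p)) , w ⟫ ≡ ⟪ v , (λ σ → w (σ · swap p)) ⟫
          shift = trans (sym (E-R (swap p) (λ σ → v (σ · swap p) * w σ))) (E-cong (λ σ → cong (λ g → v g * w (σ · swap p)) (tr² σ x y)))

  record Weight (v : F) (p : Pair n) (c : ℚ) : Set where
    constructor weighted
    field shift : ∀ σ → v (σ · swap p) ≡ c * v σ

  weight-own : ∀ {c} p v → c * c ≡ 1ℚ → Weight (op c p v) p c
  weight-own {c} p@(x , y) v cc = weighted λ σ → trans (cong (λ g → v (σ · swap p) + c * v g) (tr² σ x y)) (trans (eq (v σ) (v (σ · swap p)) c) (cong (λ z → c * (v σ + c * v (σ · swap p)) - (z - 1ℚ) * v (σ · swap p)) cc ⟨trans⟩ eq′ (c * (v σ + c * v (σ · swap p))) (v (σ · swap p))))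
    where eq : ∀ a b c → b + c * a ≡ c * (a + c * b) - (c * c - 1ℚ) * b
          eq = solve-∀ ring
          eq′ : ∀ a b → a - (1ℚ - 1ℚ) * b ≡ a
          eq′ = solve-∀ ring
          _⟨trans⟩_ : ∀ {x y z : ℚ} → x ≡ y → y ≡ z → x ≡ z
          _⟨trans⟩_ = trans

  weight-op : ∀ {v p c} q d → (p ≡ q ⊎ Apart p q) → Weight v p c → Weight (op d q v) p c
  weight-op {v} {p} {c} q d (inj₁ refl) (weighted h) = weighted λ σ → trans (cong₂ (λ a b → a + d * b) (h σ) (h (σ · swap p))) (eq c d (v σ) (v (σ · swap p)))
    where eq : ∀ c d a b → c * a + d * (c * b) ≡ c * (a + d * b)
          eq = solve-∀ ring
  weight-op {v} {p} {c} q d (inj₂ ap) (weighted h) = weighted λ σ → trans (cong₂ (λ a b → a + d * b) (h σ) (trans (cong v (trans (·-assoc σ (swap p) (swap q)) (trans (cong (σ ·_) (commute-apart ap)) (sym (·-assoc σ (swap q) (swap p)))))) (h (σ · swap q))))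
      (eq c d (v σ) (v (σ · swap q)))
    where eq : ∀ c d a b → c * a + d * (c * b) ≡ c * (a + d * b)
          eq = solve-∀ ring

  -- The product of `(1 - (a b)) (1 + (c d))` over `j` quadruples, acting by right translations.
  -- Each factor is self-adjoint, so the reversed product `quads′` is the adjoint.
  quads quads′ : ∀ j → V (j ℕ.* 4) → F → F
  quads zero [] v = v
  quads (suc j) (a ∷ b ∷ c ∷ d ∷ z) v = op (- 1ℚ) (a , b) (op 1ℚ (c , d) (quads j z v))
  quads′ zero [] v = v
  quads′ (suc j) (a ∷ b ∷ c ∷ d ∷ z) v = quads′ j z (op 1ℚ (c , d) (op (- 1ℚ) (a , b) v))

  quads-- : ∀ j z v w σ → quads j z (λ σ → v σ - w σ) σ ≡ quads j z v σ - quads j z w σ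
  quads-- zero [] v w σ = refl
  quads-- (suc j) (a ∷ b ∷ c ∷ d ∷ z) v w σ = trans (op-cong (- 1ℚ) (a , b) (λ τ → trans (op-cong 1ℚ (c , d) (quads-- j z v w) τ) (op-- 1ℚ (c , d) (quads j z v) (quads j z w) τ)) σ)
    (op-- (- 1ℚ) (a , b) (op 1ℚ (c , d) (quads j z v)) (op 1ℚ (c , d) (quads j z w)) σ)

  quads-adjoint : ∀ j z v w → ⟪ quads j z v , w ⟫ ≡ ⟪ v , quads′ j z w ⟫
  quads-adjoint zero [] v w = refl
  quads-adjoint (suc j) (a ∷ b ∷ c ∷ d ∷ z) v w = trans (op-adjoint (- 1ℚ) (a , b) (op 1ℚ (c , d) (quads j z v)) w) (trans (op-adjoint 1ℚ (c , d) (quads j z v) (op (- 1ℚ) (a , b) w)) (quads-adjoint j z v _))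

  Proper : ∀ j → V (j ℕ.* 4) → Set
  Proper zero [] = ⊤
  Proper (suc j) (a ∷ b ∷ c ∷ d ∷ z) = a ≢ b × c ≢ d × Proper j z

  proper : ∀ j z → AllDistinct z → Proper j z
  proper zero [] _ = tt
  proper (suc j) (a ∷ b ∷ c ∷ d ∷ z) ((a≢b , _) , _ , (c≢d , _) , _ , h) = a≢b , c≢d , proper j z h

  -- Treats the low levels and their sign twists together. Twisting turns `op c` into `op (- c)`
  -- only for genuine transpositions, whence the condition `x ≢ y`.
  record Stable : Set₁ where
    field
      X : F → Set
      X-op : ∀ {v} c x y → x ≢ y → X v → X (op c (x , y) v)
      P : F → F
      P∈ : ∀ f → X (P f)
      P⊥ : ∀ f {p} → X p → ⟪ (λ σ → f σ - P f σ) , p ⟫ ≡ 0ℚ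

    X-quads : ∀ j z → Proper j z → ∀ {v} → X v → X (quads j z v)
    X-quads zero [] _ h = h
    X-quads (suc j) (a ∷ b ∷ c ∷ d ∷ z) (ab , cd , pr) h = X-op (- 1ℚ) a b ab (X-op 1ℚ c d cd (X-quads j z pr h))

    X-quads′ : ∀ j z → Proper j z → ∀ {v} → X v → X (quads′ j z v)
    X-quads′ zero [] _ h = h
    X-quads′ (suc j) (a ∷ b ∷ c ∷ d ∷ z) (ab , cd , pr) h = X-quads′ j z pr (X-op 1ℚ c d cd (X-op (- 1ℚ) a b ab h))

    ⟪P⟫ : ∀ f {p} → X p → ⟪ P f , p ⟫ ≡ ⟪ f , p ⟫
    ⟪P⟫ f {p} h = sym (trans (x≡x-y+y ⟪ f , p ⟫ ⟪ P f , p ⟫) (trans (cong (_+ ⟪ P f , p ⟫) (trans (sym (⟪⟫--ˡ f (P f) p)) (P⊥ f h))) (ℚP.+-identityˡ _)))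

    -- `w = quads j z (P f)` lies in `X`. Moving the operator to the other side of `⟪ w , w ⟫`
    -- allows `P f` to be replaced by `f`, so `w` is orthogonal to itself.
    quads-proj : ∀ j z → Proper j z → ∀ f → (∀ σ → quads j z f σ ≡ 0ℚ) → ∀ σ → quads j z (P f) σ ≡ 0ℚ
    quads-proj j z pr f h = ⟪⟫-definite w (ℚP.≤-reflexive (trans (quads-adjoint j z (P f) w) (trans (⟪P⟫ f (X-quads′ j z pr w∈)) (trans (sym (quads-adjoint j z f w))
        (E-zero (λ σ → trans (cong (_* w σ) (h σ)) (ℚP.*-zeroˡ (w σ))))))))
      where w = quads j z (P f)
            w∈ : X w
            w∈ = X-quads j z pr (P∈ f)

  J-op : ∀ {i v} c p → J i v → J i (op c p v)
  J-op c p h = add h (scale c (J-R (swap p) h) (λ _ → refl)) (λ _ → refl)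

  plain : ℕ → Stable
  plain D = record { X = J D ; X-op = λ c x y _ → J-op c (x , y) ; P = proj D ; P∈ = proj∈ D ; P⊥ = λ f → proj⊥ D f }

  twist : F → F
  twist f σ = f σ * sgn σ

  twist² : ∀ f σ → twist (twist f) σ ≡ f σ
  twist² f σ = trans (ℚP.*-assoc (f σ) (sgn σ) (sgn σ)) (trans (cong (f σ *_) (sgn-sq σ)) (ℚP.*-identityʳ (f σ)))

  ⟪twist⟫ : ∀ f g → ⟪ twist f , g ⟫ ≡ ⟪ f , twist g ⟫
  ⟪twist⟫ f g = E-cong (λ σ → xy*z≡x*zy (f σ) (sgn σ) (g σ))

  twist-op : ∀ v c x y → x ≢ y → ∀ σ → twist (op c (x , y) v) σ ≡ op (- c) (x , y) (twist v) σ
  twist-op v c x y ne σ = trans (eq (v σ) c (v (σ · tr x y)) (sgn σ)) (cong (λ s → v σ * sgn σ + - c * (v (σ · tr x y) * s)) (sym (trans (sgn-· σ (tr x y)) (cong (sgn σ *_) (sgn-tr ne)))))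
    where eq : ∀ a c b s → (a + c * b) * s ≡ a * s + - c * (b * (s * - 1ℚ))
          eq = solve-∀ ring

  twisted : ℕ → Stable
  twisted D = record
    { X = λ v → J D (twist v)
    ; X-op = λ {v} c x y ne h → span-resp (twist-op v c x y ne) (J-op (- c) (x , y) h)
    ; P = λ f → twist (proj D (twist f))
    ; P∈ = λ f → span-resp (twist² (proj D (twist f))) (proj∈ D (twist f))
    ; P⊥ = λ f {p} h → trans (E-cong (λ σ → trans (cong (λ z → (z - twist (proj D (twist f)) σ) * p σ) (sym (twist² f σ))) (eq (twist f σ) (proj D (twist f) σ) (sgn σ) (p σ)))) (proj⊥ D (twist f) h) }
    where eq : ∀ a b s p → (a * s - b * s) * p ≡ (a - b) * (p * s)
          eq = solve-∀ ring

  J-mono : Fin n → ∀ {i k p} → i ℕ.≤ k → J i p → J k p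
  J-mono x₀ {i} {k} {p} i≤k h = subst (λ m → J m p) (ℕP.m∸n+n≡m i≤k) (go (k ℕ.∸ i))
    where go : ∀ d → J (d ℕ.+ i) p
          go zero = h
          go (suc d) = J-suc x₀ (go d)

  -- Two indicators involve at most `D + D` points; transposing two further points fixes both and
  -- changes the sign.
  plain⊥twisted : ∀ {D p q} → 2 ℕ.+ (D ℕ.+ D) ℕ.≤ n → J D p → J D (twist q) → ⟪ p , q ⟫ ≡ 0ℚ
  plain⊥twisted {D} {p} {q} big hp hq = trans (E-cong (λ σ → cong (p σ *_) (sym (twist² q σ)))) (trans (sym (⟪twist⟫ p (twist q))) (⊥-span {f = twist p} (juntas-elim {Q = λ b → ⟪ twist p , b ⟫ ≡ 0ℚ} (λ I′ K′ →
      trans (⟪twist⟫ p (ind I′ K′)) (trans (⟪⟫-comm p (twist (ind I′ K′))) (⊥-span {f = twist (ind I′ K′)} (juntas-elim {Q = λ b → ⟪ twist (ind I′ K′) , b ⟫ ≡ 0ℚ} (λ I K → vanish I′ K′ I K)) hp)))) hq))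
    where
    avoid : ∀ {i k} (I : V i) (I′ : V k) {z} → z ∉ᵛ (I Vec.++ I′) → z ∉ᵛ I × z ∉ᵛ I′
    avoid [] I′ h = tt , h
    avoid (x ∷ I) I′ (a , h) = (a , proj₁ (avoid I I′ h)) , proj₂ (avoid I I′ h)
    vanish : ∀ (I′ K′ I K : V D) → ⟪ twist (ind I′ K′) , ind I K ⟫ ≡ 0ℚ
    vanish I′ K′ I K with fresh-point (I Vec.++ I′) (ℕP.≤-trans (ℕP.n≤1+n _) big)
    ... | a , a∉ with fresh-point (a ∷ (I Vec.++ I′)) big
    ...   | b , b≢a , b∉ = antisymmetric⇒E≡0 (tr a b) (λ σ → trans (cong₂ _*_ (cong₂ _*_ (ind-fresh I′ K′ σ (proj₂ (avoid I I′ a∉)) (proj₂ (avoid I I′ b∉))) (trans (sgn-· σ (tr a b)) (cong (sgn σ *_) (sgn-tr (b≢a ∘ sym)))))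
          (ind-fresh I K σ (proj₁ (avoid I I′ a∉)) (proj₁ (avoid I I′ b∉)))) (eq (ind I′ K′ σ) (sgn σ) (ind I K σ)))
      where eq : ∀ a s b → a * (s * - 1ℚ) * b ≡ - (a * s * b)
            eq = solve-∀ ring

  -- A function fixed by all transpositions outside xs depends only on the images of xs.
  outside-invariant : ∀ {i} (xs : V i) (u : F) → (∀ a b → a ∉ᵛ xs → b ∉ᵛ xs → a ≢ b → ∀ σ → u (σ · tr a b) ≡ u σ) →
    ∀ σ τ → image σ xs ≡ image τ xs → u σ ≡ u τ
  outside-invariant xs u inv-u σ τ agree = go (allFin n) σ agree (λ z z∉ → ⊥-elim (z∉ (MemP.∈-allFin z)))
    where
    differ : ∀ {i} (xs : V i) σ y → image σ xs ≡ image τ xs → σ ⟨ y ⟩ ≢ τ ⟨ y ⟩ → y ∉ᵛ xs × (∀ y′ → σ ⟨ y′ ⟩ ≡ τ ⟨ y ⟩ → y′ ∉ᵛ xs)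
    differ [] σ y _ _ = tt , λ _ _ → tt
    differ (x ∷ xs) σ y agree ne = ((λ { refl → ne (VecP.∷-injectiveˡ agree) }) , proj₁ rest) ,
        λ y′ h → (λ { refl → ne (trans (cong (σ ⟨_⟩) (sym (act-inj τ (trans (sym (VecP.∷-injectiveˡ agree)) h)))) h) }) , proj₂ rest y′ h
      where rest = differ xs σ y (VecP.∷-injectiveʳ agree) ne
    unmoved : ∀ {i} (xs : V i) σ a b → a ∉ᵛ xs → b ∉ᵛ xs → image (σ · tr a b) xs ≡ image σ xs
    unmoved [] σ a b _ _ = refl
    unmoved (x ∷ xs) σ a b (ax , ha) (bx , hb) = cong₂ _∷_ (trans (act-· σ (tr a b) x) (cong (σ ⟨_⟩) (tr-o a b (ax ∘ sym) (bx ∘ sym)))) (unmoved xs σ a b ha hb)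
    -- Corrects `σ` one position at a time by transposing `y` with the position where `σ` takes the
    -- value `τ y`. Both positions lie outside `xs`, as `σ` and `τ` agree on `xs`.
    go : ∀ ys σ → image σ xs ≡ image τ xs → (∀ z → z ∉ ys → σ ⟨ z ⟩ ≡ τ ⟨ z ⟩) → u σ ≡ u τ
    go [] σ agree off = cong u (ext (λ z → off z (λ ())))
    go (y ∷ ys) σ agree off with σ ⟨ y ⟩ FinP.≟ τ ⟨ y ⟩
    ... | yes same = go ys σ agree λ z z∉ → case z FinP.≟ y of λ where
          (yes refl) → same
          (no z≢y) → off z (λ { (here e′) → z≢y e′ ; (there m) → z∉ m })
    ... | no ne = trans (sym (inv-u y y′ y∉ y′∉ y≢y′ σ)) (go ys (σ · tr y y′) (trans (unmoved xs σ y y′ y∉ y′∉) agree) off′)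
      where
      y′ = inv σ ⟨ τ ⟨ y ⟩ ⟩
      σy′ : σ ⟨ y′ ⟩ ≡ τ ⟨ y ⟩
      σy′ = act-inv′ σ (τ ⟨ y ⟩)
      y≢y′ : y ≢ y′
      y≢y′ e′ = ne (trans (cong (σ ⟨_⟩) e′) σy′)
      y∉ = proj₁ (differ xs σ y agree ne)
      y′∉ = proj₂ (differ xs σ y agree ne) y′ σy′
      off′ : ∀ z → z ∉ ys → (σ · tr y y′) ⟨ z ⟩ ≡ τ ⟨ z ⟩
      off′ z z∉ with z FinP.≟ y
      ... | yes refl = trans (act-· σ (tr z y′) z) (trans (cong (σ ⟨_⟩) (tr-l z y′)) σy′)
      ... | no z≢y = trans (act-· σ (tr y y′) z) (trans (cong (σ ⟨_⟩) (tr-o y y′ z≢y (λ { refl → z≢y (act-inj τ (trans (sym σz) σy′)) }))) σz)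
        where σz = off z (λ { (here e′) → z≢y e′ ; (there m) → z∉ m })

  -- By `outside-invariant`, `u` is constant on the event that `xs` has the image given by `σ`; the
  -- inner product with its indicator is `u σ` times a positive probability.
  invariant-⊥⇒0 : ∀ {i} (xs : V i) (u : F) → (∀ a b → a ∉ᵛ xs → b ∉ᵛ xs → a ≢ b → ∀ σ → u (σ · tr a b) ≡ u σ) →
    (∀ K → ⟪ u , ind xs K ⟫ ≡ 0ℚ) → ∀ σ → u σ ≡ 0ℚ
  invariant-⊥⇒0 {i} xs u inv-u u⊥ σ = trans (sym (trans (cong (_* u σ) P*1/P) (ℚP.*-identityˡ (u σ)))) (trans (eq (ℚ.1/ P) P (u σ)) (trans (cong (ℚ.1/ P *_) uP≡0) (ℚP.*-zeroʳ (ℚ.1/ P))))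
    where
    P = E (ind xs (image σ xs))
    0<P : 0ℚ < P
    0<P with ≡∨pos (0≤E (0≤ind xs (image σ xs)))
    ... | inj₂ h = h
    ... | inj₁ z = ⊥-elim (ℚP.<-irrefl refl (ℚP.<-≤-trans 0<1 (subst (1ℚ ≤_) (trans (cong (M i *_) z) (ℚP.*-zeroʳ (M i))) (ind-lower xs σ))))
    instance _ = ℚ.positive 0<P
             _ = ℚP.pos⇒nonZero P
    P*1/P : ℚ.1/ P * P ≡ 1ℚ
    P*1/P = ℚP.*-inverseˡ P
    uP≡0 : u σ * P ≡ 0ℚ
    uP≡0 = trans (sym (E-*ˡ (u σ) (ind xs (image σ xs)))) (trans (E-cong const) (u⊥ (image σ xs)))
      where const : ∀ τ → u σ * ind xs (image σ xs) τ ≡ u τ * ind xs (image σ xs) τ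
            const τ with ind-cases xs (image σ xs) τ
            ... | inj₁ e′ = cong (_* ind xs (image σ xs) τ) (outside-invariant xs u inv-u σ τ (sym e′))
            ... | inj₂ z = trans (cong (u σ *_) z) (trans (ℚP.*-zeroʳ (u σ)) (sym (trans (cong (u τ *_) z) (ℚP.*-zeroʳ (u τ)))))
    eq : ∀ r p u → r * p * u ≡ r * (u * p)
    eq = solve-∀ ring

  Perp : ℕ → F → Set
  Perp D v = (∀ {p} → J D p → ⟪ v , p ⟫ ≡ 0ℚ) × (∀ {p} → J D (twist p) → ⟪ v , p ⟫ ≡ 0ℚ)

  perp-op : ∀ {D v} c x y → x ≢ y → Perp D v → Perp D (op c (x , y) v)
  perp-op {D} {v} c x y ne (a , b) = (λ {p} h → trans (op-adjoint c (x , y) v p) (a (J-op c (x , y) h))) ,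
    (λ {p} h → trans (op-adjoint c (x , y) v p) (b (Stable.X-op (twisted D) {p} c x y ne h)))

  perp-quads : ∀ {D} j z → Proper j z → ∀ {v} → Perp D v → Perp D (quads j z v)
  perp-quads zero [] _ h = h
  perp-quads (suc j) (a ∷ b ∷ c ∷ d ∷ z) (ab , cd , pr) {v} h = perp-op {v = op 1ℚ (c , d) (quads j z v)} (- 1ℚ) a b ab (perp-op {v = quads j z v} 1ℚ c d cd (perp-quads j z pr h))

  -- If v is killed by (1 - s)(1 + s′) for all disjoint transpositions s , s′ outside xs, then all of these
  -- transpositions act on v in the same way, so v is a sum of an invariant and a sign-invariant function.
  killed⇒0 : ∀ {D i} → Fin n → (xs : V i) → AllDistinct xs → i ℕ.≤ D → 6 ℕ.+ i ℕ.≤ n → (v : F) → Perp D v →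
    (∀ a b c d → AllDistinct (a ∷ b ∷ c ∷ d ∷ xs) → ∀ σ → op (- 1ℚ) (a , b) (op 1ℚ (c , d) v) σ ≡ 0ℚ) → ∀ σ → v σ ≡ 0ℚ
  killed⇒0 {D} {i} x₀ xs dxs i≤D big v (v⊥ , v⊥s) killed σ = trans (eq (v σ) (w σ)) (cong₂ (λ a b → ℚ.½ * (a + b)) (v₊≡0 σ) (v₋≡0 σ))
    where
    eq : ∀ a b → a ≡ ℚ.½ * (a + 1ℚ * b + (a + - 1ℚ * b))
    eq = solve-∀ ring
    -- The relations for the two transpositions in either order are subtracted; the term containing
    -- both transpositions cancels.
    same-disjoint : ∀ a b c d → AllDistinct (a ∷ b ∷ c ∷ d ∷ xs) → ∀ σ → v (σ · tr a b) ≡ v (σ · tr c d)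
    same-disjoint a b c d dd@((ab , ac , ad , a∉) , (bc , bd , b∉) , (cd , c∉) , d∉ , dx) σ = solve₂ (v σ) (v (σ · tr a b)) (v (σ · tr c d)) (v (σ · tr a b · tr c d))
        (killed a b c d dd σ)
        (subst (λ g → v σ + 1ℚ * v (σ · tr a b) + - 1ℚ * (v (σ · tr c d) + 1ℚ * v g) ≡ 0ℚ) comm
          (killed c d a b ((cd , ac ∘ sym , bc ∘ sym , c∉) , (ad ∘ sym , bd ∘ sym , d∉) , (ab , a∉) , b∉ , dx) σ))
      where
      comm : σ · tr c d · tr a b ≡ σ · tr a b · tr c d
      comm = trans (·-assoc σ (tr c d) (tr a b)) (trans (cong (σ ·_) (sym (commute-apart {a , b} {c , d} (ac , ad , bc , bd)))) (sym (·-assoc σ (tr a b) (tr c d))))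
      solve₂ : ∀ x p q r → x + 1ℚ * q + - 1ℚ * (p + 1ℚ * r) ≡ 0ℚ → x + 1ℚ * p + - 1ℚ * (q + 1ℚ * r) ≡ 0ℚ → p ≡ q
      solve₂ x p q r h h′ = trans (e₁ x p q r) (trans (cong₂ (λ a b → q + ℚ.½ * (b - a)) h h′) (e₂ q))
        where e₁ : ∀ x p q r → p ≡ q + ℚ.½ * (x + 1ℚ * p + - 1ℚ * (q + 1ℚ * r) - (x + 1ℚ * q + - 1ℚ * (p + 1ℚ * r)))
              e₁ = solve-∀ ring
              e₂ : ∀ q → q + ℚ.½ * (0ℚ - 0ℚ) ≡ q
              e₂ = solve-∀ ring
    -- Transpositions that may overlap are compared through a third one disjoint from both; its two
    -- new points explain the 6 in `big`.
    same : ∀ a b c d → a ∉ᵛ xs → b ∉ᵛ xs → a ≢ b → c ∉ᵛ xs → d ∉ᵛ xs → c ≢ d → ∀ σ → v (σ · tr a b) ≡ v (σ · tr c d)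
    same a b c d a∉ b∉ ab c∉ d∉ cd σ with fresh-point (a ∷ b ∷ c ∷ d ∷ xs) (ℕP.≤-trans (ℕP.n≤1+n (5 ℕ.+ i)) big)
    ... | f , fa , fb , fc , fd , f∉ with fresh-point (f ∷ a ∷ b ∷ c ∷ d ∷ xs) big
    ...   | g , gf , ga , gb , gc , gd , g∉ = trans
          (same-disjoint a b f g ((ab , fa ∘ sym , ga ∘ sym , a∉) , (fb ∘ sym , gb ∘ sym , b∉) , (gf ∘ sym , f∉) , g∉ , dxs) σ)
          (sym (same-disjoint c d f g ((cd , fc ∘ sym , gc ∘ sym , c∉) , (fd ∘ sym , gd ∘ sym , d∉) , (gf ∘ sym , f∉) , g∉ , dxs) σ))
    fp = fresh-points xs dxs 2 (ℕP.≤-trans (ℕP.+-monoˡ-≤ i {2} {6} (ℕ.s≤s (ℕ.s≤s ℕ.z≤n))) big)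
    a₀ = lookup (proj₁ fp) zero
    b₀ = lookup (proj₁ fp) (suc zero)
    a₀∉ : a₀ ∉ᵛ xs
    a₀∉ = proj₂ (proj₂ fp) zero
    b₀∉ : b₀ ∉ᵛ xs
    b₀∉ = proj₂ (proj₂ fp) (suc zero)
    a₀≢b₀ : a₀ ≢ b₀
    a₀≢b₀ e′ with distinct-lookup (proj₁ fp) (distinct-++ˡ (proj₁ fp) (proj₁ (proj₂ fp))) {zero} {suc zero} e′
    ... | ()
    w : F
    w σ = v (σ · tr a₀ b₀)
    v₊ v₋ : F
    v₊ = op 1ℚ (a₀ , b₀) v
    v₋ = op (- 1ℚ) (a₀ , b₀) v
    moved : ∀ a b → a ∉ᵛ xs → b ∉ᵛ xs → a ≢ b → ∀ σ → v (σ · tr a b) ≡ w σ × w (σ · tr a b) ≡ v σ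
    moved a b a∉ b∉ ab σ = same a b a₀ b₀ a∉ b∉ ab a₀∉ b₀∉ a₀≢b₀ σ , trans (sym (same a b a₀ b₀ a∉ b∉ ab a₀∉ b₀∉ a₀≢b₀ (σ · tr a b))) (cong v (tr² σ a b))
    xs∈J : ∀ K → J D (ind xs K)
    xs∈J K = J-mono x₀ i≤D (ind∈J xs K)
    v₊≡0 : ∀ σ → v₊ σ ≡ 0ℚ
    v₊≡0 = invariant-⊥⇒0 xs v₊ (λ a b a∉ b∉ ab σ → trans (cong₂ (λ p q → p + 1ℚ * q) (proj₁ (moved a b a∉ b∉ ab σ)) (proj₂ (moved a b a∉ b∉ ab σ))) (eq₁ (v σ) (w σ)))
        (λ K → trans (op-adjoint 1ℚ (a₀ , b₀) v (ind xs K)) (v⊥ (J-op 1ℚ (a₀ , b₀) (xs∈J K))))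
      where eq₁ : ∀ a b → b + 1ℚ * a ≡ a + 1ℚ * b
            eq₁ = solve-∀ ring
    v₋≡0 : ∀ σ → v₋ σ ≡ 0ℚ
    v₋≡0 σ = trans (sym (twist² v₋ σ)) (trans (cong (_* sgn σ) (tv₋≡0 σ)) (ℚP.*-zeroˡ (sgn σ)))
      where
      eq₁ : ∀ a b s → (b + - 1ℚ * a) * (s * - 1ℚ) ≡ (a + - 1ℚ * b) * s
      eq₁ = solve-∀ ring
      tv₋≡0 : ∀ σ → twist v₋ σ ≡ 0ℚ
      tv₋≡0 = invariant-⊥⇒0 xs (twist v₋) (λ a b a∉ b∉ ab σ → trans (cong₂ _*_ (cong₂ (λ p q → p + - 1ℚ * q) (proj₁ (moved a b a∉ b∉ ab σ)) (proj₂ (moved a b a∉ b∉ ab σ)))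
            (trans (sgn-· σ (tr a b)) (cong (sgn σ *_) (sgn-tr ab)))) (eq₁ (v σ) (w σ) (sgn σ)))
          (λ K → trans (⟪twist⟫ v₋ (ind xs K)) (trans (op-adjoint (- 1ℚ) (a₀ , b₀) v (twist (ind xs K)))
            (v⊥s (Stable.X-op (twisted D) {twist (ind xs K)} (- 1ℚ) a₀ b₀ a₀≢b₀ (span-resp (twist² (ind xs K)) (xs∈J K))))))

  -- Each function `quads j z v` meets the hypotheses of `killed⇒0` with `z` as the exceptional
  -- points, so the product of factors can be shortened by one quadruple.
  quads-killed⇒0 : ∀ {D} → Fin n → (v : F) → Perp D v → ∀ j → j ℕ.* 4 ℕ.≤ D → 6 ℕ.+ D ℕ.≤ n →
    (∀ (z : V (j ℕ.* 4)) → AllDistinct z → ∀ σ → quads j z v σ ≡ 0ℚ) → ∀ σ → v σ ≡ 0ℚ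
  quads-killed⇒0 x₀ v perp zero _ _ h = h [] tt
  quads-killed⇒0 {D} x₀ v perp (suc j) j≤D big h = quads-killed⇒0 x₀ v perp j j*4≤D big λ z dz →
      killed⇒0 x₀ z dz j*4≤D (ℕP.≤-trans (ℕP.+-monoʳ-≤ 6 j*4≤D) big) (quads j z v) (perp-quads j z (proper j z dz) {v} perp) (λ a b c d dd → h (a ∷ b ∷ c ∷ d ∷ z) dd)
    where j*4≤D : j ℕ.* 4 ℕ.≤ D
          j*4≤D = ℕP.≤-trans (ℕP.m≤n+m (j ℕ.* 4) 4) j≤D

-- Spread-out families

module SpreadFamilies {n : ℕ} (𝓖 : PermGroup n) where
  open PermGroup 𝓖
  open Functions 𝓖
  open Convolution 𝓖
  open HighLevels 𝓖
  open Juntas 𝓖 using (J)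

  Signed : F → Pair n → Set
  Signed v p = Weight v p 1ℚ ⊎ Weight v p (- 1ℚ)

  signed-op : ∀ {v p} q d → (p ≡ q ⊎ Apart p q) → Signed v p → Signed (op d q v) p
  signed-op q d h (inj₁ w) = inj₁ (weight-op q d h w)
  signed-op q d h (inj₂ w) = inj₂ (weight-op q d h w)

  translate : ∀ {v c} g t p → t · g ≡ g · swap p → Weight v p c → ∀ σ → v (σ · t · g) ≡ c * v (σ · g)
  translate {v} g t p h (weighted w) σ = trans (cong v (trans (·-assoc σ t g) (trans (cong (σ ·_) h) (sym (·-assoc σ g (swap p)))))) (w (σ · g))

  -- In each of j groups there is a pair of weight -1, a pair of weight 1 and M pairs of unknown weight.
  module Family (j M : ℕ) (pr : Fin j → Fin (2 ℕ.+ M) → Pair n)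
    (apart : ∀ l s l′ s′ → (l ≢ l′ ⊎ s ≢ s′) → Apart (pr l s) (pr l′ s′))
    (proper-pair : ∀ l s → proj₁ (pr l s) ≢ proj₂ (pr l s)) where

    Base Extra : F → Set
    Base v = ∀ l → Weight v (pr l zero) (- 1ℚ) × Weight v (pr l (suc zero)) 1ℚ
    Extra v = ∀ l b → Signed v (pr l (suc (suc b)))

    equal-or-apart : ∀ l s l′ s′ → pr l s ≡ pr l′ s′ ⊎ Apart (pr l s) (pr l′ s′)
    equal-or-apart l s l′ s′ with l FinP.≟ l′ | s FinP.≟ s′
    ... | yes refl | yes refl = inj₁ refl
    ... | no h | _ = inj₂ (apart l s l′ s′ (inj₁ h))
    ... | _ | no h = inj₂ (apart l s l′ s′ (inj₂ h))

    module _ (v : F) (base : Base v) (extra : Extra v) where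

      -- The pair of known weight whose weight is opposite to that of the extra pair `b`.
      anchor : Fin j → Fin M → Fin (2 ℕ.+ M)
      anchor l b with extra l b
      ... | inj₁ _ = zero
      ... | inj₂ _ = suc zero

      anchor≢ : ∀ l b b′ → anchor l b ≢ suc (suc b′)
      anchor≢ l b b′ with extra l b
      ... | inj₁ _ = λ ()
      ... | inj₂ _ = λ ()

      opposite : ∀ l b → ∃[ c ] ∃[ c′ ] (c * c′ ≡ - 1ℚ) × (c′ * c ≡ - 1ℚ) × Weight v (pr l (anchor l b)) c × Weight v (pr l (suc (suc b))) c′
      opposite l b with extra l b
      ... | inj₁ w = - 1ℚ , 1ℚ , refl , refl , proj₁ (base l) , w
      ... | inj₂ w = 1ℚ , - 1ℚ , refl , refl , proj₂ (base l) , w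

      -- Swaps the extra pair `b` with its anchor, so that the transposition of pair `b` acts on the
      -- translate of `v` by the weight of the anchor.
      exchange : Fin j → Fin M → G
      exchange l b = tr (proj₁ (pr l (suc (suc b)))) (proj₁ (pr l (anchor l b))) · tr (proj₂ (pr l (suc (suc b)))) (proj₂ (pr l (anchor l b)))

      exchange-fixes : ∀ l b l′ s′ → (l ≢ l′ ⊎ (suc (suc b) ≢ s′ × anchor l b ≢ s′)) →
        exchange l b ⟨ proj₁ (pr l′ s′) ⟩ ≡ proj₁ (pr l′ s′) × exchange l b ⟨ proj₂ (pr l′ s′) ⟩ ≡ proj₂ (pr l′ s′)
      exchange-fixes l b l′ s′ h = fix , fix′
        where
        x = proj₁ (pr l (suc (suc b)))
        y = proj₂ (pr l (suc (suc b)))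
        x′ = proj₁ (pr l (anchor l b))
        y′ = proj₂ (pr l (anchor l b))
        ap : Apart (pr l (suc (suc b))) (pr l′ s′)
        ap = apart l (suc (suc b)) l′ s′ ([ inj₁ , inj₂ ∘ proj₁ ]′ h)
        ap′ : Apart (pr l (anchor l b)) (pr l′ s′)
        ap′ = apart l (anchor l b) l′ s′ ([ inj₁ , inj₂ ∘ proj₂ ]′ h)
        outside : ∀ {z} → z ≢ x → z ≢ y → z ≢ x′ → z ≢ y′ → exchange l b ⟨ z ⟩ ≡ z
        outside {z} a c d f = trans (act-· (tr x x′) (tr y y′) z) (trans (cong (tr x x′ ⟨_⟩) (tr-o y y′ c f)) (tr-o x x′ a d))
        fix : exchange l b ⟨ proj₁ (pr l′ s′) ⟩ ≡ proj₁ (pr l′ s′)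
        fix = outside (proj₁ ap ∘ sym) (proj₁ (proj₂ (proj₂ ap)) ∘ sym) (proj₁ ap′ ∘ sym) (proj₁ (proj₂ (proj₂ ap′)) ∘ sym)
        fix′ : exchange l b ⟨ proj₂ (pr l′ s′) ⟩ ≡ proj₂ (pr l′ s′)
        fix′ = outside (proj₁ (proj₂ ap) ∘ sym) (proj₂ (proj₂ (proj₂ ap)) ∘ sym) (proj₁ (proj₂ ap′) ∘ sym) (proj₂ (proj₂ (proj₂ ap′)) ∘ sym)

      exchange-swap : ∀ l b → swap (pr l (suc (suc b))) · exchange l b ≡ exchange l b · swap (pr l (anchor l b))
      exchange-swap l b = sym (trans (conj-tr (exchange l b) x′ y′) (cong₂ (λ p q → tr p q · exchange l b) moved-x moved-y))
        where
        x = proj₁ (pr l (suc (suc b)))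
        y = proj₂ (pr l (suc (suc b)))
        x′ = proj₁ (pr l (anchor l b))
        y′ = proj₂ (pr l (anchor l b))
        ap : Apart (pr l (suc (suc b))) (pr l (anchor l b))
        ap = apart l (suc (suc b)) l (anchor l b) (inj₂ (λ e′ → anchor≢ l b b (sym e′)))
        moved-x : exchange l b ⟨ x′ ⟩ ≡ x
        moved-x = trans (act-· (tr x x′) (tr y y′) x′) (trans (cong (tr x x′ ⟨_⟩) (tr-o y y′ (proj₁ (proj₂ (proj₂ ap)) ∘ sym) (proper-pair l (anchor l b)))) (tr-r x x′))
        moved-y : exchange l b ⟨ y′ ⟩ ≡ y
        moved-y = trans (act-· (tr x x′) (tr y y′) y′) (trans (cong (tr x x′ ⟨_⟩) (tr-r y y′)) (tr-o x x′ (proper-pair l (suc (suc b)) ∘ sym) (proj₁ (proj₂ (proj₂ ap)))))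

      translates : List (Fin j) → List G
      translates [] = e ∷ []
      translates (l ∷ ls) = concatMap (λ b → map (exchange l b ·_) (translates ls)) (allFin M)

      length-translates : ∀ ls → length (translates ls) ≡ M ℕ.^ length ls
      length-translates [] = refl
      length-translates (l ∷ ls) = trans (go (allFin M)) (cong₂ ℕ._*_ (ListP.length-tabulate {n = M} id) (length-translates ls))
        where go : ∀ bs → length (concatMap (λ b → map (exchange l b ·_) (translates ls)) bs) ≡ length bs ℕ.* length (translates ls)
              go [] = refl
              go (b ∷ bs) = trans (ListP.length-++ (map (exchange l b ·_) (translates ls))) (cong₂ ℕ._+_ (ListP.length-map (exchange l b ·_) (translates ls)) (go bs))

      Fixes : Fin j → G → Set
      Fixes l π = ∀ s → π ⟨ proj₁ (pr l s) ⟩ ≡ proj₁ (pr l s) × π ⟨ proj₂ (pr l s) ⟩ ≡ proj₂ (pr l s)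

      translates-fix : ∀ ls l → All (l ≢_) ls → All (Fixes l) (translates ls)
      translates-fix [] l _ = (λ s → act-e _ , act-e _) ∷ []
      translates-fix (l′ ∷ ls) l (l≢l′ ∷ h) = go (allFin M)
        where
        go : ∀ bs → All (Fixes l) (concatMap (λ b → map (exchange l′ b ·_) (translates ls)) bs)
        go [] = []
        go (b ∷ bs) = AllP.++⁺ (AllP.map⁺ (All.map (λ {π} f s → trans (act-· (exchange l′ b) π _) (trans (cong (exchange l′ b ⟨_⟩) (proj₁ (f s))) (proj₁ (exchange-fixes l′ b l s (inj₁ (l≢l′ ∘ sym)))))
            , trans (act-· (exchange l′ b) π _) (trans (cong (exchange l′ b ⟨_⟩) (proj₂ (f s))) (proj₂ (exchange-fixes l′ b l s (inj₁ (l≢l′ ∘ sym)))))) (translates-fix ls l h))) (go bs)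

      fixes-commute : ∀ {l π} s → Fixes l π → swap (pr l s) · π ≡ π · swap (pr l s)
      fixes-commute {l} {π} s f = sym (commute-fixed π (proj₁ (pr l s)) (proj₂ (pr l s)) (proj₁ (f s)) (proj₂ (f s)))

      -- The transposition of pair `b` acts on the first translate through the anchor and on the
      -- second directly, as `exchange l b′` fixes pair `b`. By the choice of the anchor the two
      -- weights are opposite.
      separate-different : ∀ l {b b′ π π′} → b ≢ b′ → Fixes l π → Fixes l π′ → Separated v (exchange l b · π) (exchange l b′ · π′)
      separate-different l {b} {b′} {π} {π′} b≢b′ f f′ with opposite l b
      ... | c , c′ , cc′ , _ , wa , wb = swap (pr l (suc (suc b))) , c , c′ , cc′ ,
          translate (exchange l b · π) (swap (pr l (suc (suc b)))) (pr l (anchor l b)) (trans (sym (·-assoc _ (exchange l b) π)) (trans (cong (_· π) (exchange-swap l b)) (trans (·-assoc (exchange l b) _ π) (trans (cong (exchange l b ·_) (fixes-commute (anchor l b) f)) (sym (·-assoc (exchange l b) π _)))))) wa ,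
          translate (exchange l b′ · π′) (swap (pr l (suc (suc b)))) (pr l (suc (suc b))) (trans (sym (·-assoc _ (exchange l b′) π′)) (trans (cong (_· π′) other) (trans (·-assoc (exchange l b′) _ π′) (trans (cong (exchange l b′ ·_) (fixes-commute (suc (suc b)) f′)) (sym (·-assoc (exchange l b′) π′ _)))))) wb
        where
        fixed = exchange-fixes l b′ l (suc (suc b)) (inj₂ ((λ e′ → b≢b′ (sym (FinP.suc-injective (FinP.suc-injective e′)))) , anchor≢ l b′ b))
        other : swap (pr l (suc (suc b))) · exchange l b′ ≡ exchange l b′ · swap (pr l (suc (suc b)))
        other = sym (commute-fixed (exchange l b′) (proj₁ (pr l (suc (suc b)))) (proj₂ (pr l (suc (suc b)))) (proj₁ fixed) (proj₂ fixed))

      -- A common left factor merely conjugates the separating element.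
      separate-same : ∀ w {π π′} → Separated v π π′ → Separated v (w · π) (w · π′)
      separate-same w {π} {π′} (t , c , c′ , cc′ , h , h′) = w · t · inv w , c , c′ , cc′ , go π c h , go π′ c′ h′
        where go : ∀ π c → (∀ σ → v (σ · t · π) ≡ c * v (σ · π)) → ∀ σ → v (σ · (w · t · inv w) · (w · π)) ≡ c * v (σ · (w · π))
              go π c h σ = trans (cong v eq) (trans (h (σ · w)) (cong (λ g → c * v g) (·-assoc σ w π)))
                where eq : σ · (w · t · inv w) · (w · π) ≡ σ · w · t · π
                      eq = trans (·-assoc σ _ (w · π)) (trans (cong (σ ·_) (trans (·-assoc (w · t) (inv w) (w · π)) (cong (w · t ·_) (cancel-invˡ′ w π))))
                        (trans (sym (·-assoc σ (w · t) π)) (cong (_· π) (sym (·-assoc σ w t)))))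

      separated-translates : ∀ ls → Unique ls → AllPairs (Separated v) (translates ls)
      separated-translates [] _ = [] ∷ []
      separated-translates (l ∷ ls) (l∉ ∷ u) = go (allFin M) (UniqueP.allFin⁺ M)
        where
        fixes = translates-fix ls l l∉
        same : ∀ w {ts} → AllPairs (Separated v) ts → AllPairs (Separated v) (map (w ·_) ts)
        same w [] = []
        same w (x ∷ xs) = AllP.map⁺ (All.map (separate-same w) x) ∷ same w xs
        cross : ∀ b bs → All (b ≢_) bs → All (λ π → All (Separated v π) (concatMap (λ b → map (exchange l b ·_) (translates ls)) bs)) (map (exchange l b ·_) (translates ls))
        cross b bs b∉ = AllP.map⁺ (All.map (λ {π} f → inner π f bs b∉) fixes)
          where inner : ∀ π → Fixes l π → ∀ bs → All (b ≢_) bs → All (Separated v (exchange l b · π)) (concatMap (λ b → map (exchange l b ·_) (translates ls)) bs)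
                inner π f [] [] = []
                inner π f (b′ ∷ bs) (ne ∷ h) = AllP.++⁺ (AllP.map⁺ (All.map (λ f′ → separate-different l ne f f′) fixes)) (inner π f bs h)
        append : ∀ {xs ys} → AllPairs (Separated v) xs → AllPairs (Separated v) ys → All (λ x → All (Separated v x) ys) xs → AllPairs (Separated v) (xs ++ ys)
        append [] q [] = q
        append (x ∷ p) q (y ∷ c) = AllP.++⁺ x y ∷ append p q c
        go : ∀ bs → Unique bs → AllPairs (Separated v) (concatMap (λ b → map (exchange l b ·_) (translates ls)) bs)
        go [] [] = []
        go (b ∷ bs) (b∉ ∷ ub) = append (same (exchange l b) (separated-translates ls u)) (go bs ub) (cross b bs b∉)

      spread-out : Spread-out (M ℕ.^ j) v
      spread-out = translates (allFin j) , trans (length-translates (allFin j)) (cong (M ℕ.^_) (ListP.length-tabulate {n = j} id)) , separated-translates (allFin j) (UniqueP.allFin⁺ j)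

    base-op : ∀ {v} l b d → Base v → Base (op d (pr l (suc (suc b))) v)
    base-op l b d h l′ = weight-op (pr l (suc (suc b))) d (equal-or-apart l′ zero l (suc (suc b))) (proj₁ (h l′)) , weight-op (pr l (suc (suc b))) d (equal-or-apart l′ (suc zero) l (suc (suc b))) (proj₂ (h l′))

    private
      At : F → Fin j × Fin M → Set
      At v (l , b) = Signed v (pr l (suc (suc b)))

      -- Halves `v` into its parts of weight 1 and -1 along one extra pair after another; signs
      -- already found survive, since equal or disjoint transpositions commute. The continuation
      -- receives the pieces with all signs known.
      split : ∀ todo known v → Base v → All (At v) known → (∀ v′ → Base v′ → All (At v′) known → All (At v′) todo → Span (Spread-out (M ℕ.^ j)) v′) → Span (Spread-out (M ℕ.^ j)) v
      split [] known v base kn cont = cont v base kn []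
      split ((l , b) ∷ todo) known v base kn cont = add (scale ℚ.½ (part 1ℚ inj₁ refl) (λ _ → refl)) (scale ℚ.½ (part (- 1ℚ) inj₂ refl) (λ _ → refl))
          (λ σ → eq (v σ) (v (σ · swap p)))
        where
        p = pr l (suc (suc b))
        eq : ∀ a b → a ≡ ℚ.½ * (a + 1ℚ * b) + ℚ.½ * (a + - 1ℚ * b)
        eq = solve-∀ ring
        part : ∀ c → (Weight (op c p v) p c → Signed (op c p v) p) → c * c ≡ 1ℚ → Span (Spread-out (M ℕ.^ j)) (op c p v)
        part c inj cc = split todo ((l , b) ∷ known) (op c p v) (base-op l b c base)
          (inj (weight-own p v cc) ∷ All.map (λ {(l′ , b′)} s → signed-op p c (equal-or-apart l′ (suc (suc b′)) l (suc (suc b))) s) kn)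
          (λ { v′ base′ (s ∷ kn′) rest → cont v′ base′ kn′ (s ∷ rest) })

    base⇒span : ∀ v → Base v → Span (Spread-out (M ℕ.^ j)) v
    base⇒span v base = split (cartesianProduct (allFin j) (allFin M)) [] v base [] λ v′ base′ _ all →
      gen (spread-out v′ base′ (λ l b → All.lookup all (MemP.∈-cartesianProduct⁺ (MemP.∈-allFin l) (MemP.∈-allFin b))))

  δ-at : G → F
  δ-at τ σ = if does (σ ≟G τ) then 1ℚ else 0ℚ

  ⟪δ-at⟫ : ∀ f τ → ⟪ f , δ-at τ ⟫ ≡ 0ℚ → f τ ≡ 0ℚ
  ⟪δ-at⟫ f τ h = trans (sym (trans (cong (f τ *_) δ-self) (ℚP.*-identityʳ (f τ)))) (sq≡0 (ℚP.≤-reflexive (trans (eq (f τ) (δ-at τ τ)) (E-definite g 0≤g (ℚP.≤-reflexive Eg) τ))))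
    where
    δ-self : δ-at τ τ ≡ 1ℚ
    δ-self = cong (λ b → if b then 1ℚ else 0ℚ) (dec-true (τ ≟G τ) refl)
    g : F
    g σ = f τ * (f σ * (δ-at τ σ * δ-at τ σ))
    δ-cases : ∀ σ → (σ ≡ τ) ⊎ δ-at τ σ ≡ 0ℚ
    δ-cases σ with σ ≟G τ
    ... | yes h = inj₁ h
    ... | no _ = inj₂ refl
    0≤g : ∀ σ → 0ℚ ≤ g σ
    0≤g σ with δ-cases σ
    ... | inj₁ refl = subst (0ℚ ≤_) (eq′ (f τ) (δ-at τ τ)) (0≤sq (f τ * δ-at τ τ))
      where eq′ : ∀ a b → a * b * (a * b) ≡ a * (a * (b * b))
            eq′ = solve-∀ ring
    ... | inj₂ z = ℚP.≤-reflexive (sym (trans (cong (λ d → f τ * (f σ * (d * d))) z) (eq′ (f τ) (f σ))))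
      where eq′ : ∀ a b → a * (b * (0ℚ * 0ℚ)) ≡ 0ℚ
            eq′ = solve-∀ ring
    idem : ∀ σ → δ-at τ σ * δ-at τ σ ≡ δ-at τ σ
    idem σ with σ ≟G τ
    ... | yes _ = refl
    ... | no _ = refl
    Eg : E g ≡ 0ℚ
    Eg = trans (E-*ˡ (f τ) _) (trans (cong (f τ *_) (trans (E-cong (λ σ → cong (f σ *_) (idem σ))) h)) (ℚP.*-zeroʳ (f τ)))
    eq : ∀ a b → a * b * (a * b) ≡ a * (a * (b * b))
    eq = solve-∀ ring

  quads′-weight : ∀ j z {v x y c} → x ∉ᵛ z → y ∉ᵛ z → Weight v (x , y) c → Weight (quads′ j z v) (x , y) c
  quads′-weight zero [] _ _ h = h
  quads′-weight (suc j) (a ∷ b ∷ c ∷ d ∷ z) (xa , xb , xc , xd , x∉) (ya , yb , yc , yd , y∉) h =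
    quads′-weight j z x∉ y∉ (weight-op (c , d) 1ℚ (inj₂ (xc , xd , yc , yd)) (weight-op (a , b) (- 1ℚ) (inj₂ (xa , xb , ya , yb)) h))

  -- In the reversed product every factor remains visible as a weight at its own pair, because the
  -- factors applied after it belong to disjoint pairs. Quadruple `l` occupies the positions `4 l`
  -- to `4 l + 3` of `z`.
  quads′-base : ∀ j z → AllDistinct z → ∀ v (l : Fin j) →
    Weight (quads′ j z v) (lookup z (Fin.combine l zero) , lookup z (Fin.combine l (suc zero))) (- 1ℚ) ×
    Weight (quads′ j z v) (lookup z (Fin.combine l (suc (suc zero))) , lookup z (Fin.combine l (suc (suc (suc zero))))) 1ℚ
  quads′-base (suc j) (a ∷ b ∷ c ∷ d ∷ z) ((ab , ac , ad , a∉) , (bc , bd , b∉) , (cd , c∉) , d∉ , dz) v zero =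
    quads′-weight j z a∉ b∉ (weight-op (c , d) 1ℚ (inj₂ (ac , ad , bc , bd)) (weight-own (a , b) v refl)) , quads′-weight j z c∉ d∉ (weight-own (c , d) (op (- 1ℚ) (a , b) v) refl)
  quads′-base (suc j) (a ∷ b ∷ c ∷ d ∷ z) (_ , _ , _ , _ , dz) v (suc l) = quads′-base j z dz (op 1ℚ (c , d) (op (- 1ℚ) (a , b) v)) l

  -- The `j * (M * 2)` fresh points provide `M` extra pairs for each group; the two base pairs of a
  -- group are those of its quadruple.
  quads′∈span : ∀ j M z → AllDistinct z → j ℕ.* (M ℕ.* 2) ℕ.+ j ℕ.* 4 ℕ.≤ n → ∀ v → Span (Spread-out (M ℕ.^ j)) (quads′ j z v)
  quads′∈span j M z dz big v with fresh-points z dz (j ℕ.* (M ℕ.* 2)) big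
  ... | ws , dws , out = Family.base⇒span j M pr apart proper-pair (quads′ j z v) (quads′-base j z dz v)
    where
    pt : Fin j → Fin (2 ℕ.+ M) → Fin 2 → Fin n
    pt l zero i = lookup z (Fin.combine l (Fin.combine {2} {2} zero i))
    pt l (suc zero) i = lookup z (Fin.combine l (Fin.combine {2} {2} (suc zero) i))
    pt l (suc (suc b)) i = lookup ws (Fin.combine l (Fin.combine b i))
    pr : Fin j → Fin (2 ℕ.+ M) → Pair n
    pr l s = pt l s zero , pt l s (suc zero)
    inner : ∀ {l l′ : Fin j} {s s′ : Fin 2} {i i′ : Fin 2} → lookup z (Fin.combine l (Fin.combine s i)) ≡ lookup z (Fin.combine l′ (Fin.combine s′ i′)) → l ≡ l′ × s ≡ s′ × i ≡ i′
    inner {l} {l′} {s} {s′} {i} {i′} h with FinP.combine-injective l (Fin.combine s i) l′ (Fin.combine s′ i′) (distinct-lookup z dz h)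
    ... | a , b = a , FinP.combine-injective s i s′ i′ b
    outer : ∀ {l l′ : Fin j} {s s′ : Fin M} {i i′ : Fin 2} → lookup ws (Fin.combine l (Fin.combine s i)) ≡ lookup ws (Fin.combine l′ (Fin.combine s′ i′)) → l ≡ l′ × s ≡ s′ × i ≡ i′
    outer {l} {l′} {s} {s′} {i} {i′} h with FinP.combine-injective l (Fin.combine s i) l′ (Fin.combine s′ i′) (distinct-lookup ws (distinct-++ˡ ws dws) h)
    ... | a , b = a , FinP.combine-injective s i s′ i′ b
    mixed : ∀ {k l} → lookup ws k ≢ lookup z l
    mixed {k} {l} = ∉ᵛ-lookup z (out k) l
    injective : ∀ l s i l′ s′ i′ → pt l s i ≡ pt l′ s′ i′ → l ≡ l′ × s ≡ s′ × i ≡ i′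
    injective l zero i l′ zero i′ h = case inner {s = zero} {zero} h of λ { (a , b , c) → a , refl , c }
    injective l zero i l′ (suc zero) i′ h = case inner {s = zero} {suc zero} h of λ { (_ , () , _) }
    injective l (suc zero) i l′ zero i′ h = case inner {s = suc zero} {zero} h of λ { (_ , () , _) }
    injective l (suc zero) i l′ (suc zero) i′ h = case inner {s = suc zero} {suc zero} h of λ { (a , b , c) → a , refl , c }
    injective l (suc (suc b)) i l′ (suc (suc b′)) i′ h = case outer h of λ { (x , y , w) → x , cong (λ c → suc (suc c)) y , w }
    injective l zero i l′ (suc (suc b′)) i′ h = ⊥-elim (mixed (sym h))
    injective l (suc zero) i l′ (suc (suc b′)) i′ h = ⊥-elim (mixed (sym h))
    injective l (suc (suc b)) i l′ zero i′ h = ⊥-elim (mixed h)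
    injective l (suc (suc b)) i l′ (suc zero) i′ h = ⊥-elim (mixed h)
    apart : ∀ l s l′ s′ → (l ≢ l′ ⊎ s ≢ s′) → Apart (pr l s) (pr l′ s′)
    apart l s l′ s′ ne = go zero zero , go zero (suc zero) , go (suc zero) zero , go (suc zero) (suc zero)
      where go : ∀ i i′ → pt l s i ≢ pt l′ s′ i′
            go i i′ h with injective l s i l′ s′ i′ h
            ... | a , b , _ = [ (λ f → f a) , (λ f → f b) ]′ ne
    proper-pair : ∀ l s → pt l s zero ≢ pt l s (suc zero)
    proper-pair l s h with injective l s zero l s (suc zero) h
    ... | _ , _ , ()

  -- The residue `r` of `h` modulo the functions `quads′ j z (δ-at τ)` is killed by all `quads j z`
  -- with distinct `z`. It stays killed when its low and twisted parts are subtracted, so by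
  -- `quads-killed⇒0` it is the sum of these parts. Being then orthogonal to `h` and to the
  -- projection of `h`, it vanishes.
  high-levels : ∀ j M → Fin n → 6 ℕ.+ j ℕ.* 4 ℕ.≤ n → 2 ℕ.+ (j ℕ.* 4 ℕ.+ j ℕ.* 4) ℕ.≤ n → j ℕ.* (M ℕ.* 2) ℕ.+ j ℕ.* 4 ℕ.≤ n →
    ∀ {h} → Perp (j ℕ.* 4) h → Span (Spread-out (M ℕ.^ j)) h
  high-levels j M x₀ big₁ big₂ big₃ {h} (h⊥ , h⊥s) = span-resp h≡ (span-⊆ us⇒span (Projection.proj∈ Π h))
    where
    D = j ℕ.* 4
    generator : G → Vec (Fin n) D → List F
    generator τ z with allDistinct? z
    ... | yes _ = quads′ j z (δ-at τ) ∷ []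
    ... | no _ = []
    us : List F
    us = concatMap (λ τ → concatMap (generator τ) (allVecs n D)) els
    Π = gram-schmidt us
    us⇒span : ∀ {p} → p ∈ us → Span (Spread-out (M ℕ.^ j)) p
    us⇒span {p} p∈ = outerl els (MemP.∈-concatMap⁻ (λ τ → concatMap (generator τ) (allVecs n D)) {xs = els} p∈)
      where
      one : ∀ τ z → p ∈ generator τ z → Span (Spread-out (M ℕ.^ j)) p
      one τ z q with allDistinct? z
      one τ z (here refl) | yes dz = quads′∈span j M z dz big₃ (δ-at τ)
      innerl : ∀ τ zs → Any (λ z → p ∈ generator τ z) zs → Span (Spread-out (M ℕ.^ j)) p
      innerl τ (z ∷ zs) (here q) = one τ z q
      innerl τ (z ∷ zs) (there q) = innerl τ zs q
      outerl : ∀ τs → Any (λ τ → p ∈ concatMap (generator τ) (allVecs n D)) τs → Span (Spread-out (M ℕ.^ j)) p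
      outerl (τ ∷ τs) (here q) = innerl τ (allVecs n D) (MemP.∈-concatMap⁻ (generator τ) {xs = allVecs n D} q)
      outerl (τ ∷ τs) (there q) = outerl τs q
    ∈us : ∀ τ z → AllDistinct z → quads′ j z (δ-at τ) ∈ us
    ∈us τ z dz = MemP.∈-concatMap⁺ (λ τ → concatMap (generator τ) (allVecs n D)) (Any.map (λ { refl → MemP.∈-concatMap⁺ (generator τ) (Any.map (λ { refl → gen∈ }) (∈-allVecs z)) }) (∈els τ))
      where gen∈ : quads′ j z (δ-at τ) ∈ generator τ z
            gen∈ with allDistinct? z
            ... | yes _ = here refl
            ... | no nd = ⊥-elim (nd dz)
    r r₁ r₂ r′ : F
    r σ = h σ - Projection.proj Π h σ
    r₁ = Stable.P (plain D) r
    r₂ = Stable.P (twisted D) r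
    r′ σ = r σ - r₁ σ - r₂ σ
    r-killed : ∀ z → AllDistinct z → ∀ σ → quads j z r σ ≡ 0ℚ
    r-killed z dz τ = ⟪δ-at⟫ (quads j z r) τ (trans (quads-adjoint j z r (δ-at τ)) (Projection.proj⊥ Π h (gen (∈us τ z dz))))
    r′-killed : ∀ z → AllDistinct z → ∀ σ → quads j z r′ σ ≡ 0ℚ
    r′-killed z dz σ = trans (quads-- j z (λ σ → r σ - r₁ σ) r₂ σ) (trans (cong (_- quads j z r₂ σ) (quads-- j z r r₁ σ))
      (trans (cong₂ _-_ (cong₂ _-_ (r-killed z dz σ) (Stable.quads-proj (plain D) j z (proper j z dz) r (r-killed z dz) σ)) (Stable.quads-proj (twisted D) j z (proper j z dz) r (r-killed z dz) σ)) refl))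
    r′-perp : Perp D r′
    r′-perp = (λ {p} hp → trans (⟪⟫--ˡ (λ σ → r σ - r₁ σ) r₂ p) (trans (cong₂ _-_ (Stable.P⊥ (plain D) r hp) (trans (⟪⟫-comm r₂ p) (plain⊥twisted big₂ hp (Stable.P∈ (twisted D) r)))) refl)) ,
      (λ {p} hp → trans (E-cong (λ σ → eq (r σ) (r₁ σ) (r₂ σ) (p σ))) (trans (E-- (λ σ → (r σ - r₂ σ) * p σ) (λ σ → r₁ σ * p σ)) (trans (cong₂ _-_ (Stable.P⊥ (twisted D) r {p} hp) (plain⊥twisted big₂ (Stable.P∈ (plain D) r) hp)) refl)))
      where eq : ∀ a b c d → (a - b - c) * d ≡ (a - c) * d - b * d
            eq = solve-∀ ring
    r′≡0 : ∀ σ → r′ σ ≡ 0ℚ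
    r′≡0 = quads-killed⇒0 x₀ r′ r′-perp j ℕP.≤-refl big₁ r′-killed
    r≡ : ∀ σ → r σ ≡ r₁ σ + r₂ σ
    r≡ σ = trans (eq (r σ) (r₁ σ) (r₂ σ)) (trans (cong (_+ (r₁ σ + r₂ σ)) (r′≡0 σ)) (ℚP.+-identityˡ (r₁ σ + r₂ σ)))
      where eq : ∀ a b c → a ≡ a - b - c + (b + c)
            eq = solve-∀ ring
    ⟪r,r⟫ : ⟪ r , r ⟫ ≡ 0ℚ
    ⟪r,r⟫ = trans (⟪⟫--ʳ h (Projection.proj Π h) r) (trans (cong₂ _-_ (trans (⟪⟫-comm r h) (trans (⟪⟫-cong {h} (λ _ → refl) r≡) (trans (⟪⟫-+ʳ r₁ r₂ h) (cong₂ _+_ (h⊥ (Stable.P∈ (plain D) r)) (h⊥s (Stable.P∈ (twisted D) r))))))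
      (Projection.proj⊥ Π h (Projection.proj∈ Π h))) refl)
    h≡ : ∀ σ → h σ ≡ Projection.proj Π h σ
    h≡ σ = trans (x≡x-y+y (h σ) (Projection.proj Π h σ)) (trans (cong (_+ Projection.proj Π h σ) (⟪⟫-definite r (ℚP.≤-reflexive ⟪r,r⟫) σ)) (ℚP.+-identityˡ (Projection.proj Π h σ)))

-- The symmetric group

module SymmetricGroup (n : ℕ) where

  distinct⇒injective : ∀ {m} (v : Vec (Fin n) m) → Distinct v → ∀ i k → lookup v i ≡ lookup v k → i ≡ k
  distinct⇒injective (x ∷ v) (x∉ ∷ d) = go
    where
    at : ∀ {m} {v : Vec (Fin n) m} → All (x ≢_) (toList v) → ∀ i → x ≢ lookup v i
    at {v = y ∷ v} (a ∷ as) zero = a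
    at {v = y ∷ v} (a ∷ as) (suc i) = at as i
    go : ∀ i k → lookup (x ∷ v) i ≡ lookup (x ∷ v) k → i ≡ k
    go zero zero _ = refl
    go zero (suc k) h = ⊥-elim (at x∉ k h)
    go (suc i) zero h = ⊥-elim (at x∉ i (sym h))
    go (suc i) (suc k) h = cong suc (distinct⇒injective v d i k h)

  injective⇒distinct : ∀ {m} (v : Vec (Fin n) m) → (∀ i k → lookup v i ≡ lookup v k → i ≡ k) → Distinct v
  injective⇒distinct [] h = []
  injective⇒distinct (x ∷ v) h = all v (λ i e → case h zero (suc i) e of λ ()) ∷ injective⇒distinct v (λ i k e → FinP.suc-injective (h (suc i) (suc k) e))
    where all : ∀ {m} (v : Vec (Fin n) m) → (∀ i → x ≢ lookup v i) → All (x ≢_) (toList v)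
          all [] f = []
          all (y ∷ v) f = f zero ∷ all v (f ∘ suc)

  -- The proof of distinctness is irrelevant, so equality in `S` is equality of vectors; `recompute`
  -- restores it from its decidability.
  record S : Set where
    constructor perm
    field
      vec : Perm n
      .isDistinct : Distinct vec
  open S public using (vec)

  _⟪_⟫ : S → Fin n → Fin n
  g ⟪ x ⟫ = lookup (vec g) x

  act-injective : ∀ g {x y} → g ⟪ x ⟫ ≡ g ⟪ y ⟫ → x ≡ y
  act-injective (perm v d) = distinct⇒injective v (recompute (distinct? v) d) _ _

  fromFunction : (f : Fin n → Fin n) → (∀ {x y} → f x ≡ f y → x ≡ y) → S
  fromFunction f inj = perm (tabulate f) (injective⇒distinct (tabulate f) (λ i k h → inj (trans (sym (VecP.lookup∘tabulate f i)) (trans h (VecP.lookup∘tabulate f k)))))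

  S-ext : ∀ {g h} → (∀ x → g ⟪ x ⟫ ≡ h ⟪ x ⟫) → g ≡ h
  S-ext {perm v _} {perm w _} h with trans (sym (VecP.tabulate∘lookup v)) (trans (VecP.tabulate-cong h) (VecP.tabulate∘lookup w))
  ... | refl = refl

  compose : S → S → S
  compose g h = perm (vec g ∘ₚ vec h) (injective⇒distinct (vec g ∘ₚ vec h) (λ i k e → act-injective h (act-injective g
    (trans (sym (VecP.lookup∘tabulate (λ x → g ⟪ h ⟪ x ⟫ ⟫) i)) (trans e (VecP.lookup∘tabulate (λ x → g ⟪ h ⟪ x ⟫ ⟫) k))))))

  identity : S
  identity = fromFunction id id

  -- Pigeonhole: a missed value put in front of the vector of `g` would inject `n + 1` positions
  -- into `n` values.
  preimage : ∀ g y → ∃[ x ] g ⟪ x ⟫ ≡ y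
  preimage g y with ∉ᵛ? y (vec g)
  ... | inj₂ h = h
  ... | inj₁ y∉ = ⊥-elim (ℕP.<⇒≱ (ℕP.n<1+n n) (FinP.injective⇒≤ {f = lookup (y ∷ vec g)} inj))
    where inj : ∀ {a b} → lookup (y ∷ vec g) a ≡ lookup (y ∷ vec g) b → a ≡ b
          inj {zero} {zero} _ = refl
          inj {zero} {suc b} h = ⊥-elim (∉ᵛ-lookup (vec g) y∉ b h)
          inj {suc a} {zero} h = ⊥-elim (∉ᵛ-lookup (vec g) y∉ a (sym h))
          inj {suc a} {suc b} h = cong suc (act-injective g h)

  inverse : S → S
  inverse g = fromFunction (λ y → proj₁ (preimage g y)) (λ {x} {y} h → trans (sym (proj₂ (preimage g x))) (trans (cong (g ⟪_⟫) h) (proj₂ (preimage g y))))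

  flip : Fin n → Fin n → Fin n → Fin n
  flip x y z with z FinP.≟ x | z FinP.≟ y
  ... | yes _ | _ = y
  ... | no _ | yes _ = x
  ... | no _ | no _ = z

  flip-l : ∀ x y → flip x y x ≡ y
  flip-l x y with x FinP.≟ x | x FinP.≟ y
  ... | yes _ | _ = refl
  ... | no h | _ = ⊥-elim (h refl)

  flip-r : ∀ x y → flip x y y ≡ x
  flip-r x y with y FinP.≟ x | y FinP.≟ y
  ... | yes h | _ = h
  ... | no _ | yes _ = refl
  ... | no _ | no h = ⊥-elim (h refl)

  flip-o : ∀ x y {z} → z ≢ x → z ≢ y → flip x y z ≡ z
  flip-o x y {z} a b with z FinP.≟ x | z FinP.≟ y
  ... | yes h | _ = ⊥-elim (a h)
  ... | no _ | yes h = ⊥-elim (b h)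
  ... | no _ | no _ = refl

  flip-flip : ∀ x y z → flip x y (flip x y z) ≡ z
  flip-flip x y z with z FinP.≟ x | z FinP.≟ y
  ... | yes refl | _ = flip-r z y
  ... | no _ | yes refl = flip-l x z
  ... | no a | no b = flip-o x y a b

  transposition : Fin n → Fin n → S
  transposition x y = fromFunction (flip x y) (λ {a} {b} h → trans (sym (flip-flip x y a)) (trans (cong (flip x y) h) (flip-flip x y b)))

  act-transposition : ∀ x y z → transposition x y ⟪ z ⟫ ≡ flip x y z
  act-transposition x y z = VecP.lookup∘tabulate (flip x y) z

  act-compose : ∀ g h x → compose g h ⟪ x ⟫ ≡ g ⟪ h ⟪ x ⟫ ⟫
  act-compose g h x = VecP.lookup∘tabulate (λ x → g ⟪ h ⟪ x ⟫ ⟫) x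

  collect : List (Perm n) → List S
  collect [] = []
  collect (v ∷ vs) with distinct? v
  ... | yes d = perm v d ∷ collect vs
  ... | no _ = collect vs

  map-collect : ∀ vs → map vec (collect vs) ≡ filter distinct? vs
  map-collect [] = refl
  map-collect (v ∷ vs) with distinct? v
  ... | yes d = cong (v ∷_) (map-collect vs)
  ... | no _ = map-collect vs

  ∈-collect : ∀ g {vs} → vec g ∈ vs → g ∈ collect vs
  ∈-collect (perm v d) {v ∷ vs} (here refl) with distinct? v
  ... | yes _ = here refl
  ... | no nd = ⊥-elim (nd (recompute (distinct? v) d))
  ∈-collect g {v ∷ vs} (there p) with distinct? v
  ... | yes d = there (∈-collect g p)
  ... | no nd = ∈-collect g p

  all-perms : List S
  all-perms = collect (allVecs n n)

  unique-allVecs : ∀ m → Unique (allVecs n m)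
  unique-allVecs zero = [] ∷ []
  unique-allVecs (suc m) = go (allFin n) (UniqueP.allFin⁺ n)
    where
    disjoint : ∀ {x} ys → All (x ≢_) ys → ∀ {v} → v ∈ map (x ∷_) (allVecs n m) → v ∈ concatMap (λ y → map (y ∷_) (allVecs n m)) ys → ⊥
    disjoint {x} (y ∷ ys) (x≢y ∷ h) {v} p q with MemP.∈-map⁻ (x ∷_) p | MemP.∈-++⁻ (map (y ∷_) (allVecs n m)) q
    ... | _ , _ , refl | inj₁ q′ = x≢y (VecP.∷-injectiveˡ (proj₂ (proj₂ (MemP.∈-map⁻ (y ∷_) q′))))
    ... | _ , _ , refl | inj₂ q′ = disjoint ys h p q′
    go : ∀ xs → Unique xs → Unique (concatMap (λ x → map (x ∷_) (allVecs n m)) xs)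
    go [] [] = []
    go (x ∷ xs) (x∉ ∷ u) = UniqueP.++⁺ (UniqueP.map⁺ VecP.∷-injectiveʳ (unique-allVecs m)) (go xs u) (λ (p , q) → disjoint xs x∉ p q)

  unique-perms : Unique all-perms
  unique-perms = UniqueP.map⁻ (subst Unique (sym (map-collect (allVecs n n))) (UniqueP.filter⁺ distinct? (unique-allVecs n)))

  ∑-bijection : (φ ψ : Fin n → Fin n) → (∀ x → φ (ψ x) ≡ x) → (∀ x → ψ (φ x) ≡ x) → (f : Fin n → ℚ) → ∑ᶠ n (f ∘ φ) ≡ ∑ᶠ n f
  ∑-bijection φ ψ h h′ f = trans (∑-cong (allFin n) (λ x → sym (∑-select (φ x) f))) (trans (∑-swap (allFin n) (allFin n) (λ x y → [ φ x ≟ y ] * f y))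
    (∑-cong (allFin n) (λ y → trans (∑-*ʳ (allFin n) (λ x → [ φ x ≟ y ]) (f y)) (trans (cong (_* f y) (trans (∑-cong (allFin n) (transpose y)) (∑-≟ (ψ y)))) (ℚP.*-identityˡ (f y))))))
    where transpose : ∀ y x → [ φ x ≟ y ] ≡ [ ψ y ≟ x ]
          transpose y x with 0∨1 (φ x) y
          ... | inj₁ (refl , e) = trans e (sym (trans (cong [_≟ x ] (h′ x)) (≟-refl x)))
          ... | inj₂ (ne , e) = trans e (sym (≟-≢ (λ e′ → ne (trans (cong φ (sym e′)) (h y)))))

  reindex-perms : (φ ψ : S → S) → (∀ g → φ (ψ g) ≡ g) → (∀ g → ψ (φ g) ≡ g) → (f : S → ℚ) → ∑ all-perms (f ∘ φ) ≡ ∑ all-perms f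
  reindex-perms φ ψ h h′ f = trans (sym (∑-map φ all-perms f)) (∑-↭ f (∼bag⇒↭ (unique∧set⇒bag (UniqueP.map⁺ inj unique-perms) unique-perms
      (λ {g} → mk⇔ (λ _ → complete g) (λ _ → subst (_∈ map φ all-perms) (h g) (MemP.∈-map⁺ φ (complete (ψ g))))))))
    where
    complete : ∀ g → g ∈ all-perms
    complete g = ∈-collect g (∈-allVecs (vec g))
    inj : ∀ {a b} → φ a ≡ φ b → a ≡ b
    inj {a} {b} e = trans (sym (h′ a)) (trans (cong ψ e) (h′ b))

  S-≟ : (g h : S) → Dec (g ≡ h)
  S-≟ g h with VecP.≡-dec FinP._≟_ (vec g) (vec h)
  ... | yes e = yes (S-ext (λ x → cong (λ v → lookup v x) e))
  ... | no ne = no (ne ∘ cong vec)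

  -- The sign as a character.

  neg χ : Bool → ℚ
  neg b = if b then - 1ℚ else 1ℚ
  χ b = if b then 1ℚ else 0ℚ

  ∏ : {A : Set} → List A → (A → ℚ) → ℚ
  ∏ [] f = 1ℚ
  ∏ (x ∷ xs) f = f x * ∏ xs f

  count : {A : Set} → List A → (A → Bool) → ℕ
  count [] b = 0
  count (x ∷ xs) b = (if b x then 1 else 0) ℕ.+ count xs b

  ∏-neg : {A : Set} (xs : List A) (b : A → Bool) → ∏ xs (neg ∘ b) ≡ (- 1ℚ) ^ℚ count xs b
  ∏-neg [] b = refl
  ∏-neg (x ∷ xs) b with b x
  ... | true = cong (- 1ℚ *_) (∏-neg xs b)
  ... | false = trans (ℚP.*-identityˡ (∏ xs (neg ∘ b))) (∏-neg xs b)

  nat-count : {A : Set} (xs : List A) (b : A → Bool) → nat (count xs b) ≡ ∑ xs (χ ∘ b)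
  nat-count [] b = nat-0
  nat-count (x ∷ xs) b with b x
  ... | true = trans (nat-suc (count xs b)) (cong (1ℚ +_) (nat-count xs b))
  ... | false = trans (nat-count xs b) (sym (ℚP.+-identityˡ (∑ xs (χ ∘ b))))

  nat-injective : ∀ {a b} → nat a ≡ nat b → a ≡ b
  nat-injective h = ℕP.≤-antisym (nat-cancel (ℚP.≤-reflexive h)) (nat-cancel (ℚP.≤-reflexive (sym h)))

  ∏-cong : {A : Set} (xs : List A) {f g : A → ℚ} → (∀ x → f x ≡ g x) → ∏ xs f ≡ ∏ xs g
  ∏-cong [] h = refl
  ∏-cong (x ∷ xs) h = cong₂ _*_ (h x) (∏-cong xs h)

  ∏-* : {A : Set} (xs : List A) (f g : A → ℚ) → ∏ xs (λ x → f x * g x) ≡ ∏ xs f * ∏ xs g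
  ∏-* [] f g = refl
  ∏-* (x ∷ xs) f g = trans (cong (f x * g x *_) (∏-* xs f g)) (xy*zw≡xz*yw (f x) (g x) (∏ xs f) (∏ xs g))

  length-filter : {A : Set} {P : A → Set} (P? : ∀ x → Dec (P x)) (xs : List A) → length (filter P? xs) ≡ count xs (does ∘ P?)
  length-filter P? [] = refl
  length-filter P? (x ∷ xs) with does (P? x)
  ... | true = cong suc (length-filter P? xs)
  ... | false = length-filter P? xs

  parity : ∀ m → (if (m ℕ.% 2) ℕ.≡ᵇ 0 then 1ℚ else - 1ℚ) ≡ (- 1ℚ) ^ℚ m
  parity zero = refl
  parity (suc zero) = refl
  parity (suc (suc m)) = trans (cong (λ r → if r ℕ.≡ᵇ 0 then 1ℚ else - 1ℚ) (trans (cong (ℕ._% 2) (ℕP.+-comm 2 m)) (DivMod.[m+n]%n≡m%n m 2)))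
    (trans (parity m) (eq ((- 1ℚ) ^ℚ m)))
    where eq : ∀ a → a ≡ - 1ℚ * (- 1ℚ * a)
          eq = solve-∀ ring

  lt : Fin n → Fin n → Bool
  lt i k = does (toℕ i ℕP.<? toℕ k)

  lt-cases : ∀ i k → (i ≡ k × lt i k ≡ false × lt k i ≡ false) ⊎ (i ≢ k × ((lt i k ≡ true × lt k i ≡ false) ⊎ (lt i k ≡ false × lt k i ≡ true)))
  lt-cases i k with ℕP.<-cmp (toℕ i) (toℕ k)
  ... | tri≈ a e c = inj₁ (FinP.toℕ-injective e , dec-false (toℕ i ℕP.<? toℕ k) a , dec-false (toℕ k ℕP.<? toℕ i) c)
  ... | tri< a e c = inj₂ ((λ { refl → e refl }) , inj₁ (dec-true (toℕ i ℕP.<? toℕ k) a , dec-false (toℕ k ℕP.<? toℕ i) c))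
  ... | tri> a e c = inj₂ ((λ { refl → e refl }) , inj₂ (dec-false (toℕ i ℕP.<? toℕ k) a , dec-true (toℕ k ℕP.<? toℕ i) c))

  pairs : List (Fin n × Fin n)
  pairs = cartesianProduct (allFin n) (allFin n)

  ∑-pairs : (f : Fin n × Fin n → ℚ) → ∑ pairs f ≡ ∑ᶠ n (λ i → ∑ᶠ n (λ k → f (i , k)))
  ∑-pairs f = go (allFin n)
    where go : ∀ is → ∑ (cartesianProduct is (allFin n)) f ≡ ∑ is (λ i → ∑ᶠ n (λ k → f (i , k)))
          go [] = refl
          go (i ∷ is) = trans (∑-++ (map (i ,_) (allFin n)) (cartesianProduct is (allFin n)) f) (cong₂ _+_ (∑-map (i ,_) (allFin n) f) (go is))

  inverted : S → Fin n × Fin n → Bool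
  inverted g (i , k) = lt i k ∧ lt (g ⟪ k ⟫) (g ⟪ i ⟫)

  -- Inversion as a property of the unordered pair; composition with another permutation may reverse
  -- the order of the two points.
  inverts : S → Fin n → Fin n → Bool
  inverts g i k = inverted g (i , k) ∨ inverted g (k , i)

  signS : S → ℚ
  signS g = sign (vec g)

  sign≡∏ : ∀ g → signS g ≡ ∏ pairs (neg ∘ inverted g)
  sign≡∏ g = trans (parity (inversions (vec g))) (trans (cong ((- 1ℚ) ^ℚ_) (length-filter _ pairs)) (sym (∏-neg pairs (inverted g))))

  -- Reindexing by a permutation does not respect `i < k`. Doubling turns the sum over `i < k` into
  -- a sum over all pairs, which can be reindexed.
  doubled : (R : Fin n → Fin n → Bool) → (∀ i k → R i k ≡ R k i) → (∀ i → R i i ≡ false) →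
    ∑ pairs (λ (i , k) → χ (lt i k ∧ R i k)) + ∑ pairs (λ (i , k) → χ (lt i k ∧ R i k)) ≡ ∑ᶠ n (λ i → ∑ᶠ n (λ k → χ (R i k)))
  doubled R R-sym R-irr = trans (cong₂ _+_ (∑-pairs _) (trans (∑-pairs _) (∑-swap (allFin n) (allFin n) (λ i k → χ (lt i k ∧ R i k)))))
      (trans (sym (∑-+ (allFin n) _ _)) (∑-cong (allFin n) (λ i → trans (sym (∑-+ (allFin n) _ _)) (∑-cong (allFin n) (each i)))))
    where
    each : ∀ i k → χ (lt i k ∧ R i k) + χ (lt k i ∧ R k i) ≡ χ (R i k)
    each i k with lt-cases i k
    ... | inj₁ (refl , a , _) = subst (λ b → χ (b ∧ R i i) + χ (b ∧ R i i) ≡ χ (R i i)) (sym a) (cong χ (sym (R-irr i)))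
    ... | inj₂ (_ , inj₁ (a , b)) = trans (cong₂ (λ x y → χ (x ∧ R i k) + χ (y ∧ R k i)) a b) (ℚP.+-identityʳ (χ (R i k)))
    ... | inj₂ (_ , inj₂ (a , b)) = trans (cong₂ (λ x y → χ (x ∧ R i k) + χ (y ∧ R k i)) a b) (trans (ℚP.+-identityˡ (χ (R k i))) (cong χ (R-sym k i)))

  inverts-sym : ∀ g i k → inverts g i k ≡ inverts g k i
  inverts-sym g i k = BoolP.∨-comm (inverted g (i , k)) (inverted g (k , i))

  inverts-irr : ∀ g i → inverts g i i ≡ false
  inverts-irr g i with lt-cases i i
  ... | inj₁ (_ , a , _) = cong (λ b → (b ∧ lt (g ⟪ i ⟫) (g ⟪ i ⟫)) ∨ (b ∧ lt (g ⟪ i ⟫) (g ⟪ i ⟫))) a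
  ... | inj₂ (ne , _) = ⊥-elim (ne refl)

  -- For `i < k`, the composite inverts the pair when exactly one of `h` at `(i , k)` and `g` at the
  -- unordered image pair does. The image pairs run through all unordered pairs, so the second
  -- factors multiply to the sign of `g`.
  sign-compose : ∀ g h → signS (compose g h) ≡ signS g * signS h
  sign-compose g h = begin
      signS (compose g h) ≡⟨ sign≡∏ (compose g h) ⟩
      ∏ pairs (neg ∘ inverted (compose g h)) ≡⟨ ∏-cong pairs (λ (i , k) → each i k) ⟩
      ∏ pairs (λ (i , k) → neg (inverted h (i , k)) * neg (lt i k ∧ inverts g (h ⟪ i ⟫) (h ⟪ k ⟫))) ≡⟨ ∏-* pairs (neg ∘ inverted h) _ ⟩
      ∏ pairs (neg ∘ inverted h) * ∏ pairs (λ (i , k) → neg (lt i k ∧ inverts g (h ⟪ i ⟫) (h ⟪ k ⟫))) ≡⟨ cong (∏ pairs (neg ∘ inverted h) *_) moved ⟩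
      ∏ pairs (neg ∘ inverted h) * ∏ pairs (neg ∘ inverted g) ≡⟨ cong₂ _*_ (sym (sign≡∏ h)) (sym (sign≡∏ g)) ⟩
      signS h * signS g ≡⟨ ℚP.*-comm (signS h) (signS g) ⟩
      signS g * signS h ∎
    where
    open ≡-Reasoning
    R : Fin n → Fin n → Bool
    R i k = inverts g (h ⟪ i ⟫) (h ⟪ k ⟫)
    each : ∀ i k → neg (inverted (compose g h) (i , k)) ≡ neg (inverted h (i , k)) * neg (lt i k ∧ R i k)
    each i k = trans (cong₂ (λ a b → neg (lt i k ∧ lt a b)) (act-compose g h k) (act-compose g h i)) (go (lt-cases i k))
      where
      a b : Fin n
      a = h ⟪ i ⟫
      b = h ⟪ k ⟫
      go : _ → neg (lt i k ∧ lt (g ⟪ b ⟫) (g ⟪ a ⟫)) ≡ neg (lt i k ∧ lt b a) * neg (lt i k ∧ R i k)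
      go (inj₁ (_ , e , _)) = trans (cong (λ l → neg (l ∧ lt (g ⟪ b ⟫) (g ⟪ a ⟫))) e) (sym (cong (λ l → neg (l ∧ lt b a) * neg (l ∧ R i k)) e))
      go (inj₂ (_ , inj₂ (e , _))) = trans (cong (λ l → neg (l ∧ lt (g ⟪ b ⟫) (g ⟪ a ⟫))) e) (sym (cong (λ l → neg (l ∧ lt b a) * neg (l ∧ R i k)) e))
      go (inj₂ (ne , inj₁ (e , _))) = trans (cong (λ l → neg (l ∧ lt (g ⟪ b ⟫) (g ⟪ a ⟫))) e) (trans (inner (lt-cases a b)) (sym (cong (λ l → neg (l ∧ lt b a) * neg (l ∧ R i k)) e)))
        where
        inner : _ → neg (lt (g ⟪ b ⟫) (g ⟪ a ⟫)) ≡ neg (lt b a) * neg (R i k)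
        inner (inj₁ (eq , _)) = ⊥-elim (ne (act-injective h eq))
        inner (inj₂ (_ , inj₁ (p , q))) = sym (trans (cong₂ (λ x y → neg y * neg ((x ∧ lt (g ⟪ b ⟫) (g ⟪ a ⟫)) ∨ (y ∧ lt (g ⟪ a ⟫) (g ⟪ b ⟫)))) p q)
          (trans (ℚP.*-identityˡ (neg (lt (g ⟪ b ⟫) (g ⟪ a ⟫) ∨ false))) (cong neg (BoolP.∨-identityʳ (lt (g ⟪ b ⟫) (g ⟪ a ⟫))))))
        inner (inj₂ (a≢b , inj₂ (p , q))) = trans (opp (lt-cases (g ⟪ a ⟫) (g ⟪ b ⟫))) (sym (cong₂ (λ x y → neg y * neg ((x ∧ lt (g ⟪ b ⟫) (g ⟪ a ⟫)) ∨ (y ∧ lt (g ⟪ a ⟫) (g ⟪ b ⟫)))) p q))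
          where opp : _ → neg (lt (g ⟪ b ⟫) (g ⟪ a ⟫)) ≡ neg true * neg (lt (g ⟪ a ⟫) (g ⟪ b ⟫))
                opp (inj₁ (eq , _)) = ⊥-elim (a≢b (act-injective g eq))
                opp (inj₂ (_ , inj₁ (x , y))) = trans (cong neg y) (sym (cong (λ l → neg true * neg l) x))
                opp (inj₂ (_ , inj₂ (x , y))) = trans (cong neg y) (sym (cong (λ l → neg true * neg l) x))
    moved : ∏ pairs (λ (i , k) → neg (lt i k ∧ R i k)) ≡ ∏ pairs (neg ∘ inverted g)
    moved = trans (∏-neg pairs (λ (i , k) → lt i k ∧ R i k)) (trans (cong ((- 1ℚ) ^ℚ_) (nat-injective counts)) (sym (∏-neg pairs (inverted g))))
      where
      half : ∀ {x y : ℚ} → x + x ≡ y + y → x ≡ y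
      half {x} {y} e = trans (e₁ x) (trans (cong (ℚ.½ *_) e) (sym (e₁ y)))
        where e₁ : ∀ x → x ≡ ℚ.½ * (x + x)
              e₁ = solve-∀ ring
      below : ∀ i k → lt i k ∧ inverts g i k ≡ inverted g (i , k)
      below i k with lt-cases i k
      ... | inj₁ (_ , e , _) = trans (cong (_∧ inverts g i k) e) (sym (cong (_∧ lt (g ⟪ k ⟫) (g ⟪ i ⟫)) e))
      ... | inj₂ (_ , inj₂ (e , _)) = trans (cong (_∧ inverts g i k) e) (sym (cong (_∧ lt (g ⟪ k ⟫) (g ⟪ i ⟫)) e))
      ... | inj₂ (_ , inj₁ (p , q)) = trans (cong₂ (λ x y → x ∧ ((x ∧ lt (g ⟪ k ⟫) (g ⟪ i ⟫)) ∨ (y ∧ lt (g ⟪ i ⟫) (g ⟪ k ⟫)))) p q)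
            (trans (BoolP.∨-identityʳ (lt (g ⟪ k ⟫) (g ⟪ i ⟫))) (sym (cong (_∧ lt (g ⟪ k ⟫) (g ⟪ i ⟫)) p)))
      counts : nat (count pairs (λ (i , k) → lt i k ∧ R i k)) ≡ nat (count pairs (inverted g))
      counts = trans (nat-count pairs _) (trans (half (begin
          ∑ pairs (λ (i , k) → χ (lt i k ∧ R i k)) + ∑ pairs (λ (i , k) → χ (lt i k ∧ R i k)) ≡⟨ doubled R (λ i k → inverts-sym g (h ⟪ i ⟫) (h ⟪ k ⟫)) (λ i → inverts-irr g (h ⟪ i ⟫)) ⟩
          ∑ᶠ n (λ i → ∑ᶠ n (λ k → χ (R i k))) ≡⟨ ∑-cong (allFin n) (λ i → bij (λ k → χ (inverts g (h ⟪ i ⟫) k))) ⟩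
          ∑ᶠ n (λ i → ∑ᶠ n (λ k → χ (inverts g (h ⟪ i ⟫) k))) ≡⟨ bij (λ i → ∑ᶠ n (λ k → χ (inverts g i k))) ⟩
          ∑ᶠ n (λ i → ∑ᶠ n (λ k → χ (inverts g i k))) ≡⟨ doubled (inverts g) (inverts-sym g) (inverts-irr g) ⟨
          ∑ pairs (λ (i , k) → χ (lt i k ∧ inverts g i k)) + ∑ pairs (λ (i , k) → χ (lt i k ∧ inverts g i k)) ∎))
        (trans (∑-cong pairs (λ (i , k) → cong χ (below i k))) (sym (nat-count pairs (inverted g)))))
        where bij : (f : Fin n → ℚ) → ∑ᶠ n (λ i → f (h ⟪ i ⟫)) ≡ ∑ᶠ n f
              bij = ∑-bijection (h ⟪_⟫) (λ y → proj₁ (preimage h y)) (λ y → proj₂ (preimage h y)) (λ x → act-injective h (proj₂ (preimage h (h ⟪ x ⟫))))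

  sign-sq : ∀ g → signS g * signS g ≡ 1ℚ
  sign-sq g with (inversions (vec g) ℕ.% 2) ℕ.≡ᵇ 0
  ... | true = refl
  ... | false = refl

  sign-conjugate : ∀ π t t′ → compose π t ≡ compose t′ π → signS t ≡ signS t′
  sign-conjugate π t t′ h = trans (sym (strip t)) (trans (cong (signS π *_) (trans (sym (sign-compose π t)) (trans (cong signS h) (trans (sign-compose t′ π) (ℚP.*-comm (signS t′) (signS π)))))) (strip t′))
    where strip : ∀ t → signS π * (signS π * signS t) ≡ signS t
          strip t = trans (sym (ℚP.*-assoc (signS π) (signS π) (signS t))) (trans (cong (_* signS t) (sign-sq π)) (ℚP.*-identityˡ (signS t)))

  conjugate-transposition : ∀ π x y → compose π (transposition x y) ≡ compose (transposition (π ⟪ x ⟫) (π ⟪ y ⟫)) π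
  conjugate-transposition π x y = S-ext λ z → trans (act-compose π (transposition x y) z) (trans (cong (π ⟪_⟫) (act-transposition x y z))
      (trans (go z (z FinP.≟ x) (z FinP.≟ y)) (sym (trans (act-compose (transposition (π ⟪ x ⟫) (π ⟪ y ⟫)) π z) (act-transposition (π ⟪ x ⟫) (π ⟪ y ⟫) (π ⟪ z ⟫))))))
    where
    go : ∀ z → Dec (z ≡ x) → Dec (z ≡ y) → π ⟪ flip x y z ⟫ ≡ flip (π ⟪ x ⟫) (π ⟪ y ⟫) (π ⟪ z ⟫)
    go z (yes refl) _ = trans (cong (π ⟪_⟫) (flip-l z y)) (sym (flip-l (π ⟪ z ⟫) (π ⟪ y ⟫)))
    go z (no _) (yes refl) = trans (cong (π ⟪_⟫) (flip-r x z)) (sym (flip-r (π ⟪ x ⟫) (π ⟪ z ⟫)))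
    go z (no a) (no b) = trans (cong (π ⟪_⟫) (flip-o x y a b)) (sym (flip-o (π ⟪ x ⟫) (π ⟪ y ⟫) (a ∘ act-injective π) (b ∘ act-injective π)))

-- The pair `(0 , 1)` is the only inversion.
sign-adjacent : ∀ m → let open SymmetricGroup (suc (suc m)) in signS (transposition zero (suc zero)) ≡ - 1ℚ
sign-adjacent m = trans (sign≡∏ t) (trans (∏-neg pairs (inverted t)) (cong ((- 1ℚ) ^ℚ_) (nat-injective (trans (nat-count pairs (inverted t))
    (trans (∑-pairs (χ ∘ inverted t)) (trans (∑-cong (allFin N) (λ i → ∑-cong (allFin N) (each i))) (trans (∑-product (allFin N) (allFin N) [ zero ≟_] [ suc zero ≟_])
      (trans (cong₂ _*_ (∑-≟ {N} zero) (∑-≟ {N} (suc zero))) (sym nat-1)))))))))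
  where
  N = suc (suc m)
  open SymmetricGroup N
  t = transposition zero (suc zero)
  each : ∀ i k → χ (inverted t (i , k)) ≡ [ zero ≟ i ] * [ suc zero ≟ k ]
  each i k = trans (cong₂ (λ a b → χ (lt i k ∧ lt a b)) (act-transposition zero (suc zero) k) (act-transposition zero (suc zero) i)) (go i k)
    where
    go : ∀ i k → χ (lt i k ∧ lt (flip zero (suc zero) k) (flip zero (suc zero) i)) ≡ [ zero ≟ i ] * [ suc zero ≟ k ]
    go zero zero = refl
    go zero (suc zero) = refl
    go zero (suc (suc k)) = refl
    go (suc zero) zero = refl
    go (suc zero) (suc zero) = refl
    go (suc zero) (suc (suc k)) = refl
    go (suc (suc i)) zero = refl
    go (suc (suc i)) (suc zero) = refl
    go (suc (suc i)) (suc (suc k)) with lt-cases (suc (suc i)) (suc (suc k))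
    ... | inj₁ (_ , e , _) = cong (λ b → χ (b ∧ lt (suc (suc k)) (suc (suc i)))) e
    ... | inj₂ (_ , inj₁ (a , b)) = cong₂ (λ a b → χ (a ∧ b)) a b
    ... | inj₂ (_ , inj₂ (a , b)) = cong₂ (λ a b → χ (a ∧ b)) a b

-- Every transposition is conjugate to the one of 0 and 1, through a `π` that sends 0 to `x` and 1
-- to `y`.
sign-transposition : ∀ {n} {x y : Fin n} → x ≢ y → let open SymmetricGroup n in signS (transposition x y) ≡ - 1ℚ
sign-transposition {suc zero} {zero} {zero} h = ⊥-elim (h refl)
sign-transposition {suc (suc m)} {x} {y} x≢y = trans (sym (sign-conjugate π (transposition zero (suc zero)) (transposition x y) (trans (conjugate-transposition π zero (suc zero)) (cong₂ (λ a b → compose (transposition a b) π) π0 π1)))) (sign-adjacent m)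
  where
  open SymmetricGroup (suc (suc m))
  α = transposition zero x
  c = α ⟪ suc zero ⟫
  π = compose (transposition c y) α
  α0 : α ⟪ zero ⟫ ≡ x
  α0 = trans (act-transposition zero x zero) (flip-l zero x)
  x≢c : x ≢ c
  x≢c e with act-injective α {zero} {suc zero} (trans α0 e)
  ... | ()
  π0 : π ⟪ zero ⟫ ≡ x
  π0 = trans (act-compose (transposition c y) α zero) (trans (act-transposition c y (α ⟪ zero ⟫)) (trans (cong (flip c y) α0) (flip-o c y x≢c x≢y)))
  π1 : π ⟪ suc zero ⟫ ≡ y
  π1 = trans (act-compose (transposition c y) α (suc zero)) (trans (act-transposition c y c) (flip-l c y))

𝕊 : (n : ℕ) → PermGroup n
𝕊 n = record
  { G = S ; els = all-perms ; ∈els = λ g → ∈-collect g (∈-allVecs (vec g)) ; _≟G_ = S-≟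
  ; _·_ = compose ; e = identity ; inv = inverse ; _⟨_⟩ = _⟪_⟫ ; ext = S-ext
  ; act-· = act-compose ; act-e = VecP.lookup∘tabulate id
  ; act-inv = λ g x → trans (VecP.lookup∘tabulate (λ y → proj₁ (preimage g y)) (g ⟪ x ⟫)) (act-injective g (proj₂ (preimage g (g ⟪ x ⟫))))
  ; act-inv′ = λ g x → trans (cong (g ⟪_⟫) (VecP.lookup∘tabulate (λ y → proj₁ (preimage g y)) x)) (proj₂ (preimage g x))
  ; tr = transposition
  ; tr-l = λ x y → trans (act-transposition x y x) (flip-l x y)
  ; tr-r = λ x y → trans (act-transposition x y y) (flip-r x y)
  ; tr-o = λ x y {z} a b → trans (act-transposition x y z) (flip-o x y a b)
  ; reindex = reindex-perms
  ; sgn = signS ; sgn-· = sign-compose ; sgn-sq = sign-sq ; sgn-tr = sign-transposition }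
  where open SymmetricGroup n

-- Averages over the symmetric group

∑-cartesian : {A B : Set} (xs : List A) (ys : List B) (f : A × B → ℚ) → ∑ (cartesianProduct xs ys) f ≡ ∑ xs (λ x → ∑ ys (λ y → f (x , y)))
∑-cartesian [] ys f = refl
∑-cartesian (x ∷ xs) ys f = trans (∑-++ (map (x ,_) ys) (cartesianProduct xs ys) f) (cong₂ _+_ (∑-map (x ,_) ys f) (∑-cartesian xs ys f))

length-cartesian : {A B : Set} (xs : List A) (ys : List B) → nat (length (cartesianProduct xs ys)) ≡ nat (length xs) * nat (length ys)
length-cartesian xs ys = trans (sym (trans (∑-const (cartesianProduct xs ys) 1ℚ) (ℚP.*-identityʳ (nat (length (cartesianProduct xs ys))))))
  (trans (∑-cartesian xs ys (λ _ → 1ℚ)) (trans (∑-cong xs (λ _ → trans (∑-const ys 1ℚ) (ℚP.*-identityʳ (nat (length ys))))) (∑-const xs (nat (length ys)))))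

sumℚ≡∑ : {A : Set} (f : A → ℚ) (xs : List A) → sumℚ (map f xs) ≡ ∑ xs f
sumℚ≡∑ f [] = refl
sumℚ≡∑ f (x ∷ xs) = cong (f x +_) (sumℚ≡∑ f xs)

nat-reciprocal : ∀ k → nat (suc k) * (ℤ.+ 1 ℚ./ suc k) ≡ 1ℚ
nat-reciprocal k = trans (cong (_* (ℤ.+ 1 ℚ./ suc k)) (nat≡fromℕ (suc k))) (ℚP.toℚᵘ-injective (UP.≃-trans (ℚP.toℚᵘ-homo-* (fromℕ (suc k)) (ℤ.+ 1 ℚ./ suc k))
  (UP.≃-trans (UP.*-cong (ℚP.toℚᵘ-fromℚᵘ (ℤ.+ suc k U./ 1)) (ℚP.toℚᵘ-fromℚᵘ (U.mkℚᵘ (ℤ.+ 1) k))) (U.*≡* (cong ℤ.+_ (eq k))))))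
  where eq : ∀ k → suc k ℕ.* 1 ℕ.* 1 ≡ 1 ℕ.* (1 ℕ.* suc k)
        eq = ℕR.solve-∀

avg-sum : {A : Set} (f : A → ℚ) (xs : List A) → nat (length xs) * avg (map f xs) ≡ ∑ xs f
avg-sum f [] = ℚP.*-zeroʳ (nat 0)
avg-sum f (x ∷ xs) = trans (cong (λ k → nat (suc (length xs)) * (sumℚ (map f (x ∷ xs)) * (ℤ.+ 1 ℚ./ suc k))) (ListP.length-map f xs))
    (trans (x*yz≡xz*y (nat (suc (length xs))) (sumℚ (map f (x ∷ xs))) (ℤ.+ 1 ℚ./ suc (length xs))) (trans (cong (_* sumℚ (map f (x ∷ xs))) (nat-reciprocal (length xs)))
      (trans (ℚP.*-identityˡ (sumℚ (map f (x ∷ xs)))) (sumℚ≡∑ f (x ∷ xs)))))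

*-cancelˡ-≡ : ∀ {r p q} → 0ℚ < r → r * p ≡ r * q → p ≡ q
*-cancelˡ-≡ h e = ℚP.≤-antisym (cancelˡ h (ℚP.≤-reflexive e)) (cancelˡ h (ℚP.≤-reflexive (sym e)))

∑-filter : {A : Set} {P : A → Set} (P? : ∀ x → Dec (P x)) (f : A → ℚ) (xs : List A) → ∑ (filter P? xs) f ≡ ∑ xs (λ x → 𝟙 (does (P? x)) * f x)
∑-filter P? f [] = refl
∑-filter P? f (x ∷ xs) with does (P? x)
... | true = cong₂ _+_ (sym (ℚP.*-identityˡ (f x))) (∑-filter P? f xs)
... | false = trans (∑-filter P? f xs) (trans (sym (ℚP.+-identityˡ (∑ xs (λ x → 𝟙 (does (P? x)) * f x)))) (cong (_+ ∑ xs (λ x → 𝟙 (does (P? x)) * f x)) (sym (ℚP.*-zeroˡ (f x)))))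

module Averages (n : ℕ) where
  open SymmetricGroup n hiding (sign≡∏)
  open PermGroup (𝕊 n) using (els; ∈els)
  open Functions (𝕊 n)
  open Convolution (𝕊 n)
  open Indicators (𝕊 n)

  private
    N : ℚ
    N = nat (length els)

    0<N : 0ℚ < N
    0<N = 0<nat (nonempty (∈els identity))
      where nonempty : ∀ {x} {xs : List S} → x ∈ xs → 1 ℕ.≤ length xs
            nonempty {xs = _ ∷ _} _ = ℕ.s≤s ℕ.z≤n

    Sn≡ : Sn n ≡ map vec els
    Sn≡ = sym (map-collect (allVecs n n))

    length-Sn : length (Sn n) ≡ length els
    length-Sn = trans (cong length Sn≡) (ListP.length-map vec els)

    ∑-Sn : (f : Perm n → ℚ) → ∑ (Sn n) f ≡ N * E (f ∘ vec)
    ∑-Sn f = trans (cong (λ xs → ∑ xs f) Sn≡) (trans (∑-map vec els f) (E-∑els (f ∘ vec)))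

  𝔼≡E : (f : Perm n → ℚ) → 𝔼 f ≡ E (f ∘ vec)
  𝔼≡E f = *-cancelˡ-≡ 0<N (trans (cong (λ k → nat k * 𝔼 f) (sym length-Sn)) (trans (avg-sum f (Sn n)) (∑-Sn f)))

  𝔼₂≡E : (f : Perm n → Perm n → ℚ) → 𝔼₂ f ≡ E (λ σ → E (λ τ → f (vec σ) (vec τ)))
  𝔼₂≡E f = *-cancelˡ-≡ (0<* 0<N 0<N) (begin
      N * N * 𝔼₂ f ≡⟨ cong (_* 𝔼₂ f) (sym (trans (length-cartesian (Sn n) (Sn n)) (cong₂ _*_ (cong nat length-Sn) (cong nat length-Sn)))) ⟩
      nat (length (cartesianProduct (Sn n) (Sn n))) * 𝔼₂ f ≡⟨ avg-sum (λ p → f (proj₁ p) (proj₂ p)) (cartesianProduct (Sn n) (Sn n)) ⟩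
      ∑ (cartesianProduct (Sn n) (Sn n)) (λ p → f (proj₁ p) (proj₂ p)) ≡⟨ ∑-cartesian (Sn n) (Sn n) (λ p → f (proj₁ p) (proj₂ p)) ⟩
      ∑ (Sn n) (λ σ → ∑ (Sn n) (f σ)) ≡⟨ ∑-cong (Sn n) (λ σ → ∑-Sn (f σ)) ⟩
      ∑ (Sn n) (λ σ → N * E (λ τ → f σ (vec τ))) ≡⟨ ∑-Sn (λ σ → N * E (λ τ → f σ (vec τ))) ⟩
      N * E (λ σ → N * E (λ τ → f (vec σ) (vec τ))) ≡⟨ cong (N *_) (E-*ˡ N (λ σ → E (λ τ → f (vec σ) (vec τ)))) ⟩
      N * (N * E (λ σ → E (λ τ → f (vec σ) (vec τ)))) ≡⟨ ℚP.*-assoc N N (E (λ σ → E (λ τ → f (vec σ) (vec τ)))) ⟨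
      N * N * E (λ σ → E (λ τ → f (vec σ) (vec τ))) ∎)
    where open ≡-Reasoning

  𝔼₂≡tri : (f g h : Perm n → ℚ) → 𝔼₂ (λ σ τ → f σ * g τ * h (σ ∘ₚ τ)) ≡ tri (f ∘ vec) (g ∘ vec) (h ∘ vec)
  𝔼₂≡tri f g h = 𝔼₂≡E (λ σ τ → f σ * g τ * h (σ ∘ₚ τ))

  ind-cases : ∀ {i} (I J : Vec (Fin n) i) σ → (InU I J (vec σ) × ind I J σ ≡ 1ℚ) ⊎ (¬ InU I J (vec σ) × ind I J σ ≡ 0ℚ)
  ind-cases [] [] σ = inj₁ ((λ ()) , refl)
  ind-cases (x ∷ I) (u ∷ J) σ with 0∨1 (σ ⟪ x ⟫) u | ind-cases I J σ
  ... | inj₁ (a , e) | inj₁ (h , e′) = inj₁ ((λ { zero → a ; (suc l) → h l }) , cong₂ _*_ e e′)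
  ... | inj₂ (a , e) | _ = inj₂ ((λ h → a (h zero)) , trans (cong (_* ind I J σ) e) (ℚP.*-zeroˡ (ind I J σ)))
  ... | inj₁ (_ , e) | inj₂ (h , e′) = inj₂ ((λ k → h (k ∘ suc)) , cong₂ _*_ e e′)

  𝟙-inU : ∀ {i} (I J : Vec (Fin n) i) σ → 𝟙 (does (inU? I J (vec σ))) ≡ ind I J σ
  𝟙-inU I J σ with ind-cases I J σ
  ... | inj₁ (h , e) = trans (cong 𝟙 (dec-true (inU? I J (vec σ)) h)) (sym e)
  ... | inj₂ (h , e) = trans (cong 𝟙 (dec-false (inU? I J (vec σ)) h)) (sym e)

  -- The product form also covers events that no permutation satisfies, where `avg` takes its
  -- default value 0.
  E-ind*condNorm : ∀ {i} (f : Perm n → ℚ) (I J : Vec (Fin n) i) → E (ind I J) * condNorm2² f I J ≡ E (λ σ → f (vec σ) * f (vec σ) * ind I J σ)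
  E-ind*condNorm f I J = *-cancelˡ-≡ 0<N (begin
      N * (E (ind I J) * c) ≡⟨ ℚP.*-assoc N (E (ind I J)) c ⟨
      N * E (ind I J) * c ≡⟨ cong (λ z → N * z * c) (E-cong (λ σ → trans (sym (𝟙-inU I J σ)) (sym (ℚP.*-identityʳ (𝟙 (does (inU? I J (vec σ)))))))) ⟩
      N * E (λ σ → 𝟙 (does (inU? I J (vec σ))) * 1ℚ) * c ≡⟨ cong (_* c) (trans (sym (∑-Sn (λ σ → 𝟙 (does (inU? I J σ)) * 1ℚ))) (trans (sym (∑-filter (inU? I J) (λ _ → 1ℚ) (Sn n))) (trans (∑-const U 1ℚ) (ℚP.*-identityʳ (nat (length U)))))) ⟩
      nat (length U) * c ≡⟨ avg-sum (λ σ → f σ * f σ) U ⟩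
      ∑ U (λ σ → f σ * f σ) ≡⟨ ∑-filter (inU? I J) (λ σ → f σ * f σ) (Sn n) ⟩
      ∑ (Sn n) (λ σ → 𝟙 (does (inU? I J σ)) * (f σ * f σ)) ≡⟨ ∑-Sn (λ σ → 𝟙 (does (inU? I J σ)) * (f σ * f σ)) ⟩
      N * E (λ σ → 𝟙 (does (inU? I J (vec σ))) * (f (vec σ) * f (vec σ))) ≡⟨ cong (N *_) (E-cong (λ σ → trans (cong (_* (f (vec σ) * f (vec σ))) (𝟙-inU I J σ)) (ℚP.*-comm (ind I J σ) (f (vec σ) * f (vec σ))))) ⟩
      N * E (λ σ → f (vec σ) * f (vec σ) * ind I J σ) ∎)
    where
    open ≡-Reasoning
    c = condNorm2² f I J
    U = filter (inU? I J) (Sn n)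

  allDistinct⇒distinct : ∀ {i} (I : Vec (Fin n) i) → AllDistinct I → Distinct I
  allDistinct⇒distinct [] _ = []
  allDistinct⇒distinct (x ∷ I) (x∉ , d) = all I x∉ ∷ allDistinct⇒distinct I d
    where all : ∀ {i} (I : Vec (Fin n) i) → x ∉ᵛ I → All (x ≢_) (toList I)
          all [] _ = []
          all (y ∷ I) (a , b) = a ∷ all I b

  ind≡0 : ∀ {i} (I J : Vec (Fin n) i) → Distinct I → ¬ Distinct J → ∀ σ → ind I J σ ≡ 0ℚ
  ind≡0 I J dI ¬dJ σ with ind-cases I J σ
  ... | inj₂ (_ , e) = e
  ... | inj₁ (h , _) = ⊥-elim (¬dJ (injective⇒distinct J (λ i k e → distinct⇒injective I dI i k (act-injective σ (trans (h i) (trans e (sym (h k))))))))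

  -- Globalness in the form in which it is used, for 0/1-valued f; tuples J with repetitions come for free.
  restricted-mean : ∀ {i K} (f : Perm n → ℚ) → (∀ σ → f σ * f σ ≡ f σ) → 0ℚ ≤ K →
    (∀ (I J : Vec (Fin n) i) → Distinct I → Distinct J → condNorm2² f I J ≤ K) →
    ∀ I J → AllDistinct I → E (λ σ → f (vec σ) * ind I J σ) ≤ K * E (ind I J)
  restricted-mean {i} {K} f f² 0≤K h I J dI with distinct? J
  ... | no ¬dJ = ℚP.≤-trans (ℚP.≤-reflexive (E-zero (λ σ → trans (cong (f (vec σ) *_) (ind≡0 I J (allDistinct⇒distinct I dI) ¬dJ σ)) (ℚP.*-zeroʳ (f (vec σ)))))) (0≤* 0≤K (0≤E (0≤ind I J)))
  ... | yes dJ = begin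
      E (λ σ → f (vec σ) * ind I J σ) ≡⟨ E-cong (λ σ → cong (_* ind I J σ) (sym (f² (vec σ)))) ⟩
      E (λ σ → f (vec σ) * f (vec σ) * ind I J σ) ≡⟨ E-ind*condNorm f I J ⟨
      E (ind I J) * condNorm2² f I J ≤⟨ *-monoˡ (0≤E (0≤ind I J)) (h I J (allDistinct⇒distinct I dI) dJ) ⟩
      E (ind I J) * K ≡⟨ ℚP.*-comm (E (ind I J)) K ⟩
      K * E (ind I J) ∎
    where open ≤R

-- The trilinear form

sum< : ℕ → (ℕ → ℚ) → ℚ
sum< zero t = 0ℚ
sum< (suc D) t = sum< D t + t D

module LevelDecomposition {n : ℕ} (𝓖 : PermGroup n) (x₀ : Fin n) where
  open PermGroup 𝓖
  open Functions 𝓖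
  open Convolution 𝓖
  open Indicators 𝓖
  open Juntas 𝓖 hiding (ind-cases)
  open HighLevels 𝓖

  J₀-constant : ∀ {p} → J 0 p → ∀ σ → p σ ≡ E p
  J₀-constant (gen m) σ = juntas-elim {Q = λ p → p σ ≡ E p} (λ { [] [] → sym (E-const 1ℚ) }) m
  J₀-constant (null h) σ = trans (h σ) (sym (E-zero h))
  J₀-constant (add {p} {q} s t h) σ = trans (h σ) (trans (cong₂ _+_ (J₀-constant s σ) (J₀-constant t σ)) (sym (trans (E-cong h) (E-+ p q))))
  J₀-constant (scale {p} c s h) σ = trans (h σ) (trans (cong (c *_) (J₀-constant s σ)) (sym (trans (E-cong h) (E-*ˡ c p))))

  proj₀ : ∀ f σ → proj 0 f σ ≡ E f
  proj₀ f σ = trans (J₀-constant (proj∈ 0 f) σ) (trans (sym (one (proj 0 f))) (trans (⟪proj⟫ 0 f (ind∈J [] [])) (one f)))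
    where one : ∀ f → ⟪ f , ind [] [] ⟫ ≡ E f
          one f = E-cong (λ σ → ℚP.*-identityʳ (f σ))

  proj-cong : ∀ i {f g} → (∀ σ → f σ ≡ g σ) → ∀ σ → proj i f σ ≡ proj i g σ
  proj-cong i {f} {g} h σ = trans (eq (proj i f σ) (proj i g σ)) (trans (cong (_+ proj i g σ) (⟪⟫-definite d (ℚP.≤-reflexive (trans (⟪⟫--ˡ (proj i f) (proj i g) d)
      (trans (cong₂ _-_ (⟪proj⟫ i f d∈) (⟪proj⟫ i g d∈)) (trans (cong (_- ⟪ g , d ⟫) (⟪⟫-cong {f} {g} {d} h (λ _ → refl))) (ℚP.+-inverseʳ ⟪ g , d ⟫))))) σ)) (ℚP.+-identityˡ (proj i g σ)))
    where
    d : F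
    d σ = proj i f σ - proj i g σ
    d∈ : J i d
    d∈ = span-- (proj∈ i f) (proj∈ i g)
    eq : ∀ a b → a ≡ a - b + b
    eq = solve-∀ ring

  tri-constant : ∀ f g c → tri f g (λ _ → c) ≡ E f * E g * c
  tri-constant f g c = trans (E-cong (λ σ → trans (E-*ʳ (λ τ → f σ * g τ) c) (cong (_* c) (E-*ˡ (f σ) g)))) (trans (E-*ʳ (λ σ → f σ * E g) c) (cong (_* c) (E-*ʳ f (E g))))

  ⟪⟫-shiftR : ∀ p h τ → ⟪ p , (λ σ → h (σ · τ)) ⟫ ≡ ⟪ (λ σ → p (σ · inv τ)) , h ⟫
  ⟪⟫-shiftR p h τ = trans (E-cong (λ σ → cong (λ π → p π * h (σ · τ)) (sym (cancel-invʳ′ τ σ)))) (E-R τ (λ σ → p (σ · inv τ) * h σ))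

  ⟪⟫-shiftL : ∀ p h τ → ⟪ p , (λ σ → h (τ · σ)) ⟫ ≡ ⟪ (λ σ → p (inv τ · σ)) , h ⟫
  ⟪⟫-shiftL p h τ = trans (E-cong (λ σ → cong (λ π → p π * h (τ · σ)) (sym (cancel-invˡ′ τ σ)))) (E-L τ (λ σ → p (inv τ · σ) * h σ))

  off-level : ∀ i f {h} → J (suc i) h → ⟪ proj i f , h ⟫ ≡ 0ℚ → ⟪ (λ σ → f σ - level i f σ) , h ⟫ ≡ 0ℚ
  off-level i f {h} h∈ h⊥ = trans (E-cong (λ σ → eq (f σ) (proj (suc i) f σ) (proj i f σ) (h σ)))
      (trans (E-+ (λ σ → (f σ - proj (suc i) f σ) * h σ) (λ σ → proj i f σ * h σ)) (trans (cong₂ _+_ (proj⊥ (suc i) f h∈) h⊥) refl))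
    where eq : ∀ a b c d → (a - (b - c)) * d ≡ (a - b) * d + c * d
          eq = solve-∀ ring

  -- Left and right translates of `level i h` stay in `J (suc i)` and orthogonal to `J i`, so the
  -- remaining parts of `f` and `g` drop out by `tri-⊥₁` and `tri-⊥₂`.
  tri-same-level : ∀ i f g h → tri f g (level i h) ≡ tri (level i f) (level i g) (level i h)
  tri-same-level i f g h = trans (drop (trans (sym (tri--₁ f (level i f) g l)) (tri-⊥₁ (λ σ → f σ - level i f σ) g l (λ τ →
        off-level i f (J-R τ l∈) (trans (⟪⟫-shiftR (proj i f) l τ) (l⊥ (J-R (inv τ) (proj∈ i f))))))))
      (drop (trans (sym (tri--₂ (level i f) g (level i g) l)) (tri-⊥₂ (level i f) (λ σ → g σ - level i g σ) l (λ σ →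
        off-level i g (J-L σ l∈) (trans (⟪⟫-shiftL (proj i g) l σ) (l⊥ (J-L (inv σ) (proj∈ i g))))))))
    where
    l : F
    l = level i h
    l∈ : J (suc i) l
    l∈ = level∈ x₀ i h
    l⊥ : ∀ {p} → J i p → ⟪ p , l ⟫ ≡ 0ℚ
    l⊥ {p} s = trans (⟪⟫-comm p l) (level⊥ x₀ i h s)
    drop : ∀ {p q} → p - q ≡ 0ℚ → p ≡ q
    drop {p} {q} e = trans (x≡x-y+y p q) (trans (cong (_+ q) e) (ℚP.+-identityˡ q))

  tri-low : ∀ f g h D → tri f g (proj D h) ≡ E f * E g * E h + sum< D (λ i → tri (level i f) (level i g) (level i h))
  tri-low f g h zero = trans (tri-cong {f} {f} {g} {g} (λ _ → refl) (λ _ → refl) (proj₀ h)) (trans (tri-constant f g (E h)) (sym (ℚP.+-identityʳ (E f * E g * E h))))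
  tri-low f g h (suc D) = begin
      tri f g (proj (suc D) h) ≡⟨ tri-cong {f} {f} {g} {g} (λ _ → refl) (λ _ → refl) (λ σ → eq (proj (suc D) h σ) (proj D h σ)) ⟩
      tri f g (λ σ → proj D h σ + level D h σ) ≡⟨ tri-+₃ f g (proj D h) (level D h) ⟩
      tri f g (proj D h) + tri f g (level D h) ≡⟨ cong₂ _+_ (tri-low f g h D) (tri-same-level D f g h) ⟩
      E f * E g * E h + Σ′ + t ≡⟨ ℚP.+-assoc (E f * E g * E h) Σ′ t ⟩
      E f * E g * E h + (Σ′ + t) ∎
    where
    open ≡-Reasoning
    Σ′ = sum< D (λ i → tri (level i f) (level i g) (level i h))
    t = tri (level D f) (level D g) (level D h)
    eq : ∀ a b → a ≡ b + (a - b)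
    eq = solve-∀ ring

  module _ (D : ℕ) (big : 2 ℕ.+ (D ℕ.+ D) ℕ.≤ n) where

    signed : F → F
    signed h = twist (proj D (twist h))

    high : F → F
    high h σ = h σ - proj D h σ - signed h σ

    signed∈ : ∀ h → J D (twist (signed h))
    signed∈ h = span-resp (twist² (proj D (twist h))) (proj∈ D (twist h))

    high-perp : ∀ h → Perp D (high h)
    high-perp h = (λ {p} s → trans (⟪⟫--ˡ (λ σ → h σ - proj D h σ) (signed h) p) (trans (cong₂ _-_ (proj⊥ D h s) (trans (⟪⟫-comm (signed h) p) (plain⊥twisted {q = signed h} big s (signed∈ h)))) refl))
      , (λ {p} s → trans (E-cong (λ σ → cong (_* p σ) (eq (h σ) (proj D h σ) (signed h σ)))) (trans (⟪⟫--ˡ (λ σ → h σ - signed h σ) (proj D h) p)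
          (trans (cong₂ _-_ (Stable.P⊥ (twisted D) h {p} s) (plain⊥twisted {q = p} big (proj∈ D h) s)) refl)))
      where eq : ∀ a b c → a - b - c ≡ a - c - b
            eq = solve-∀ ring

    low+signed : F → F
    low+signed h σ = proj D h σ + signed h σ

    low+signed⊥ : ∀ g {h} → Perp D h → ⟪ low+signed g , h ⟫ ≡ 0ℚ
    low+signed⊥ g {h} (h⊥ , h⊥s) = trans (⟪⟫-+ˡ (proj D g) (signed g) h) (trans (cong₂ _+_ (trans (⟪⟫-comm (proj D g) h) (h⊥ (proj∈ D g))) (trans (⟪⟫-comm (signed g) h) (h⊥s (signed∈ g)))) refl)

    perp-L : ∀ π {h} → Perp D h → Perp D (λ σ → h (π · σ))
    perp-L π {h} (h⊥ , h⊥s) = (λ {p} s → trans (moved p) (h⊥ (J-L (inv π) s)))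
      , (λ {p} s → trans (moved p) (h⊥s (scale (sgn (inv π)) (J-L (inv π) s) (λ σ → eq p σ))))
      where
      moved : ∀ p → ⟪ (λ σ → h (π · σ)) , p ⟫ ≡ ⟪ h , (λ σ → p (inv π · σ)) ⟫
      moved p = trans (⟪⟫-comm (λ σ → h (π · σ)) p) (trans (⟪⟫-shiftL p h π) (⟪⟫-comm (λ σ → p (inv π · σ)) h))
      eq : ∀ p σ → twist (λ σ → p (inv π · σ)) σ ≡ sgn (inv π) * twist p (inv π · σ)
      eq p σ = sym (trans (cong (λ z → sgn (inv π) * (p (inv π · σ) * z)) (sgn-· (inv π) σ)) (trans (e₁ (sgn (inv π)) (p (inv π · σ)) (sgn σ)) (trans (cong (_* (p (inv π · σ) * sgn σ)) (sgn-sq (inv π))) (ℚP.*-identityˡ (p (inv π · σ) * sgn σ)))))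
        where e₁ : ∀ a b c → a * (b * (a * c)) ≡ a * a * (b * c)
              e₁ = solve-∀ ring

    -- `Perp` is stable under left translation, so the low and twisted parts of `g` contribute
    -- nothing. This makes the second factor eligible for `gain`.
    tri-high : ∀ f g h → tri f g (high h) ≡ tri f (high g) (high h)
    tri-high f g h = sym (trans (tri-cong {f} {f} {high g} {λ σ → g σ - low+signed g σ} {high h} (λ _ → refl) (λ σ → eq (g σ) (proj D g σ) (signed g σ)) (λ _ → refl)) (trans (tri--₂ f g (low+signed g) (high h))
      (trans (cong (λ z → tri f g (high h) - z) (tri-⊥₂ f (low+signed g) (high h) (λ σ → low+signed⊥ g {λ τ → high h (σ · τ)} (perp-L σ {high h} (high-perp h))))) (eq₀ (tri f g (high h))))))
      where eq : ∀ a b c → a - b - c ≡ a - (b + c)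
            eq = solve-∀ ring
            eq₀ : ∀ a → a - 0ℚ ≡ a
            eq₀ = solve-∀ ring

    ‖high‖ : ∀ h → ⟪ high h , high h ⟫ ≤ ⟪ h , h ⟫
    ‖high‖ h = subst (⟪ high h , high h ⟫ ≤_) (sym split) (subst (_≤ ⟪ low+signed h , low+signed h ⟫ + ⟪ high h , high h ⟫) (ℚP.+-identityˡ ⟪ high h , high h ⟫) (ℚP.+-monoˡ-≤ ⟪ high h , high h ⟫ {0ℚ} {⟪ low+signed h , low+signed h ⟫} (0≤⟪⟫ (low+signed h))))
      where
      split : ⟪ h , h ⟫ ≡ ⟪ low+signed h , low+signed h ⟫ + ⟪ high h , high h ⟫
      split = trans (E-cong (λ σ → eq (h σ) (proj D h σ) (signed h σ))) (trans (E-+ (λ σ → low+signed h σ * low+signed h σ + high h σ * high h σ) (λ σ → 2ℚ * (low+signed h σ * high h σ)))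
        (trans (cong₂ _+_ (E-+ (λ σ → low+signed h σ * low+signed h σ) (λ σ → high h σ * high h σ)) (trans (E-*ˡ 2ℚ (λ σ → low+signed h σ * high h σ)) (trans (cong (2ℚ *_) (low+signed⊥ h (high-perp h))) (ℚP.*-zeroʳ 2ℚ))))
          (ℚP.+-identityʳ _)))
        where eq : ∀ a b c → a * a ≡ (b + c) * (b + c) + (a - b - c) * (a - b - c) + 2ℚ * ((b + c) * (a - b - c))
              eq = solve-∀ ring

    -- The sign of `σ · τ` splits into the signs of the two other arguments; the twisted part of `h`
    -- thus becomes a plain low-level part for the twisted functions.
    tri-signed : ∀ f g h → tri f g (signed h) ≡ tri (twist f) (twist g) (proj D (twist h))
    tri-signed f g h = E-cong (λ σ → E-cong (λ τ → trans (cong (λ z → f σ * g τ * (proj D (twist h) (σ · τ) * z)) (sgn-· σ τ)) (eq (f σ) (g τ) (proj D (twist h) (σ · τ)) (sgn σ) (sgn τ))))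
      where eq : ∀ a b c s t → a * b * (c * (s * t)) ≡ a * s * (b * t) * c
            eq = solve-∀ ring

    deviation : ∀ f g h → tri f g h - E (twist f) * E (twist g) * E (twist h) - E f * E g * E h ≡
      sum< D (λ i → tri (level i f) (level i g) (level i h)) + sum< D (λ i → tri (level i (twist f)) (level i (twist g)) (level i (twist h))) + tri f (high g) (high h)
    deviation f g h = trans (cong (λ z → z - E (twist f) * E (twist g) * E (twist h) - E f * E g * E h) (begin
        tri f g h ≡⟨ tri-cong {f} {f} {g} {g} (λ _ → refl) (λ _ → refl) (λ σ → eq (h σ) (proj D h σ) (signed h σ)) ⟩
        tri f g (λ σ → proj D h σ + signed h σ + high h σ) ≡⟨ trans (tri-+₃ f g (low+signed h) (high h)) (cong (_+ tri f g (high h)) (tri-+₃ f g (proj D h) (signed h))) ⟩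
        tri f g (proj D h) + tri f g (signed h) + tri f g (high h) ≡⟨ cong₂ _+_ (cong₂ _+_ (tri-low f g h D) (trans (tri-signed f g h) (tri-low (twist f) (twist g) (twist h) D))) (tri-high f g h) ⟩
        m + s + (m′ + s′) + w ∎)) (eq′ m s m′ s′ w)
      where
      open ≡-Reasoning
      m = E f * E g * E h
      m′ = E (twist f) * E (twist g) * E (twist h)
      s = sum< D (λ i → tri (level i f) (level i g) (level i h))
      s′ = sum< D (λ i → tri (level i (twist f)) (level i (twist g)) (level i (twist h)))
      w = tri f (high g) (high h)
      eq : ∀ a b c → a ≡ b + c + (a - b - c)
      eq = solve-∀ ring
      eq′ : ∀ m s m′ s′ w → m + s + (m′ + s′) + w - m′ - m ≡ s + s′ + w
      eq′ = solve-∀ ring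

  -- The gain M^j of a function orthogonal to all low levels under convolution beats the density loss n^c once j > c.
  tri-high-bound : ∀ j M → 6 ℕ.+ j ℕ.* 4 ℕ.≤ n → (big : 2 ℕ.+ (j ℕ.* 4 ℕ.+ j ℕ.* 4) ℕ.≤ n) → j ℕ.* (M ℕ.* 2) ℕ.+ j ℕ.* 4 ℕ.≤ n → 1 ℕ.≤ M →
    ∀ f g h → nat (M ℕ.^ j) * (tri f (high (j ℕ.* 4) big g) (high (j ℕ.* 4) big h) * tri f (high (j ℕ.* 4) big g) (high (j ℕ.* 4) big h)) ≤ ⟪ f , f ⟫ * ⟪ g , g ⟫ * ⟪ h , h ⟫
  tri-high-bound j M big₁ big₂ big₃ 1≤M f g h = begin
      N * (t * t) ≤⟨ *-monoˡ (0≤nat (M ℕ.^ j)) (tri-sq f g′ h′) ⟩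
      N * (⟪ conv f g′ , conv f g′ ⟫ * ⟪ h′ , h′ ⟫) ≡⟨ ℚP.*-assoc N ⟪ conv f g′ , conv f g′ ⟫ ⟪ h′ , h′ ⟫ ⟨
      N * ⟪ conv f g′ , conv f g′ ⟫ * ⟪ h′ , h′ ⟫ ≤⟨ *-monoʳ (0≤⟪⟫ h′) (gain f (ℕP.m^n>0 M {{ℕ.>-nonZero 1≤M}} j) (SpreadFamilies.high-levels 𝓖 j M x₀ big₁ big₂ big₃ (high-perp D big₂ g))) ⟩
      ⟪ f , f ⟫ * ⟪ g′ , g′ ⟫ * ⟪ h′ , h′ ⟫ ≤⟨ *-mono (0≤* (0≤⟪⟫ f) (0≤⟪⟫ g′)) (0≤⟪⟫ h′) (*-monoˡ (0≤⟪⟫ f) (‖high‖ D big₂ g)) (‖high‖ D big₂ h) ⟩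
      ⟪ f , f ⟫ * ⟪ g , g ⟫ * ⟪ h , h ⟫ ∎
    where
    open ≤R
    D = j ℕ.* 4
    N = nat (M ℕ.^ j)
    g′ = high D big₂ g
    h′ = high D big₂ h
    t = tri f g′ h′

-- Disjoint pairs, sums of squares and the level estimates.

pair-off : {A : Set} (k : ℕ) → Vec A (k ℕ.* 2) → Vec (A × A) k
pair-off zero [] = []
pair-off (suc k) (x ∷ y ∷ v) = (x , y) ∷ pair-off k v

disjoint-pair-off : ∀ {n} k (v : Vec (Fin n) (k ℕ.* 2)) → AllDistinct v → Disjoint (pair-off k v)
disjoint-pair-off zero [] _ = tt
disjoint-pair-off (suc k) (x ∷ y ∷ v) ((x≢y , x∉) , y∉ , d) = x≢y , fresh k v x∉ , fresh k v y∉ , disjoint-pair-off k v d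
  where fresh : ∀ {z} k (v : Vec (Fin _) (k ℕ.* 2)) → z ∉ᵛ v → Fresh z (pair-off k v)
        fresh zero [] _ = tt
        fresh (suc k) (x ∷ y ∷ v) (a , b , h) = a , b , fresh k v h

disjoint-pairs : ∀ {n} k → k ℕ.* 2 ℕ.≤ n → ∃[ ps ] Disjoint {n} {k} ps
disjoint-pairs {n} k h with fresh-points {n} [] tt (k ℕ.* 2) (subst (ℕ._≤ n) (sym (ℕP.+-identityʳ (k ℕ.* 2))) h)
... | ws , d , _ = pair-off k ws , disjoint-pair-off k ws (distinct-++ˡ ws {[]} d)

square-mean : ∀ {ρ κ Y u v} → 0ℚ ≤ ρ → ρ * (u * u) ≤ κ * Y → ρ * (v * v) ≤ κ * Y → ρ * ((u + v) * (u + v)) ≤ 2ℚ * 2ℚ * κ * Y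
square-mean {ρ} {κ} {Y} {u} {v} 0≤ρ hu hv = begin
    ρ * ((u + v) * (u + v)) ≤⟨ 0≤-⇒≤ {ρ * ((u + v) * (u + v))} {2ℚ * (ρ * (u * u) + ρ * (v * v))} (subst (0ℚ ≤_) (eq ρ u v) (0≤* 0≤ρ (0≤sq (u - v)))) ⟩
    2ℚ * (ρ * (u * u) + ρ * (v * v)) ≤⟨ *-monoˡ 0≤2 (ℚP.+-mono-≤ {ρ * (u * u)} {κ * Y} {ρ * (v * v)} {κ * Y} hu hv) ⟩
    2ℚ * (κ * Y + κ * Y) ≡⟨ eq′ κ Y ⟩
    2ℚ * 2ℚ * κ * Y ∎
  where open ≤R
        eq : ∀ ρ u v → ρ * ((u - v) * (u - v)) ≡ 2ℚ * (ρ * (u * u) + ρ * (v * v)) - ρ * ((u + v) * (u + v))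
        eq = solve-∀ ring
        eq′ : ∀ κ Y → 2ℚ * (κ * Y + κ * Y) ≡ 2ℚ * 2ℚ * κ * Y
        eq′ = solve-∀ ring

4ℚ : ℚ
4ℚ = 2ℚ * 2ℚ

1≤4 : 1ℚ ≤ 4ℚ
1≤4 = ℚP.+-monoʳ-≤ 1ℚ {0ℚ} {4ℚ - 1ℚ} (ℚP.nonNegative⁻¹ (4ℚ - 1ℚ))

sum<-square : ∀ {ρ Y} D {t : ℕ → ℚ} → 0ℚ ≤ ρ → 0ℚ ≤ Y → (∀ i → i ℕ.< D → ρ * (t i * t i) ≤ Y) → ρ * (sum< D t * sum< D t) ≤ 4ℚ ^ℚ D * Y
sum<-square {ρ} {Y} zero 0≤ρ 0≤Y h = subst₂ _≤_ (eq ρ) (sym (ℚP.*-identityˡ Y)) 0≤Y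
  where eq : ∀ ρ → 0ℚ ≡ ρ * (0ℚ * 0ℚ)
        eq = solve-∀ ring
sum<-square {ρ} {Y} (suc D) {t} 0≤ρ 0≤Y h = square-mean {ρ} {4ℚ ^ℚ D} {Y} {sum< D t} {t D} 0≤ρ (sum<-square D 0≤ρ 0≤Y (λ i i<D → h i (ℕP.m≤n⇒m≤1+n i<D)))
  (ℚP.≤-trans (h D ℕP.≤-refl) (subst (_≤ 4ℚ ^ℚ D * Y) (ℚP.*-identityˡ Y) (*-monoʳ 0≤Y (1≤^ D 1≤4))))

1≤choose : ∀ i {q} → 1 ℕ.≤ q → 1 ℕ.≤ choose i (2 ℕ.^ i ℕ.* q)
1≤choose i {q} h = ℕP.≤-trans (ℕP.m^n>0 q {{ℕ.>-nonZero h}} i) (q^m≤choose i q)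

[m*n]^o : ∀ m n o → (m ℕ.* n) ℕ.^ o ≡ m ℕ.^ o ℕ.* n ℕ.^ o
[m*n]^o m n zero = refl
[m*n]^o m n (suc o) = trans (cong (m ℕ.* n ℕ.*_) ([m*n]^o m n o)) (eq m n (m ℕ.^ o) (n ℕ.^ o))
  where eq : ∀ a b c d → a ℕ.* b ℕ.* (c ℕ.* d) ≡ a ℕ.* c ℕ.* (b ℕ.* d)
        eq = ℕR.solve-∀

-- With about n / 2 pairs to choose from, n^i is bounded by a constant times the number of i-tuples of pairs.
power≤choose : ∀ {n D q i} → n ℕ.≤ 2 ℕ.^ D ℕ.* q ℕ.* 4 → i ℕ.≤ D → n ℕ.^ i ℕ.≤ (2 ℕ.^ D ℕ.* 4) ℕ.^ D ℕ.* choose i (2 ℕ.^ D ℕ.* q)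
power≤choose {n} {D} {q} {i} h i≤D = begin
    n ℕ.^ i ≤⟨ ℕP.^-monoˡ-≤ i h ⟩
    (2 ℕ.^ D ℕ.* q ℕ.* 4) ℕ.^ i ≡⟨ cong (ℕ._^ i) (eq (2 ℕ.^ D) q) ⟩
    (2 ℕ.^ D ℕ.* 4 ℕ.* q) ℕ.^ i ≡⟨ [m*n]^o (2 ℕ.^ D ℕ.* 4) q i ⟩
    (2 ℕ.^ D ℕ.* 4) ℕ.^ i ℕ.* q ℕ.^ i ≤⟨ ℕP.*-mono-≤ (ℕP.^-monoʳ-≤ (2 ℕ.^ D ℕ.* 4) {{ℕP.m*n≢0 (2 ℕ.^ D) 4 {{ℕP.m^n≢0 2 D}}}} i≤D)
                                                          (ℕP.≤-trans (q^m≤choose i q) (choose-mono i (ℕP.*-monoˡ-≤ q (ℕP.^-monoʳ-≤ 2 i≤D)))) ⟩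
    (2 ℕ.^ D ℕ.* 4) ℕ.^ D ℕ.* choose i (2 ℕ.^ D ℕ.* q) ∎
  where open ℕP.≤-Reasoning
        eq : ∀ a q → a ℕ.* q ℕ.* 4 ≡ a ℕ.* 4 ℕ.* q
        eq = ℕR.solve-∀

module LevelEstimates {n : ℕ} (𝓖 : PermGroup n) (x₀ : Fin n) where
  open PermGroup 𝓖
  open Functions 𝓖
  open Convolution 𝓖
  open Indicators 𝓖
  open Juntas 𝓖 hiding (ind-cases)
  open Harmonic {n} using (coincidences)
  open Values 𝓖

  module _ {D q : ℕ} (1≤q : 1 ℕ.≤ q) (n≤ : n ℕ.≤ 2 ℕ.^ D ℕ.* q ℕ.* 4) (n≥ : 2 ℕ.^ D ℕ.* q ℕ.* 2 ℕ.≤ n) where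

    private
      k = 2 ℕ.^ D ℕ.* q
      C = nat ((2 ℕ.^ D ℕ.* 4) ℕ.^ D)

    -- The factor `M (suc i)` in `norm²-energy` is matched by the number of sub-tuples of the `k`
    -- disjoint pairs, up to the constant `C`.
    norm²-bound : ∀ {i} → i ℕ.< D → 2ℚ ^ℚ suc i * 2ℚ ^ℚ suc i * nat (coincidences (suc i)) ≤ nat n → ∀ f {b} → 0ℚ ≤ b →
      ((ps : Vec (Pair n) k) → Disjoint ps → Quadratic.energy ps f (suc i) (nones k) ≤ b) → norm² (suc i) (level i f) ≤ C * b
    norm²-bound {i} i<D big f {b} 0≤b h = cancelˡ (0<nat (ℕP.≤-trans (1≤choose (suc i) 1≤q) (choose-mono (suc i) (ℕP.*-monoˡ-≤ q (ℕP.^-monoʳ-≤ 2 i<D))))) (begin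
        c * norm² (suc i) (level i f) ≤⟨ LevelMoments.norm²-energy 𝓖 x₀ i f big (proj₁ (disjoint-pairs k n≥)) (proj₂ (disjoint-pairs k n≥)) b
                                             (λ π → h (LevelMoments.pair-image 𝓖 π (proj₁ (disjoint-pairs k n≥))) (LevelMoments.disjoint-image 𝓖 π (proj₁ (disjoint-pairs k n≥)) (proj₂ (disjoint-pairs k n≥)))) ⟩
        M (suc i) * b ≤⟨ *-monoʳ 0≤b (subst₂ _≤_ (nat-^ n (suc i)) (nat-* ((2 ℕ.^ D ℕ.* 4) ℕ.^ D) (choose (suc i) k)) (nat-mono (power≤choose {n} {D} {q} n≤ i<D))) ⟩
        C * c * b ≡⟨ eq C c b ⟩
        c * (C * b) ∎)
      where
      open ≤R
      c = nat (choose (suc i) k)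
      eq : ∀ a b c → a * b * c ≡ b * (a * c)
      eq = solve-∀ ring

  -- ρ stands for n^(1/4) and ζ for ρ^(-3/2).
  tri-level-bound : ∀ i f g h {ρ ζ a b c C} → 1ℚ ≤ ρ → 0ℚ ≤ ζ → 0ℚ ≤ a → 0ℚ ≤ b → 0ℚ ≤ c → 0ℚ ≤ C → nat n ≤ ρ ^ℚ 4 → ρ * (ρ ^ℚ 8 * ζ ^ℚ 6) ≡ 1ℚ →
    norm² (suc i) (level i f) ≤ a * a * (C * ζ ^ℚ (2 ℕ.* suc i)) → norm² (suc i) (level i g) ≤ b * b * (C * ζ ^ℚ (2 ℕ.* suc i)) → norm² (suc i) (level i h) ≤ c * c * (C * ζ ^ℚ (2 ℕ.* suc i)) →
    ρ * (tri (level i f) (level i g) (level i h) * tri (level i f) (level i g) (level i h)) ≤ C * C * C * (a * b * c * (a * b * c))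
  tri-level-bound i f g h {ρ} {ζ} {a} {b} {c} {C} 1≤ρ 0≤ζ 0≤a 0≤b 0≤c 0≤C n≤ρ⁴ ρw≡1 hf hg hh = begin
      ρ * (t * t)
        ≤⟨ *-monoˡ 0≤ρ (tri-level x₀ (level i f) (level∈ x₀ i g) (level∈ x₀ i h)) ⟩
      ρ * (m * m * (norm² I (level i f) * norm² I (level i g) * norm² I (level i h)))
        ≤⟨ *-monoˡ 0≤ρ (*-mono (0≤* (0≤M I) (0≤M I)) (0≤* (0≤* (0≤norm² I (level i f)) (0≤norm² I (level i g))) (0≤norm² I (level i h))) (sq-mono (0≤M I) (^-mono I (0≤nat n) n≤ρ⁴))
             (*-mono (0≤* (0≤norm² I (level i f)) (0≤norm² I (level i g))) (0≤norm² I (level i h)) (*-mono (0≤norm² I (level i f)) (0≤norm² I (level i g)) hf hg) hh)) ⟩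
      ρ * ((ρ ^ℚ 4) ^ℚ I * (ρ ^ℚ 4) ^ℚ I * (a * a * (C * Z) * (b * b * (C * Z)) * (c * c * (C * Z))))
        ≡⟨ eq ρ ((ρ ^ℚ 4) ^ℚ I) a b c C Z ⟩
      ρ * ((ρ ^ℚ 4) ^ℚ I * (ρ ^ℚ 4) ^ℚ I * (Z * Z * Z)) * X
        ≡⟨ cong (λ z → ρ * z * X) powers ⟩
      -- One factor `w` cancels the leading `ρ`; the other `i` factors are at most 1.
      ρ * w ^ℚ I * X
        ≡⟨ cong (_* X) (trans (sym (ℚP.*-assoc ρ w (w ^ℚ i))) (trans (cong (_* w ^ℚ i) ρw≡1) (ℚP.*-identityˡ (w ^ℚ i)))) ⟩
      w ^ℚ i * X
        ≤⟨ *-monoʳ 0≤X (subst (w ^ℚ i ≤_) (1^ i) (^-mono i 0≤w w≤1)) ⟩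
      1ℚ * X
        ≡⟨ ℚP.*-identityˡ X ⟩
      X ∎
    where
    open ≤R
    I = suc i
    m = M I
    t = tri (level i f) (level i g) (level i h)
    Z = ζ ^ℚ (2 ℕ.* I)
    w = ρ ^ℚ 8 * ζ ^ℚ 6
    X = C * C * C * (a * b * c * (a * b * c))
    0≤ρ : 0ℚ ≤ ρ
    0≤ρ = ℚP.≤-trans 0≤1 1≤ρ
    0≤X : 0ℚ ≤ X
    0≤X = 0≤* (0≤* (0≤* 0≤C 0≤C) 0≤C) (0≤sq (a * b * c))
    0≤w : 0ℚ ≤ w
    0≤w = 0≤* (0≤^ 8 0≤ρ) (0≤^ 6 0≤ζ)
    w≤1 : w ≤ 1ℚ
    w≤1 = subst₂ _≤_ (ℚP.*-identityˡ w) ρw≡1 (*-monoʳ 0≤w 1≤ρ)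
    powers : (ρ ^ℚ 4) ^ℚ I * (ρ ^ℚ 4) ^ℚ I * (Z * Z * Z) ≡ w ^ℚ I
    powers = trans (cong₂ _*_ (trans (sym (^-* (ρ ^ℚ 4) (ρ ^ℚ 4) I)) (cong (_^ℚ I) (sym (^-+ ρ 4 4))))
        (trans (cong (λ z → z * z * z) (sym (^-^ ζ 2 I))) (trans (cong (_* (ζ ^ℚ 2) ^ℚ I) (sym (^-* (ζ ^ℚ 2) (ζ ^ℚ 2) I))) (trans (sym (^-* (ζ ^ℚ 2 * ζ ^ℚ 2) (ζ ^ℚ 2) I)) (cong (_^ℚ I) (trans (cong (_* ζ ^ℚ 2) (sym (^-+ ζ 2 2))) (sym (^-+ ζ 4 2))))))))
      (sym (^-* (ρ ^ℚ 8) (ζ ^ℚ 6) I))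
    eq : ∀ ρ p a b c C Z → ρ * (p * p * (a * a * (C * Z) * (b * b * (C * Z)) * (c * c * (C * Z)))) ≡ ρ * (p * p * (Z * Z * Z)) * (C * C * C * (a * b * c * (a * b * c)))
    eq = solve-∀ ring

-- Constants of the final estimate; they depend on the density exponent c but not on n.
module Constants (c m : ℕ) (B : ℚ) where

  -- With `j = c + 1` the gain of order `n^j` exceeds the density loss `n^c` by a whole factor `n`.
  -- Each of the `j` quadruples uses four points, whence `D`; `T` bounds the number of fixed points
  -- met in the level inequality.
  j D T : ℕ
  j = suc c
  D = j ℕ.* 4
  T = point-range m (2 ℕ.* D) (2 ℕ.* D) ℕ.+ 2 ℕ.* level-range m (2 ℕ.* D) (2 ℕ.* D)

  K₁ Λ K Q C X : ℚ
  K₁ = 2ℚ * B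
  Λ = 10ℚ * K₁
  K = Λ ^ℚ level-range m (2 ℕ.* D) (2 ℕ.* D)
  Q = Λ ^ℚ D * scaled m Λ (2 ℕ.* D) K
  C = nat ((2 ℕ.^ D ℕ.* 4) ℕ.^ D)
  -- The first summand serves the low levels, the second the remainder.
  X = C * Q * (C * Q) * (C * Q) + B * nat (j ℕ.* 8) ^ℚ j

-- The mixing estimate at abstract scales.

module Mixing {n : ℕ} (𝓖 : PermGroup n) (x₀ : Fin n) where
  open PermGroup 𝓖
  open Functions 𝓖
  open Convolution 𝓖
  open Indicators 𝓖
  open Juntas 𝓖 hiding (ind-cases)
  open HighLevels 𝓖 using (twist)
  open Harmonic {n} using (coincidences)
  open LevelDecomposition 𝓖 x₀
  open LevelEstimates 𝓖 x₀

  -- ρ is essentially n^(1/4), σ = 1 / ρ and ζ = ρ^(-3/2); s is a small power of n.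
  record Scales : Set where
    field
      s ρ σ ζ B : ℚ
      1≤s : 1ℚ ≤ s
      1≤ρ : 1ℚ ≤ ρ
      1≤B : 1ℚ ≤ B
      0≤σ : 0ℚ ≤ σ
      0≤ζ : 0ℚ ≤ ζ
      ρσ : ρ * σ ≡ 1ℚ
      ρ³ζ² : ρ ^ℚ 3 * (ζ * ζ) ≡ 1ℚ
      n≤ρ⁴ : nat n ≤ ρ ^ℚ 4
      ρ⁴≤n : ρ ^ℚ 4 ≤ B * nat n

  module _ (scales : Scales) (c m : ℕ) where
    open Scales scales
    open Constants c m B

    private
      -- Equal to `2 B / ρ^4` and hence at least `2 / n`. It is written with `ζ` and `σ` so that
      -- `ρ * r` is exactly `R`.
      r : ℚ
      r = K₁ * (ζ * ζ) * σ
      0≤s : 0ℚ ≤ s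
      0≤s = ℚP.≤-trans 0≤1 1≤s
      0≤ρ : 0ℚ ≤ ρ
      0≤ρ = ℚP.≤-trans 0≤1 1≤ρ
      0≤B : 0ℚ ≤ B
      0≤B = ℚP.≤-trans 0≤1 1≤B
      0≤K₁ : 0ℚ ≤ K₁
      0≤K₁ = 0≤* 0≤2 0≤B
      0≤Λ : 0ℚ ≤ Λ
      0≤Λ = 0≤* (ℚP.nonNegative⁻¹ 10ℚ) 0≤K₁
      1≤K₁ : 1ℚ ≤ K₁
      1≤K₁ = *-mono {1ℚ} {2ℚ} {1ℚ} {B} 0≤1 0≤1 (ℚP.+-monoʳ-≤ 1ℚ {0ℚ} {1ℚ} 0≤1) 1≤B
      R : ℚ
      R = K₁ * (ζ * ζ)
      0≤R : 0ℚ ≤ R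
      0≤R = 0≤* 0≤K₁ (0≤sq ζ)
      0≤r : 0ℚ ≤ r
      0≤r = 0≤* 0≤R 0≤σ
      ρr≡R : ρ * r ≡ R
      ρr≡R = trans (x*yz≡y*xz ρ R σ) (trans (cong (R *_) ρσ) (ℚP.*-identityʳ R))
      r≤R : r ≤ R
      r≤R = subst₂ _≤_ (ℚP.*-identityˡ r) ρr≡R (*-monoʳ 0≤r 1≤ρ)
      2≤rn : 2ℚ ≤ r * nat n
      2≤rn = begin
          2ℚ ≡⟨ trans (cong₂ (λ x y → 2ℚ * x * y) ρσ ρ³ζ²) refl ⟨
          2ℚ * (ρ * σ) * (ρ ^ℚ 3 * (ζ * ζ)) ≡⟨ eq ρ (ρ ^ℚ 3) σ (ζ * ζ) ⟩
          2ℚ * (ζ * ζ) * σ * (ρ * ρ ^ℚ 3) ≤⟨ *-monoˡ (0≤* (0≤* 0≤2 (0≤sq ζ)) 0≤σ) ρ⁴≤n ⟩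
          2ℚ * (ζ * ζ) * σ * (B * nat n) ≡⟨ eq′ B (ζ * ζ) σ (nat n) ⟩
          r * nat n ∎
        where open ≤R
              eq : ∀ ρ p σ z → 2ℚ * (ρ * σ) * (p * z) ≡ 2ℚ * z * σ * (ρ * p)
              eq = solve-∀ ring
              eq′ : ∀ B z σ n → 2ℚ * z * σ * (B * n) ≡ 2ℚ * B * z * σ * n
              eq′ = solve-∀ ring
      ρw≡1 : ρ * (ρ ^ℚ 8 * ζ ^ℚ 6) ≡ 1ℚ
      ρw≡1 = trans (eq ρ ζ) (trans (cong₂ _*_ (cong₂ _*_ ρ³ζ² ρ³ζ²) ρ³ζ²) refl)
        where eq : ∀ ρ ζ → ρ * ((ρ * (ρ * (ρ * (ρ * (ρ * (ρ * (ρ * (ρ * 1ℚ)))))))) * (ζ * (ζ * (ζ * (ζ * (ζ * (ζ * 1ℚ))))))) ≡ (ρ * (ρ * (ρ * 1ℚ))) * (ζ * ζ) * ((ρ * (ρ * (ρ * 1ℚ))) * (ζ * ζ)) * ((ρ * (ρ * (ρ * 1ℚ))) * (ζ * ζ))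
              eq = solve-∀ ring

    -- In the application a is E f, and the last field follows from a ≥ n^(-c).
    record Global (f : F) (a : ℚ) : Set where
      field
        0≤a : 0ℚ ≤ a
        idempotent : ∀ σ → f σ * f σ ≡ f σ
        mean : E f ≡ a
        spread : ∀ {i} (I J : Vec (Fin n) i) → AllDistinct I → E (λ σ → f σ * ind I J σ) ≤ ρ ^ℚ i * a * E (ind I J)
        dense : 1ℚ ≤ squared m s * squared m s * a

    module _ (2T≤n : T ℕ.+ T ℕ.≤ n) where

      private
        -- The 2 in `K₁` compensates for `n - T` being possibly as small as `n / 2`.
        1≤r* : 1ℚ ≤ r * (nat n - nat T)
        1≤r* = cancelˡ {2ℚ} (ℚP.positive⁻¹ 2ℚ) (begin
            2ℚ * 1ℚ ≡⟨⟩
            2ℚ ≤⟨ 2≤rn ⟩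
            r * nat n ≤⟨ *-monoˡ 0≤r (0≤-⇒≤ {nat n} {2ℚ * (nat n - nat T)} (subst (0ℚ ≤_) (eq (nat n) (nat T)) (≤⇒0≤- (subst (_≤ nat n) (nat-+ T T) (nat-mono 2T≤n))))) ⟩
            r * (2ℚ * (nat n - nat T)) ≡⟨ eq′ r (nat n - nat T) ⟩
            2ℚ * (r * (nat n - nat T)) ∎)
          where open ≤R
                eq : ∀ n t → n - (t + t) ≡ 2ℚ * (n - t) - n
                eq = solve-∀ ring
                eq′ : ∀ a b → a * (2ℚ * b) ≡ 2ℚ * (a * b)
                eq′ = solve-∀ ring

      energy-bound : ∀ {f a} → Global f a → ∀ ε → (∀ σ → ε σ * ε σ ≡ 1ℚ) → ∀ {k} (ps : Vec (Pair n) k) → Disjoint ps → ∀ i → i ℕ.≤ D →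
        Values.Quadratic.energy 𝓖 ps (λ σ → f σ * ε σ) i (nones k) ≤ a * a * (Q * s * ζ ^ℚ (2 ℕ.* i))
      energy-bound {f} {a} gf ε ε² ps disj = LevelInequality.level-inequality 𝓖 ps disj 0≤r 1≤r* f G.idempotent K₁ ζ a 1≤K₁ 0≤ζ G.0≤a spread′
          ε ε² m ℕP.≤-refl r≤R ℚP.≤-refl 0≤s G.dense (ℚP.≤-reflexive G.mean)
        where
        module G = Global gf
        spread′ : ∀ {i} (I J : Vec (Fin n) i) → AllDistinct I → i ℕ.≤ T → E (λ σ → f σ * ind I J σ) ≤ R ^ℚ i * a
        spread′ {i} I J d i≤T = begin
            E (λ σ → f σ * ind I J σ) ≤⟨ G.spread I J d ⟩
            ρ ^ℚ i * a * E (ind I J) ≤⟨ *-monoˡ (0≤* (0≤^ i 0≤ρ) G.0≤a) (ind-prob 0≤r 1≤r* I J d i≤T) ⟩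
            ρ ^ℚ i * a * r ^ℚ i ≡⟨ eq (ρ ^ℚ i) a (r ^ℚ i) ⟩
            ρ ^ℚ i * r ^ℚ i * a ≡⟨ cong (_* a) (trans (sym (^-* ρ r i)) (cong (_^ℚ i) ρr≡R)) ⟩
            R ^ℚ i * a ∎
          where open ≤R
                eq : ∀ a b c → a * b * c ≡ a * c * b
                eq = solve-∀ ring

      module _ {q M : ℕ} (1≤q : 1 ℕ.≤ q) (n≤q : n ℕ.≤ 2 ℕ.^ D ℕ.* q ℕ.* 4) (q≤n : 2 ℕ.^ D ℕ.* q ℕ.* 2 ℕ.≤ n)
        (1≤M : 1 ℕ.≤ M) (n≤M : n ℕ.≤ j ℕ.* 8 ℕ.* M) (M≤n : j ℕ.* (M ℕ.* 2) ℕ.+ j ℕ.* 4 ℕ.≤ n)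
        (big₁ : 6 ℕ.+ D ℕ.≤ n) (big₂ : 2 ℕ.+ (D ℕ.+ D) ℕ.≤ n) (big₃ : ∀ {i} → i ℕ.< D → 2ℚ ^ℚ suc i * 2ℚ ^ℚ suc i * nat (coincidences (suc i)) ≤ nat n)
        {f g h : F} {a b c′ : ℚ} (gf : Global f a) (gg : Global g b) (gh : Global h c′) (dense : 1ℚ ≤ a * b * c′ * nat n ^ℚ c) where

        private
          module Gf = Global gf
          module Gg = Global gg
          module Gh = Global gh
          P L : ℚ
          P = a * b * c′
          L = C * (Q * s)
          0≤P : 0ℚ ≤ P
          0≤P = 0≤* (0≤* Gf.0≤a Gg.0≤a) Gh.0≤a
          0≤Q : 0ℚ ≤ Q
          0≤Q = 0≤* (0≤^ D 0≤Λ) (0≤scaled m (2 ℕ.* D))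
            where 0≤scaled : ∀ m τ → 0ℚ ≤ scaled m Λ τ K
                  0≤scaled zero τ = 0≤^ (level-range m (2 ℕ.* D) (2 ℕ.* D)) 0≤Λ
                  0≤scaled (suc m) τ = 0≤* (0≤^ τ 0≤Λ) (0≤scaled m (2 ℕ.* τ))
          0≤C : 0ℚ ≤ C
          0≤C = 0≤nat ((2 ℕ.^ D ℕ.* 4) ℕ.^ D)
          Y : ℚ
          Y = X * s ^ℚ 3 * (P * P)

          0≤X₁ : 0ℚ ≤ C * Q * (C * Q) * (C * Q)
          0≤X₁ = 0≤* (0≤sq (C * Q)) (0≤* 0≤C 0≤Q)
          0≤X₂ : 0ℚ ≤ B * nat (j ℕ.* 8) ^ℚ j
          0≤X₂ = 0≤* 0≤B (0≤^ j (0≤nat (j ℕ.* 8)))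
          0≤s³PP : 0ℚ ≤ s ^ℚ 3 * (P * P)
          0≤s³PP = 0≤* (0≤^ 3 0≤s) (0≤sq P)
          0≤Y : 0ℚ ≤ Y
          0≤Y = 0≤* (0≤* (0≤+ 0≤X₁ 0≤X₂) (0≤^ 3 0≤s)) (0≤sq P)

          levels : ∀ {f a} → Global f a → ∀ ε → (∀ σ → ε σ * ε σ ≡ 1ℚ) → ∀ {i} → i ℕ.< D → norm² (suc i) (level i (λ σ → f σ * ε σ)) ≤ a * a * (L * ζ ^ℚ (2 ℕ.* suc i))
          levels {f} {a} gf ε ε² {i} i<D = subst (norm² (suc i) (level i (λ σ → f σ * ε σ)) ≤_) (eq C a Q s (ζ ^ℚ (2 ℕ.* suc i)))
              (norm²-bound {D} {q} 1≤q n≤q q≤n i<D (big₃ i<D) (λ σ → f σ * ε σ) (0≤* (0≤sq a) (0≤* (0≤* 0≤Q 0≤s) (0≤^ (2 ℕ.* suc i) 0≤ζ))) (λ ps d → energy-bound gf ε ε² ps d (suc i) i<D))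
            where eq : ∀ C a Q s z → C * (a * a * (Q * s * z)) ≡ a * a * (C * (Q * s) * z)
                  eq = solve-∀ ring

          low : ∀ ε → (∀ σ → ε σ * ε σ ≡ 1ℚ) → ∀ i → i ℕ.< D → let t = tri (level i (λ σ → f σ * ε σ)) (level i (λ σ → g σ * ε σ)) (level i (λ σ → h σ * ε σ)) in ρ * (t * t) ≤ Y
          low ε ε² i i<D = ℚP.≤-trans (tri-level-bound i (λ σ → f σ * ε σ) (λ σ → g σ * ε σ) (λ σ → h σ * ε σ) 1≤ρ 0≤ζ Gf.0≤a Gg.0≤a Gh.0≤a (0≤* 0≤C (0≤* 0≤Q 0≤s)) n≤ρ⁴ ρw≡1
              (levels gf ε ε² i<D) (levels gg ε ε² i<D) (levels gh ε ε² i<D))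
            (0≤-⇒≤ {L * L * L * (P * P)} {Y} (subst (0ℚ ≤_) (eq (C) Q (B * nat (j ℕ.* 8) ^ℚ j) s (P * P)) (0≤* 0≤X₂ 0≤s³PP)))
            where eq : ∀ C Q x s p → x * ((s * (s * (s * 1ℚ))) * p) ≡ (C * Q * (C * Q) * (C * Q) + x) * (s * (s * (s * 1ℚ))) * p - C * (Q * s) * (C * (Q * s)) * (C * (Q * s)) * p
                  eq = solve-∀ ring

          t : ℚ
          t = tri f (high D big₂ g) (high D big₂ h)

          norm≡mean : ∀ {f a} → Global f a → ⟪ f , f ⟫ ≡ a
          norm≡mean gf = trans (E-cong (Global.idempotent gf)) (Global.mean gf)

          -- The gain `M^j` is of order `n^(c + 1)` and the density costs `n^c`, so one factor `n`
          -- is left over.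
          nt² : nat n * (t * t) ≤ nat (j ℕ.* 8) ^ℚ j * (P * P)
          nt² = cancelˡ {nat n ^ℚ c} (0<^ c (0<nat (ℕP.≤-trans (ℕ.s≤s ℕ.z≤n) big₁))) (begin
              N ^ℚ c * (N * (t * t)) ≡⟨ eq (N ^ℚ c) N (t * t) ⟩
              N ^ℚ j * (t * t) ≤⟨ *-monoʳ (0≤sq t) (^-mono j (0≤nat n) (subst (N ≤_) (nat-* (j ℕ.* 8) M) (nat-mono n≤M))) ⟩
              (k * nat M) ^ℚ j * (t * t) ≡⟨ trans (cong (_* (t * t)) (trans (^-* k (nat M) j) (cong (k ^ℚ j *_) (sym (nat-^ M j))))) (ℚP.*-assoc (k ^ℚ j) (nat (M ℕ.^ j)) (t * t)) ⟩
              k ^ℚ j * (nat (M ℕ.^ j) * (t * t)) ≤⟨ *-monoˡ 0≤kʲ (tri-high-bound j M big₁ big₂ M≤n 1≤M f g h) ⟩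
              k ^ℚ j * (⟪ f , f ⟫ * ⟪ g , g ⟫ * ⟪ h , h ⟫) ≡⟨ cong (k ^ℚ j *_) (cong₂ _*_ (cong₂ _*_ (norm≡mean gf) (norm≡mean gg)) (norm≡mean gh)) ⟩
              k ^ℚ j * P ≡⟨ cong (k ^ℚ j *_) (ℚP.*-identityʳ P) ⟨
              k ^ℚ j * (P * 1ℚ) ≤⟨ *-monoˡ 0≤kʲ (*-monoˡ 0≤P dense) ⟩
              k ^ℚ j * (P * (P * N ^ℚ c)) ≡⟨ eq′ (k ^ℚ j) P (N ^ℚ c) ⟩
              N ^ℚ c * (k ^ℚ j * (P * P)) ∎)
            where
            open ≤R
            N k : ℚ
            N = nat n
            k = nat (j ℕ.* 8)
            0≤kʲ : 0ℚ ≤ k ^ℚ j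
            0≤kʲ = 0≤^ j (0≤nat (j ℕ.* 8))
            eq : ∀ a b c → a * (b * c) ≡ b * a * c
            eq = solve-∀ ring
            eq′ : ∀ k P n → k * (P * (P * n)) ≡ n * (k * (P * P))
            eq′ = solve-∀ ring

          top : ρ * (t * t) ≤ Y
          top = begin
              ρ * (t * t) ≤⟨ *-monoʳ (0≤sq t) (subst (_≤ ρ ^ℚ 4) (ℚP.*-identityʳ ρ) (*-monoˡ 0≤ρ (1≤^ 3 1≤ρ))) ⟩
              ρ ^ℚ 4 * (t * t) ≤⟨ *-monoʳ (0≤sq t) ρ⁴≤n ⟩
              B * nat n * (t * t) ≡⟨ ℚP.*-assoc B (nat n) (t * t) ⟩
              B * (nat n * (t * t)) ≤⟨ *-monoˡ 0≤B nt² ⟩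
              B * (k * (P * P)) ≡⟨ ℚP.*-assoc B k (P * P) ⟨
              B * k * (P * P) ≤⟨ *-monoˡ 0≤X₂ (subst (_≤ s ^ℚ 3 * (P * P)) (ℚP.*-identityˡ (P * P)) (*-monoʳ (0≤sq P) (1≤^ 3 1≤s))) ⟩
              B * k * (s ^ℚ 3 * (P * P)) ≤⟨ 0≤-⇒≤ {B * k * (s ^ℚ 3 * (P * P))} {Y} (subst (0ℚ ≤_) (eq (C * Q * (C * Q) * (C * Q)) (B * k) (s ^ℚ 3) (P * P)) (0≤* 0≤X₁ 0≤s³PP)) ⟩
              Y ∎
            where
            open ≤R
            k = nat (j ℕ.* 8) ^ℚ j
            eq : ∀ x y s p → x * (s * p) ≡ (x + y) * s * p - y * (s * p)
            eq = solve-∀ ring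

          plain : ∀ (f : F) σ → f σ * 1ℚ ≡ f σ
          plain f σ = ℚP.*-identityʳ (f σ)

        mixing : let δ = tri f g h - E (twist f) * E (twist g) * E (twist h) - a * b * c′ in
          ρ * (δ * δ) ≤ 4ℚ * (4ℚ * 4ℚ ^ℚ D) * (X * s ^ℚ 3 * (a * b * c′ * (a * b * c′)))
        mixing = subst (λ z → ρ * (z * z) ≤ 4ℚ * (4ℚ * 4ℚ ^ℚ D) * Y) (sym (trans (cong (λ z → tri f g h - E (twist f) * E (twist g) * E (twist h) - z) (sym (cong₂ _*_ (cong₂ _*_ Gf.mean Gg.mean) Gh.mean))) (deviation D big₂ f g h)))
          (square-mean {ρ} {4ℚ * 4ℚ ^ℚ D} {Y} {s₀ + s₁} {t} 0≤ρ
            (square-mean {ρ} {4ℚ ^ℚ D} {Y} {s₀} {s₁} 0≤ρ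
              (sum<-square D 0≤ρ 0≤Y (λ i i<D → subst (λ z → ρ * (z * z) ≤ Y) (tri-cong (unlevel f i) (unlevel g i) (unlevel h i)) (low (λ _ → 1ℚ) (λ _ → refl) i i<D)))
              (sum<-square D 0≤ρ 0≤Y (low sgn sgn-sq)))
            (ℚP.≤-trans top (subst (_≤ 4ℚ * 4ℚ ^ℚ D * Y) (ℚP.*-identityˡ Y) (*-monoʳ 0≤Y (1≤^ (suc D) 1≤4)))))
          where
          s₀ = sum< D (λ i → tri (level i f) (level i g) (level i h))
          s₁ = sum< D (λ i → tri (level i (twist f)) (level i (twist g)) (level i (twist h)))
          unlevel : ∀ f i σ → level i (λ σ → f σ * 1ℚ) σ ≡ level i f σ
          unlevel f i σ = cong₂ _-_ (proj-cong (suc i) (plain f) σ) (proj-cong i (plain f) σ)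

-- Numerical estimates

-- `C ≤ ceiling C` with the denominator cleared. The ceiling is the negated floor of `- C`, so the
-- bound for integer division is applied to the negated numerator.
ceiling-bound : ∀ C → 0ℚ < C → ℤ.∣ ↥ C ∣ ℕ.≤ ↧ₙ C ℕ.* ℤ.∣ ceiling C ∣
ceiling-bound C@(ℚ.mkℚ (ℤ.+ suc a) d-1 _) _ = go (ℤ.-[1+ a ] ℤ./ (ℤ.+ d)) (ℤDM.[n/d]*d≤n ℤ.-[1+ a ] (ℤ.+ d))
  where
  d = suc d-1
  go : ∀ q → q ℤ.* (ℤ.+ d) ℤ.≤ ℤ.-[1+ a ] → suc a ℕ.≤ d ℕ.* ℤ.∣ ℤ.- q ∣
  go (ℤ.+ q) h with subst (ℤ._≤ ℤ.-[1+ a ]) (sym (ℤP.pos-* q d)) h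
  ... | ()
  go (ℤ.-[1+ q ]) (ℤ.-≤- h) = subst (suc a ℕ.≤_) (ℕP.*-comm (suc q) d) (ℕ.s≤s h)
ceiling-bound (ℚ.mkℚ (ℤ.+ 0) _ _) (ℚ.*<* (ℤ.+<+ h)) = ⊥-elim (ℕP.<-irrefl refl h)
ceiling-bound (ℚ.mkℚ ℤ.-[1+ _ ] _ _) (ℚ.*<* ())

integer-root : ∀ k n → ∃[ t ] t ℕ.^ suc k ℕ.≤ n × n ℕ.< suc t ℕ.^ suc k
integer-root k zero = 0 , ℕ.z≤n , ℕP.m^n>0 1 (suc k)
integer-root k (suc n) with integer-root k n
... | t , h , h′ with suc t ℕ.^ suc k ℕP.≤? suc n
...   | no ≰ = t , ℕP.m≤n⇒m≤1+n h , ℕP.≰⇒> ≰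
...   | yes ≤ = suc t , ≤ , ℕP.≤-<-trans h′ (ℕP.^-monoˡ-< (suc k) (ℕP.n<1+n (suc t)))

-- The root is rounded up. Its integer part is at least 1, so adding 1 at most doubles it.
rounded-root : ∀ k {n} → 1 ℕ.≤ n → ∃[ s ] 1 ℕ.≤ s × n ℕ.≤ s ℕ.^ suc k × s ℕ.^ suc k ℕ.≤ 2 ℕ.^ suc k ℕ.* n
rounded-root k {n} 1≤n with integer-root k n
... | zero , _ , h = ⊥-elim (ℕP.<⇒≱ h (subst (ℕ._≤ n) (sym (ℕP.^-zeroˡ (suc k))) 1≤n))
... | suc t , h , h′ = suc (suc t) , ℕ.s≤s ℕ.z≤n , ℕP.<⇒≤ h′ , ℕP.≤-trans (ℕP.^-monoˡ-≤ (suc k) (ℕP.≤-trans (ℕP.m≤m+n (suc (suc t)) t) (ℕP.≤-reflexive (eq t))))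
      (ℕP.≤-trans (ℕP.≤-reflexive ([m*n]^o 2 (suc t) (suc k))) (ℕP.*-monoʳ-≤ (2 ℕ.^ suc k) h))
  where eq : ∀ t → suc (suc t) ℕ.+ t ≡ 2 ℕ.* suc t
        eq = ℕR.solve-∀

m≤2^m : ∀ m → m ℕ.≤ 2 ℕ.^ m
m≤2^m zero = ℕ.z≤n
m≤2^m (suc m) = subst (suc m ℕ.≤_) (cong (2 ℕ.^ m ℕ.+_) (sym (ℕP.+-identityʳ (2 ℕ.^ m)))) (ℕP.+-mono-≤ (ℕP.m^n>0 2 m) (m≤2^m m))

squared≡^ : ∀ m s → squared m s ≡ s ^ℚ (2 ℕ.^ m)
squared≡^ zero s = sym (ℚP.*-identityʳ s)
squared≡^ (suc m) s = trans (squared≡^ m (s * s)) (trans (cong (_^ℚ (2 ℕ.^ m)) (cong (s *_) (sym (ℚP.*-identityʳ s)))) (^-^ s 2 (2 ℕ.^ m)))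

-- The exponents 64, 16 and 48 are those of the scales ρ = s^16 and ζ = s^(-24), with s^64 ≈ n.
decimal-saving : ∀ {s x P X n} → 0ℚ < s → 0ℚ ≤ X → X ^ℚ 5 ≤ s → n ≤ s ^ℚ 64 → s ^ℚ 16 * (x * x) ≤ X * s ^ℚ 3 * (P * P) → ∣ x ∣ ^ℚ 10 * n ≤ P ^ℚ 10
decimal-saving {s} {x} {P} {X} {n} 0<s 0≤X X⁵≤s n≤ h = subst₂ (λ a b → a * n ≤ b) (trans (cong (_^ℚ 5) (sym ∣x∣²)) (^-^ ∣ x ∣ 2 5)) (trans (cong (_^ℚ 5) (sym (sq P))) (^-^ P 2 5))
  (cancelˡ (0<^ 16 0<s) (begin
    s ^ℚ 16 * ((x * x) ^ℚ 5 * n) ≤⟨ *-monoˡ (0≤^ 16 0≤s) (*-monoˡ (0≤^ 5 (0≤sq x)) n≤) ⟩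
    s ^ℚ 16 * ((x * x) ^ℚ 5 * s ^ℚ 64) ≡⟨ eq (s ^ℚ 16) ((x * x) ^ℚ 5) (s ^ℚ 64) ⟩
    s ^ℚ 16 * s ^ℚ 64 * (x * x) ^ℚ 5 ≡⟨ cong (_* (x * x) ^ℚ 5) (trans (sym (^-+ s 16 64)) (sym (^-^ s 16 5))) ⟩
    (s ^ℚ 16) ^ℚ 5 * (x * x) ^ℚ 5 ≡⟨ ^-* (s ^ℚ 16) (x * x) 5 ⟨
    (s ^ℚ 16 * (x * x)) ^ℚ 5 ≤⟨ ^-mono 5 (0≤* (0≤^ 16 0≤s) (0≤sq x)) h ⟩
    (X * s ^ℚ 3 * (P * P)) ^ℚ 5 ≡⟨ trans (^-* (X * s ^ℚ 3) (P * P) 5) (cong (_* (P * P) ^ℚ 5) (trans (^-* X (s ^ℚ 3) 5) (cong (X ^ℚ 5 *_) (^-^ s 3 5)))) ⟩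
    X ^ℚ 5 * s ^ℚ 15 * (P * P) ^ℚ 5 ≤⟨ *-monoʳ (0≤^ 5 (0≤sq P)) (*-monoʳ (0≤^ 15 0≤s) X⁵≤s) ⟩
    s ^ℚ 16 * (P * P) ^ℚ 5 ∎))
  where
  open ≤R
  0≤s : 0ℚ ≤ s
  0≤s = ℚP.<⇒≤ 0<s
  sq : ∀ p → p ^ℚ 2 ≡ p * p
  sq p = cong (p *_) (ℚP.*-identityʳ p)
  ∣x∣² : ∣ x ∣ ^ℚ 2 ≡ x * x
  ∣x∣² with ℚP.∣p∣≡p∨∣p∣≡-p x
  ... | inj₁ e = trans (cong (_^ℚ 2) e) (sq x)
  ... | inj₂ e = trans (cong (_^ℚ 2) e) (trans (sq (- x)) (neg-sq x))
    where neg-sq : ∀ p → - p * - p ≡ p * p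
          neg-sq = solve-∀ ring
  eq : ∀ a b c → a * (b * c) ≡ a * c * b
  eq = solve-∀ ring

coincidences≤ : ∀ {n} m → Harmonic.coincidences {n} m ℕ.≤ 3 ℕ.* m ℕ.* m
coincidences≤ zero = ℕ.z≤n
coincidences≤ {n} (suc m) = ℕP.≤-trans (ℕP.+-monoʳ-≤ (suc (3 ℕ.* m)) (coincidences≤ {n} m)) (ℕP.≤-trans (ℕP.m≤m+n (suc (3 ℕ.* m) ℕ.+ 3 ℕ.* m ℕ.* m) (2 ℕ.+ 3 ℕ.* m)) (ℕP.≤-reflexive (eq m)))
  where eq : ∀ m → suc (3 ℕ.* m) ℕ.+ 3 ℕ.* m ℕ.* m ℕ.+ (2 ℕ.+ 3 ℕ.* m) ≡ 3 ℕ.* suc m ℕ.* suc m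
        eq = ℕR.solve-∀

enough-points : ∀ {n D i} → 2 ℕ.^ D ℕ.* 2 ℕ.^ D ℕ.* (3 ℕ.* D ℕ.* D) ℕ.≤ n → i ℕ.≤ D → 2ℚ ^ℚ i * 2ℚ ^ℚ i * nat (Harmonic.coincidences {n} i) ≤ nat n
enough-points {n} {D} {i} h i≤D = subst (_≤ nat n) (trans (nat-* (2 ℕ.^ i ℕ.* 2 ℕ.^ i) (Harmonic.coincidences {n} i)) (cong (_* nat (Harmonic.coincidences {n} i))
    (trans (nat-* (2 ℕ.^ i) (2 ℕ.^ i)) (cong₂ _*_ 2^ 2^))))
  (nat-mono (ℕP.≤-trans (ℕP.*-mono-≤ (ℕP.*-mono-≤ (ℕP.^-monoʳ-≤ 2 i≤D) (ℕP.^-monoʳ-≤ 2 i≤D)) (ℕP.≤-trans (coincidences≤ {n} i) (ℕP.*-mono-≤ (ℕP.*-monoʳ-≤ 3 i≤D) i≤D))) h))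
  where 2^ : nat (2 ℕ.^ i) ≡ 2ℚ ^ℚ i
        2^ = trans (nat-^ 2 i) (cong (_^ℚ i) (nat≡fromℕ 2))

quotient-bounds : ∀ d .{{_ : ℕ.NonZero d}} {n} → d ℕ.≤ n → let M = n ℕ./ d in 1 ℕ.≤ M × M ℕ.* d ℕ.≤ n × n ℕ.≤ M ℕ.* d ℕ.* 2
quotient-bounds d {n} d≤n = 1≤M , DivMod.m/n*n≤m n d , (begin
    n ≡⟨ DivMod.m≡m%n+[m/n]*n n d ⟩
    n ℕ.% d ℕ.+ n ℕ./ d ℕ.* d ≤⟨ ℕP.+-monoˡ-≤ (n ℕ./ d ℕ.* d) (ℕP.≤-trans (ℕP.<⇒≤ (DivMod.m%n<n n d)) (ℕP.m≤n*m d (n ℕ./ d) {{ℕ.>-nonZero 1≤M}})) ⟩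
    n ℕ./ d ℕ.* d ℕ.+ n ℕ./ d ℕ.* d ≡⟨ eq (n ℕ./ d ℕ.* d) ⟩
    n ℕ./ d ℕ.* d ℕ.* 2 ∎)
  where open ℕP.≤-Reasoning
        1≤M : 1 ℕ.≤ n ℕ./ d
        1≤M = DivMod.m≥n⇒m/n>0 d≤n
        eq : ∀ a → a ℕ.+ a ≡ a ℕ.* 2
        eq = ℕR.solve-∀

-- Scales and threshold for the symmetric group.

module Threshold (c : ℕ) where

  -- It suffices that `2^m ≥ 64 c`, for then `squared m s = s^(2^m)` is at least `n^c`, which the
  -- density hypothesis compares with the means.
  m : ℕ
  m = 64 ℕ.* c

  -- The loss from rounding up a 64-th root.
  B : ℚ
  B = nat (2 ℕ.^ 64)

  open Constants c m B

  X′ : ℚ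
  X′ = 4ℚ * (4ℚ * 4ℚ ^ℚ D) * X

  s-min : ℕ
  s-min = proj₁ (archimedean (X′ ^ℚ 5))

  -- The first summand lets `s` absorb the constant `X′^5`; the others provide the points consumed
  -- by the individual estimates.
  N : ℕ
  N = s-min ℕ.^ 64 ℕ.+ (T ℕ.+ T ℕ.+ (6 ℕ.+ D ℕ.+ (2 ℕ.+ (D ℕ.+ D) ℕ.+ (2 ℕ.^ D ℕ.* 2 ℕ.+ 2 ℕ.^ D ℕ.* 2 ℕ.^ D ℕ.* (3 ℕ.* D ℕ.* D)))))

  𝟙-idem : ∀ b → 𝟙 b * 𝟙 b ≡ 𝟙 b
  𝟙-idem true = refl
  𝟙-idem false = refl

  𝟙≤1 : ∀ b → 𝟙 b ≤ 1ℚ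
  𝟙≤1 true = ℚP.≤-refl
  𝟙≤1 false = 0≤1

  0≤𝟙 : ∀ b → 0ℚ ≤ 𝟙 b
  0≤𝟙 b = subst (0ℚ ≤_) (𝟙-idem b) (0≤sq (𝟙 b))

  1≤B : 1ℚ ≤ B
  1≤B = subst (_≤ B) nat-1 (nat-mono (ℕP.m^n>0 2 64))

  0≤X′ : 0ℚ ≤ X′
  0≤X′ = 0≤* (0≤* {4ℚ} (ℚP.nonNegative⁻¹ 4ℚ) (0≤^ (suc D) (ℚP.nonNegative⁻¹ 4ℚ))) (0≤+ (0≤* (0≤sq (C * Q)) (0≤* 0≤C 0≤Q)) (0≤* (0≤nat (2 ℕ.^ 64)) (0≤^ j (0≤nat (j ℕ.* 8)))))
    where
    0≤Λ : 0ℚ ≤ Λ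
    0≤Λ = 0≤* {10ℚ} (ℚP.nonNegative⁻¹ 10ℚ) (0≤* 0≤2 (0≤nat (2 ℕ.^ 64)))
    0≤C : 0ℚ ≤ C
    0≤C = 0≤nat ((2 ℕ.^ D ℕ.* 4) ℕ.^ D)
    0≤scaled : ∀ m τ {K} → 0ℚ ≤ K → 0ℚ ≤ scaled m Λ τ K
    0≤scaled zero τ h = h
    0≤scaled (suc m) τ h = 0≤* (0≤^ τ 0≤Λ) (0≤scaled m (2 ℕ.* τ) h)
    0≤Q : 0ℚ ≤ Q
    0≤Q = 0≤* (0≤^ D 0≤Λ) (0≤scaled m (2 ℕ.* D) (0≤^ (level-range m (2 ℕ.* D) (2 ℕ.* D)) 0≤Λ))

  module Large {n : ℕ} (N≤n : N ℕ.≤ n) where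

    private
      rest₀ : T ℕ.+ T ℕ.+ (6 ℕ.+ D ℕ.+ (2 ℕ.+ (D ℕ.+ D) ℕ.+ (2 ℕ.^ D ℕ.* 2 ℕ.+ 2 ℕ.^ D ℕ.* 2 ℕ.^ D ℕ.* (3 ℕ.* D ℕ.* D)))) ℕ.≤ n
      rest₀ = ℕP.m+n≤o⇒n≤o (s-min ℕ.^ 64) N≤n
      rest₁ = ℕP.m+n≤o⇒n≤o (T ℕ.+ T) rest₀
      rest₂ = ℕP.m+n≤o⇒n≤o (6 ℕ.+ D) rest₁
      rest₃ = ℕP.m+n≤o⇒n≤o (2 ℕ.+ (D ℕ.+ D)) rest₂

    big₁ : 6 ℕ.+ D ℕ.≤ n
    big₁ = ℕP.m+n≤o⇒m≤o (6 ℕ.+ D) rest₁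

    big₂ : 2 ℕ.+ (D ℕ.+ D) ℕ.≤ n
    big₂ = ℕP.m+n≤o⇒m≤o (2 ℕ.+ (D ℕ.+ D)) rest₂

    1≤n : 1 ℕ.≤ n
    1≤n = ℕP.≤-trans (ℕ.s≤s ℕ.z≤n) big₁

    x₀ : Fin n
    x₀ = Fin.fromℕ< 1≤n

    module 𝕄 = Mixing (𝕊 n) x₀
    open Functions (𝕊 n)
    open Indicators (𝕊 n)
    open Averages n
    open SymmetricGroup n using (vec)

    private
      root = rounded-root 63 {n} 1≤n
      s u : ℚ
      s = nat (proj₁ root)

    1≤s : 1ℚ ≤ s
    1≤s = subst (_≤ s) nat-1 (nat-mono (proj₁ (proj₂ root)))

    0<s : 0ℚ < s
    0<s = ℚP.<-≤-trans 0<1 1≤s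

    private instance
      s-positive = ℚ.positive 0<s
      s-nonZero = ℚP.pos⇒nonZero s

    u = ℚ.1/ s

    0≤u : 0ℚ ≤ u
    0≤u = ℚP.<⇒≤ (ℚP.positive⁻¹ u {{ℚP.1/pos⇒pos s}})

    s^u^ : ∀ k → s ^ℚ k * u ^ℚ k ≡ 1ℚ
    s^u^ k = trans (sym (^-* s u k)) (trans (cong (_^ℚ k) (ℚP.*-inverseʳ s)) (1^ k))

    n≤s^64 : nat n ≤ s ^ℚ 64
    n≤s^64 = subst (nat n ≤_) (nat-^ (proj₁ root) 64) (nat-mono (proj₁ (proj₂ (proj₂ root))))

    s^64≤n : s ^ℚ 64 ≤ B * nat n
    s^64≤n = subst₂ _≤_ (nat-^ (proj₁ root) 64) (nat-* (2 ℕ.^ 64) n) (nat-mono (proj₂ (proj₂ (proj₂ root))))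

    X′⁵≤s : X′ ^ℚ 5 ≤ s
    X′⁵≤s = ℚP.≤-trans (proj₂ (archimedean (X′ ^ℚ 5))) (^-cancel 63 (0≤nat s-min) (ℚP.<⇒≤ 0<s)
      (ℚP.≤-trans (subst (_≤ nat n) (nat-^ s-min 64) (nat-mono (ℕP.m+n≤o⇒m≤o (s-min ℕ.^ 64) N≤n))) n≤s^64))

    scales : 𝕄.Scales
    scales = record
      { s = s ; ρ = s ^ℚ 16 ; σ = u ^ℚ 16 ; ζ = u ^ℚ 24 ; B = B
      ; 1≤s = 1≤s ; 1≤ρ = 1≤^ 16 1≤s ; 1≤B = 1≤B ; 0≤σ = 0≤^ 16 0≤u ; 0≤ζ = 0≤^ 24 0≤u
      ; ρσ = s^u^ 16
      ; ρ³ζ² = trans (cong₂ _*_ (^-^ s 16 3) (sym (^-+ u 24 24))) (s^u^ 48)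
      ; n≤ρ⁴ = subst (nat n ≤_) (sym (^-^ s 16 4)) n≤s^64
      ; ρ⁴≤n = subst (_≤ B * nat n) (sym (^-^ s 16 4)) s^64≤n }

    ρ : ℚ
    ρ = s ^ℚ 16

    1≤ρ : 1ℚ ≤ ρ
    1≤ρ = 1≤^ 16 1≤s

    0≤ρ : 0ℚ ≤ ρ
    0≤ρ = ℚP.≤-trans 0≤1 1≤ρ

    n^≤ρ^ : ∀ i → nat n ^ℚ i ≤ ρ ^ℚ (4 ℕ.* i)
    n^≤ρ^ i = subst (nat n ^ℚ i ≤_) (^-^ ρ 4 i) (^-mono i (0≤nat n) (𝕄.Scales.n≤ρ⁴ scales))

    module _ (f : Perm n → Bool) where

      private
        f₁ : Perm n → ℚ
        f₁ σ = 𝟙 (f σ)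
        a : ℚ
        a = 𝔼 f₁

      0≤mean : 0ℚ ≤ 𝔼 f₁
      0≤mean = subst (0ℚ ≤_) (sym (𝔼≡E f₁)) (0≤E (λ σ → 0≤𝟙 (f (vec σ))))

      mean≤1 : 𝔼 f₁ ≤ 1ℚ
      mean≤1 = subst₂ _≤_ (sym (𝔼≡E f₁)) (E-const 1ℚ) (E-mono (λ σ → 𝟙≤1 (f (vec σ))))

      norm≡mean : norm2² f₁ ≡ 𝔼 f₁
      norm≡mean = trans (𝔼≡E (λ σ → f₁ σ * f₁ σ)) (trans (E-cong (λ σ → 𝟙-idem (f (vec σ)))) (sym (𝔼≡E f₁)))

      -- Fourth roots are taken of the globalness hypothesis, with `ρ` in the role of `n^(1/4)`.
      condNorm-bound : ∀ i → RelGlobalRoot4 f₁ i → ∀ (I J : Vec (Fin n) i) → Distinct I → Distinct J → condNorm2² f₁ I J ≤ ρ ^ℚ i * 𝔼 f₁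
      condNorm-bound i h I J dI dJ = bound (h I J dI dJ) (ℚP.≤-total 0ℚ (condNorm2² f₁ I J))
        where
        open ≤R
        bound : ∀ {x} → x ^ℚ 4 ≤ fromℕ (n ℕ.^ i) * norm2² f₁ ^ℚ 4 → 0ℚ ≤ x ⊎ x ≤ 0ℚ → x ≤ ρ ^ℚ i * a
        bound _ (inj₂ neg) = ℚP.≤-trans neg (0≤* (0≤^ i 0≤ρ) 0≤mean)
        bound {x} x⁴≤ (inj₁ pos) = ^-cancel 3 pos (0≤* (0≤^ i 0≤ρ) 0≤mean) (begin
          x ^ℚ 4 ≤⟨ x⁴≤ ⟩
          fromℕ (n ℕ.^ i) * norm2² f₁ ^ℚ 4 ≡⟨ cong₂ _*_ (trans (sym (nat≡fromℕ (n ℕ.^ i))) (nat-^ n i)) (cong (_^ℚ 4) norm≡mean) ⟩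
          nat n ^ℚ i * a ^ℚ 4 ≤⟨ *-monoʳ (0≤^ 4 0≤mean) (n^≤ρ^ i) ⟩
          ρ ^ℚ (4 ℕ.* i) * a ^ℚ 4 ≡⟨ cong (_* a ^ℚ 4) (trans (cong (ρ ^ℚ_) (ℕP.*-comm 4 i)) (sym (^-^ ρ i 4))) ⟩
          (ρ ^ℚ i) ^ℚ 4 * a ^ℚ 4 ≡⟨ ^-* (ρ ^ℚ i) a 4 ⟨
          (ρ ^ℚ i * a) ^ℚ 4 ∎)

      global : 1ℚ ≤ 𝔼 f₁ * nat n ^ℚ c → (∀ i → 1 ℕ.≤ i → i ℕ.≤ 4 ℕ.* c → RelGlobalRoot4 f₁ i) → 𝕄.Global scales c m (f₁ ∘ vec) (𝔼 f₁)
      global dense glob = record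
        { 0≤a = 0≤mean ; idempotent = λ σ → 𝟙-idem (f (vec σ)) ; mean = sym (𝔼≡E f₁) ; spread = spread
        ; dense = ℚP.≤-trans dense (begin
            a * nat n ^ℚ c ≤⟨ *-monoˡ 0≤mean (^-mono c (0≤nat n) n≤s^64) ⟩
            a * (s ^ℚ 64) ^ℚ c ≡⟨ cong (a *_) (^-^ s 64 c) ⟩
            a * s ^ℚ m ≤⟨ *-monoˡ 0≤mean (^-monoᵉ 1≤s (m≤2^m m)) ⟩
            a * s ^ℚ (2 ℕ.^ m) ≡⟨ trans (cong (a *_) (sym (squared≡^ m s))) (ℚP.*-comm a S) ⟩
            S * a ≤⟨ *-monoʳ 0≤mean (subst (_≤ S * S) (ℚP.*-identityʳ S) (*-monoˡ (ℚP.≤-trans 0≤1 1≤S) 1≤S)) ⟩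
            S * S * a ∎) }
        where
        open ≤R
        S : ℚ
        S = squared m s
        1≤S : 1ℚ ≤ S
        1≤S = subst (1ℚ ≤_) (sym (squared≡^ m s)) (1≤^ (2 ℕ.^ m) 1≤s)
        spread : ∀ {i} (I J : Vec (Fin n) i) → AllDistinct I → E (λ σ → f₁ (vec σ) * ind I J σ) ≤ ρ ^ℚ i * a * E (ind I J)
        spread {zero} [] [] _ = ℚP.≤-reflexive (trans (E-cong (λ σ → ℚP.*-identityʳ (f₁ (vec σ)))) (trans (sym (𝔼≡E f₁))
          (trans (sym (trans (ℚP.*-identityʳ (1ℚ * a)) (ℚP.*-identityˡ a))) (cong (1ℚ * a *_) (sym (E-const 1ℚ))))))
        spread {suc i} I J d = split (suc i ℕP.≤? 4 ℕ.* c)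
          where
          split : Dec (suc i ℕ.≤ 4 ℕ.* c) → E (λ σ → f₁ (vec σ) * ind I J σ) ≤ ρ ^ℚ suc i * a * E (ind I J)
          split (yes i≤) = restricted-mean f₁ (λ σ → 𝟙-idem (f σ)) (0≤* (0≤^ (suc i) 0≤ρ) 0≤mean) (condNorm-bound (suc i) (glob (suc i) (ℕ.s≤s ℕ.z≤n) i≤)) I J d
          -- Beyond `4 * c` points the density takes over from globalness: `a * n^c ≥ 1` and
          -- `n ≤ ρ^4` give `ρ^i * a ≥ 1`, and bounding `f` by 1 suffices.
          split (no i≰) = begin
            E (λ σ → f₁ (vec σ) * ind I J σ) ≤⟨ E-mono (λ σ → subst (f₁ (vec σ) * ind I J σ ≤_) (ℚP.*-identityˡ (ind I J σ)) (*-monoʳ (0≤ind I J σ) (𝟙≤1 (f (vec σ))))) ⟩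
            E (ind I J) ≡⟨ ℚP.*-identityˡ (E (ind I J)) ⟨
            1ℚ * E (ind I J) ≤⟨ *-monoʳ (0≤E (0≤ind I J)) (ℚP.≤-trans dense (ℚP.≤-trans (*-monoˡ 0≤mean (ℚP.≤-trans (n^≤ρ^ c) (^-monoᵉ 1≤ρ (ℕP.<⇒≤ (ℕP.≰⇒> i≰))))) (ℚP.≤-reflexive (ℚP.*-comm a (ρ ^ℚ suc i))))) ⟩
            ρ ^ℚ suc i * a * E (ind I J) ∎

    private
      instance
        2^D*2≢0 : ℕ.NonZero (2 ℕ.^ D ℕ.* 2)
        2^D*2≢0 = ℕP.m*n≢0 (2 ℕ.^ D) 2 {{ℕP.m^n≢0 2 D}}
      q M : ℕ
      q = n ℕ./ (2 ℕ.^ D ℕ.* 2)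
      M = n ℕ./ D
      hq = quotient-bounds (2 ℕ.^ D ℕ.* 2) {n} (ℕP.m+n≤o⇒m≤o (2 ℕ.^ D ℕ.* 2) rest₃)
      2D≤n : D ℕ.+ D ℕ.≤ n
      2D≤n = ℕP.m+n≤o⇒n≤o 2 big₂
      hM = quotient-bounds D {n} (ℕP.m+n≤o⇒m≤o D 2D≤n)
      n≤q : n ℕ.≤ 2 ℕ.^ D ℕ.* q ℕ.* 4
      n≤q = subst (n ℕ.≤_) (eq q (2 ℕ.^ D)) (proj₂ (proj₂ hq))
        where eq : ∀ q a → q ℕ.* (a ℕ.* 2) ℕ.* 2 ≡ a ℕ.* q ℕ.* 4
              eq = ℕR.solve-∀
      q≤n : 2 ℕ.^ D ℕ.* q ℕ.* 2 ℕ.≤ n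
      q≤n = subst (ℕ._≤ n) (eq q (2 ℕ.^ D)) (proj₁ (proj₂ hq))
        where eq : ∀ q a → q ℕ.* (a ℕ.* 2) ≡ a ℕ.* q ℕ.* 2
              eq = ℕR.solve-∀
      n≤M : n ℕ.≤ j ℕ.* 8 ℕ.* M
      n≤M = subst (n ℕ.≤_) (eq M j) (proj₂ (proj₂ hM))
        where eq : ∀ M j → M ℕ.* (j ℕ.* 4) ℕ.* 2 ≡ j ℕ.* 8 ℕ.* M
              eq = ℕR.solve-∀
      M≤n : j ℕ.* (M ℕ.* 2) ℕ.+ D ℕ.≤ n
      M≤n = ℕP.*-cancelˡ-≤ 2 (subst₂ ℕ._≤_ (eq M j) (eq′ n) (ℕP.+-mono-≤ (proj₁ (proj₂ hM)) 2D≤n))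
        where eq : ∀ M j → M ℕ.* (j ℕ.* 4) ℕ.+ (j ℕ.* 4 ℕ.+ j ℕ.* 4) ≡ 2 ℕ.* (j ℕ.* (M ℕ.* 2) ℕ.+ j ℕ.* 4)
              eq = ℕR.solve-∀
              eq′ : ∀ n → n ℕ.+ n ≡ 2 ℕ.* n
              eq′ = ℕR.solve-∀

    module _ (f g h : Perm n → Bool) where

      private
        f₁ g₁ h₁ : Perm n → ℚ
        f₁ σ = 𝟙 (f σ)
        g₁ σ = 𝟙 (g σ)
        h₁ σ = 𝟙 (h σ)
        P Δ : ℚ
        P = 𝔼 f₁ * 𝔼 g₁ * 𝔼 h₁
        Δ = 𝔼₂ (λ σ τ → f₁ σ * g₁ τ * h₁ (σ ∘ₚ τ)) - 𝔼 (tilde f₁) * 𝔼 (tilde g₁) * 𝔼 (tilde h₁) - P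

      0≤P : 0ℚ ≤ 𝔼 f₁ * 𝔼 g₁ * 𝔼 h₁
      0≤P = 0≤* (0≤* (0≤mean f) (0≤mean g)) (0≤mean h)

      conclusion : 1ℚ ≤ 𝔼 f₁ * 𝔼 g₁ * 𝔼 h₁ * nat n ^ℚ c → (∀ i → 1 ℕ.≤ i → i ℕ.≤ 4 ℕ.* c → RelGlobalRoot4 f₁ i × RelGlobalRoot4 g₁ i × RelGlobalRoot4 h₁ i) →
        ∣ 𝔼₂ (λ σ τ → f₁ σ * g₁ τ * h₁ (σ ∘ₚ τ)) - 𝔼 (tilde f₁) * 𝔼 (tilde g₁) * 𝔼 (tilde h₁) - 𝔼 f₁ * 𝔼 g₁ * 𝔼 h₁ ∣ ^ℚ 10 * fromℕ n ≤ (𝔼 f₁ * 𝔼 g₁ * 𝔼 h₁) ^ℚ 10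
      conclusion dense glob = decimal-saving {s} {Δ} {P} {X′} {fromℕ n} 0<s 0≤X′ X′⁵≤s (subst (_≤ s ^ℚ 64) (nat≡fromℕ n) n≤s^64) (subst₂ (λ x y → ρ * (x * x) ≤ y) {y = Δ}
          (sym (cong₂ (λ x y → x - y - P) (𝔼₂≡tri f₁ g₁ h₁) (cong₂ _*_ (cong₂ _*_ (𝔼≡E (tilde f₁)) (𝔼≡E (tilde g₁))) (𝔼≡E (tilde h₁)))))
          (eq (4ℚ * (4ℚ * 4ℚ ^ℚ D)) X (s ^ℚ 3) (P * P))
          (𝕄.mixing scales c m (ℕP.m+n≤o⇒m≤o (T ℕ.+ T) rest₀) {q} {M} (proj₁ hq) n≤q q≤n (proj₁ hM) n≤M M≤n big₁ big₂
            (enough-points (ℕP.m+n≤o⇒n≤o (2 ℕ.^ D ℕ.* 2) rest₃))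
            (global f (dense-f (0≤mean f) (mean≤1 g) (0≤mean g) (mean≤1 h) (eq₁ (𝔼 f₁) (𝔼 g₁) (𝔼 h₁))) (λ i a b → proj₁ (glob i a b)))
            (global g (dense-f (0≤mean g) (mean≤1 f) (0≤mean f) (mean≤1 h) (eq₂ (𝔼 f₁) (𝔼 g₁) (𝔼 h₁))) (λ i a b → proj₁ (proj₂ (glob i a b))))
            (global h (dense-f (0≤mean h) (mean≤1 f) (0≤mean f) (mean≤1 g) (eq₃ (𝔼 f₁) (𝔼 g₁) (𝔼 h₁))) (λ i a b → proj₂ (proj₂ (glob i a b))))
            dense))
        where
        eq : ∀ x y z p → x * (y * z * p) ≡ x * y * z * p
        eq = solve-∀ ring
        eq₁ : ∀ a b c → a * b * c ≡ a * (b * c)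
        eq₁ = solve-∀ ring
        eq₂ : ∀ a b c → a * b * c ≡ b * (a * c)
        eq₂ = solve-∀ ring
        eq₃ : ∀ a b c → a * b * c ≡ c * (a * b)
        eq₃ = solve-∀ ring
        -- The other two means are at most 1, so the lower bound for the product passes to each
        -- factor.
        dense-f : ∀ {x y z} → 0ℚ ≤ x → y ≤ 1ℚ → 0ℚ ≤ y → z ≤ 1ℚ → P ≡ x * (y * z) → 1ℚ ≤ x * nat n ^ℚ c
        dense-f {x} {y} {z} 0≤x y≤1 0≤y z≤1 e = ℚP.≤-trans dense (*-monoʳ (0≤^ c (0≤nat n)) (subst₂ _≤_ (sym e) (ℚP.*-identityʳ x)
          (*-monoˡ 0≤x (ℚP.≤-trans (*-monoˡ 0≤y z≤1) (subst (_≤ 1ℚ) (sym (ℚP.*-identityʳ y)) y≤1)))))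

-- Fractional powers of `n` are cleared by raising the density hypothesis to the power `↧ₙ C` and
-- the conclusion to the power 10, an equivalent form because all quantities compared are
-- nonnegative. A real exponent is covered by a rational one between it and its ceiling: the ceiling
-- stays the same and the density hypothesis becomes weaker.
theorem2p11 : (C : ℚ) → 0ℚ < C →
    ∃[ N ] ((n : ℕ) → N ℕ.≤ n → (f g h : Perm n → Bool) →
      let F = λ σ → 𝟙 (f σ)
          G = λ σ → 𝟙 (g σ)
          H = λ σ → 𝟙 (h σ)
          P = 𝔼 F * 𝔼 G * 𝔼 H
      in 1ℚ ≤ (P ^ℚ (↧ₙ C)) * fromℕ (n ℕ.^ ℤ.∣ ↥ C ∣) →
         ((i : ℕ) → 1 ℕ.≤ i → i ℕ.≤ 4 ℕ.* ℤ.∣ ceiling C ∣ →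
            RelGlobalRoot4 F i × RelGlobalRoot4 G i × RelGlobalRoot4 H i) →
         (∣ 𝔼₂ (λ σ τ → F σ * G τ * H (σ ∘ₚ τ)) - 𝔼 (tilde F) * 𝔼 (tilde G) * 𝔼 (tilde H) - P ∣ ^ℚ 10)
           * fromℕ n ≤ P ^ℚ 10)
theorem2p11 C 0<C = N , λ n N≤n f g h dense glob →
    let open Large N≤n in conclusion f g h (root-dense n 1≤n (0≤P f g h) dense) glob
  where
  c : ℕ
  c = ℤ.∣ ceiling C ∣
  open Threshold c
  -- The exponent `C` is enlarged to its ceiling, which makes the power of `n` integral once the
  -- `↧ₙ C`-th root is taken.
  root-dense : ∀ n → 1 ℕ.≤ n → ∀ {P} → 0ℚ ≤ P → 1ℚ ≤ P ^ℚ (↧ₙ C) * fromℕ (n ℕ.^ ℤ.∣ ↥ C ∣) → 1ℚ ≤ P * nat n ^ℚ c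
  root-dense n 1≤n {P} 0≤P h = ^-cancel (ℚ.denominator-1 C) 0≤1 (0≤* 0≤P (0≤^ c (0≤nat n))) (begin
      1ℚ ^ℚ (↧ₙ C) ≡⟨ 1^ (↧ₙ C) ⟩
      1ℚ ≤⟨ h ⟩
      P ^ℚ (↧ₙ C) * fromℕ (n ℕ.^ ℤ.∣ ↥ C ∣) ≡⟨ cong (P ^ℚ (↧ₙ C) *_) (trans (sym (nat≡fromℕ (n ℕ.^ ℤ.∣ ↥ C ∣))) (nat-^ n ℤ.∣ ↥ C ∣)) ⟩
      P ^ℚ (↧ₙ C) * nat n ^ℚ ℤ.∣ ↥ C ∣ ≤⟨ *-monoˡ (0≤^ (↧ₙ C) 0≤P) (^-monoᵉ (subst (_≤ nat n) nat-1 (nat-mono 1≤n)) (subst (ℤ.∣ ↥ C ∣ ℕ.≤_) (ℕP.*-comm (↧ₙ C) c) (ceiling-bound C 0<C))) ⟩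
      P ^ℚ (↧ₙ C) * nat n ^ℚ (c ℕ.* ↧ₙ C) ≡⟨ cong (P ^ℚ (↧ₙ C) *_) (^-^ (nat n) c (↧ₙ C)) ⟨
      P ^ℚ (↧ₙ C) * (nat n ^ℚ c) ^ℚ (↧ₙ C) ≡⟨ ^-* P (nat n ^ℚ c) (↧ₙ C) ⟨
      (P * nat n ^ℚ c) ^ℚ (↧ₙ C) ∎)
    where open ≤R
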